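{- For every $0<\varepsilon<1$ there exists $n_0\in\mathbb{N}$ such that the following holds: if $G$ is an $r$-regular (simple) graph on $n\ge n_0$ vertices with $r\ge \frac{1}{2}(1+\varepsilon)n$, then $\chi_T(G)\le \Delta(G)+2$.
   Context: A total coloring of a graph $G$ is an assignment of colors to the vertices and edges of $G$ such that adjacent vertices receive different colors, adjacent edges (edges sharing an endpoint) receive different colors, and every edge receives a color different from the colors of both of its endpoints. The total chromatic number $\chi_T(G)$ is the minimum number of colors in a total coloring of $G$. $\Delta(G)$ denotes the maximum degree of $G$. -}

module Defs where

open import Data.Nat using (ℕ; zero; suc; _⊔_)
open import Data.Fin using (Fin)
open import Data.Bool using (Bool; true; false)
open import Data.List using (List; length; filter)
open import Data.List using (allFin)
open import Data.Product using (Σ; _×_; _,_)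
open import Relation.Binary.PropositionalEquality using (_≡_; _≢_)
open import Data.Bool.Properties using (T?)
open import Data.Bool using (T)

record Graph (n : ℕ) : Set where
  field
    adj   : Fin n → Fin n → Bool
    sym   : ∀ u v → adj u v ≡ adj v u
    irrefl : ∀ v → adj v v ≡ false

open Graph public

Adj : ∀ {n} → Graph n → Fin n → Fin n → Set
Adj G u v = T (adj G u v)

degree : ∀ {n} → Graph n → Fin n → ℕ
degree {n} G v = length (filter (λ u → T? (adj G v u)) (allFin n))

maxDegree : ∀ {n} → Graph n → ℕ
maxDegree {zero} G = 0
maxDegree {suc n} G = Data.List.foldr (λ v m → degree G v ⊔ m) 0 (allFin (suc n))

Regular : ∀ {n} → Graph n → ℕ → Set
Regular G r = ∀ v → degree G v ≡ r

-- A total coloring of G with colors from Fin k: a vertex coloring and an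
-- edge coloring (an edge {u,v} gets one color, whence the symmetry field).
record TotalColoring {n : ℕ} (G : Graph n) (k : ℕ) : Set where
  field
    vcol : Fin n → Fin k
    ecol : (u v : Fin n) → Adj G u v → Fin k
    ecol-sym : ∀ u v (a : Adj G u v) (b : Adj G v u) → ecol u v a ≡ ecol v u b
    vertex-proper : ∀ u v → Adj G u v → vcol u ≢ vcol v
    edge-proper : ∀ u v w (a : Adj G u v) (b : Adj G u w) → v ≢ w →
                  ecol u v a ≢ ecol u w b
    incidence-proper : ∀ u v (a : Adj G u v) → ecol u v a ≢ vcol u

χT≤ : ∀ {n} → Graph n → ℕ → Set
χT≤ G k = TotalColoring G k

{-# OPTIONS --safe #-}
module Submission where

-- If r = n - 1, colour every edge uv with u + v and every vertex v with 2 v modulo an odd number in {n, n + 1}.  Otherwise, after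
-- adding an isolated vertex when n is odd, take a large matching ψ of the complement: a vertex colour class is an edge of ψ
-- or a single vertex.  A fourth-moment argument splits the vertices into halves A and B that respect ψ, with every vertex
-- having almost as many neighbours in A as in B.  The classes in B receive the first colours and those in A the last ones;
-- a colour used in B is forbidden, besides, at as many vertices of A.  The edges inside A and B are coloured first, by nearly
-- perfect matchings of equal size (Kempe changes), and exchanges with cross edges make every colour cover all vertices where it is
-- allowed.  So what remains is bipartite of degree D with D + 1 colours left, one of which is forbidden at each vertex of A:
-- this is solved by Galvin's theorem on list colourings.

-- Degree plus number of forbidden colours is arranged to be r + 1 at every vertex, the added vertex
-- (with suitable new edges) included. Once k colours cover all vertices where they are allowed, D =
-- r + 1 - k edges are left at each vertex, and D + 1 further colours make r + 2 in all. The
-- remainder is bipartite only if these k colours use up every edge inside A and inside B. The first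
-- phase leaves some of these edges over; they go into auxiliary colours, always one edge of A
-- together with one of B, so that such a colour misses equally many vertices on both sides and can
-- be completed by cross edges alone. The exchanges work because every vertex is joined to more than
-- half of the other side, and this is where r > n / 2 enters; all errors and the number of
-- auxiliary colours must be small compared with 2 r - n. Hence the discrepancies of the partition
-- have to be below a small fraction of N. Second moments, of total order N², give no such bound;
-- fourth moments have total order N³, less than the fourth power of any fixed fraction of N once N
-- is large.

module Prelude where

  open import Data.Nat public using (ℕ; zero; suc; _+_; _*_; _∸_; _≤_; _<_; z≤n; s≤s; _≤?_; _<?_; _/_; _%_; NonZero; nonZero)
  open import Data.Nat.Properties public hiding (_≟_)
  open import Data.Nat.Tactic.RingSolver public using (solve-∀)
  open import Data.Fin public using (Fin; zero; suc; toℕ; fromℕ<; _↑ˡ_; _↑ʳ_; splitAt)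
  open import Data.Fin.Properties public using (_≟_; any?; all?; toℕ-injective; toℕ<n; toℕ-fromℕ<; splitAt-↑ˡ; splitAt-↑ʳ)
  open import Data.Bool public using (Bool; true; false; not; _∧_; _∨_; _xor_; if_then_else_) renaming (_≟_ to _≟ᵇ_)
  open import Data.Product public using (Σ; ∃; _×_; _,_; proj₁; proj₂)
  open import Data.Sum public using (_⊎_; inj₁; inj₂; [_,_])
  open import Data.Empty public using (⊥; ⊥-elim)
  open import Data.List public using (List; []; _∷_; length)
  open import Relation.Nullary public using (¬_; Dec; yes; no; does)
  open import Relation.Binary.PropositionalEquality public using (_≡_; _≢_; refl; sym; trans; cong; cong₂; subst; subst₂; module ≡-Reasoning)
  open import Function public using (_∘_; id; case_of_)

-- Finite sums, indicators and parity

module Sums where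
  open Prelude

  ⟦_⟧ : Bool → ℕ
  ⟦ true ⟧ = 1
  ⟦ false ⟧ = 0

  infix 7 _==_
  _==_ : ∀ {n} → Fin n → Fin n → Bool
  zero == zero = true
  zero == suc _ = false
  suc _ == zero = false
  suc x == suc y = x == y

  ==-refl : ∀ {n} (x : Fin n) → (x == x) ≡ true
  ==-refl zero = refl
  ==-refl (suc x) = ==-refl x

  ==-sound : ∀ {n} {x y : Fin n} → (x == y) ≡ true → x ≡ y
  ==-sound {x = zero} {zero} _ = refl
  ==-sound {x = suc x} {suc y} e = cong suc (==-sound e)

  ==-sym : ∀ {n} (x y : Fin n) → (x == y) ≡ (y == x)
  ==-sym zero zero = refl
  ==-sym zero (suc y) = refl
  ==-sym (suc x) zero = refl
  ==-sym (suc x) (suc y) = ==-sym x y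

  ==-≢ : ∀ {n} {x y : Fin n} → x ≢ y → (x == y) ≡ false
  ==-≢ {x = x} {y} ne with x == y in e
  ... | true = ⊥-elim (ne (==-sound e))
  ... | false = refl

  ==-false : ∀ {n} {x y : Fin n} → (x == y) ≡ false → x ≢ y
  ==-false {x = x} e refl with trans (sym e) (==-refl x)
  ... | ()

  tf : ∀ {b : Bool} {A : Set} → b ≡ true → b ≡ false → A
  tf refl ()

  not-true : ∀ {b} → not b ≡ true → b ≡ false
  not-true {false} _ = refl

  not-false : ∀ {b} → not b ≡ false → b ≡ true
  not-false {true} _ = refl

  ¬true : ∀ {b} → b ≢ true → b ≡ false
  ¬true {true} h = ⊥-elim (h refl)
  ¬true {false} h = refl

  ∧-true : ∀ {a b} → a ∧ b ≡ true → a ≡ true × b ≡ true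
  ∧-true {true} {true} _ = refl , refl

  ∧-intro : ∀ {a b} → a ≡ true → b ≡ true → a ∧ b ≡ true
  ∧-intro refl refl = refl

  ∨-true : ∀ {a b} → a ∨ b ≡ true → a ≡ true ⊎ b ≡ true
  ∨-true {true} _ = inj₁ refl
  ∨-true {false} e = inj₂ e

  ⟦⟧≤1 : ∀ b → ⟦ b ⟧ ≤ 1
  ⟦⟧≤1 true = s≤s z≤n
  ⟦⟧≤1 false = z≤n

  ⟦⟧-mono : ∀ {a b} → (a ≡ true → b ≡ true) → ⟦ a ⟧ ≤ ⟦ b ⟧
  ⟦⟧-mono {true} h rewrite h refl = ≤-refl
  ⟦⟧-mono {false} h = z≤n

  ⟦⟧-pos : ∀ {b} → 0 < ⟦ b ⟧ → b ≡ true
  ⟦⟧-pos {true} _ = refl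

  ⟦⟧-not : ∀ b → ⟦ b ⟧ + ⟦ not b ⟧ ≡ 1
  ⟦⟧-not true = refl
  ⟦⟧-not false = refl

  ⟦⟧-∧ : ∀ a b → ⟦ a ∧ b ⟧ ≡ ⟦ a ⟧ * ⟦ b ⟧
  ⟦⟧-∧ true b = sym (+-identityʳ _)
  ⟦⟧-∧ false b = refl

  isTrue : ∀ b → b ≡ true ⊎ b ≡ false
  isTrue true = inj₁ refl
  isTrue false = inj₂ refl

  -- From a ≤ b one gets x ≤ y once y + a = x + b + c: a linear consequence, the identity being left to the ring solver.
  lin : ∀ {a b x y} c → a ≤ b → y + a ≡ x + b + c → x ≤ y
  lin {a} {b} {x} {y} c h e = +-cancelʳ-≤ b x y (begin
    x + b ≤⟨ m≤m+n (x + b) c ⟩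
    x + b + c ≡⟨ sym e ⟩
    y + a ≤⟨ +-monoʳ-≤ y h ⟩
    y + b ∎)
    where open ≤-Reasoning

  private
    +-interchange : ∀ a b c d → a + b + (c + d) ≡ a + c + (b + d)
    +-interchange = solve-∀

  abstract
    ∑ : ∀ {n} → (Fin n → ℕ) → ℕ
    ∑ {zero} f = 0
    ∑ {suc n} f = f zero + ∑ (λ i → f (suc i))

    ∑-nil : (f : Fin 0 → ℕ) → ∑ f ≡ 0
    ∑-nil f = refl

    ∑-cons : ∀ {n} (f : Fin (suc n) → ℕ) → ∑ f ≡ f zero + ∑ (λ i → f (suc i))
    ∑-cons f = refl

    ∑-cong : ∀ {n} {f g : Fin n → ℕ} → (∀ i → f i ≡ g i) → ∑ f ≡ ∑ g
    ∑-cong {zero} h = refl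
    ∑-cong {suc n} h = cong₂ _+_ (h zero) (∑-cong (λ i → h (suc i)))

    ∑-mono : ∀ {n} {f g : Fin n → ℕ} → (∀ i → f i ≤ g i) → ∑ f ≤ ∑ g
    ∑-mono {zero} h = z≤n
    ∑-mono {suc n} h = +-mono-≤ (h zero) (∑-mono (λ i → h (suc i)))

    ∑-mono-< : ∀ {n} {f g : Fin n → ℕ} → (∀ i → f i ≤ g i) → ∀ j → f j < g j → ∑ f < ∑ g
    ∑-mono-< {suc n} h zero lt = +-mono-<-≤ lt (∑-mono (λ i → h (suc i)))
    ∑-mono-< {suc n} h (suc j) lt = +-mono-≤-< (h zero) (∑-mono-< (λ i → h (suc i)) j lt)

    ∑-+ : ∀ {n} (f g : Fin n → ℕ) → ∑ (λ i → f i + g i) ≡ ∑ f + ∑ g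
    ∑-+ {zero} f g = refl
    ∑-+ {suc n} f g = trans (cong (f zero + g zero +_) (∑-+ (λ i → f (suc i)) (λ i → g (suc i))))
      (+-interchange (f zero) (g zero) (∑ (λ i → f (suc i))) (∑ (λ i → g (suc i))))

    ∑-const : ∀ n (c : ℕ) → ∑ {n} (λ _ → c) ≡ n * c
    ∑-const zero c = refl
    ∑-const (suc n) c = cong (c +_) (∑-const n c)

    ∑-*ˡ : ∀ {n} c (f : Fin n → ℕ) → ∑ (λ i → c * f i) ≡ c * ∑ f
    ∑-*ˡ {zero} c f = sym (*-zeroʳ c)
    ∑-*ˡ {suc n} c f = trans (cong (c * f zero +_) (∑-*ˡ c (λ i → f (suc i)))) (sym (*-distribˡ-+ c (f zero) _))

    ∑-swap : ∀ {m n} (f : Fin m → Fin n → ℕ) → ∑ (λ i → ∑ (λ j → f i j)) ≡ ∑ (λ j → ∑ (λ i → f i j))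
    ∑-swap {zero} {n} f = sym (trans (∑-const n 0) (*-zeroʳ n))
    ∑-swap {suc m} f = trans (cong (∑ (f zero) +_) (∑-swap (λ i → f (suc i))))
      (sym (∑-+ (f zero) (λ j → ∑ (λ i → f (suc i) j))))

    term≤∑ : ∀ {n} (f : Fin n → ℕ) j → f j ≤ ∑ f
    term≤∑ f zero = m≤m+n _ _
    term≤∑ f (suc j) = ≤-trans (term≤∑ (λ i → f (suc i)) j) (m≤n+m _ _)

    ∑<→∃ : ∀ {n} (f g : Fin n → ℕ) → ∑ f < ∑ g → ∃ λ i → f i < g i
    ∑<→∃ {suc n} f g lt with f zero <? g zero
    ... | yes p = zero , p
    ... | no ¬p with ∑<→∃ (λ i → f (suc i)) (λ i → g (suc i)) (≰⇒> λ le → <⇒≱ lt (+-mono-≤ (≮⇒≥ ¬p) le))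
    ...   | i , q = suc i , q

    ∑-δ : ∀ {n} (x : Fin n) (f : Fin n → ℕ) → ∑ (λ u → ⟦ x == u ⟧ * f u) ≡ f x
    ∑-δ {suc n} zero f = trans (cong₂ _+_ (+-identityʳ (f zero)) (trans (∑-const n 0) (*-zeroʳ n))) (+-identityʳ _)
    ∑-δ {suc n} (suc x) f = ∑-δ x (λ u → f (suc u))

    ∑-upd : ∀ {n} (f g : Fin n → ℕ) x → (∀ v → v ≢ x → f v ≡ g v) → ∑ f + g x ≡ ∑ g + f x
    ∑-upd {suc n} f g zero h = begin
      f zero + S f + g zero ≡⟨ cong (λ t → f zero + t + g zero) (∑-cong (λ i → h (suc i) λ ())) ⟩
      f zero + S g + g zero ≡⟨ lem (f zero) (S g) (g zero) ⟩
      g zero + S g + f zero ∎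
      where
      open ≡-Reasoning
      S : (Fin (suc n) → ℕ) → ℕ
      S k = ∑ (λ i → k (suc i))
      lem : ∀ a b c → a + b + c ≡ c + b + a
      lem = solve-∀
    ∑-upd {suc n} f g (suc x) h = begin
      f zero + S f + g (suc x) ≡⟨ +-assoc (f zero) _ _ ⟩
      f zero + (S f + g (suc x)) ≡⟨ cong₂ _+_ (h zero λ ()) (∑-upd (λ i → f (suc i)) (λ i → g (suc i)) x (λ v ne → h (suc v) (λ { refl → ne refl }))) ⟩
      g zero + (S g + f (suc x)) ≡⟨ sym (+-assoc (g zero) _ _) ⟩
      g zero + S g + f (suc x) ∎
      where
      open ≡-Reasoning
      S : (Fin (suc n) → ℕ) → ℕ
      S k = ∑ (λ i → k (suc i))

    ∑-≤1 : ∀ {n} (P : Fin n → Bool) → (∀ i j → P i ≡ true → P j ≡ true → i ≡ j) → ∑ (λ i → ⟦ P i ⟧) ≤ 1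
    ∑-≤1 {zero} P h = z≤n
    ∑-≤1 {suc n} P h with P zero in e
    ... | true = ≤-reflexive (cong suc (trans (∑-cong (λ i → cong ⟦_⟧ (¬true λ t → case h zero (suc i) e t of λ ()))) (trans (∑-const n 0) (*-zeroʳ n))))
    ... | false = ∑-≤1 (λ i → P (suc i)) (λ i j a b → suc-inj (h (suc i) (suc j) a b))
      where
      suc-inj : ∀ {i j : Fin n} → _≡_ {A = Fin (suc n)} (suc i) (suc j) → i ≡ j
      suc-inj refl = refl

    ∑-↑ : ∀ {m} k (f : Fin (m + k) → ℕ) → ∑ f ≡ ∑ (λ i → f (i ↑ˡ k)) + ∑ (λ j → f (m ↑ʳ j))
    ∑-↑ {zero} k f = refl
    ∑-↑ {suc m} k f = trans (cong (f zero +_) (∑-↑ {m} k (λ i → f (suc i)))) (sym (+-assoc (f zero) _ _))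

    -- Handshake lemma: the first row and the first column have equal sums and meet in a zero, so
    -- removing both changes the total by an even number.
    ∑∑-even : ∀ {n} (f : Fin n → Fin n → ℕ) → (∀ u v → f u v ≡ f v u) → (∀ v → f v v ≡ 0) →
              ∃ λ s → ∑ (λ u → ∑ (f u)) ≡ s + s
    ∑∑-even {zero} f sy ir = 0 , refl
    ∑∑-even {suc n} f sy ir with ∑∑-even (λ u v → f (suc u) (suc v)) (λ u v → sy (suc u) (suc v)) (λ v → ir (suc v))
    ... | s , e = R + s , (begin
      f zero zero + R + ∑ (λ u → f (suc u) zero + ∑ (λ v → f (suc u) (suc v)))
        ≡⟨ cong₂ (λ a b → a + R + b) (ir zero) (∑-+ (λ u → f (suc u) zero) (λ u → ∑ (λ v → f (suc u) (suc v)))) ⟩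
      R + (∑ (λ u → f (suc u) zero) + ∑ (λ u → ∑ (λ v → f (suc u) (suc v))))
        ≡⟨ cong₂ (λ a b → R + (a + b)) (∑-cong (λ u → sy (suc u) zero)) e ⟩
      R + (R + (s + s)) ≡⟨ lem R s ⟩
      R + s + (R + s) ∎)
      where
      open ≡-Reasoning
      R : ℕ
      R = ∑ (λ v → f zero (suc v))
      lem : ∀ R s → R + (R + (s + s)) ≡ R + s + (R + s)
      lem = solve-∀

  ∑-0 : ∀ {n} {f : Fin n → ℕ} → (∀ i → f i ≡ 0) → ∑ f ≡ 0
  ∑-0 {n} h = trans (∑-cong h) (trans (∑-const n 0) (*-zeroʳ n))

  ∑-1 : ∀ n → ∑ {n} (λ _ → 1) ≡ n
  ∑-1 n = trans (∑-const n 1) (*-identityʳ n)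

  ∑-≤ : ∀ {n} {f : Fin n → ℕ} {c} → (∀ i → f i ≤ c) → ∑ f ≤ n * c
  ∑-≤ {n} {c = c} h = ≤-trans (∑-mono h) (≤-reflexive (∑-const n c))

  ∑-*ʳ : ∀ {n} c (f : Fin n → ℕ) → ∑ (λ i → f i * c) ≡ ∑ f * c
  ∑-*ʳ c f = trans (∑-cong (λ i → *-comm (f i) c)) (trans (∑-*ˡ c f) (*-comm c (∑ f)))

  ∑≡0 : ∀ {n} {f : Fin n → ℕ} → ∑ f ≡ 0 → ∀ i → f i ≡ 0
  ∑≡0 {f = f} e i = n≤0⇒n≡0 (≤-trans (term≤∑ f i) (≤-reflexive e))

  ∑>0→∃ : ∀ {n} (f : Fin n → ℕ) → 0 < ∑ f → ∃ λ i → 0 < f i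
  ∑>0→∃ {n} f lt = ∑<→∃ (λ _ → 0) f (subst (_< ∑ f) (sym (∑-0 {n} (λ _ → refl))) lt)

  count∃ : ∀ {n} (P : Fin n → Bool) → 0 < ∑ (λ i → ⟦ P i ⟧) → ∃ λ i → P i ≡ true
  count∃ P lt with ∑>0→∃ _ lt
  ... | i , q = i , ⟦⟧-pos q

  ∑-δ1 : ∀ {n} (x : Fin n) → ∑ (λ u → ⟦ x == u ⟧) ≡ 1
  ∑-δ1 x = trans (∑-cong {g = λ u → ⟦ x == u ⟧ * 1} (λ u → sym (*-identityʳ _))) (∑-δ x (λ _ → 1))

  ∑-δ1′ : ∀ {n} (x : Fin n) → ∑ (λ u → ⟦ u == x ⟧) ≡ 1
  ∑-δ1′ x = trans (∑-cong (λ u → cong ⟦_⟧ (==-sym u x))) (∑-δ1 x)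

  ∑-inv : ∀ {n} (p : Fin n → Fin n) → (∀ v → p (p v) ≡ v) → (f : Fin n → ℕ) → ∑ (λ v → f (p v)) ≡ ∑ f
  ∑-inv p inv f = begin
    ∑ (λ v → f (p v)) ≡⟨ ∑-cong (λ v → sym (∑-δ (p v) f)) ⟩
    ∑ (λ v → ∑ (λ u → ⟦ p v == u ⟧ * f u)) ≡⟨ ∑-swap _ ⟩
    ∑ (λ u → ∑ (λ v → ⟦ p v == u ⟧ * f u)) ≡⟨ ∑-cong (λ u → trans (∑-cong (λ v → cong (λ b → ⟦ b ⟧ * f u) (flip v u))) (∑-δ (p u) (λ _ → f u))) ⟩
    ∑ f ∎
    where
    open ≡-Reasoning
    flip : ∀ v u → (p v == u) ≡ (p u == v)
    flip v u with isTrue (p v == u) | isTrue (p u == v)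
    ... | inj₁ a | inj₁ b = trans a (sym b)
    ... | inj₂ a | inj₂ b = trans a (sym b)
    ... | inj₁ a | inj₂ b = ⊥-elim (==-false b (trans (cong p (sym (==-sound a))) (inv v)))
    ... | inj₂ a | inj₁ b = ⊥-elim (==-false a (trans (cong p (sym (==-sound b))) (inv u)))

  ∑-split : ∀ {n} (P : Fin n → Bool) (f : Fin n → ℕ) → ∑ (λ v → ⟦ P v ⟧ * f v) + ∑ (λ v → ⟦ not (P v) ⟧ * f v) ≡ ∑ f
  ∑-split P f = trans (sym (∑-+ _ _)) (∑-cong λ v → pt (P v) (f v))
    where
    pt : ∀ b x → ⟦ b ⟧ * x + ⟦ not b ⟧ * x ≡ x
    pt true x = trans (+-identityʳ _) (+-identityʳ x)
    pt false x = +-identityʳ x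

  least : ∀ {n} (P : Fin n → Bool) i → P i ≡ true → ∃ λ j → P j ≡ true × toℕ j ≤ toℕ i × (∀ l → toℕ l < toℕ j → P l ≡ false)
  least {suc n} P i t with P zero in e
  ... | true = zero , e , z≤n , λ _ ()
  least {suc n} P zero t | false = tf t e
  least {suc n} P (suc i) t | false with least (λ i → P (suc i)) i t
  ... | j , a , b , c = suc j , a , s≤s b , λ { zero _ → e ; (suc l) (s≤s q) → c l q }


  even-part : ∀ m b a → a + (b + b) ≡ m + m → ∃ λ t → a ≡ t + t
  even-part m zero a e = m , trans (sym (+-identityʳ a)) e
  even-part zero (suc b) a e = ⊥-elim (1+n≢0 (trans (sym (+-suc a _)) e))
  even-part (suc m) (suc b) a e = even-part m b a (suc-injective (suc-injective
    (trans (sym (trans (+-suc a _) (cong suc (trans (cong (a +_) (+-suc b b)) (+-suc a _))))) (trans e (cong suc (+-suc m m))))))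

  -- An even number that is not 0 is at least 2, more than the count of the single element `u`. This
  -- is how uncovered vertices are found in pairs.
  another : ∀ {n} (P : Fin n → Bool) u → P u ≡ true → (∃ λ t → ∑ (λ v → ⟦ P v ⟧) ≡ t + t) → ∃ λ w → u ≢ w × P w ≡ true
  another P u pu ev with ∑<→∃ (λ w → ⟦ u == w ⟧) (λ w → ⟦ P w ⟧) (≤-trans (≤-reflexive (cong suc (∑-δ1 u)))
      (two _ (≤-trans (subst (λ b → 1 ≤ ⟦ b ⟧) (sym pu) ≤-refl) (term≤∑ (λ w → ⟦ P w ⟧) u)) ev))
    where
    two : ∀ a → 1 ≤ a → (∃ λ t → a ≡ t + t) → 2 ≤ a
    two a h (zero , refl) = ⊥-elim (n≮0 h)
    two a h (suc t , refl) = s≤s (≤-trans (s≤s z≤n) (m≤n+m (suc t) t))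
  ... | w , h = w , (λ e → <⇒≱ h (≤-trans (⟦⟧≤1 _) (subst (λ b → 1 ≤ ⟦ b ⟧) (sym (trans (cong (u ==_) (sym e)) (==-refl u))) ≤-refl)))
                  , ⟦⟧-pos (≤-trans (s≤s z≤n) h)

-- Alternating paths of two involutions

module Kempe where
  open Prelude
  open import Data.Fin.Properties using (pigeonhole)

  leastℕ : (P : ℕ → Set) → (∀ n → Dec (P n)) → ∀ n → P n → ∃ λ e → P e × (∀ j → j < e → ¬ P j)
  leastℕ P d zero p = zero , p , λ _ ()
  leastℕ P d (suc n) p with d zero
  ... | yes q = zero , q , λ _ ()
  ... | no ¬q with leastℕ (λ j → P (suc j)) (λ j → d (suc j)) n p
  ...   | e , q , h = suc e , q , λ { zero _ → ¬q ; (suc j) (s≤s l) → h j l }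

  does-sound : ∀ {A : Set} (d : Dec A) → does d ≡ true → A
  does-sound (yes a) _ = a

  does-complete : ∀ {A : Set} (d : Dec A) → A → does d ≡ true
  does-complete (yes _) _ = refl
  does-complete (no ¬a) a = ⊥-elim (¬a a)

  does-false : ∀ {A : Set} (d : Dec A) → ¬ A → does d ≡ false
  does-false (yes a) na = ⊥-elim (na a)
  does-false (no ¬a) _ = refl

  Bool-≡ : ∀ {a b} → (a ≡ true → b ≡ true) → (b ≡ true → a ≡ true) → a ≡ b
  Bool-≡ {true} {true} f g = refl
  Bool-≡ {true} {false} f g = sym (f refl)
  Bool-≡ {false} {true} f g = g refl
  Bool-≡ {false} {false} f g = refl

  -- All that a Kempe change needs to know of a component in the union of two colour classes:
  -- closure under both involutions, and at most two ends, where an end is a fixed point of one of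
  -- them. A vertex fixed by both is its own component, with `y` equal to `x`.
  record Component {N} (P Q : Fin N → Fin N) (x : Fin N) : Set where
    no-eta-equality
    field
      S : Fin N → Bool
      x∈S : S x ≡ true
      closedP : ∀ v → S (P v) ≡ S v
      closedQ : ∀ v → S (Q v) ≡ S v
      y : Fin N
      ends : ∀ z → S z ≡ true → P z ≡ z ⊎ Q z ≡ z → z ≡ x ⊎ z ≡ y

  -- The alternating walk from x can only turn back at an end of its component, so the ends
  -- of the component are x and the first point where the walk stalls.
  module Walk {N} (P Q : Fin N → Fin N) (Pinv : ∀ v → P (P v) ≡ v) (Qinv : ∀ v → Q (Q v) ≡ v)
              (x : Fin N) (Px : P x ≡ x) where

    F : ℕ → Fin N → Fin N
    F zero = Q
    F (suc zero) = P
    F (suc (suc n)) = F n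

    w : ℕ → Fin N
    w zero = x
    w (suc n) = F n (w n)

    F-inv : ∀ n v → F n (F n v) ≡ v
    F-inv zero = Qinv
    F-inv (suc zero) = Pinv
    F-inv (suc (suc n)) = F-inv n

    back : ∀ n → F n (w (suc n)) ≡ w n
    back n = F-inv n (w n)

    F-even : ∀ t n → F (t + t + n) ≡ F n
    F-even zero n = refl
    F-even (suc t) n rewrite +-suc t t = F-even t n

    F-par : ∀ n j → F n ≡ F j ⊎ F n ≡ F (suc j)
    F-par zero zero = inj₁ refl
    F-par zero (suc zero) = inj₂ refl
    F-par zero (suc (suc j)) = F-par zero j
    F-par (suc zero) zero = inj₂ refl
    F-par (suc zero) (suc zero) = inj₁ refl
    F-par (suc zero) (suc (suc j)) = F-par (suc zero) j
    F-par (suc (suc n)) j = F-par n j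

    Stall : ℕ → Set
    Stall j = w j ≡ w (suc j)

    -- Steps of equal parity use the same involution, so both positions can be moved back together
    -- until the earlier one is `x`. The last step to the later one was by `P`, which fixes `x`: the
    -- walk stalled there.
    collide-even : ∀ t i → w i ≡ w (suc t + suc t + i) → ∃ Stall
    collide-even t zero e = t + suc t , (begin
      w (t + suc t) ≡⟨ sym (back (t + suc t)) ⟩
      F (t + suc t) (w (suc (t + suc t))) ≡⟨ cong₂ (λ f v → f v) Feq (trans (cong w (sym (+-identityʳ (suc t + suc t)))) (sym e)) ⟩
      P x ≡⟨ Px ⟩
      x ≡⟨ e ⟩
      w (suc t + suc t + 0) ≡⟨ cong w (+-identityʳ (suc t + suc t)) ⟩
      w (suc (t + suc t)) ∎)
      where
      open ≡-Reasoning
      Feq : F (t + suc t) ≡ P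
      Feq = trans (cong F (trans (+-suc t t) (sym (+-comm (t + t) 1)))) (F-even t 1)
    collide-even t (suc i) e = collide-even t i (begin
      w i ≡⟨ sym (back i) ⟩
      F i (w (suc i)) ≡⟨ cong₂ (λ f v → f v) (sym (F-even (suc t) i)) (trans e (cong w (+-suc (suc t + suc t) i))) ⟩
      F (suc t + suc t + i) (w (suc (suc t + suc t + i))) ≡⟨ back (suc t + suc t + i) ⟩
      w (suc t + suc t + i) ∎)
      where open ≡-Reasoning

    -- With opposite parities, moving the earlier position forward and the later one back applies
    -- the same involution to both. The positions approach each other and meet in a stall.
    collide-odd : ∀ t i → w i ≡ w (suc (t + t + i)) → ∃ Stall
    collide-odd zero i e = i , e
    collide-odd (suc t) i e = collide-odd t (suc i) (begin
      F i (w i) ≡⟨ cong₂ (λ f v → f v) (sym (F-even (suc t) i)) e ⟩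
      F (suc t + suc t + i) (w (suc (suc t + suc t + i))) ≡⟨ back (suc t + suc t + i) ⟩
      w (suc t + suc t + i) ≡⟨ cong w (lem t i) ⟩
      w (suc (t + t + suc i)) ∎)
      where
      open ≡-Reasoning
      lem : ∀ t i → suc t + suc t + i ≡ suc (t + t + suc i)
      lem = solve-∀

    halve : ∀ d → ∃ λ t → d ≡ t + t ⊎ d ≡ suc (t + t)
    halve zero = zero , inj₁ refl
    halve (suc d) with halve d
    ... | t , inj₁ e = t , inj₂ (cong suc e)
    ... | t , inj₂ e = suc t , inj₁ (cong suc (trans e (sym (+-suc t t))))

    abstract
      stall : ∃ Stall
      stall with pigeonhole (n<1+n N) (λ i → w (toℕ i))
      ... | i , j , lt , e with m≤n⇒∃[o]m+o≡n lt
      ...   | d , q with halve (suc d)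
      ...     | zero , inj₁ ()
      ...     | suc t , inj₁ h = collide-even t (toℕ i) (trans e (cong w (trans (sym q) (trans (cong suc (+-comm (toℕ i) d)) (cong (_+ toℕ i) h)))))
      ...     | t , inj₂ h = collide-odd t (toℕ i) (trans e (cong w (trans (sym q) (trans (cong suc (+-comm (toℕ i) d)) (cong (_+ toℕ i) h)))))

      first : ∃ λ e → Stall e × (∀ j → j < e → ¬ Stall j)
      first = leastℕ Stall (λ j → w j ≟ w (suc j)) (proj₁ stall) (proj₂ stall)

    e : ℕ
    e = proj₁ first

    S? : ∀ z → Dec (∃ λ (j : Fin (suc e)) → w (toℕ j) ≡ z)
    S? z = any? (λ j → w (toℕ j) ≟ z)

    S : Fin N → Bool
    S z = does (S? z)

    S-in : ∀ j → j ≤ e → S (w j) ≡ true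
    S-in j le = does-complete (S? _) (fromℕ< (s≤s le) , cong w (toℕ-fromℕ< (s≤s le)))

    S-out : ∀ {z} → S z ≡ true → ∃ λ j → j ≤ e × w j ≡ z
    S-out {z} h with does-sound (S? z) h
    ... | j , q = toℕ j , ≤-pred (toℕ<n j) , q

    step : ∀ j → j ≤ e → S (F j (w j)) ≡ true
    step j le with m≤n⇒m<n∨m≡n le
    ... | inj₁ lt = S-in (suc j) lt
    ... | inj₂ refl = subst (λ v → S v ≡ true) (proj₁ (proj₂ first)) (S-in e ≤-refl)

    step′ : ∀ j → j ≤ e → S (F (suc j) (w j)) ≡ true
    step′ zero le = subst (λ v → S v ≡ true) (sym Px) (S-in 0 z≤n)
    step′ (suc j) le = subst (λ v → S v ≡ true) (sym (back j)) (S-in j (≤-trans (n≤1+n j) le))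

    closed⇒ : ∀ n v → S v ≡ true → S (F n v) ≡ true
    closed⇒ n v h with S-out h
    ... | j , le , refl with F-par n j
    ...   | inj₁ q = subst (λ f → S (f (w j)) ≡ true) (sym q) (step j le)
    ...   | inj₂ q = subst (λ f → S (f (w j)) ≡ true) (sym q) (step′ j le)

    closed : ∀ n v → S (F n v) ≡ S v
    closed n v = Bool-≡ (λ h → subst (λ u → S u ≡ true) (F-inv n v) (closed⇒ n _ h)) (closed⇒ n v)

    endsF : ∀ n j → j ≤ e → F n (w j) ≡ w j → w j ≡ x ⊎ w j ≡ w e
    endsF n j le h with F-par n j
    endsF n j le h | inj₁ q with m≤n⇒m<n∨m≡n le
    ... | inj₁ lt = ⊥-elim (proj₂ (proj₂ first) j lt (sym (trans (sym (cong (λ f → f (w j)) q)) h)))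
    ... | inj₂ refl = inj₂ refl
    endsF n zero le h | inj₂ q = inj₁ refl
    endsF n (suc j) le h | inj₂ q = ⊥-elim (proj₂ (proj₂ first) j le (trans (sym (back j)) (trans (sym (cong (λ f → f (w (suc j))) q)) h)))

    component : Component P Q x
    component = record
      { S = S ; x∈S = S-in 0 z≤n ; closedP = closed 1 ; closedQ = closed 0 ; y = w e
      ; ends = λ z h → λ
        { (inj₁ q) → let (j , le , r) = S-out h in subst (λ z → z ≡ x ⊎ z ≡ w e) r (endsF 1 j le (subst (λ z → P z ≡ z) (sym r) q))
        ; (inj₂ q) → let (j , le , r) = S-out h in subst (λ z → z ≡ x ⊎ z ≡ w e) r (endsF 0 j le (subst (λ z → Q z ≡ z) (sym r) q)) } }

    -- Before the first stall every step changes the class. A position of odd index was reached by a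
    -- proper `Q`-step and is not fixed by `Q`; so a vertex of the component that `Q` fixes has even
    -- index.
    bipartite : (c : Fin N → Bool) → (∀ v → P v ≢ v → c (P v) ≡ not (c v)) → (∀ v → Q v ≢ v → c (Q v) ≡ not (c v)) →
                ∀ z → S z ≡ true → Q z ≡ z → c z ≡ c x
    bipartite c cP cQ z h q with S-out h
    ... | j , le , refl with halve j
    ...   | t , inj₁ refl = even t le
      where
      flip : ∀ n → F n (w n) ≢ w n → c (F n (w n)) ≡ not (c (w n))
      flip n with F-par n 0
      ... | inj₁ e rewrite e = cQ (w n)
      ... | inj₂ e rewrite e = cP (w n)
      nn : ∀ b → not (not b) ≡ b
      nn true = refl
      nn false = refl
      even : ∀ t → t + t ≤ e → c (w (t + t)) ≡ c x
      even zero _ = refl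
      even (suc t) le rewrite +-suc t t =
        trans (flip (suc (t + t)) (λ h → proj₂ (proj₂ first) (suc (t + t)) le (sym h)))
          (trans (cong not (flip (t + t) (λ h → proj₂ (proj₂ first) (t + t) (≤-trans (n≤1+n _) le) (sym h))))
            (trans (nn _) (even t (≤-trans (≤-trans (n≤1+n _) (n≤1+n _)) le))))
    ...   | t , inj₂ refl = ⊥-elim (proj₂ (proj₂ first) (t + t) le (trans (sym (back (t + t)))
            (trans (cong (λ f → f (w (suc (t + t)))) (trans (cong F (sym (+-identityʳ (t + t)))) (F-even t 0))) q)))

  abstract
    component-of : ∀ {N} (P Q : Fin N → Fin N) → (∀ v → P (P v) ≡ v) → (∀ v → Q (Q v) ≡ v) → ∀ x → P x ≡ x ⊎ Q x ≡ x → Component P Q x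
    component-of P Q Pi Qi x (inj₁ e) = Walk.component P Q Pi Qi x e
    component-of P Q Pi Qi x (inj₂ e) = record
      { S = S ; x∈S = x∈S ; closedP = closedQ ; closedQ = closedP ; y = y
      ; ends = λ z h → λ { (inj₁ q) → ends z h (inj₂ q) ; (inj₂ q) → ends z h (inj₁ q) } }
      where open Component (Walk.component Q P Qi Pi x e)

-- Partial edge colourings with forbidden colours

module EdgeColouring where
  open Prelude
  open Sums
  open Kempe

  upd : ∀ {k} {A : Set} → (Fin k → A) → Fin k → A → Fin k → A
  upd f α g i = if i == α then g else f i

  upd-same : ∀ {k} {A : Set} (f : Fin k → A) α g → upd f α g α ≡ g
  upd-same f α g rewrite ==-refl α = refl

  upd-other : ∀ {k} {A : Set} (f : Fin k → A) α g i → i ≢ α → upd f α g i ≡ f i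
  upd-other f α g i ne rewrite ==-≢ ne = refl

  record SimpleGraph (N : ℕ) : Set where
    no-eta-equality
    field
      E : Fin N → Fin N → Bool
      E-sym : ∀ u v → E u v ≡ E v u
      E-irr : ∀ v → E v v ≡ false

    ≢-of : ∀ {u v} → E u v ≡ true → u ≢ v
    ≢-of {u} h refl = tf h (E-irr u)

    deg : Fin N → ℕ
    deg v = ∑ (λ u → ⟦ E v u ⟧)

  -- One weighted count serves for all edges, for same-side edges, for cross edges and for the
  -- covered vertices of one side. A weight that vanishes on the diagonal ignores uncovered
  -- vertices, because these are the fixed points of the colour class.
  Weight : ℕ → Set
  Weight N = Fin N → Fin N → ℕ

  Diag0 : ∀ {N} → Weight N → Set
  Diag0 F = ∀ v → F v v ≡ 0

  ne : ∀ {N} → Weight N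
  ne u v = ⟦ not (u == v) ⟧

  ne-diag : ∀ {N} → Diag0 {N} ne
  ne-diag v rewrite ==-refl v = refl

  ne-≢ : ∀ {N} {u v : Fin N} → u ≢ v → ne u v ≡ 1
  ne-≢ h rewrite ==-≢ h = refl

  ne-sym : ∀ {N} (u v : Fin N) → ne u v ≡ ne v u
  ne-sym u v = cong (λ b → ⟦ not b ⟧) (==-sym u v)

  -- A partial proper edge colouring, one involution per colour class; a fixed point is an
  -- uncovered vertex, and lock i v forbids colour i at v.
  record Colouring {N k} (G : SimpleGraph N) (lock : Fin k → Fin N → Bool) : Set where
    no-eta-equality
    open SimpleGraph G
    field
      p : Fin k → Fin N → Fin N
      inv : ∀ i v → p i (p i v) ≡ v
      edge : ∀ i v → p i v ≢ v → E v (p i v) ≡ true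
      disj : ∀ i j v → p i v ≢ v → p i v ≡ p j v → i ≡ j
      locked : ∀ i v → lock i v ≡ true → p i v ≡ v

    row : Weight N → Fin N → ℕ
    row F v = ∑ (λ i → F v (p i v))

    col : Weight N → Fin k → ℕ
    col F i = ∑ (λ v → F v (p i v))

    avail : Fin k → Fin N → Bool
    avail i v = (p i v == v) ∧ not (lock i v)

    avail-intro : ∀ {i v} → p i v ≡ v → lock i v ≡ false → avail i v ≡ true
    avail-intro {i} {v} e l rewrite l | e | ==-refl v = refl

    avail-p : ∀ {i v} → avail i v ≡ true → p i v ≡ v
    avail-p h = ==-sound (proj₁ (∧-true h))

    avail-lock : ∀ {i v} → avail i v ≡ true → lock i v ≡ false
    avail-lock {i} {v} h = not-true (proj₂ (∧-true {p i v == v} h))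

    trichotomy : ∀ i v → ne v (p i v) + ⟦ lock i v ⟧ + ⟦ avail i v ⟧ ≡ 1
    trichotomy i v with p i v ≟ v | lock i v in el
    ... | yes e | true rewrite e | ==-refl v = refl
    ... | yes e | false rewrite e | ==-refl v = refl
    ... | no h | true = ⊥-elim (h (locked i v el))
    ... | no h | false rewrite ==-≢ h | ==-≢ (λ e → h (sym e)) = refl

    row-total : ∀ v → row ne v + ∑ (λ i → ⟦ lock i v ⟧) + ∑ (λ i → ⟦ avail i v ⟧) ≡ k
    row-total v = trans (sym (trans (∑-+ _ _) (cong (_+ ∑ (λ i → ⟦ avail i v ⟧)) (∑-+ _ _)))) (trans (∑-cong (λ i → trichotomy i v)) (∑-1 k))

    col-total : ∀ i → col ne i + ∑ (λ v → ⟦ lock i v ⟧) + ∑ (λ v → ⟦ avail i v ⟧) ≡ N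
    col-total i = trans (sym (trans (∑-+ _ _) (cong (_+ ∑ (λ v → ⟦ avail i v ⟧)) (∑-+ _ _)))) (trans (∑-cong (trichotomy i)) (∑-1 N))

    hit? : ∀ v u → Dec (∃ λ i → p i v ≡ u)
    hit? v u = any? (λ i → p i v ≟ u)

    unc : Fin N → Fin N → Bool
    unc v u = E v u ∧ not (does (hit? v u))

    unc-E : ∀ {v u} → unc v u ≡ true → E v u ≡ true
    unc-E h = proj₁ (∧-true h)

    unc-free : ∀ {v u} → unc v u ≡ true → ∀ i → p i v ≢ u
    unc-free {v} {u} h i e = tf (does-complete (hit? v u) (i , e)) (not-true (proj₂ (∧-true {E v u} h)))

    unc-intro : ∀ {v u} → E v u ≡ true → (∀ i → p i v ≢ u) → unc v u ≡ true
    unc-intro {v} {u} e h = ∧-intro e (cong not (does-false (hit? v u) (λ (i , q) → h i q)))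

    unc-sym : ∀ {v u} → unc v u ≡ true → unc u v ≡ true
    unc-sym {v} {u} h = unc-intro (trans (E-sym u v) (unc-E h)) (λ i e → unc-free h i (trans (cong (p i) (sym e)) (inv i u)))

    ∑row≡∑col : ∀ F → ∑ (row F) ≡ ∑ (col F)
    ∑row≡∑col F = ∑-swap _

    -- An edge at `v` is uncoloured or has exactly one colour, by `disj`. Delta functions turn the
    -- sum over colours into a sum over neighbours.
    deg-split : ∀ F → Diag0 F → ∀ v → ∑ (λ u → F v u * ⟦ E v u ⟧) ≡ row F v + ∑ (λ u → F v u * ⟦ unc v u ⟧)
    deg-split F F0 v = begin
      ∑ (λ u → F v u * ⟦ E v u ⟧) ≡⟨ ∑-cong pt ⟩
      ∑ (λ u → ∑ (λ i → ⟦ p i v == u ⟧ * F v u) + F v u * ⟦ unc v u ⟧) ≡⟨ ∑-+ _ _ ⟩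
      ∑ (λ u → ∑ (λ i → ⟦ p i v == u ⟧ * F v u)) + ∑ (λ u → F v u * ⟦ unc v u ⟧)
        ≡⟨ cong (_+ ∑ (λ u → F v u * ⟦ unc v u ⟧)) (trans (∑-swap _) (∑-cong (λ i → ∑-δ (p i v) (F v)))) ⟩
      row F v + ∑ (λ u → F v u * ⟦ unc v u ⟧) ∎
      where
      open ≡-Reasoning
      pt : ∀ u → F v u * ⟦ E v u ⟧ ≡ ∑ (λ i → ⟦ p i v == u ⟧ * F v u) + F v u * ⟦ unc v u ⟧
      pt u with u ≟ v
      ... | yes refl rewrite F0 v = sym (trans (+-identityʳ _) (∑-0 (λ i → *-zeroʳ ⟦ p i v == v ⟧)))
      ... | no u≢v with hit? v u
      ...   | yes (i , refl) rewrite edge i v u≢v = trans (*-identityʳ _) (sym (trans (cong₂ _+_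
                (trans (∑-*ʳ (F v (p i v)) (λ j → ⟦ p j v == p i v ⟧)) (trans (cong (_* F v (p i v)) one) (+-identityʳ _)))
                (*-zeroʳ (F v (p i v)))) (+-identityʳ _)))
        where
        one : ∑ (λ j → ⟦ p j v == p i v ⟧) ≡ 1
        one = ≤-antisym (∑-≤1 _ (λ a b x y → trans (sym (disj i a v u≢v (sym (==-sound x)))) (disj i b v u≢v (sym (==-sound y)))))
          (≤-trans (≤-reflexive (cong ⟦_⟧ (sym (==-refl (p i v))))) (term≤∑ _ i))
      ...   | no h with E v u
      ...     | true = sym (cong (_+ F v u * 1) (∑-0 (λ i → cong (λ b → ⟦ b ⟧ * F v u) (==-≢ (λ q → h (i , q))))))
      ...     | false = sym (cong (_+ F v u * 0) (∑-0 (λ i → cong (λ b → ⟦ b ⟧ * F v u) (==-≢ (λ q → h (i , q))))))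

    row≤ : ∀ F → Diag0 F → ∀ v → row F v ≤ ∑ (λ u → F v u * ⟦ E v u ⟧)
    row≤ F F0 v = ≤-trans (m≤m+n _ _) (≤-reflexive (sym (deg-split F F0 v)))

    deg-ne : ∀ v → deg v ≡ row ne v + ∑ (λ u → ⟦ unc v u ⟧)
    deg-ne v = trans (∑-cong (λ u → sym (absorb (E v u) u (λ h → ≢-of h)))) (trans (deg-split ne ne-diag v)
      (cong (row ne v +_) (∑-cong (λ u → absorb (unc v u) u (λ h → ≢-of (unc-E h))))))
      where
      absorb : ∀ b u → (b ≡ true → v ≢ u) → ne v u * ⟦ b ⟧ ≡ ⟦ b ⟧
      absorb true u h = trans (*-identityʳ _) (ne-≢ (h refl))
      absorb false u h = *-zeroʳ (ne v u)

  module _ {N k} {G : SimpleGraph N} {lock : Fin k → Fin N → Bool} (C : Colouring G lock) where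
    open SimpleGraph G
    open Colouring C

    -- The common core of adding and deleting an edge: by `gok` the new involution may, at each
    -- vertex, leave the vertex uncovered, keep the old edge of colour `α`, or take an edge that no
    -- colour uses.
    module Recolour (α : Fin k) (g : Fin N → Fin N) (ginv : ∀ v → g (g v) ≡ v)
             (gok : ∀ v → g v ≡ v ⊎ g v ≡ p α v ⊎ (E v (g v) ≡ true × (∀ i → p i v ≢ g v)))
             (glock : ∀ v → lock α v ≡ true → g v ≡ v) where

      p′ : Fin k → Fin N → Fin N
      p′ = upd p α g

      same : ∀ v → p′ α v ≡ g v
      same v = cong (λ f → f v) (upd-same p α g)

      other : ∀ i v → i ≢ α → p′ i v ≡ p i v
      other i v h = cong (λ f → f v) (upd-other p α g i h)

      new : Colouring G lock
      new .Colouring.p = p′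
      new .Colouring.inv i v with i ≟ α
      ... | yes refl = trans (same _) (trans (cong g (same v)) (ginv v))
      ... | no h = trans (other i _ h) (trans (cong (p i) (other i v h)) (inv i v))
      new .Colouring.edge i v with i ≟ α
      ... | no h rewrite other i v h = edge i v
      ... | yes refl rewrite same v = λ q → case gok v of λ
        { (inj₁ e) → ⊥-elim (q e) ; (inj₂ (inj₁ e)) → subst (λ z → E v z ≡ true) (sym e) (edge α v (λ z → q (trans e z))) ; (inj₂ (inj₂ (e , _))) → e }
      new .Colouring.disj i j v with i ≟ α | j ≟ α
      ... | yes refl | yes refl = λ _ _ → refl
      ... | no h | no h′ rewrite other i v h | other j v h′ = disj i j v
      ... | yes refl | no h rewrite same v | other j v h = λ a b → case gok v of λ
        { (inj₁ e) → ⊥-elim (a e) ; (inj₂ (inj₁ e)) → disj α j v (λ z → a (trans e z)) (trans (sym e) b) ; (inj₂ (inj₂ (_ , f))) → ⊥-elim (f j (sym b)) }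
      ... | no h | yes refl rewrite same v | other i v h = λ a b → case gok v of λ
        { (inj₁ e) → ⊥-elim (a (trans b e)) ; (inj₂ (inj₁ e)) → disj i α v a (trans b e) ; (inj₂ (inj₂ (_ , f))) → ⊥-elim (f i b) }
      new .Colouring.locked i v l with i ≟ α
      ... | yes refl = trans (same v) (glock v l)
      ... | no h = trans (other i v h) (locked i v l)

      row-upd : ∀ F v → Colouring.row new F v + F v (p α v) ≡ row F v + F v (g v)
      row-upd F v = trans (∑-upd (λ i → F v (p′ i v)) (λ i → F v (p i v)) α (λ i h → cong (F v) (other i v h)))
        (cong (λ z → row F v + F v z) (same v))

      col-same : ∀ F → Colouring.col new F α ≡ ∑ (λ v → F v (g v))
      col-same F = ∑-cong (λ v → cong (F v) (same v))

    -- The effect of changing the colour class α at u and w only; F u w and F w u are gained.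
    record Added (α : Fin k) (u w : Fin N) : Set where
      no-eta-equality
      field
        new : Colouring G lock
        rest : ∀ v → v ≢ u → v ≢ w → Colouring.p new α v ≡ p α v
        other : ∀ i v → i ≢ α → Colouring.p new i v ≡ p i v
        row-eq : ∀ F → Diag0 F → ∀ v → Colouring.row new F v ≡ row F v + (⟦ v == u ⟧ * F u w + ⟦ v == w ⟧ * F w u)
        col-eq : ∀ F → Diag0 F → Colouring.col new F α ≡ col F α + (F u w + F w u)

      col-other : ∀ F i → i ≢ α → Colouring.col new F i ≡ col F i
      col-other F i h = ∑-cong (λ v → cong (F v) (other i v h))

    record Deleted (α : Fin k) (u w : Fin N) : Set where
      no-eta-equality
      field
        new : Colouring G lock
        at-u : Colouring.p new α u ≡ u
        at-w : Colouring.p new α w ≡ w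
        rest : ∀ v → v ≢ u → v ≢ w → Colouring.p new α v ≡ p α v
        other : ∀ i v → i ≢ α → Colouring.p new i v ≡ p i v
        row-eq : ∀ F → Diag0 F → ∀ v → Colouring.row new F v + (⟦ v == u ⟧ * F u w + ⟦ v == w ⟧ * F w u) ≡ row F v
        col-eq : ∀ F → Diag0 F → Colouring.col new F α + (F u w + F w u) ≡ col F α

      col-other : ∀ F i → i ≢ α → Colouring.col new F i ≡ col F i
      col-other F i h = ∑-cong (λ v → cong (F v) (other i v h))

    private
      pair : (Fin N → Fin N) → Fin N → Fin N → (Fin N → Fin N)
      pair f u w v = if v == u then w else if v == w then u else f v

      pair-u : ∀ f u w → pair f u w u ≡ w
      pair-u f u w rewrite ==-refl u = refl

      pair-w : ∀ f u w → pair f u w w ≡ u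
      pair-w f u w with w ≟ u
      ... | yes refl rewrite ==-refl u = refl
      ... | no h rewrite ==-≢ h | ==-refl w = refl

      pair-o : ∀ f u w v → v ≢ u → v ≢ w → pair f u w v ≡ f v
      pair-o f u w v a b rewrite ==-≢ a | ==-≢ b = refl

      three : ∀ (v u w : Fin N) → v ≡ u ⊎ v ≡ w ⊎ (v ≢ u × v ≢ w)
      three v u w with v ≟ u | v ≟ w
      ... | yes a | _ = inj₁ a
      ... | no a | yes b = inj₂ (inj₁ b)
      ... | no a | no b = inj₂ (inj₂ (a , b))

      ∑-gain : ∀ (u w : Fin N) a b → ∑ (λ v → ⟦ v == u ⟧ * a + ⟦ v == w ⟧ * b) ≡ a + b
      ∑-gain u w a b = trans (∑-+ _ _) (cong₂ _+_ (d u a) (d w b))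
        where
        d : ∀ u a → ∑ (λ v → ⟦ v == u ⟧ * a) ≡ a
        d u a = trans (∑-*ʳ a (λ v → ⟦ v == u ⟧)) (trans (cong (_* a) (∑-δ1′ u)) (+-identityʳ a))

    abstract
      add : ∀ α u w → unc u w ≡ true → p α u ≡ u → p α w ≡ w → lock α u ≡ false → lock α w ≡ false → Added α u w
      add α u w un pu pw lu lw = record
        { new = R.new
        ; rest = λ v a b → trans (R.same v) (pair-o (p α) u w v a b)
        ; other = R.other
        ; row-eq = r
        ; col-eq = λ F F0 → begin
            Colouring.col R.new F α ≡⟨ R.col-same F ⟩
            ∑ (λ v → F v (g v)) ≡⟨ ∑-cong (gF F F0) ⟩
            ∑ (λ v → F v (p α v) + (⟦ v == u ⟧ * F u w + ⟦ v == w ⟧ * F w u)) ≡⟨ ∑-+ _ _ ⟩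
            col F α + ∑ (λ v → ⟦ v == u ⟧ * F u w + ⟦ v == w ⟧ * F w u) ≡⟨ cong (col F α +_) (∑-gain u w _ _) ⟩
            col F α + (F u w + F w u) ∎ }
        where
        open ≡-Reasoning
        u≢w : u ≢ w
        u≢w = ≢-of (unc-E un)
        g : Fin N → Fin N
        g = pair (p α) u w
        ginv : ∀ v → g (g v) ≡ v
        ginv v with three v u w
        ... | inj₁ refl = trans (cong g (pair-u (p α) v w)) (pair-w (p α) v w)
        ... | inj₂ (inj₁ refl) = trans (cong g (pair-w (p α) u v)) (pair-u (p α) u v)
        ... | inj₂ (inj₂ (a , b)) = trans (cong g (pair-o (p α) u w v a b))
          (trans (pair-o (p α) u w (p α v) (λ e → a (trans (sym (inv α v)) (trans (cong (p α) e) pu))) (λ e → b (trans (sym (inv α v)) (trans (cong (p α) e) pw)))) (inv α v))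
        gok : ∀ v → g v ≡ v ⊎ g v ≡ p α v ⊎ (E v (g v) ≡ true × (∀ i → p i v ≢ g v))
        gok v with three v u w
        ... | inj₁ refl = inj₂ (inj₂ (subst (λ z → E v z ≡ true) (sym (pair-u (p α) v w)) (unc-E un) , λ i e → unc-free un i (trans e (pair-u (p α) v w))))
        ... | inj₂ (inj₁ refl) = inj₂ (inj₂ (subst (λ z → E v z ≡ true) (sym (pair-w (p α) u v)) (unc-E (unc-sym un)) , λ i e → unc-free (unc-sym un) i (trans e (pair-w (p α) u v))))
        ... | inj₂ (inj₂ (a , b)) = inj₂ (inj₁ (pair-o (p α) u w v a b))
        glock : ∀ v → lock α v ≡ true → g v ≡ v
        glock v l with three v u w
        ... | inj₁ refl = tf l lu
        ... | inj₂ (inj₁ refl) = tf l lw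
        ... | inj₂ (inj₂ (a , b)) = trans (pair-o (p α) u w v a b) (locked α v l)
        module R = Recolour α g ginv gok glock
        h : Weight N → Fin N → ℕ
        h F v = ⟦ v == u ⟧ * F u w + ⟦ v == w ⟧ * F w u
        gF : ∀ F → Diag0 F → ∀ v → F v (g v) ≡ F v (p α v) + h F v
        gF F F0 v with three v u w
        ... | inj₁ refl rewrite pair-u (p α) v w | pu | F0 v | ==-refl v | ==-≢ u≢w = sym (trans (+-identityʳ _) (+-identityʳ _))
        ... | inj₂ (inj₁ refl) rewrite pair-w (p α) u v | pw | F0 v | ==-refl v | ==-≢ (λ z → u≢w (sym z)) = sym (+-identityʳ _)
        ... | inj₂ (inj₂ (a , b)) rewrite pair-o (p α) u w v a b | ==-≢ a | ==-≢ b = sym (+-identityʳ _)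
        r : ∀ F → Diag0 F → ∀ v → Colouring.row R.new F v ≡ row F v + h F v
        r F F0 v = +-cancelʳ-≡ (F v (p α v)) _ _ (trans (R.row-upd F v) (trans (cong (row F v +_) (trans (gF F F0 v) (+-comm (F v (p α v)) _))) (sym (+-assoc (row F v) _ _))))

    abstract
      delete : ∀ α u → p α u ≢ u → Deleted α u (p α u)
      delete α u pu = record
        { new = R.new
        ; at-u = trans (R.same u) gu ; at-w = trans (R.same w) gw
        ; rest = λ v a b → trans (R.same v) (go v a b)
        ; other = R.other
        ; row-eq = r
        ; col-eq = λ F F0 → begin
            Colouring.col R.new F α + (F u w + F w u) ≡⟨ cong₂ _+_ (R.col-same F) (sym (∑-gain u w _ _)) ⟩
            ∑ (λ v → F v (g v)) + ∑ (h F) ≡⟨ sym (∑-+ _ _) ⟩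
            ∑ (λ v → F v (g v) + h F v) ≡⟨ ∑-cong (λ v → sym (gF F F0 v)) ⟩
            col F α ∎ }
        where
        open ≡-Reasoning
        w : Fin N
        w = p α u
        pw : p α w ≡ u
        pw = inv α u
        g : Fin N → Fin N
        g v = if v == u then u else if v == w then w else p α v
        gu : g u ≡ u
        gu rewrite ==-refl u = refl
        gw : g w ≡ w
        gw rewrite ==-≢ pu | ==-refl w = refl
        go : ∀ v → v ≢ u → v ≢ w → g v ≡ p α v
        go v a b rewrite ==-≢ a | ==-≢ b = refl
        ginv : ∀ v → g (g v) ≡ v
        ginv v with three v u w
        ... | inj₁ refl = trans (cong g gu) gu
        ... | inj₂ (inj₁ refl) = trans (cong g gw) gw
        ... | inj₂ (inj₂ (a , b)) = trans (cong g (go v a b)) (trans (go (p α v) (λ e → b (trans (sym (inv α v)) (cong (p α) e)))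
             (λ e → a (trans (sym (inv α v)) (trans (cong (p α) e) pw)))) (inv α v))
        gok : ∀ v → g v ≡ v ⊎ g v ≡ p α v ⊎ (E v (g v) ≡ true × (∀ i → p i v ≢ g v))
        gok v with three v u w
        ... | inj₁ refl = inj₁ gu
        ... | inj₂ (inj₁ refl) = inj₁ gw
        ... | inj₂ (inj₂ (a , b)) = inj₂ (inj₁ (go v a b))
        glock : ∀ v → lock α v ≡ true → g v ≡ v
        glock v l with three v u w
        ... | inj₁ refl = gu
        ... | inj₂ (inj₁ refl) = gw
        ... | inj₂ (inj₂ (a , b)) = trans (go v a b) (locked α v l)
        module R = Recolour α g ginv gok glock
        h : Weight N → Fin N → ℕ
        h F v = ⟦ v == u ⟧ * F u w + ⟦ v == w ⟧ * F w u
        gF : ∀ F → Diag0 F → ∀ v → F v (p α v) ≡ F v (g v) + h F v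
        gF F F0 v with three v u w
        ... | inj₁ refl rewrite gu | F0 v | ==-refl v | ==-≢ (λ z → pu (sym z)) = sym (trans (+-identityʳ _) (+-identityʳ _))
        ... | inj₂ (inj₁ refl) rewrite gw | F0 w | ==-refl w | ==-≢ pu | pw = sym (+-identityʳ _)
        ... | inj₂ (inj₂ (a , b)) rewrite go v a b | ==-≢ a | ==-≢ b = sym (+-identityʳ _)
        r : ∀ F → Diag0 F → ∀ v → Colouring.row R.new F v + h F v ≡ row F v
        r F F0 v = +-cancelʳ-≡ (F v (g v)) _ _ (trans (trans (+-assoc (Colouring.row R.new F v) _ _) (cong (Colouring.row R.new F v +_)
           (trans (+-comm (h F v) _) (sym (gF F F0 v))))) (R.row-upd F v))

-- Nearly complete edge colourings by Kempe changes

module Vizing where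
  open Prelude
  open Sums
  open Kempe
  open EdgeColouring

  module _ {N} (P Q : Fin N → Fin N) (Pi : ∀ v → P (P v) ≡ v) (Qi : ∀ v → Q (Q v) ≡ v) where

    End : Fin N → Set
    End z = P z ≡ z ⊎ Q z ≡ z

    record Avoiding (Z : Fin N → Bool) (b : ℕ) : Set where
      no-eta-equality
      field
        W : Fin N → Bool
        closedP : ∀ v → W (P v) ≡ W v
        closedQ : ∀ v → W (Q v) ≡ W v
        avoids : ∀ z → Z z ≡ true → W z ≡ false
        many : ∀ (X : Fin N → Bool) → (∀ x → X x ≡ true → End x) → ∑ (λ v → ⟦ X v ⟧) ≤ ∑ (λ v → ⟦ X v ∧ W v ⟧) + 2 * b

    abstract
      -- Remove the components of the vertices of Z; each of them contains at most two ends.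
      avoid : ∀ b Z → ∑ (λ v → ⟦ Z v ⟧) ≤ b → (∀ z → Z z ≡ true → End z) → Avoiding Z b
      avoid b Z le zend with any? (λ v → Z v ≟ᵇ true)
      ... | no h = record { W = λ _ → true ; closedP = λ _ → refl ; closedQ = λ _ → refl ; avoids = λ z e → ⊥-elim (h (z , e))
                          ; many = λ X _ → ≤-trans (∑-mono (λ v → ⟦⟧-mono (λ e → ∧-intro e refl))) (m≤m+n _ _) }
      avoid zero Z le zend | yes (z , e) = ⊥-elim (<⇒≱ (subst (λ b → 0 < ⟦ b ⟧) (sym e) (s≤s z≤n)) (≤-trans (term≤∑ _ z) le))
      avoid (suc b) Z le zend | yes (z , e) = record
        { W = λ v → A.W v ∧ not (S v)
        ; closedP = λ v → cong₂ _∧_ (A.closedP v) (cong not (closedP v))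
        ; closedQ = λ v → cong₂ _∧_ (A.closedQ v) (cong not (closedQ v))
        ; avoids = av
        ; many = mn }
        where
        open Component (component-of P Q Pi Qi z (zend z e))
        Z′ : Fin N → Bool
        Z′ v = Z v ∧ not (v == z)
        pt : ∀ v → ⟦ Z v ⟧ ≡ ⟦ Z′ v ⟧ + ⟦ v == z ⟧
        pt v with v ≟ z
        ... | yes refl rewrite e | ==-refl v = refl
        ... | no h rewrite ==-≢ h with Z v
        ...   | true = refl
        ...   | false = refl
        le′ : ∑ (λ v → ⟦ Z′ v ⟧) ≤ b
        le′ = +-cancelʳ-≤ 1 _ _ (≤-trans (≤-reflexive (sym (trans (∑-cong pt) (trans (∑-+ _ _) (cong (∑ (λ v → ⟦ Z′ v ⟧) +_) (∑-δ1′ z))))))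
          (≤-trans le (≤-reflexive (+-comm 1 b))))
        A₀ : Avoiding Z′ b
        A₀ = avoid b Z′ le′ (λ v h → zend v (proj₁ (∧-true h)))
        module A = Avoiding A₀
        av : ∀ v → Z v ≡ true → A.W v ∧ not (S v) ≡ false
        av v h with v ≟ z
        ... | yes refl rewrite x∈S with A.W v
        ...   | true = refl
        ...   | false = refl
        av v h | no ne rewrite A.avoids v (∧-intro h (cong not (==-≢ ne))) = refl
        mn : ∀ (X : Fin N → Bool) → (∀ x → X x ≡ true → End x) → ∑ (λ v → ⟦ X v ⟧) ≤ ∑ (λ v → ⟦ X v ∧ (A.W v ∧ not (S v)) ⟧) + 2 * suc b
        mn X xe = ≤-trans (A.many X xe) (≤-trans (+-monoˡ-≤ (2 * b) (≤-trans (∑-mono q) (≤-reflexive (trans (∑-+ _ _)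
          (cong (∑ (λ v → ⟦ X v ∧ (A.W v ∧ not (S v)) ⟧) +_) (trans (∑-+ _ _) (cong₂ _+_ (∑-δ1′ z) (∑-δ1′ y))))))))
          (≤-reflexive (ar _ b)))
          where
          ar : ∀ s b → s + 2 + 2 * b ≡ s + 2 * suc b
          ar = solve-∀
          q : ∀ v → ⟦ X v ∧ A.W v ⟧ ≤ ⟦ X v ∧ (A.W v ∧ not (S v)) ⟧ + (⟦ v == z ⟧ + ⟦ v == y ⟧)
          q v with X v in ex | A.W v | S v in es
          ... | false | _ | _ = z≤n
          ... | true | false | _ = z≤n
          ... | true | true | false = s≤s z≤n
          ... | true | true | true with ends v es (xe v ex)
          ...   | inj₁ refl rewrite ==-refl v = s≤s z≤n
          ...   | inj₂ refl rewrite ==-refl v = ≤-trans (s≤s z≤n) (m≤n+m 1 _)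

  -- A Kempe change on a union `W` of components. Forbidden colours stay respected because no vertex
  -- of `W` is locked for either colour, which is the reason why components of locked vertices have
  -- to be avoided.
  module Swap {N k} {G : SimpleGraph N} {lock : Fin k → Fin N → Bool} (C : Colouring G lock) (α β : Fin k) (W : Fin N → Bool)
              (cα : ∀ v → W (Colouring.p C α v) ≡ W v) (cβ : ∀ v → W (Colouring.p C β v) ≡ W v)
              (lα : ∀ v → W v ≡ true → lock α v ≡ false) (lβ : ∀ v → W v ≡ true → lock β v ≡ false) where
    open SimpleGraph G
    open Colouring C

    τ : Fin k → Fin k
    τ i = if i == α then β else if i == β then α else i

    σ : Bool → Fin k → Fin k
    σ b i = if b then τ i else i

    τα : τ α ≡ β
    τα rewrite ==-refl α = refl

    τβ : τ β ≡ α
    τβ with β ≟ α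
    ... | yes refl rewrite ==-refl β = refl
    ... | no h rewrite ==-≢ h | ==-refl β = refl

    τo : ∀ i → i ≢ α → i ≢ β → τ i ≡ i
    τo i a b rewrite ==-≢ a | ==-≢ b = refl

    data Cases (i : Fin k) : Set where
      isα : i ≡ α → Cases i
      isβ : i ≡ β → Cases i
      isO : i ≢ α → i ≢ β → Cases i

    cases : ∀ i → Cases i
    cases i with i ≟ α | i ≟ β
    ... | yes a | _ = isα a
    ... | no _ | yes b = isβ b
    ... | no a | no b = isO a b

    ττ : ∀ i → τ (τ i) ≡ i
    ττ i with cases i
    ... | isα refl = trans (cong τ τα) τβ
    ... | isβ refl = trans (cong τ τβ) τα
    ... | isO a b = trans (cong τ (τo i a b)) (τo i a b)

    σσ : ∀ b i → σ b (σ b i) ≡ i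
    σσ true = ττ
    σσ false _ = refl

    σ-O : ∀ b i → i ≢ α → i ≢ β → σ b i ≡ i
    σ-O true = τo
    σ-O false i _ _ = refl

    σ-inj : ∀ b i j → σ b i ≡ σ b j → i ≡ j
    σ-inj b i j e = trans (sym (σσ b i)) (trans (cong (σ b) e) (σσ b j))

    p′ : Fin k → Fin N → Fin N
    p′ i v = p (σ (W v) i) v

    W-closed : ∀ i v → i ≡ α ⊎ i ≡ β → W (p′ i v) ≡ W v
    W-closed i v h with W v in e
    W-closed i v (inj₁ refl) | true = trans (cong (λ j → W (p j v)) τα) (trans (cβ v) e)
    W-closed i v (inj₂ refl) | true = trans (cong (λ j → W (p j v)) τβ) (trans (cα v) e)
    W-closed i v (inj₁ refl) | false = trans (cα v) e
    W-closed i v (inj₂ refl) | false = trans (cβ v) e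

    new : Colouring G lock
    new .Colouring.p = p′
    new .Colouring.inv i v = trans (cong (λ j → p j (p′ i v)) (σ-cl i)) (inv (σ (W v) i) v)
      where
      σ-cl : ∀ i → σ (W (p′ i v)) i ≡ σ (W v) i
      σ-cl i with cases i
      ... | isα a = cong (λ b → σ b i) (W-closed i v (inj₁ a))
      ... | isβ b = cong (λ b → σ b i) (W-closed i v (inj₂ b))
      ... | isO a b = trans (σ-O (W (p′ i v)) i a b) (sym (σ-O (W v) i a b))
    new .Colouring.edge i v = edge (σ (W v) i) v
    new .Colouring.disj i j v a b = σ-inj (W v) i j (disj _ _ v a b)
    new .Colouring.locked i v l with W v in e
    ... | false = locked i v l
    ... | true with cases i
    ...   | isα refl = tf l (lα v e)
    ...   | isβ refl = tf l (lβ v e)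
    ...   | isO a b = trans (cong (λ j → p j v) (τo i a b)) (locked i v l)

    row-same : ∀ F v → Colouring.row new F v ≡ row F v
    row-same F v = ∑-inv (σ (W v)) (σσ (W v)) (λ i → F v (p i v))

    unc-same : ∀ {v u} → unc v u ≡ true → Colouring.unc new v u ≡ true
    unc-same h = Colouring.unc-intro new (unc-E h) (λ i → unc-free h _)

    p′-out : ∀ i v → W v ≡ false → p′ i v ≡ p i v
    p′-out i v e rewrite e = refl

    p′-other : ∀ i v → i ≢ α → i ≢ β → p′ i v ≡ p i v
    p′-other i v a b = cong (λ j → p j v) (σ-O (W v) i a b)

    p′-α : ∀ v → W v ≡ true → p′ α v ≡ p β v
    p′-α v e rewrite e = cong (λ j → p j v) τα

    p′-β : ∀ v → W v ≡ true → p′ β v ≡ p α v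
    p′-β v e rewrite e = cong (λ j → p j v) τβ

  module _ {N k} (G : SimpleGraph N) (lock : Fin k → Fin N → Bool) (c s K : ℕ)
           (few-locks : ∀ i → ∑ (λ v → ⟦ lock i v ⟧) ≤ c)
           (slack : ∀ v → SimpleGraph.deg G v + ∑ (λ i → ⟦ lock i v ⟧) + s ≤ k)
           (numeric : 2 * (1 + (c + c)) * k < K * s) where
    open SimpleGraph G

    private
      s>0 : 0 < s
      s>0 = pos s numeric
        where
        pos : ∀ s {a} → a < K * s → 0 < s
        pos zero h = ⊥-elim (n≮0 (≤-trans h (≤-reflexive (*-zeroʳ K))))
        pos (suc s) _ = s≤s z≤n

      avail≥ : ∀ (C : Colouring G lock) u → s ≤ ∑ (λ i → ⟦ Colouring.avail C i u ⟧)
      avail≥ C u = +-cancelˡ-≤ (deg u + ∑ (λ i → ⟦ lock i u ⟧)) _ _ (≤-trans (slack u) (≤-trans (≤-reflexive (sym (Colouring.row-total C u)))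
        (+-monoˡ-≤ _ (+-monoˡ-≤ _ (m+n≤o⇒m≤o _ (≤-reflexive (sym (Colouring.deg-ne C u))))))))

    private
      R = 2 * (1 + (c + c))

      or-f : ∀ {a b} → a ∨ b ≡ false → a ≡ false × b ≡ false
      or-f {false} {false} _ = refl , refl

      or3 : ∀ a b d → ⟦ a ∨ (b ∨ d) ⟧ ≤ ⟦ a ⟧ + (⟦ b ⟧ + ⟦ d ⟧)
      or3 true b d = s≤s z≤n
      or3 false true d = s≤s z≤n
      or3 false false d = ≤-refl

      Z : Fin N → Fin k → Fin k → Fin N → Bool
      Z v α β u = (v == u) ∨ (lock α u ∨ lock β u)

      Z≤ : ∀ v α β → ∑ (λ u → ⟦ Z v α β u ⟧) ≤ 1 + (c + c)
      Z≤ v α β = ≤-trans (∑-mono (λ u → or3 (v == u) (lock α u) (lock β u)))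
        (≤-trans (≤-reflexive (trans (∑-+ _ _) (cong₂ _+_ (∑-δ1 v) (∑-+ _ _)))) (+-monoʳ-≤ 1 (+-mono-≤ (few-locks α) (few-locks β))))

    module _ (C : Colouring G lock) (v : Fin N) where
      open Colouring C

      private
        finish : ∀ α β → p β v ≡ v → lock β v ≡ false →
          (A : Avoiding (p α) (p β) (inv α) (inv β) (Z v α β) (1 + (c + c))) →
          ∀ u → unc v u ≡ true → avail α u ≡ true → Avoiding.W A u ≡ true →
          Σ (Colouring G lock) λ C′ → ∑ (row ne) < ∑ (Colouring.row C′ ne)
        finish α β βv βl A u vu αu Wu = Added.new ad , lt
          where
          module A = Avoiding A
          open ≤-Reasoning
          Wl : ∀ u → A.W u ≡ true → Z v α β u ≡ false
          Wl u e = ¬true (λ z → tf e (A.avoids u z))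
          lβ : ∀ u → A.W u ≡ true → lock β u ≡ false
          lβ u e = proj₂ (or-f {lock α u} (proj₂ (or-f {v == u} (Wl u e))))
          module Sw = Swap C α β A.W A.closedP A.closedQ (λ u e → proj₁ (or-f (proj₂ (or-f {v == u} (Wl u e))))) lβ
          Wv : A.W v ≡ false
          Wv = A.avoids v (cong (_∨ (lock α v ∨ lock β v)) (==-refl v))
          ad : Added Sw.new β v u
          ad = add Sw.new β v u (Sw.unc-same vu) (trans (Sw.p′-out β v Wv) βv)
                 (trans (Sw.p′-β u Wu) (==-sound (proj₁ (∧-true {p α u == u} αu)))) βl (lβ u Wu)
          one : ⟦ v == v ⟧ * ne v u ≡ 1
          one rewrite ==-refl v | ne-≢ (≢-of (unc-E vu)) = refl
          lt : ∑ (row ne) < ∑ (Colouring.row (Added.new ad) ne)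
          lt = ∑-mono-< (λ x → ≤-trans (≤-reflexive (sym (Sw.row-same ne x))) (≤-trans (m≤m+n _ _) (≤-reflexive (sym (Added.row-eq ad ne ne-diag x))))) v
            (begin
              suc (row ne v) ≡⟨ cong suc (sym (Sw.row-same ne v)) ⟩
              suc (Colouring.row Sw.new ne v) ≡⟨ +-comm 1 _ ⟩
              Colouring.row Sw.new ne v + 1 ≤⟨ +-monoʳ-≤ (Colouring.row Sw.new ne v) (≤-trans (≤-reflexive (sym one)) (m≤m+n _ _)) ⟩
              Colouring.row Sw.new ne v + (⟦ v == v ⟧ * ne v u + ⟦ v == u ⟧ * ne u v) ≡⟨ sym (Added.row-eq ad ne ne-diag v) ⟩
              Colouring.row (Added.new ad) ne v ∎)

        -- Double counting: each of at least `K` neighbours along uncoloured edges has `s` available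
        -- colours, and by `numeric` the average over the `k` colours exceeds `R`.
        popular : K ≤ ∑ (λ u → ⟦ unc v u ⟧) → ∃ λ α → R < ∑ (λ u → ⟦ unc v u ∧ avail α u ⟧)
        popular big = ∑<→∃ (λ _ → R) (λ α → ∑ (λ u → ⟦ unc v u ∧ avail α u ⟧)) (begin-strict
          ∑ {k} (λ _ → R) ≡⟨ trans (∑-const k R) (*-comm k R) ⟩
          R * k <⟨ numeric ⟩
          K * s ≤⟨ *-monoˡ-≤ s big ⟩
          ∑ (λ u → ⟦ unc v u ⟧) * s ≡⟨ sym (∑-*ʳ s (λ u → ⟦ unc v u ⟧)) ⟩
          ∑ (λ u → ⟦ unc v u ⟧ * s) ≤⟨ ∑-mono (λ u → *-monoʳ-≤ ⟦ unc v u ⟧ (avail≥ C u)) ⟩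
          ∑ (λ u → ⟦ unc v u ⟧ * ∑ (λ i → ⟦ avail i u ⟧)) ≡⟨ ∑-cong (λ u → trans (sym (∑-*ˡ ⟦ unc v u ⟧ (λ i → ⟦ avail i u ⟧))) (∑-cong (λ i → sym (⟦⟧-∧ (unc v u) (avail i u))))) ⟩
          ∑ (λ u → ∑ (λ i → ⟦ unc v u ∧ avail i u ⟧)) ≡⟨ ∑-swap _ ⟩
          ∑ (λ i → ∑ (λ u → ⟦ unc v u ∧ avail i u ⟧)) ∎)
          where open ≤-Reasoning

        -- The components of `v` and of the vertices locked for `α` or `β` contain at most `R` ends.
        -- So one of the neighbours missing `α` lies in another component; after a swap there, `β`
        -- is missing at both ends of the uncoloured edge.
        choose : ∀ α → R < ∑ (λ u → ⟦ unc v u ∧ avail α u ⟧) → ∀ β → avail β v ≡ true →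
          Σ (Colouring G lock) λ C′ → ∑ (row ne) < ∑ (Colouring.row C′ ne)
        choose α pop β βa = go (count∃ _ (+-cancelʳ-< R 0 _ (≤-trans pop (Avoiding.many A X (λ x h → inj₁ (==-sound (proj₁ (∧-true (proj₂ (∧-true {unc v x} h))))))))))
          where
          X : Fin N → Bool
          X u = unc v u ∧ avail α u
          βv : p β v ≡ v
          βv = ==-sound (proj₁ (∧-true βa))
          Zend : ∀ z → Z v α β z ≡ true → End (p α) (p β) (inv α) (inv β) z
          Zend z h with ∨-true {v == z} h
          ... | inj₁ e = inj₂ (subst (λ x → p β x ≡ x) (==-sound e) βv)
          ... | inj₂ h′ with ∨-true {lock α z} h′
          ...   | inj₁ e = inj₁ (locked α z e)
          ...   | inj₂ e = inj₂ (locked β z e)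
          A : Avoiding (p α) (p β) (inv α) (inv β) (Z v α β) (1 + (c + c))
          A = avoid (p α) (p β) (inv α) (inv β) (1 + (c + c)) (Z v α β) (Z≤ v α β) Zend
          go : (∃ λ u → X u ∧ Avoiding.W A u ≡ true) → Σ (Colouring G lock) λ C′ → ∑ (row ne) < ∑ (Colouring.row C′ ne)
          go (u , h) = finish α β βv (not-true (proj₂ (∧-true {p β v == v} βa))) A u
            (proj₁ (∧-true {unc v u} (proj₁ (∧-true h)))) (proj₂ (∧-true {unc v u} (proj₁ (∧-true {X u} h)))) (proj₂ (∧-true {X u} h))

      abstract
        grow : K ≤ ∑ (λ u → ⟦ unc v u ⟧) → Σ (Colouring G lock) λ C′ → ∑ (row ne) < ∑ (Colouring.row C′ ne)
        grow big = go (popular big) (count∃ (λ i → avail i v) (≤-trans s>0 (avail≥ C v)))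
          where
          go : (∃ λ α → R < ∑ (λ u → ⟦ unc v u ∧ avail α u ⟧)) → (∃ λ β → avail β v ≡ true) → Σ (Colouring G lock) λ C′ → ∑ (row ne) < ∑ (Colouring.row C′ ne)
          go (α , pop) (β , βa) = choose α pop β βa

    empty : Colouring G lock
    empty = record { p = λ _ v → v ; inv = λ _ _ → refl ; edge = λ _ _ h → ⊥-elim (h refl) ; disj = λ _ _ _ h → ⊥-elim (h refl) ; locked = λ _ _ _ → refl }

    private
      Good : Set
      Good = ∃ λ (C : Colouring G lock) → ∀ v → ∑ (λ u → ⟦ Colouring.unc C v u ⟧) < K

      row≤deg : ∀ (C : Colouring G lock) v → Colouring.row C ne v ≤ deg v
      row≤deg C v = m+n≤o⇒m≤o _ (≤-reflexive (sym (Colouring.deg-ne C v)))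

      loop : ∀ f (C : Colouring G lock) → ∑ deg ≤ ∑ (Colouring.row C ne) + f → Good
      again : ∀ f (C : Colouring G lock) → ∑ deg ≤ ∑ (Colouring.row C ne) + f → (Σ (Colouring G lock) λ C′ → ∑ (Colouring.row C ne) < ∑ (Colouring.row C′ ne)) → Good

      loop f C le = case any? (λ v → K ≤? ∑ (λ u → ⟦ Colouring.unc C v u ⟧)) of λ
        { (no h) → C , λ v → ≰⇒> (λ q → h (v , q))
        ; (yes (v , big)) → again f C le (grow C v big) }
      again zero C le (C′ , lt) = ⊥-elim (<⇒≱ lt (≤-trans (∑-mono (row≤deg C′)) (≤-trans le (≤-reflexive (+-identityʳ _)))))
      again (suc f) C le (C′ , lt) = loop f C′ (≤-trans le (≤-trans (≤-reflexive (+-suc _ f)) (+-monoˡ-≤ f lt)))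

    abstract
      -- Allowing fewer than `K` uncoloured edges at each vertex replaces the fans of Vizing's
      -- theorem by counting, and makes it possible to tolerate boundedly many forbidden vertices
      -- per colour.
      vizing : ∃ λ (C : Colouring G lock) → ∀ v → ∑ (λ u → ⟦ Colouring.unc C v u ⟧) < K
      vizing = loop (∑ deg) empty (m≤n+m _ _)

-- Equalising the colour classes

module Equalize where
  open Prelude
  open Sums
  open Kempe
  open EdgeColouring
  open Vizing

  -- Kempe changes on a component that contains ends of the scarce colour only even out the colour classes.
  module _ {N k} {G : SimpleGraph N} {lock : Fin k → Fin N → Bool} (c a τ₀ : ℕ)
           (few-locks : ∀ i → ∑ (λ v → ⟦ lock i v ⟧) ≤ c)
           (τ₀-big : 2 * (a + (c + c)) ≤ τ₀) (τ₀-big′ : a + 2 ≤ τ₀) where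
    open SimpleGraph G

    gap : Colouring G lock → Fin k → ℕ
    gap C i = ∑ (λ v → ⟦ Colouring.avail C i v ⟧)

    excess : Colouring G lock → ℕ
    excess C = ∑ (λ i → gap C i ∸ τ₀)

    SameRows : Colouring G lock → Colouring G lock → Set
    SameRows C D = ∀ F v → Colouring.row D F v ≡ Colouring.row C F v

    -- Equal rows mean that every vertex has as many available colours as before; summing over the
    -- vertices instead of the colours gives the total gap.
    gap-total : ∀ C D → SameRows C D → ∑ (gap D) ≡ ∑ (gap C)
    gap-total C D h = trans (sym (∑-swap _)) (trans (∑-cong (λ v → +-cancelˡ-≡ (Colouring.row C ne v + ∑ (λ i → ⟦ lock i v ⟧)) _ _
      (trans (cong (λ t → t + _ + _) (sym (h ne v))) (trans (Colouring.row-total D v) (sym (Colouring.row-total C v)))))) (∑-swap _))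

    module _ (C : Colouring G lock) where
      open Colouring C

      private
        or-f : ∀ {a b} → a ∨ b ≡ false → a ≡ false × b ≡ false
        or-f {false} {false} _ = refl , refl

        Z : Fin k → Fin k → Fin N → Bool
        Z i j v = avail j v ∨ (lock i v ∨ lock j v)

        Z-out : ∀ i j v → Z i j v ≡ false → avail j v ≡ false × lock i v ≡ false × lock j v ≡ false
        Z-out i j v h with or-f {avail j v} h
        ... | e , h′ = e , or-f {lock i v} h′

        -- The component of `x` has no gap of colour `j` and no locked vertex, so its gaps of colour
        -- `i` are `x` and at most one more. The swap turns them into gaps of `j`, which has room
        -- for two: the excess of `i` falls and that of `j` remains 0.
        transfer : ∀ i j → τ₀ < gap C i → gap C j ≤ a → (A : Avoiding (p i) (p j) (inv i) (inv j) (Z i j) (a + (c + c))) →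
          ∀ x → avail i x ≡ true → Avoiding.W A x ≡ true → (K : Component (p i) (p j) x) →
          Σ (Colouring G lock) λ D → SameRows C D × excess D < excess C
        transfer i j big small A x xi xW K = Sw.new , Sw.row-same , ∑-mono-< le i lt-i
          where
          module A = Avoiding A
          module K = Component K
          S : Fin N → Bool
          S v = K.S v ∧ A.W v
          Sout : ∀ v → S v ≡ true → avail j v ≡ false × lock i v ≡ false × lock j v ≡ false
          Sout v h = Z-out i j v (¬true (λ z → tf (proj₂ (∧-true {K.S v} h)) (A.avoids v z)))
          module Sw = Swap C i j S (λ v → cong₂ _∧_ (K.closedP v) (A.closedP v)) (λ v → cong₂ _∧_ (K.closedQ v) (A.closedQ v))
            (λ v h → proj₁ (proj₂ (Sout v h))) (λ v h → proj₂ (proj₂ (Sout v h)))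
          open Colouring Sw.new using () renaming (avail to avail′; p to p′)
          out : ∀ l v → S v ≡ false → avail′ l v ≡ avail l v
          out l v h = cong (λ z → (z == v) ∧ not (lock l v)) (Sw.p′-out l v h)
          other : ∀ l v → l ≢ i → l ≢ j → avail′ l v ≡ avail l v
          other l v h h′ = cong (λ z → (z == v) ∧ not (lock l v)) (Sw.p′-other l v h h′)
          in-i : ∀ v → S v ≡ true → avail′ i v ≡ false
          in-i v h = ¬true (λ q → tf (avail-intro (trans (sym (Sw.p′-α v h)) (Colouring.avail-p Sw.new q)) (proj₂ (proj₂ (Sout v h)))) (proj₁ (Sout v h)))
          in-j : ∀ v → S v ≡ true → avail′ j v ≡ true → avail i v ≡ true
          in-j v h q = avail-intro (trans (sym (Sw.p′-β v h)) (Colouring.avail-p Sw.new q)) (proj₁ (proj₂ (Sout v h)))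
          gap-i : gap Sw.new i < gap C i
          gap-i = ∑-mono-< (λ v → ⟦⟧-mono (λ q → mono v q)) x (subst₂ (λ b d → ⟦ b ⟧ < ⟦ d ⟧) (sym (in-i x (∧-intro K.x∈S xW))) (sym xi) (s≤s z≤n))
            where
            mono : ∀ v → avail′ i v ≡ true → avail i v ≡ true
            mono v q with isTrue (S v)
            ... | inj₁ h = tf q (in-i v h)
            ... | inj₂ h = trans (sym (out i v h)) q
          gap-j : gap Sw.new j ≤ τ₀
          gap-j = ≤-trans (∑-mono pt) (≤-trans (≤-reflexive (trans (∑-+ _ _) (cong (gap C j +_) (trans (∑-+ _ _) (cong₂ _+_ (∑-δ1′ x) (∑-δ1′ K.y))))))
            (≤-trans (+-monoˡ-≤ 2 small) τ₀-big′))
            where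
            pt : ∀ v → ⟦ avail′ j v ⟧ ≤ ⟦ avail j v ⟧ + (⟦ v == x ⟧ + ⟦ v == K.y ⟧)
            pt v with isTrue (S v)
            ... | inj₂ h rewrite out j v h = m≤m+n _ _
            ... | inj₁ h with isTrue (avail′ j v)
            ...   | inj₂ q rewrite q = z≤n
            ...   | inj₁ q with K.ends v (proj₁ (∧-true {K.S v} h)) (inj₁ (avail-p (in-j v h q)))
            ...     | inj₁ refl rewrite ==-refl v = ≤-trans (⟦⟧≤1 _) (≤-trans (m≤m+n 1 _) (m≤n+m _ ⟦ avail j v ⟧))
            ...     | inj₂ refl rewrite ==-refl v = ≤-trans (⟦⟧≤1 _) (≤-trans (m≤n+m 1 _) (m≤n+m _ ⟦ avail j v ⟧))
          lt-i : gap Sw.new i ∸ τ₀ < gap C i ∸ τ₀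
          lt-i = ∸-mono-<ˡ gap-i big
            where
            ∸-mono-<ˡ : ∀ {m n o} → m < n → o < n → m ∸ o < n ∸ o
            ∸-mono-<ˡ {zero} {suc n} {zero} _ _ = s≤s z≤n
            ∸-mono-<ˡ {zero} {n} {suc o} _ q = m<n⇒0<n∸m q
            ∸-mono-<ˡ {suc m} {suc n} {zero} h _ = h
            ∸-mono-<ˡ {suc m} {suc n} {suc o} (s≤s h) (s≤s q) = ∸-mono-<ˡ h q
          le : ∀ l → gap Sw.new l ∸ τ₀ ≤ gap C l ∸ τ₀
          le l with l ≟ i | l ≟ j
          ... | yes refl | _ = <⇒≤ lt-i
          ... | no _ | yes refl = ≤-trans (≤-reflexive (m≤n⇒m∸n≡0 gap-j)) z≤n
          ... | no h | no h′ = ≤-reflexive (cong (_∸ τ₀) (∑-cong (λ v → cong ⟦_⟧ (other l v h h′))))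

      abstract
        improve : ∀ i j → τ₀ < gap C i → gap C j ≤ a → Σ (Colouring G lock) λ D → SameRows C D × excess D < excess C
        improve i j big small = go (count∃ _ (+-cancelʳ-< (2 * (a + (c + c))) 0 _ (≤-trans (s≤s τ₀-big) (≤-trans big (Avoiding.many A (avail i) (λ v h → inj₁ (avail-p h)))))))
          where
          A : Avoiding (p i) (p j) (inv i) (inv j) (Z i j) (a + (c + c))
          A = avoid (p i) (p j) (inv i) (inv j) (a + (c + c)) (Z i j)
            (≤-trans (∑-mono (λ v → or3 (avail j v) (lock i v) (lock j v))) (≤-trans (≤-reflexive (trans (∑-+ _ _) (cong (gap C j +_) (∑-+ _ _))))
              (+-mono-≤ small (+-mono-≤ (few-locks i) (few-locks j))))) zend
            where
            or3 : ∀ a b d → ⟦ a ∨ (b ∨ d) ⟧ ≤ ⟦ a ⟧ + (⟦ b ⟧ + ⟦ d ⟧)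
            or3 true b d = s≤s z≤n
            or3 false true d = s≤s z≤n
            or3 false false d = ≤-refl
            zend : ∀ z → Z i j z ≡ true → End (p i) (p j) (inv i) (inv j) z
            zend z h with ∨-true {avail j z} h
            ... | inj₁ e = inj₂ (avail-p e)
            ... | inj₂ h′ with ∨-true {lock i z} h′
            ...   | inj₁ e = inj₁ (locked i z e)
            ...   | inj₂ e = inj₂ (locked j z e)
          go : (∃ λ x → avail i x ∧ Avoiding.W A x ≡ true) → Σ (Colouring G lock) λ D → SameRows C D × excess D < excess C
          go (x , h) = transfer i j big small A x (proj₁ (∧-true {avail i x} h)) (proj₂ (∧-true {avail i x} h))
            (component-of (p i) (p j) (inv i) (inv j) x (inj₁ (avail-p (proj₁ (∧-true {avail i x} h)))))

    private
      Result : Colouring G lock → Set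
      Result C = Σ (Colouring G lock) λ D → SameRows C D × (∀ i → gap D i ≤ τ₀)

      loop : ∀ f C → ∑ (gap C) < k * suc a → excess C ≤ f → Result C
      again : ∀ f C → ∑ (gap C) < k * suc a → excess C ≤ f → (Σ (Colouring G lock) λ D → SameRows C D × excess D < excess C) → Result C

      loop f C tot le = case any? (λ i → τ₀ <? gap C i) of λ
        { (no h) → C , (λ _ _ → refl) , λ i → ≮⇒≥ (λ q → h (i , q))
        -- Swaps preserve the total gap, so the average stays below a + 1 and in every round some
        -- colour has gap at most `a`.
        ; (yes (i , big)) → case ∑<→∃ (gap C) (λ _ → suc a) (≤-trans tot (≤-reflexive (sym (∑-const k (suc a))))) of λ
          { (j , small) → again f C tot le (improve C i j big (≤-pred small)) } }
      again zero C tot le (D , r , lt) = ⊥-elim (n≮0 (≤-trans lt le))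
      again (suc f) C tot le (D , r , lt) = case loop f D (subst (_< k * suc a) (sym (gap-total C D r)) tot) (≤-pred (≤-trans lt le)) of λ
        { (D′ , r′ , h) → D′ , (λ F v → trans (r′ F v) (r F v)) , h }

    abstract
      equalize : ∀ C → ∑ (gap C) < k * suc a → Result C
      equalize C tot = loop (excess C) C tot ≤-refl

-- Same-side and cross edges

module Sides where
  open Prelude
  open Sums
  open Kempe
  open EdgeColouring

  module _ {N} (side : Fin N → Bool) where

    Fc : Weight N
    Fc v u = ⟦ side v xor side u ⟧

    Fs : Weight N
    Fs v u = ⟦ not (v == u) ∧ not (side v xor side u) ⟧

    xor-self : ∀ b → b xor b ≡ false
    xor-self true = refl
    xor-self false = refl

    Fc-diag : Diag0 Fc
    Fc-diag v = cong ⟦_⟧ (xor-self (side v))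

    Fs-diag : Diag0 Fs
    Fs-diag v rewrite ==-refl v = refl

    ne-split : ∀ v u → ne v u ≡ Fs v u + Fc v u
    ne-split v u with v ≟ u
    ... | yes refl rewrite ==-refl v | xor-self (side v) = refl
    ... | no h rewrite ==-≢ h with side v xor side u
    ...   | true = refl
    ...   | false = refl

    xor-comm : ∀ a b → a xor b ≡ b xor a
    xor-comm true true = refl
    xor-comm true false = refl
    xor-comm false true = refl
    xor-comm false false = refl

    Fs-sym : ∀ v u → Fs v u ≡ Fs u v
    Fs-sym v u = cong₂ (λ a b → ⟦ not a ∧ not b ⟧) (==-sym v u) (xor-comm (side v) (side u))

    Fs-cross : ∀ {v u} → side v xor side u ≡ true → Fs v u ≡ 0
    Fs-cross {v} {u} h rewrite h with not (v == u)
    ... | true = refl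
    ... | false = refl

    Fs-1 : ∀ {v u} → v ≢ u → side v xor side u ≡ false → Fs v u ≡ 1
    Fs-1 h e rewrite ==-≢ h | e = refl

  -- The edges of an involution, weighted by `F`, form a symmetric matrix with zero diagonal, to
  -- which the handshake lemma applies. With `ne` this is the parity of the number of covered
  -- vertices.
  involution-even : ∀ {N} (p : Fin N → Fin N) → (∀ v → p (p v) ≡ v) → (F : Weight N) → Diag0 F → (∀ u v → F u v ≡ F v u) →
    ∃ λ s → ∑ (λ v → F v (p v)) ≡ s + s
  involution-even p inv F F0 Fsym with ∑∑-even (λ u v → ⟦ p u == v ⟧ * F u v) sy (λ v → trans (cong (⟦ p v == v ⟧ *_) (F0 v)) (*-zeroʳ ⟦ p v == v ⟧))
    where
    flip : ∀ u v → (p u == v) ≡ (p v == u)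
    flip u v = Bool-≡ (λ e → subst (λ z → (p z == u) ≡ true) (==-sound e) (trans (cong (_== u) (inv u)) (==-refl u)))
                      (λ e → subst (λ z → (p z == v) ≡ true) (==-sound e) (trans (cong (_== v) (inv v)) (==-refl v)))
    sy : ∀ u v → ⟦ p u == v ⟧ * F u v ≡ ⟦ p v == u ⟧ * F v u
    sy u v = cong₂ (λ a b → ⟦ a ⟧ * b) (flip u v) (Fsym u v)
  ... | s , e = s , trans (∑-cong (λ u → sym (∑-δ (p u) (F u)))) e

  module _ {N k} {G : SimpleGraph N} {lock : Fin k → Fin N → Bool} (C : Colouring G lock) where
    open SimpleGraph G
    open Colouring C

    lockdeg : Fin N → ℕ
    lockdeg v = ∑ (λ i → ⟦ lock i v ⟧)

    row-split : ∀ side v → row ne v ≡ row (Fs side) v + row (Fc side) v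
    row-split side v = trans (∑-cong (λ i → ne-split side v (p i v))) (∑-+ _ _)

    unlocked : ∀ {i v} → p i v ≢ v → lock i v ≡ false
    unlocked h = ¬true (λ l → h (locked _ _ l))

    unc-del : ∀ {α x y} (D : Deleted C α x y) {a b} → unc a b ≡ true → Colouring.unc (Deleted.new D) a b ≡ true
    unc-del {α} {x} {y} D {a} {b} h = Colouring.unc-intro new (unc-E h) fr
      where
      open Deleted D
      fr : ∀ i → Colouring.p new i a ≢ b
      fr i e with i ≟ α
      ... | no ne = unc-free h i (trans (sym (other i a ne)) e)
      ... | yes refl with a ≟ x | a ≟ y
      ...   | yes refl | _ = ≢-of (unc-E h) (trans (sym at-u) e)
      ...   | no _ | yes refl = ≢-of (unc-E h) (trans (sym at-w) e)
      ...   | no n₁ | no n₂ = unc-free h α (trans (sym (rest a n₁ n₂)) e)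

    unc-add : ∀ {α x y} (D : Added C α x y) {a b} → a ≢ x → a ≢ y → unc a b ≡ true → Colouring.unc (Added.new D) a b ≡ true
    unc-add {α} {x} {y} D {a} {b} n₁ n₂ h = Colouring.unc-intro new (unc-E h) fr
      where
      open Added D
      fr : ∀ i → Colouring.p new i a ≢ b
      fr i e with i ≟ α
      ... | no ne = unc-free h i (trans (sym (other i a ne)) e)
      ... | yes refl = unc-free h α (trans (sym (rest a n₁ n₂)) e)

    col-even : ∀ F → Diag0 F → (∀ u v → F u v ≡ F v u) → ∀ i → ∃ λ s → col F i ≡ s + s
    col-even F F0 Fsym i = involution-even (p i) (inv i) F F0 Fsym

-- Making the first colours perfect by exchanges

module Augment where
  open Prelude
  open Sums
  open Kempe
  open EdgeColouring
  open Sides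

  -- `L` is the number of colours that a vertex may spend on cross edges or gaps, `τ` the number of
  -- vertices that a colour may leave without a same-side edge, and `ω` bounds the vertices that
  -- cannot give up another same-side edge. `num₁` is used in `over-few`, `num₂` in `find-same` and
  -- `num₃` in `find-one`.
  record AugmentData {N k} (G : SimpleGraph N) (lock : Fin k → Fin N → Bool) : Set where
    no-eta-equality
    field
      side : Fin N → Bool
      m M₀ τ ω L : ℕ
      opposite : ∀ v → ∑ (λ u → ⟦ side v xor side u ⟧) ≡ m
      crossdeg : ∀ v → M₀ ≤ ∑ (λ u → Fc side v u * ⟦ SimpleGraph.E G v u ⟧)
      num₁ : k * τ < suc ω * L
      num₂ : m + τ + (ω + ω) + (L + L) < M₀ + M₀
      num₃ : τ + (ω + ω) + L < M₀

  module _ {N k} (G : SimpleGraph N) (lock : Fin k → Fin N → Bool) (setup : AugmentData G lock) where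
    open AugmentData setup
    open SimpleGraph G

    private
      s = Fs side
      x′ = Fc side

    module _ (C : Colouring G lock) where
      open Colouring C

      Loaded : Set
      Loaded = ∀ v → k ≤ row s v + lockdeg C v + L

      Full : Set
      Full = ∀ i → N ≤ col s i + τ

      -- Under `Loaded` these are the vertices with equality: losing one more same-side edge would
      -- violate `Loaded`.
      over : Fin N → Bool
      over v = does (row s v + lockdeg C v + L ≤? k)

      over-not : ∀ v → over v ≡ false → k < row s v + lockdeg C v + L
      over-not v h = ≰⇒> (λ q → tf (does-complete (_ ≤? _) q) h)

      cr : Fin N → Fin N → Bool
      cr u x = (side u xor side x) ∧ unc u x

      nonsame : Fin k → Fin N → Bool
      nonsame i x = not (not (x == p i x) ∧ not (side x xor side (p i x)))

      -- At least k - L colours at `u` are locked or used on same-side edges, so at most `L` cross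
      -- edges at `u` are coloured.
      cr-many : Loaded → ∀ u → M₀ ≤ ∑ (λ x → ⟦ cr u x ⟧) + L
      cr-many ld u = begin
        M₀ ≤⟨ crossdeg u ⟩
        ∑ (λ x → x′ u x * ⟦ E u x ⟧) ≡⟨ deg-split x′ (Fc-diag side) u ⟩
        row x′ u + ∑ (λ x → x′ u x * ⟦ unc u x ⟧) ≡⟨ +-comm (row x′ u) _ ⟩
        ∑ (λ x → x′ u x * ⟦ unc u x ⟧) + row x′ u ≡⟨ cong (_+ row x′ u) (∑-cong (λ x → sym (⟦⟧-∧ (side u xor side x) (unc u x)))) ⟩
        ∑ (λ x → ⟦ cr u x ⟧) + row x′ u ≤⟨ +-monoʳ-≤ _ rowc ⟩
        ∑ (λ x → ⟦ cr u x ⟧) + L ∎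
        where
        open ≤-Reasoning
        rowc : row x′ u ≤ L
        rowc = lin (∑ (λ i → ⟦ avail i u ⟧)) (ld u) (trans (cong (L +_) (trans (sym (row-total u)) (cong (λ t → t + lockdeg C u + ∑ (λ i → ⟦ avail i u ⟧)) (row-split C side u))))
          (ar′ (row s u) (row x′ u) (lockdeg C u) (∑ (λ i → ⟦ avail i u ⟧)) L))
          where
          ar′ : ∀ a b c d L → L + (a + b + c + d) ≡ b + (a + c + L) + d
          ar′ = solve-∀

      nonsame-few : Full → ∀ i → ∑ (λ x → ⟦ nonsame i x ⟧) ≤ τ
      nonsame-few fl i = +-cancelˡ-≤ (col s i) _ _ (≤-trans (≤-reflexive (trans (sym (∑-+ _ _)) (trans (∑-cong (λ x → ⟦⟧-not (not (x == p i x) ∧ not (side x xor side (p i x))))) (∑-1 N)))) (fl i))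

      -- A vertex at the limit lacks a same-side edge in at least `L` colours, while `Full` allows
      -- at most k τ such pairs of a vertex and a colour altogether.
      over-few : Full → ∑ (λ x → ⟦ over x ⟧) ≤ ω
      over-few fl = ≤-pred (*-cancelʳ-< L _ _ (≤-<-trans (+-cancelʳ-≤ (k * N) _ _ (begin
        ∑ (λ x → ⟦ over x ⟧) * L + k * N ≤⟨ +-monoʳ-≤ (∑ (λ x → ⟦ over x ⟧) * L) (begin
          k * N ≡⟨ sym (∑-const k N) ⟩
          ∑ {k} (λ _ → N) ≤⟨ ∑-mono fl ⟩
          ∑ (λ i → col s i + τ) ≡⟨ trans (∑-+ _ _) (cong (∑ (col s) +_) (∑-const k τ)) ⟩
          ∑ (col s) + k * τ ≡⟨ cong (_+ k * τ) (sym (∑row≡∑col s)) ⟩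
          ∑ (row s) + k * τ ∎) ⟩
        ∑ (λ x → ⟦ over x ⟧) * L + (∑ (row s) + k * τ) ≡⟨ sym (+-assoc (∑ (λ x → ⟦ over x ⟧) * L) _ _) ⟩
        ∑ (λ x → ⟦ over x ⟧) * L + ∑ (row s) + k * τ ≡⟨ cong (λ t → t + ∑ (row s) + k * τ) (sym (∑-*ʳ L (λ x → ⟦ over x ⟧))) ⟩
        ∑ (λ x → ⟦ over x ⟧ * L) + ∑ (row s) + k * τ ≡⟨ cong (_+ k * τ) (sym (∑-+ _ _)) ⟩
        ∑ (λ x → ⟦ over x ⟧ * L + row s x) + k * τ ≤⟨ +-monoˡ-≤ (k * τ) (∑-≤ pt) ⟩
        N * k + k * τ ≡⟨ trans (cong (_+ k * τ) (*-comm N k)) (+-comm (k * N) (k * τ)) ⟩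
        k * τ + k * N ∎)) num₁))
        where
        open ≤-Reasoning
        pt : ∀ x → ⟦ over x ⟧ * L + row s x ≤ k
        pt x with over x in e
        ... | true = ≤-trans (≤-reflexive (trans (cong (_+ row s x) (+-identityʳ L)) (+-comm L (row s x))))
                       (≤-trans (+-monoˡ-≤ L (m≤m+n (row s x) (lockdeg C x))) (does-sound (_ ≤? _) e))
        ... | false = ≤-trans (m≤m+n (row s x) _) (≤-trans (≤-reflexive (sym (row-split C side x))) (≤-trans (m≤m+n _ _) (≤-trans (m≤m+n _ _) (≤-reflexive (row-total x)))))

      over-p : Full → ∀ i → ∑ (λ x → ⟦ over (p i x) ⟧) ≤ ω
      over-p fl i = ≤-trans (≤-reflexive (∑-inv (p i) (inv i) (λ x → ⟦ over x ⟧))) (over-few fl)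

      record Good (i : Fin k) (x : Fin N) : Set where
        no-eta-equality
        field
          moved : p i x ≢ x
          sameside : side x ≡ side (p i x)
          ok : over x ≡ false
          ok′ : over (p i x) ≡ false

      private
        xor-false : ∀ {a b} → a xor b ≡ false → a ≡ b
        xor-false {true} {true} _ = refl
        xor-false {false} {false} _ = refl

        nonsame-f : ∀ {i x} → nonsame i x ≡ false → p i x ≢ x × side x ≡ side (p i x)
        nonsame-f {i} {x} h with ∧-true {not (x == p i x)} (not-false h)
        ... | a , b = (λ e → tf (trans (cong (x ==_) e) (==-refl x)) (not-true a)) , xor-false (not-true b)

        good : ∀ {i x} → ⟦ nonsame i x ⟧ + ⟦ over x ⟧ + ⟦ over (p i x) ⟧ ≡ 0 → Good i x
        good {i} {x} h with nonsame i x in e₁ | over x in e₂ | over (p i x) in e₃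
        ... | false | false | false = record { moved = proj₁ (nonsame-f {i} e₁) ; sameside = proj₂ (nonsame-f {i} e₁) ; ok = e₂ ; ok′ = e₃ }

      -- Both sets, the uncoloured cross neighbours of `u` and the `p i`-images of those of `w`, lie
      -- in the opposite side apart from exceptional vertices. Their sizes add up to more than `m`
      -- plus the number of exceptions, so they share a vertex that is not exceptional.
      find-same : Loaded → Full → ∀ i u w → side u ≡ side w → ∃ λ x → Good i x × cr u x ≡ true × cr w (p i x) ≡ true
      find-same ld fl i u w uw = go (∑<→∃ (λ x → ⟦ side u xor side x ⟧ + (⟦ nonsame i x ⟧ + ⟦ over x ⟧ + ⟦ over (p i x) ⟧)) (λ x → ⟦ cr u x ⟧ + ⟦ cr w (p i x) ⟧) lt)
        where
        open ≤-Reasoning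
        lt : ∑ (λ x → ⟦ side u xor side x ⟧ + (⟦ nonsame i x ⟧ + ⟦ over x ⟧ + ⟦ over (p i x) ⟧)) < ∑ (λ x → ⟦ cr u x ⟧ + ⟦ cr w (p i x) ⟧)
        lt = begin-strict
          ∑ (λ x → ⟦ side u xor side x ⟧ + (⟦ nonsame i x ⟧ + ⟦ over x ⟧ + ⟦ over (p i x) ⟧))
            ≡⟨ trans (∑-+ _ _) (cong₂ _+_ (opposite u) (trans (∑-+ _ _) (cong (_+ ∑ (λ x → ⟦ over (p i x) ⟧)) (∑-+ _ _)))) ⟩
          m + (∑ (λ x → ⟦ nonsame i x ⟧) + ∑ (λ x → ⟦ over x ⟧) + ∑ (λ x → ⟦ over (p i x) ⟧))
            ≤⟨ +-monoʳ-≤ m (+-mono-≤ (+-mono-≤ (nonsame-few fl i) (over-few fl)) (over-p fl i)) ⟩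
          m + (τ + ω + ω) <⟨ fin ⟩
          ∑ (λ x → ⟦ cr u x ⟧) + ∑ (λ x → ⟦ cr w x ⟧) ≡⟨ cong (∑ (λ x → ⟦ cr u x ⟧) +_) (sym (∑-inv (p i) (inv i) (λ x → ⟦ cr w x ⟧))) ⟩
          ∑ (λ x → ⟦ cr u x ⟧) + ∑ (λ x → ⟦ cr w (p i x) ⟧) ≡⟨ sym (∑-+ _ _) ⟩
          ∑ (λ x → ⟦ cr u x ⟧ + ⟦ cr w (p i x) ⟧) ∎
          where
          a = ∑ (λ x → ⟦ cr u x ⟧)
          b = ∑ (λ x → ⟦ cr w x ⟧)
          fin : m + (τ + ω + ω) < a + b
          fin = lin 0 (≤-trans num₂ (+-mono-≤ (cr-many ld u) (cr-many ld w))) (ar2 m τ ω L a b)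
            where
            ar2 : ∀ m t o L a b → a + b + suc (m + t + (o + o) + (L + L)) ≡ suc (m + (t + o + o)) + (a + L + (b + L)) + 0
            ar2 = solve-∀
        go : (∃ λ x → ⟦ side u xor side x ⟧ + (⟦ nonsame i x ⟧ + ⟦ over x ⟧ + ⟦ over (p i x) ⟧) < ⟦ cr u x ⟧ + ⟦ cr w (p i x) ⟧) → ∃ λ x → Good i x × cr u x ≡ true × cr w (p i x) ≡ true
        go (x , h) with isTrue (cr u x) | isTrue (cr w (p i x))
        ... | inj₂ e₁ | inj₂ e₂ rewrite e₁ | e₂ = ⊥-elim (n≮0 h)
        ... | inj₁ e₁ | inj₂ e₂ rewrite e₁ | e₂ | proj₁ (∧-true {side u xor side x} e₁) = ⊥-elim (n≮0 (≤-pred h))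
        ... | inj₁ e₁ | inj₁ e₂ rewrite e₁ | e₂ | proj₁ (∧-true {side u xor side x} e₁) = x , good (n≤0⇒n≡0 (≤-pred (≤-pred h))) , e₁ , e₂
        ... | inj₂ e₁ | inj₁ e₂ rewrite e₁ | e₂ with good {i} {x} (n≤0⇒n≡0 (≤-trans (m≤n+m _ ⟦ side u xor side x ⟧) (≤-pred h)))
        ...   | gd = ⊥-elim (1+n≰n (≤-trans h′ (≤-pred h)))
          where
          sx : side u xor side x ≡ true
          sx = trans (cong₂ _xor_ uw (Good.sameside gd)) (proj₁ (∧-true {side w xor side (p i x)} e₂))
          h′ : 1 ≤ ⟦ side u xor side x ⟧ + (⟦ nonsame i x ⟧ + ⟦ over x ⟧ + ⟦ over (p i x) ⟧)
          h′ rewrite sx = s≤s z≤n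

      find-one : Loaded → Full → ∀ i u → ∃ λ x → Good i x × cr u x ≡ true
      find-one ld fl i u = go (∑<→∃ (λ x → ⟦ nonsame i x ⟧ + ⟦ over x ⟧ + ⟦ over (p i x) ⟧) (λ x → ⟦ cr u x ⟧) lt)
        where
        lt : ∑ (λ x → ⟦ nonsame i x ⟧ + ⟦ over x ⟧ + ⟦ over (p i x) ⟧) < ∑ (λ x → ⟦ cr u x ⟧)
        lt = ≤-trans (s≤s (≤-trans (≤-reflexive (trans (∑-+ _ _) (cong (_+ ∑ (λ x → ⟦ over (p i x) ⟧)) (∑-+ _ _))))
                   (+-mono-≤ (+-mono-≤ (nonsame-few fl i) (over-few fl)) (over-p fl i))))
             (lin 0 (≤-trans num₃ (cr-many ld u)) (ar τ ω L (∑ (λ x → ⟦ cr u x ⟧))))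
          where
          ar : ∀ t o L a → a + suc (t + (o + o) + L) ≡ suc (t + o + o) + (a + L) + 0
          ar = solve-∀
        go : (∃ λ x → ⟦ nonsame i x ⟧ + ⟦ over x ⟧ + ⟦ over (p i x) ⟧ < ⟦ cr u x ⟧) → ∃ λ x → Good i x × cr u x ≡ true
        go (x , h) with isTrue (cr u x)
        ... | inj₂ e rewrite e = ⊥-elim (n≮0 h)
        ... | inj₁ e rewrite e = x , good (n≤0⇒n≡0 (≤-pred h)) , e

      cr-cross : ∀ {u x} → cr u x ≡ true → side u xor side x ≡ true
      cr-cross h = proj₁ (∧-true h)

      cr-unc : ∀ {u x} → cr u x ≡ true → unc u x ≡ true
      cr-unc {u} {x} h = proj₂ (∧-true {side u xor side x} h)

    loaded-step : ∀ (C C′ : Colouring G lock) x y → x ≢ y → over C x ≡ false → over C y ≡ false →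
      (∀ v → Colouring.row C′ s v + (⟦ v == x ⟧ + ⟦ v == y ⟧) ≡ Colouring.row C s v) → Loaded C → Loaded C′
    loaded-step C C′ x y x≢y ox oy eq ld v with v ≟ x | v ≟ y
    ... | yes refl | yes refl = ⊥-elim (x≢y refl)
    ... | yes refl | no h = lin 0 (over-not C v ox) (trans (cong (λ t → r′ + lockdeg C v + L + suc t) refl) (trans (ar r′ (lockdeg C v) L k) (cong (λ t → k + (t + lockdeg C v + L) + 0) e)))
      where
      r′ = Colouring.row C′ s v
      e : r′ + 1 ≡ Colouring.row C s v
      e = trans (cong₂ (λ a b → r′ + (⟦ a ⟧ + ⟦ b ⟧)) (sym (==-refl v)) (sym (==-≢ h))) (eq v)
      ar : ∀ r l L k → r + l + L + suc k ≡ k + (r + 1 + l + L) + 0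
      ar = solve-∀
    ... | no h | yes refl = lin 0 (over-not C v oy) (trans (ar r′ (lockdeg C v) L k) (cong (λ t → k + (t + lockdeg C v + L) + 0) e))
      where
      r′ = Colouring.row C′ s v
      e : r′ + 1 ≡ Colouring.row C s v
      e = trans (cong₂ (λ a b → r′ + (⟦ a ⟧ + ⟦ b ⟧)) (sym (==-≢ h)) (sym (==-refl v))) (eq v)
      ar : ∀ r l L k → r + l + L + suc k ≡ k + (r + 1 + l + L) + 0
      ar = solve-∀
    ... | no h | no h′ = subst (λ t → k ≤ t + lockdeg C v + L) (sym e) (ld v)
      where
      r′ = Colouring.row C′ s v
      e : r′ ≡ Colouring.row C s v
      e = trans (sym (+-identityʳ r′)) (trans (cong₂ (λ a b → r′ + (⟦ a ⟧ + ⟦ b ⟧)) (sym (==-≢ h)) (sym (==-≢ h′))) (eq v))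

    -- The edge from `x` to `p i x` is replaced by the one from `u` to `x`, which moves the gap from
    -- `u` to `p i x` on the other side. It is the first half of an augmentation, and by itself it
    -- brings two gaps to the same side.
    record Shifted (C : Colouring G lock) (i : Fin k) (u x : Fin N) : Set where
      no-eta-equality
      open Colouring C
      field
        new : Colouring G lock
        loaded : Loaded new
        col-s : Colouring.col new s i + 2 ≡ col s i
        col-ne : Colouring.col new ne i ≡ col ne i
        others : ∀ F j → j ≢ i → Colouring.col new F j ≡ col F j
        availʸ : Colouring.avail new i (p i x) ≡ true
        availʷ : ∀ w → w ≢ u → avail i w ≡ true → Colouring.avail new i w ≡ true
        cr-keep : ∀ w z → w ≢ u → w ≢ x → cr C w z ≡ true → cr new w z ≡ true

    module _ (C : Colouring G lock) (i : Fin k) (u x : Fin N) (ld : Loaded C) (au : Colouring.avail C i u ≡ true)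
             (gd : Good C i x) (ux : cr C u x ≡ true) where
      open Colouring C
      open Good gd

      private
        y = p i x
        D : Deleted C i x y
        D = delete C i x moved
        module D = Deleted D
        u≢x : u ≢ x
        u≢x e = tf (cr-cross C ux) (trans (cong (λ z → side z xor side x) e) (xor-self side (side x)))
        u≢y : u ≢ y
        u≢y e = moved (trans (sym e) (trans (sym (avail-p au)) (trans (cong (p i) e) (inv i x))))
        lu : lock i u ≡ false
        lu = avail-lock au
        lx : lock i x ≡ false
        lx = unlocked C moved
        A : Added D.new i u x
        A = add D.new i u x (unc-del C D (cr-unc C ux)) (trans (D.rest u u≢x u≢y) (avail-p au)) D.at-u lu lx
        module A = Added A
        sxy : s x y ≡ 1
        sxy = Fs-1 side (λ e → moved (sym e)) (trans (cong (side x xor_) (sym sameside)) (xor-self side (side x)))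
        syx : s y x ≡ 1
        syx = trans (Fs-sym side y x) sxy
        sux : s u x ≡ 0
        sux = Fs-cross side {u} {x} (cr-cross C ux)
        sxu : s x u ≡ 0
        sxu = trans (Fs-sym side x u) sux
        z1 : ∀ a b → a * 1 + b * 1 ≡ a + b
        z1 = solve-∀
        z0 : ∀ r a b → r + (a * 0 + b * 0) ≡ r
        z0 = solve-∀
        rowA : ∀ v → Colouring.row A.new s v + (⟦ v == x ⟧ + ⟦ v == y ⟧) ≡ row s v
        rowA v = trans (cong₂ _+_ (trans (A.row-eq s (Fs-diag side) v) (trans (cong₂ (λ a b → Colouring.row D.new s v + (⟦ v == u ⟧ * a + ⟦ v == x ⟧ * b)) sux sxu) (z0 (Colouring.row D.new s v) ⟦ v == u ⟧ ⟦ v == x ⟧)))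
                   (sym (trans (cong₂ (λ a b → ⟦ v == x ⟧ * a + ⟦ v == y ⟧ * b) sxy syx) (z1 ⟦ v == x ⟧ ⟦ v == y ⟧)))) (D.row-eq s (Fs-diag side) v)

      shift : Shifted C i u x
      shift = record
        { new = A.new
        ; loaded = loaded-step C A.new x y (λ e → moved (sym e)) ok ok′ rowA ld
        ; col-s = trans (cong₂ _+_ (trans (A.col-eq s (Fs-diag side)) (trans (cong₂ (λ a b → Colouring.col D.new s i + (a + b)) sux sxu) (+-identityʳ _)))
                   (sym (cong₂ _+_ sxy syx))) (D.col-eq s (Fs-diag side))
        ; col-ne = trans (A.col-eq ne ne-diag) (trans (cong (Colouring.col D.new ne i +_) (trans (cong₂ _+_ (ne-≢ u≢x) (ne-≢ (λ e → u≢x (sym e))))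
                   (sym (cong₂ _+_ (ne-≢ (λ e → moved (sym e))) (ne-≢ moved))))) (D.col-eq ne ne-diag))
        ; others = λ F j h → trans (A.col-other F j h) (D.col-other F j h)
        ; availʸ = Colouring.avail-intro A.new (trans (A.rest y (λ e → u≢y (sym e)) moved) D.at-w)
                     (unlocked C (λ e → moved (trans (sym e) (inv i x))))
        ; availʷ = λ w w≢u aw → Colouring.avail-intro A.new (trans (A.rest w w≢u (w≢x w aw)) (trans (D.rest w (w≢x w aw) (w≢y w aw)) (avail-p aw))) (avail-lock aw)
        ; cr-keep = λ w z w≢u w≢x h → ∧-intro (cr-cross C h) (unc-add D.new A w≢u w≢x (unc-del C D (cr-unc C h))) }
        where
        w≢x : ∀ w → avail i w ≡ true → w ≢ x
        w≢x w aw refl = moved (avail-p aw)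
        w≢y : ∀ w → avail i w ≡ true → w ≢ y
        w≢y w aw e = moved (trans (sym (trans (cong (p i) (sym e)) (trans (avail-p aw) e))) (inv i x))

    record Augmented (C : Colouring G lock) (i : Fin k) : Set where
      no-eta-equality
      open Colouring C
      field
        new : Colouring G lock
        loaded : Loaded new
        col-s : Colouring.col new s i + 2 ≡ col s i
        col-ne : Colouring.col new ne i ≡ col ne i + 2
        others : ∀ F j → j ≢ i → Colouring.col new F j ≡ col F j

    -- u, w uncovered on the same side: replace the edge x y of colour i by u x and y w.
    augment-same : ∀ C i u w → u ≢ w → side u ≡ side w → Colouring.avail C i u ≡ true → Colouring.avail C i w ≡ true →
      Loaded C → Full C → Augmented C i
    augment-same C i u w u≢w uw au aw ld fl = go (find-same C ld fl i u w uw)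
      where
      open Colouring C
      go : (∃ λ x → Good C i x × cr C u x ≡ true × cr C w (p i x) ≡ true) → Augmented C i
      go (x , gd , ux , wy) = record
        { new = A.new
        ; loaded = λ v → subst (λ t → k ≤ t + lockdeg C v + L) (sym (rowA v)) (S.loaded v)
        ; col-s = trans (cong (_+ 2) (trans (A.col-eq s (Fs-diag side)) (trans (cong₂ (λ a b → Colouring.col S.new s i + (a + b)) syw swy) (+-identityʳ _)))) S.col-s
        ; col-ne = trans (A.col-eq ne ne-diag) (cong₂ _+_ S.col-ne (cong₂ _+_ (ne-≢ w≢y) (ne-≢ (λ e → w≢y (sym e)))))
        ; others = λ F j h → trans (A.col-other F j h) (S.others F j h) }
        where
        S : Shifted C i u x
        S = shift C i u x ld au gd ux
        module S = Shifted S
        y = p i x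
        wx : w ≢ x
        wx refl = Good.moved gd (avail-p aw)
        aw′ = S.availʷ w (λ e → u≢w (sym e)) aw
        A : Added S.new i w y
        A = add S.new i w y (cr-unc S.new (S.cr-keep w y (λ e → u≢w (sym e)) wx wy)) (Colouring.avail-p S.new aw′)
              (Colouring.avail-p S.new S.availʸ) (avail-lock aw) (Colouring.avail-lock S.new S.availʸ)
        module A = Added A
        w≢y : w ≢ y
        w≢y e = tf (cr-cross C wy) (trans (cong (λ z → side z xor side y) e) (xor-self side (side y)))
        syw : s w y ≡ 0
        syw = Fs-cross side {w} {y} (cr-cross C wy)
        swy : s y w ≡ 0
        swy = trans (Fs-sym side y w) syw
        rowA : ∀ v → Colouring.row A.new s v ≡ Colouring.row S.new s v
        rowA v = trans (A.row-eq s (Fs-diag side) v) (trans (cong₂ (λ a b → Colouring.row S.new s v + (⟦ v == w ⟧ * a + ⟦ v == y ⟧ * b)) syw swy) (z0 (Colouring.row S.new s v) ⟦ v == w ⟧ ⟦ v == y ⟧))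
          where
          z0 : ∀ r a b → r + (a * 0 + b * 0) ≡ r
          z0 = solve-∀

    module Loop (τ₀ : ℕ) (τ-eq : τ₀ + 2 ≡ τ) (lock-even : ∀ i → ∃ λ h → ∑ (λ v → ⟦ lock i v ⟧) ≡ h + h) (half : N ≡ m + m) where

      lk : Fin k → ℕ
      lk i = ∑ (λ v → ⟦ lock i v ⟧)

      -- No augmentation increases 3 N - same - 2 cov - 2 lk.
      Budget : Colouring G lock → Set
      Budget C = ∀ i → N + N + N ≤ τ₀ + Colouring.col C s i + (Colouring.col C ne i + lk i + (Colouring.col C ne i + lk i))

      cov≤N : ∀ (C : Colouring G lock) i → Colouring.col C ne i + lk i ≤ N
      cov≤N C i = m+n≤o⇒m≤o _ (≤-reflexive (Colouring.col-total C i))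

      -- Covered and locked vertices together number at most `N`; inserting this twice into the
      -- budget leaves a bound on the same-side edges alone.
      budget-full : ∀ (C : Colouring G lock) → Budget C → ∀ i → N ≤ Colouring.col C s i + τ₀
      budget-full C bd i = +-cancelʳ-≤ (N + N) _ _ (≤-trans (≤-reflexive (sym (+-assoc N N N))) (≤-trans (bd i)
        (+-mono-≤ (≤-reflexive (+-comm τ₀ _)) (+-mono-≤ (cov≤N C i) (cov≤N C i)))))

      Next : Colouring G lock → Set
      Next C = Σ (Colouring G lock) λ D → Loaded D × Budget D × ∑ (Colouring.col C ne) < ∑ (Colouring.col D ne)

      module _ (C : Colouring G lock) (ld : Loaded C) (bd : Budget C) (i : Fin k) where
        open Colouring C

        full : Full C
        full j = ≤-trans (budget-full C bd j) (+-monoʳ-≤ (col s j) (≤-trans (m≤m+n τ₀ 2) (≤-reflexive τ-eq)))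

        partner : ∀ u → avail i u ≡ true → ∃ λ w → u ≢ w × avail i w ≡ true
        partner u au = another (avail i) u au (even (col-even C ne ne-diag ne-sym i) (lock-even i))
          where
          even : (∃ λ t → col ne i ≡ t + t) → (∃ λ h → lk i ≡ h + h) → ∃ λ t → ∑ (λ w → ⟦ avail i w ⟧) ≡ t + t
          even (t , e) (h , e′) = even-part m (t + h) _ (trans (ar t h _) (trans (cong₂ (λ a b → a + b + ∑ (λ w → ⟦ avail i w ⟧)) (sym e) (sym e′)) (trans (col-total i) half)))
            where
            ar : ∀ t h a → a + (t + h + (t + h)) ≡ t + t + (h + h) + a
            ar = solve-∀

        -- The price is at most two same-side edges, that is 4 in `col s`; the gain is two covered
        -- vertices, and these count twice in the budget.
        finish : ∀ C₁ → (∀ F j → j ≢ i → Colouring.col C₁ F j ≡ col F j) → Augmented C₁ i →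
          (∀ c → c + 2 ≡ Colouring.col C₁ s i → col s i ≤ c + 4) → Colouring.col C₁ ne i ≡ col ne i → Next C
        finish C₁ oth A hs hne = A.new , A.loaded , bd′ , lt
          where
          module A = Augmented A
          ne′ : Colouring.col A.new ne i ≡ col ne i + 2
          ne′ = trans A.col-ne (cong (_+ 2) hne)
          bd′ : Budget A.new
          bd′ j with j ≟ i
          ... | no h = subst₂ (λ a b → N + N + N ≤ τ₀ + a + (b + lk j + (b + lk j))) (sym (trans (A.others s j h) (oth s j h))) (sym (trans (A.others ne j h) (oth ne j h))) (bd j)
          ... | yes refl = ≤-trans (bd i) (subst (λ b → τ₀ + col s i + (col ne i + lk i + (col ne i + lk i)) ≤ τ₀ + Colouring.col A.new s i + (b + lk i + (b + lk i))) (sym ne′)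
                 (lin 0 (hs _ A.col-s) (ar τ₀ (col s i) (Colouring.col A.new s i) (col ne i) (lk i))))
            where
            ar : ∀ t a a′ n l → t + a′ + (n + 2 + l + (n + 2 + l)) + a ≡ t + a + (n + l + (n + l)) + (a′ + 4) + 0
            ar = solve-∀
          lt : ∑ (col ne) < ∑ (Colouring.col A.new ne)
          lt = ∑-mono-< le i (≤-trans (≤-trans (n≤1+n _) (≤-reflexive (+-comm 2 _))) (≤-reflexive (sym ne′)))
            where
            le : ∀ j → col ne j ≤ Colouring.col A.new ne j
            le j with j ≟ i
            ... | no h = ≤-reflexive (sym (trans (A.others ne j h) (oth ne j h)))
            ... | yes refl = ≤-trans (m≤m+n _ 2) (≤-reflexive (sym ne′))

        step : ∀ u w → u ≢ w → avail i u ≡ true → avail i w ≡ true → Next C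
        step u w u≢w au aw with side u ≟ᵇ side w
        ... | yes e = finish C (λ _ _ _ → refl) (augment-same C i u w u≢w e au aw ld full) (λ c q → ≤-trans (≤-reflexive (sym q)) (+-monoʳ-≤ c (s≤s (s≤s z≤n)))) refl
        -- For gaps on different sides the gap at `u` is first shifted to the side of `w`.
        ... | no ne₁ = go (find-one C ld full i u)
          where
          diff : ∀ {a b c} → a ≢ b → a xor c ≡ true → c ≡ b
          diff {true} {true} h _ = ⊥-elim (h refl)
          diff {false} {false} h _ = ⊥-elim (h refl)
          diff {true} {false} {false} _ _ = refl
          diff {false} {true} {true} _ _ = refl
          go : (∃ λ x → Good C i x × cr C u x ≡ true) → Next C
          go (x , gd , ux) = finish S.new S.others
            (augment-same S.new i (p i x) w y≢w (trans (sym (Good.sameside gd)) (diff ne₁ (cr-cross C ux))) S.availʸ (S.availʷ w (λ e → u≢w (sym e)) aw) S.loaded full′)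
            (λ c q → ≤-reflexive (trans (sym S.col-s) (trans (cong (_+ 2) (sym q)) (+-assoc c 2 2)))) S.col-ne
            where
            S : Shifted C i u x
            S = shift C i u x ld au gd ux
            module S = Shifted S
            y≢w : p i x ≢ w
            y≢w e = Good.moved gd (trans (sym (trans (cong (p i) e) (trans (avail-p aw) (sym e)))) (inv i x))
            -- After the shift, colour `i` has lost a same-side edge without covering more vertices.
            -- The 2 by which `τ` exceeds `τ₀` pays for this intermediate state.
            full′ : Full S.new
            full′ j with j ≟ i
            ... | no h = subst (λ t → N ≤ t + τ) (sym (S.others s j h)) (full j)
            ... | yes refl = ≤-trans (budget-full C bd j) (≤-reflexive (trans (cong (_+ τ₀) (sym S.col-s)) (trans (+-assoc _ 2 τ₀) (cong (Colouring.col S.new s j +_) (trans (+-comm 2 τ₀) τ-eq)))))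

        abstract
          next : ∀ u → avail i u ≡ true → Next C
          next u au = go (partner u au)
            where
            go : (∃ λ w → u ≢ w × avail i w ≡ true) → Next C
            go (w , h , aw) = step u w h au aw

      Perfect : Colouring G lock → Set
      Perfect C = ∀ i v → Colouring.avail C i v ≡ false

      private
        Result : Set
        Result = Σ (Colouring G lock) λ D → Loaded D × Perfect D

        loop : ∀ f C → Loaded C → Budget C → k * N ≤ ∑ (Colouring.col C ne) + f → Result
        again : ∀ f C → k * N ≤ ∑ (Colouring.col C ne) + f → Next C → Result

        loop f C ld bd le = case any? (λ i → any? (λ v → Colouring.avail C i v ≟ᵇ true)) of λ
          { (no h) → C , ld , λ i v → ¬true (λ e → h (i , v , e))
          ; (yes (i , v , e)) → again f C le (next C ld bd i v e) }
        again zero C le (D , ld , bd , lt) = ⊥-elim (<⇒≱ lt (≤-trans (≤-trans (∑-≤ (λ i → m+n≤o⇒m≤o _ (cov≤N D i))) le) (≤-reflexive (+-identityʳ _))))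
        again (suc f) C le (D , ld , bd , lt) = loop f D ld bd (≤-trans le (≤-trans (≤-reflexive (+-suc _ f)) (+-monoˡ-≤ f lt)))

      abstract
        perfect : ∀ C → Loaded C → Budget C → Result
        perfect C ld bd = loop (k * N) C ld bd (m≤n+m _ _)

-- Completing the auxiliary colours by cross edges

module Complete where
  open Prelude
  open Sums
  open EdgeColouring
  open Sides

  module _ {N} (side : Fin N → Bool) where

    -- Their column sums count the covered vertices of A and of B in a colour.
    FA FB : Weight N
    FA v u = ⟦ side v ⟧ * ne v u
    FB v u = ⟦ not (side v) ⟧ * ne v u

    FA-diag : Diag0 FA
    FA-diag v = trans (cong (⟦ side v ⟧ *_) (ne-diag v)) (*-zeroʳ ⟦ side v ⟧)

    FB-diag : Diag0 FB
    FB-diag v = trans (cong (⟦ not (side v) ⟧ *_) (ne-diag v)) (*-zeroʳ ⟦ not (side v) ⟧)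

    private
      cross : ∀ a b → a xor b ≡ true → ⟦ a ⟧ + ⟦ b ⟧ ≡ 1 × ⟦ not a ⟧ + ⟦ not b ⟧ ≡ 1
      cross true false _ = refl , refl
      cross false true _ = refl , refl

      one : ∀ a → a * 1 ≡ a
      one = *-identityʳ

    FA-cross : ∀ {u w} → side u xor side w ≡ true → u ≢ w → FA u w + FA w u ≡ 1
    FA-cross {u} {w} h n = trans (cong₂ (λ a b → ⟦ side u ⟧ * a + ⟦ side w ⟧ * b) (ne-≢ n) (ne-≢ (λ e → n (sym e)))) (trans (cong₂ _+_ (one ⟦ side u ⟧) (one ⟦ side w ⟧)) (proj₁ (cross (side u) (side w) h)))

    FB-cross : ∀ {u w} → side u xor side w ≡ true → u ≢ w → FB u w + FB w u ≡ 1
    FB-cross {u} {w} h n = trans (cong₂ (λ a b → ⟦ not (side u) ⟧ * a + ⟦ not (side w) ⟧ * b) (ne-≢ n) (ne-≢ (λ e → n (sym e)))) (trans (cong₂ _+_ (one ⟦ not (side u) ⟧) (one ⟦ not (side w) ⟧)) (proj₂ (cross (side u) (side w) h)))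

  -- In colours with few same-side edges, an uncovered pair a, b is covered either directly or by
  -- replacing a cross edge x y by a y and b x.
  record CompletionData {N k} (G : SimpleGraph N) (lock : Fin k → Fin N → Bool) : Set where
    no-eta-equality
    field
      side : Fin N → Bool
      m M₀ Θ H : ℕ
      opposite : ∀ v → ∑ (λ u → ⟦ side v xor side u ⟧) ≡ m
      halfA : ∑ (λ v → ⟦ side v ⟧) ≡ m
      halfB : ∑ (λ v → ⟦ not (side v) ⟧) ≡ m
      crossdeg : ∀ v → M₀ ≤ ∑ (λ u → Fc side v u * ⟦ SimpleGraph.E G v u ⟧)
      num : m + Θ + (H + H) < M₀ + M₀

  module Completion {N k} (G : SimpleGraph N) (lock : Fin k → Fin N → Bool) (setup : CompletionData G lock) where
    open CompletionData setup
    open SimpleGraph G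

    private
      s = Fs side
      x′ = Fc side
      A = FA side
      B = FB side

    Bal : Colouring G lock → Fin k → Set
    Bal C i = Colouring.col C A i ≡ Colouring.col C B i

    -- `bal` makes the gaps occur in pairs, one in A and one in B. `few` bounds the same-side edges,
    -- which are useless for an exchange with cross edges.
    record Fresh (C : Colouring G lock) (i : Fin k) : Set where
      no-eta-equality
      field
        unl : ∀ v → lock i v ≡ false
        bal : Bal C i
        few : Colouring.col C s i ≤ Θ

    Status : Colouring G lock → Set
    Status C = ∀ i → (∀ v → Colouring.avail C i v ≡ false) ⊎ Fresh C i

    Tight : Colouring G lock → Set
    Tight C = ∀ v → k ≤ Colouring.row C s v + lockdeg C v + H

    record Next (C : Colouring G lock) : Set where
      no-eta-equality
      field
        new : Colouring G lock
        rows : ∀ v → Colouring.row new s v ≡ Colouring.row C s v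
        status : Status new
        more : ∑ (Colouring.col C ne) < ∑ (Colouring.col new ne)

    module _ (C : Colouring G lock) where
      open Colouring C

      cr : Fin N → Fin N → Bool
      cr u x = (side u xor side x) ∧ unc u x

      cr-cross : ∀ {u x} → cr u x ≡ true → side u xor side x ≡ true
      cr-cross h = proj₁ (∧-true h)

      cr-unc : ∀ {u x} → cr u x ≡ true → unc u x ≡ true
      cr-unc {u} {x} h = proj₂ (∧-true {side u xor side x} h)

      cr-many : Tight C → ∀ u → M₀ ≤ ∑ (λ x → ⟦ cr u x ⟧) + H
      cr-many ld u = begin
        M₀ ≤⟨ crossdeg u ⟩
        ∑ (λ x → x′ u x * ⟦ E u x ⟧) ≡⟨ deg-split x′ (Fc-diag side) u ⟩
        row x′ u + ∑ (λ x → x′ u x * ⟦ unc u x ⟧) ≡⟨ +-comm (row x′ u) _ ⟩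
        ∑ (λ x → x′ u x * ⟦ unc u x ⟧) + row x′ u ≡⟨ cong (_+ row x′ u) (∑-cong (λ x → sym (⟦⟧-∧ (side u xor side x) (unc u x)))) ⟩
        ∑ (λ x → ⟦ cr u x ⟧) + row x′ u ≤⟨ +-monoʳ-≤ _ rowc ⟩
        ∑ (λ x → ⟦ cr u x ⟧) + H ∎
        where
        open ≤-Reasoning
        rowc : row x′ u ≤ H
        rowc = lin (∑ (λ i → ⟦ avail i u ⟧)) (ld u) (trans (cong (H +_) (trans (sym (row-total u)) (cong (λ t → t + lockdeg C u + ∑ (λ i → ⟦ avail i u ⟧)) (row-split C side u))))
          (ar (row s u) (row x′ u) (lockdeg C u) (∑ (λ i → ⟦ avail i u ⟧)) H))
          where
          ar : ∀ a b c d L → L + (a + b + c + d) ≡ b + (a + c + L) + d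
          ar = solve-∀

      cross-≢ : ∀ {u w} → side u xor side w ≡ true → u ≢ w
      cross-≢ {u} h e = tf h (trans (cong (λ z → side u xor side z) (sym e)) (xor-self side (side u)))

      add-next : Status C → ∀ α u w → Fresh C α → cr u w ≡ true → avail α u ≡ true → avail α w ≡ true → Next C
      add-next st α u w fr uw au aw = record
        { new = A′.new ; rows = rows ; status = status
        ; more = ∑-mono-< le α (≤-trans (≤-reflexive (+-comm 1 _)) (≤-trans (+-monoʳ-≤ (col ne α) (s≤s z≤n)) (≤-reflexive (sym col2)))) }
        where
        A₀ : Added C α u w
        A₀ = add C α u w (cr-unc uw) (avail-p au) (avail-p aw) (avail-lock au) (avail-lock aw)
        module A′ = Added A₀
        cx = cr-cross uw
        u≢w : u ≢ w
        u≢w = cross-≢ cx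
        s0 : s u w ≡ 0
        s0 = Fs-cross side {u} {w} cx
        s0′ : s w u ≡ 0
        s0′ = trans (Fs-sym side w u) s0
        rows : ∀ v → Colouring.row A′.new s v ≡ row s v
        rows v = trans (A′.row-eq s (Fs-diag side) v) (trans (cong₂ (λ a b → row s v + (⟦ v == u ⟧ * a + ⟦ v == w ⟧ * b)) s0 s0′) (z0 (row s v) ⟦ v == u ⟧ ⟦ v == w ⟧))
          where
          z0 : ∀ r a b → r + (a * 0 + b * 0) ≡ r
          z0 = solve-∀
        col2 : Colouring.col A′.new ne α ≡ col ne α + 2
        col2 = trans (A′.col-eq ne ne-diag) (cong (col ne α +_) (cong₂ _+_ (ne-≢ u≢w) (ne-≢ (λ e → u≢w (sym e)))))
        le : ∀ j → col ne j ≤ Colouring.col A′.new ne j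
        le j with j ≟ α
        ... | no h = ≤-reflexive (sym (A′.col-other ne j h))
        ... | yes refl = ≤-trans (m≤m+n _ 2) (≤-reflexive (sym col2))
        status : Status A′.new
        status j with j ≟ α
        ... | yes refl = inj₂ (record { unl = Fresh.unl fr
                ; bal = trans (A′.col-eq A (FA-diag side)) (trans (cong₂ _+_ (Fresh.bal fr) (trans (FA-cross side cx u≢w) (sym (FB-cross side cx u≢w)))) (sym (A′.col-eq B (FB-diag side))))
                ; few = ≤-trans (≤-reflexive (trans (A′.col-eq s (Fs-diag side)) (trans (cong₂ (λ a b → col s j + (a + b)) s0 s0′) (+-identityʳ _)))) (Fresh.few fr) })
        ... | no h with st j
        ...   | inj₁ q = inj₁ (λ v → trans (cong (λ z → (z == v) ∧ not (lock j v)) (A′.other j v h)) (q v))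
        ...   | inj₂ q = inj₂ (record { unl = Fresh.unl q ; bal = trans (A′.col-other A j h) (trans (Fresh.bal q) (sym (A′.col-other B j h)))
                ; few = ≤-trans (≤-reflexive (A′.col-other s j h)) (Fresh.few q) })

      -- The intermediate colouring of a 3-path exchange.
      del-status : Status C → ∀ α y → Fresh C α → (D : Deleted C α y (p α y)) → side y xor side (p α y) ≡ true → p α y ≢ y →
        Status (Deleted.new D) × Fresh (Deleted.new D) α × (∀ v → Colouring.row (Deleted.new D) s v ≡ row s v) × (Colouring.col (Deleted.new D) ne α + 2 ≡ col ne α)
      del-status st α y fr D cx mv = status , fr′ , rows , trans (cong (Colouring.col D.new ne α +_) (sym (cong₂ _+_ (ne-≢ (λ e → mv (sym e))) (ne-≢ mv)))) (D.col-eq ne ne-diag)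
        where
        module D = Deleted D
        x = p α y
        s0 : s y x ≡ 0
        s0 = Fs-cross side {y} {x} cx
        s0′ : s x y ≡ 0
        s0′ = trans (Fs-sym side x y) s0
        y≢x : y ≢ x
        y≢x e = mv (sym e)
        rows : ∀ v → Colouring.row D.new s v ≡ row s v
        rows v = trans (sym (trans (cong₂ (λ a b → Colouring.row D.new s v + (⟦ v == y ⟧ * a + ⟦ v == x ⟧ * b)) s0 s0′) (z0 (Colouring.row D.new s v) ⟦ v == y ⟧ ⟦ v == x ⟧))) (D.row-eq s (Fs-diag side) v)
          where
          z0 : ∀ r a b → r + (a * 0 + b * 0) ≡ r
          z0 = solve-∀
        fr′ : Fresh D.new α
        fr′ = record { unl = Fresh.unl fr
          ; bal = +-cancelʳ-≡ 1 _ _ (trans (cong (Colouring.col D.new A α +_) (sym (FA-cross side cx y≢x))) (trans (D.col-eq A (FA-diag side)) (trans (Fresh.bal fr)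
                    (trans (sym (D.col-eq B (FB-diag side))) (cong (Colouring.col D.new B α +_) (FB-cross side cx y≢x))))))
          ; few = ≤-trans (m≤m+n _ _) (≤-trans (≤-reflexive (D.col-eq s (Fs-diag side))) (Fresh.few fr)) }
        status : Status D.new
        status j with j ≟ α
        ... | yes refl = inj₂ fr′
        ... | no h with st j
        ...   | inj₁ q = inj₁ (λ v → trans (cong (λ z → (z == v) ∧ not (lock j v)) (D.other j v h)) (q v))
        ...   | inj₂ q = inj₂ (record { unl = Fresh.unl q ; bal = trans (D.col-other A j h) (trans (Fresh.bal q) (sym (D.col-other B j h)))
                ; few = ≤-trans (≤-reflexive (D.col-other s j h)) (Fresh.few q) })

      -- By `na` and `nb` all neighbours in question are covered. The neighbours of `a` and the
      -- `p α`-images of those of `b` lie in the side opposite to `a`, except where colour `α` uses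
      -- a same-side edge; having together more than m + Θ elements, they share the end of a cross
      -- edge.
      find : Tight C → ∀ α → Fresh C α → ∀ a b → side a xor side b ≡ true →
        (∀ y → cr a y ≡ true → avail α y ≡ false) → (∀ y → cr b y ≡ true → avail α y ≡ false) →
        ∃ λ y → cr a y ≡ true × cr b (p α y) ≡ true × p α y ≢ y × side y xor side (p α y) ≡ true
      find ti α fr a b ab na nb = go (∑<→∃ (λ y → ⟦ side a xor side y ⟧ + s y (p α y)) (λ y → ⟦ cr a y ⟧ + ⟦ cr b (p α y) ⟧) lt)
        where
        lt : ∑ (λ y → ⟦ side a xor side y ⟧ + s y (p α y)) < ∑ (λ y → ⟦ cr a y ⟧ + ⟦ cr b (p α y) ⟧)
        lt = ≤-trans (s≤s (≤-trans (≤-reflexive (∑-+ _ _)) (+-mono-≤ (≤-reflexive (opposite a)) (Fresh.few fr))))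
          (≤-trans (lin 0 (≤-trans num (+-mono-≤ (cr-many ti a) (cr-many ti b))) (ar m Θ H (∑ (λ x → ⟦ cr a x ⟧)) (∑ (λ x → ⟦ cr b x ⟧))))
            (≤-reflexive (sym (trans (∑-+ _ _) (cong (∑ (λ x → ⟦ cr a x ⟧) +_) (∑-inv (p α) (inv α) (λ x → ⟦ cr b x ⟧)))))))
          where
          ar : ∀ m t h a b → a + b + suc (m + t + (h + h)) ≡ suc (m + t) + (a + h + (b + h)) + 0
          ar = solve-∀
        third : ∀ {a b c} → a xor b ≡ true → b xor c ≡ true → a xor c ≡ false
        third {true} {false} {true} _ _ = refl
        third {false} {true} {false} _ _ = refl
        s-zero : ∀ y → s y (p α y) ≡ 0 → p α y ≢ y → side y xor side (p α y) ≡ true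
        s-zero y h mv with isTrue (side y xor side (p α y))
        ... | inj₁ e = e
        ... | inj₂ e = ⊥-elim (0≢1+n (trans (sym h) (Fs-1 side {y} {p α y} (λ q → mv (sym q)) e)))
        go : (∃ λ y → ⟦ side a xor side y ⟧ + s y (p α y) < ⟦ cr a y ⟧ + ⟦ cr b (p α y) ⟧) →
             ∃ λ y → cr a y ≡ true × cr b (p α y) ≡ true × p α y ≢ y × side y xor side (p α y) ≡ true
        go (y , h) with isTrue (cr a y) | isTrue (cr b (p α y))
        ... | inj₂ e₁ | inj₂ e₂ rewrite e₁ | e₂ = ⊥-elim (n≮0 h)
        ... | inj₁ e₁ | inj₂ e₂ rewrite e₁ | e₂ | proj₁ (∧-true {side a xor side y} e₁) = ⊥-elim (n≮0 (≤-pred h))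
        ... | inj₁ e₁ | inj₁ e₂ rewrite e₁ | e₂ | proj₁ (∧-true {side a xor side y} e₁) =
                y , e₁ , e₂ , mv , s-zero y (n≤0⇒n≡0 (≤-pred (≤-pred h))) mv
          where
          mv : p α y ≢ y
          mv q = tf (avail-intro q (Fresh.unl fr y)) (na y e₁)
        ... | inj₂ e₁ | inj₁ e₂ rewrite e₁ | e₂ = ⊥-elim (tf (avail-intro stay (Fresh.unl fr y)) (nb y (subst (λ z → cr b z ≡ true) stay e₂)))
          where
          z = n≤0⇒n≡0 (≤-pred h)
          stay : p α y ≡ y
          stay with p α y ≟ y
          ... | yes q = q
          ... | no q = ⊥-elim (tf (cr-cross e₂) (trans (xor-comm side (side b) (side (p α y))) (third {side (p α y)} {side y} {side b}
                  (trans (xor-comm side (side (p α y)) (side y)) (s-zero y (m+n≡0⇒n≡0 ⟦ side a xor side y ⟧ z) q)) yb)))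
            where
            eq : ∀ {a b y} → a xor y ≡ false → a xor b ≡ true → y xor b ≡ true
            eq {true} {false} {true} _ _ = refl
            eq {false} {true} {false} _ _ = refl
            yb : side y xor side b ≡ true
            yb = eq {side a} (zf (m+n≡0⇒m≡0 ⟦ side a xor side y ⟧ z)) ab
              where
              zf : ∀ {b} → ⟦ b ⟧ ≡ 0 → b ≡ false
              zf {false} _ = refl

    exchange : ∀ C → Status C → ∀ α a b y → Fresh C α → side a xor side b ≡ true → Colouring.avail C α a ≡ true → Colouring.avail C α b ≡ true →
      cr C a y ≡ true → cr C b (Colouring.p C α y) ≡ true → Colouring.p C α y ≢ y → side y xor side (Colouring.p C α y) ≡ true → Next C
    exchange C st α a b y fr ab aa abv ay bx mv cx = build (del-status C st α y fr D cx mv)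
      where
      open Colouring C
      x = p α y
      D : Deleted C α y x
      D = delete C α y mv
      module D = Deleted D
      not-y : ∀ {v} → avail α v ≡ true → v ≢ y
      not-y av refl = mv (avail-p av)
      not-x : ∀ {v} → avail α v ≡ true → v ≢ x
      not-x av e = mv (trans (sym e) (trans (sym (avail-p av)) (trans (cong (p α) e) (inv α y))))
      build : Status D.new × Fresh D.new α × (∀ v → Colouring.row D.new s v ≡ row s v) × (Colouring.col D.new ne α + 2 ≡ col ne α) → Next C
      build (st₁ , fr₁ , rows₁ , c₁) = record
        { new = N₂.new ; rows = λ v → trans (N₂.rows v) (trans (rows-A v) (rows₁ v)) ; status = N₂.status
        ; more = ≤-<-trans (∑-mono le) N₂.more }
        where
        A₁ : Added D.new α a y
        A₁ = add D.new α a y (unc-del C D (cr-unc C ay)) (trans (D.rest a (not-y aa) (not-x aa)) (avail-p aa)) D.at-u (Fresh.unl fr a) (Fresh.unl fr y)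
        module A₁ = Added A₁
        cy = cr-cross C ay
        a≢y = cross-≢ C cy
        s0 : s a y ≡ 0
        s0 = Fs-cross side {a} {y} cy
        s0′ : s y a ≡ 0
        s0′ = trans (Fs-sym side y a) s0
        rows-A : ∀ v → Colouring.row A₁.new s v ≡ Colouring.row D.new s v
        rows-A v = trans (A₁.row-eq s (Fs-diag side) v) (trans (cong₂ (λ f g → Colouring.row D.new s v + (⟦ v == a ⟧ * f + ⟦ v == y ⟧ * g)) s0 s0′) (z0 (Colouring.row D.new s v) ⟦ v == a ⟧ ⟦ v == y ⟧))
          where
          z0 : ∀ r a b → r + (a * 0 + b * 0) ≡ r
          z0 = solve-∀
        colA : Colouring.col A₁.new ne α ≡ col ne α
        colA = trans (A₁.col-eq ne ne-diag) (trans (cong (Colouring.col D.new ne α +_) (cong₂ _+_ (ne-≢ a≢y) (ne-≢ (λ e → a≢y (sym e))))) c₁)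
        frA : Fresh A₁.new α
        frA = record { unl = Fresh.unl fr
          ; bal = trans (A₁.col-eq A (FA-diag side)) (trans (cong₂ _+_ (Fresh.bal fr₁) (trans (FA-cross side cy a≢y) (sym (FB-cross side cy a≢y)))) (sym (A₁.col-eq B (FB-diag side))))
          ; few = ≤-trans (≤-reflexive (trans (A₁.col-eq s (Fs-diag side)) (trans (cong₂ (λ f g → Colouring.col D.new s α + (f + g)) s0 s0′) (+-identityʳ _)))) (Fresh.few fr₁) }
        stA : Status A₁.new
        stA j with j ≟ α
        ... | yes refl = inj₂ frA
        ... | no h with st₁ j
        ...   | inj₁ q = inj₁ (λ v → trans (cong (λ z → (z == v) ∧ not (lock j v)) (A₁.other j v h)) (q v))
        ...   | inj₂ q = inj₂ (record { unl = Fresh.unl q ; bal = trans (A₁.col-other A j h) (trans (Fresh.bal q) (sym (A₁.col-other B j h)))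
                ; few = ≤-trans (≤-reflexive (A₁.col-other s j h)) (Fresh.few q) })
        b≢a : b ≢ a
        b≢a e = cross-≢ C ab (sym e)
        bx′ : cr A₁.new b x ≡ true
        bx′ = ∧-intro (cr-cross C bx) (unc-add D.new A₁ b≢a (not-y abv) (unc-del C D (cr-unc C bx)))
        av-b : Colouring.avail A₁.new α b ≡ true
        av-b = Colouring.avail-intro A₁.new (trans (A₁.rest b b≢a (not-y abv)) (trans (D.rest b (not-y abv) (not-x abv)) (avail-p abv))) (Fresh.unl fr b)
        av-x : Colouring.avail A₁.new α x ≡ true
        av-x = Colouring.avail-intro A₁.new (trans (A₁.rest x (λ e → not-x aa (sym e)) mv) D.at-w) (Fresh.unl fr x)
        N₂ : Next A₁.new
        N₂ = add-next A₁.new stA α b x frA bx′ av-b av-x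
        module N₂ = Next N₂
        le : ∀ j → col ne j ≤ Colouring.col A₁.new ne j
        le j with j ≟ α
        ... | yes refl = ≤-reflexive (sym colA)
        ... | no h = ≤-reflexive (sym (trans (A₁.col-other ne j h) (D.col-other ne j h)))

    module _ (C : Colouring G lock) (st : Status C) (ti : Tight C) where
      open Colouring C

      -- Without locks, the gaps in a half are its uncovered vertices; both halves have `m` vertices
      -- and equally many covered ones.
      other-side : ∀ α a → Fresh C α → avail α a ≡ true → ∃ λ b → side a xor side b ≡ true × avail α b ≡ true
      other-side α a fr aa = pick (side a) refl
        where
        open ≡-Reasoning
        sum : (P : Fin N → Bool) → ∑ (λ v → ⟦ P v ⟧ * ne v (p α v)) + ∑ (λ v → ⟦ P v ⟧ * ⟦ avail α v ⟧) ≡ ∑ (λ v → ⟦ P v ⟧)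
        sum P = trans (sym (∑-+ _ _)) (∑-cong (λ v → trans (sym (*-distribˡ-+ ⟦ P v ⟧ (ne v (p α v)) ⟦ avail α v ⟧))
          (trans (cong (⟦ P v ⟧ *_) (trans (cong (_+ ⟦ avail α v ⟧) (sym (trans (cong (λ b → ne v (p α v) + ⟦ b ⟧) (Fresh.unl fr v)) (+-identityʳ _)))) (trichotomy α v))) (*-identityʳ _))))
        same : ∑ (λ v → ⟦ side v ⟧ * ⟦ avail α v ⟧) ≡ ∑ (λ v → ⟦ not (side v) ⟧ * ⟦ avail α v ⟧)
        same = +-cancelˡ-≡ (col A α) _ _ (trans (sum side) (trans (trans halfA (sym halfB)) (trans (sym (sum (λ v → not (side v)))) (cong (_+ ∑ (λ v → ⟦ not (side v) ⟧ * ⟦ avail α v ⟧)) (sym (Fresh.bal fr))))))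
        get : (P : Fin N → Bool) → 0 < ∑ (λ v → ⟦ P v ⟧ * ⟦ avail α v ⟧) → ∃ λ b → P b ≡ true × avail α b ≡ true
        get P h with count∃ (λ v → P v ∧ avail α v) (subst (0 <_) (∑-cong (λ v → sym (⟦⟧-∧ (P v) (avail α v)))) h)
        ... | b , e = b , ∧-true {P b} e
        pos : (P : Fin N → Bool) → P a ≡ true → 0 < ∑ (λ v → ⟦ P v ⟧ * ⟦ avail α v ⟧)
        pos P h = ≤-trans (subst₂ (λ x y → 0 < ⟦ x ⟧ * ⟦ y ⟧) (sym h) (sym aa) (s≤s z≤n)) (term≤∑ (λ v → ⟦ P v ⟧ * ⟦ avail α v ⟧) a)
        pick : ∀ sa → side a ≡ sa → ∃ λ b → side a xor side b ≡ true × avail α b ≡ true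
        pick true e with get (λ v → not (side v)) (subst (0 <_) same (pos side e))
        ... | b , q , r = b , trans (cong (_xor side b) e) q , r
        pick false e with get side (subst (0 <_) (sym same) (pos (λ v → not (side v)) (cong not e)))
        ... | b , q , r = b , trans (cong (_xor side b) e) q , r

      abstract
        next : ∀ α a → avail α a ≡ true → Next C
        next α a aa = case st α of λ
          { (inj₁ q) → tf aa (q a)
          ; (inj₂ fr) → main fr (other-side α a fr aa) }
          where
          main : Fresh C α → (∃ λ b → side a xor side b ≡ true × avail α b ≡ true) → Next C
          main fr (b , ab , abv) = case any? (λ y → (cr C a y ∧ avail α y) ≟ᵇ true) of λ
            { (yes (y , h)) → add-next C st α a y fr (proj₁ (∧-true {cr C a y} h)) aa (proj₂ (∧-true {cr C a y} h))
            ; (no na) → case any? (λ y → (cr C b y ∧ avail α y) ≟ᵇ true) of λ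
              { (yes (y , h)) → add-next C st α b y fr (proj₁ (∧-true {cr C b y} h)) abv (proj₂ (∧-true {cr C b y} h))
              ; (no nb) → case find C ti α fr a b ab (λ y c → ¬true (λ q → na (y , ∧-intro c q))) (λ y c → ¬true (λ q → nb (y , ∧-intro c q))) of λ
                { (y , ay , bx , mv , cx) → exchange C st α a b y fr ab aa abv ay bx mv cx } } }

    private
      Result : Colouring G lock → Set
      Result C = Σ (Colouring G lock) λ D → (∀ v → Colouring.row D s v ≡ Colouring.row C s v) × (∀ i v → Colouring.avail D i v ≡ false)

      loop : ∀ f C → Status C → Tight C → k * N ≤ ∑ (Colouring.col C ne) + f → Result C
      again : ∀ f C → Tight C → k * N ≤ ∑ (Colouring.col C ne) + f → Next C → Result C

      loop f C st ti le = case any? (λ i → any? (λ v → Colouring.avail C i v ≟ᵇ true)) of λ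
        { (no h) → C , (λ _ → refl) , λ i v → ¬true (λ e → h (i , v , e))
        ; (yes (i , v , e)) → again f C ti le (next C st ti i v e) }
      again zero C ti le nx = ⊥-elim (<⇒≱ (Next.more nx) (≤-trans (≤-trans (∑-≤ (λ i → m+n≤o⇒m≤o _ (m+n≤o⇒m≤o _ (≤-reflexive (Colouring.col-total (Next.new nx) i))))) le) (≤-reflexive (+-identityʳ _))))
      again (suc f) C ti le nx = case loop f new status (λ v → subst (λ t → k ≤ t + lockdeg C v + H) (sym (rows v)) (ti v))
          (≤-trans le (≤-trans (≤-reflexive (+-suc _ f)) (+-monoˡ-≤ f more))) of λ
          { (D , r , h) → D , (λ v → trans (r v) (rows v)) , h }
        where open Next nx

    abstract
      complete : ∀ C → Status C → Tight C → Result C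
      complete C st ti = loop (k * N) C st ti (m≤n+m _ _)

-- Distributing the leftover same-side edges

module Distribute where
  open Prelude
  open Sums
  open EdgeColouring
  open Sides
  open Complete
  open import Data.Fin.Properties using (splitAt⁻¹-↑ˡ; splitAt⁻¹-↑ʳ)

  module _ {a b : ℕ} {X : Set} (f : Fin a → X) (g : Fin b → X) where
    glue : Fin (a + b) → X
    glue i = [ f , g ] (splitAt a i)

    glue-l : ∀ j → glue (j ↑ˡ b) ≡ f j
    glue-l j = cong [ f , g ] (splitAt-↑ˡ a j b)

    glue-r : ∀ j → glue (a ↑ʳ j) ≡ g j
    glue-r j = cong [ f , g ] (splitAt-↑ʳ a b j)

  data View {a b : ℕ} : Fin (a + b) → Set where
    left : ∀ j → View (j ↑ˡ b)
    right : ∀ j → View (a ↑ʳ j)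

  view : ∀ {a b} (i : Fin (a + b)) → View {a} {b} i
  view {a} {b} i with splitAt a i in e
  ... | inj₁ j = subst View (splitAt⁻¹-↑ˡ e) (left j)
  ... | inj₂ j = subst View (splitAt⁻¹-↑ʳ e) (right j)

  ↑ˡ≢↑ʳ : ∀ {a b} (i : Fin a) (j : Fin b) → i ↑ˡ b ≢ a ↑ʳ j
  ↑ˡ≢↑ʳ {a} {b} i j e with trans (sym (splitAt-↑ˡ a i b)) (trans (cong (splitAt a) e) (splitAt-↑ʳ a b j))
  ... | ()

  ↑ʳ-inj : ∀ {a b} {i j : Fin b} → a ↑ʳ i ≡ a ↑ʳ j → i ≡ j
  ↑ʳ-inj {a} {b} {i} {j} e with trans (sym (splitAt-↑ʳ a b i)) (trans (cong (splitAt a) e) (splitAt-↑ʳ a b j))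
  ... | refl = refl

  record DistributionData (N : ℕ) : Set where
    no-eta-equality
    field
      k₁ ℓ : ℕ
      G : SimpleGraph N
      lock₁ : Fin k₁ → Fin N → Bool
      side : Fin N → Bool
      m L Θ Φ : ℕ
      halfA : ∑ (λ v → ⟦ side v ⟧) ≡ m
      halfB : ∑ (λ v → ⟦ not (side v) ⟧) ≡ m
      num₁ : N * L < suc Φ * suc Θ
      num₂ : L + L + (L + L) + Φ < ℓ
      C₁ : Colouring G lock₁
      perfect : ∀ i v → Colouring.avail C₁ i v ≡ false
      loaded : ∀ v → k₁ ≤ Colouring.row C₁ (Fs side) v + lockdeg C₁ v + L
      samedeg : ∀ v → ∑ (λ u → Fs side v u * ⟦ SimpleGraph.E G v u ⟧) + lockdeg C₁ v ≤ k₁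
      balance : ∑ (λ v → ⟦ side v ⟧ * (∑ (λ u → Fs side v u * ⟦ SimpleGraph.E G v u ⟧) + lockdeg C₁ v)) ≡ ∑ (λ v → ⟦ not (side v) ⟧ * (∑ (λ u → Fs side v u * ⟦ SimpleGraph.E G v u ⟧) + lockdeg C₁ v))

  module Distribution {N} (setup : DistributionData N) where
    open DistributionData setup
    open SimpleGraph G

    k = k₁ + ℓ

    lock : Fin k → Fin N → Bool
    lock i v = glue (λ j → lock₁ j v) (λ _ → false) i

    private
      s = Fs side
      x′ = Fc side
      A = FA side
      B = FB side
      module C₁ = Colouring C₁

      sd : Fin N → ℕ
      sd v = ∑ (λ u → s v u * ⟦ E v u ⟧)

      on : Bool → Weight N
      on b v u = ⟦ not (side v xor b) ⟧ * s v u

      on-diag : ∀ b → Diag0 (on b)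
      on-diag b v = trans (cong (⟦ not (side v xor b) ⟧ *_) (Fs-diag side v)) (*-zeroʳ ⟦ not (side v xor b) ⟧)

      tot : Bool → ℕ
      tot b = ∑ (λ v → ⟦ not (side v xor b) ⟧ * sd v)

    lock-l : ∀ j v → lock (j ↑ˡ ℓ) v ≡ lock₁ j v
    lock-l j v = glue-l (λ j → lock₁ j v) (λ (_ : Fin ℓ) → false) j

    lock-r : ∀ j v → lock (k₁ ↑ʳ j) v ≡ false
    lock-r j v = glue-r (λ j → lock₁ j v) (λ (_ : Fin ℓ) → false) j

    lockdeg-eq : ∀ v → ∑ (λ i → ⟦ lock i v ⟧) ≡ ∑ (λ i → ⟦ lock₁ i v ⟧)
    lockdeg-eq v = trans (∑-↑ ℓ _) (trans (cong₂ _+_ (∑-cong (λ j → cong ⟦_⟧ (lock-l j v))) (∑-0 (λ j → cong ⟦_⟧ (lock-r j v)))) (+-identityʳ _))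

    p₀ : Fin k → Fin N → Fin N
    p₀ i v = glue (λ j → C₁.p j v) (λ _ → v) i

    p₀-l : ∀ j v → p₀ (j ↑ˡ ℓ) v ≡ C₁.p j v
    p₀-l j v = glue-l (λ j → C₁.p j v) (λ (_ : Fin ℓ) → v) j

    p₀-r : ∀ j v → p₀ (k₁ ↑ʳ j) v ≡ v
    p₀-r j v = glue-r (λ j → C₁.p j v) (λ (_ : Fin ℓ) → v) j

    start : Colouring G lock
    start .Colouring.p = p₀
    start .Colouring.inv i v with view {k₁} {ℓ} i
    ... | left j = trans (p₀-l j _) (trans (cong (C₁.p j) (p₀-l j v)) (C₁.inv j v))
    ... | right j = trans (p₀-r j _) (p₀-r j v)
    start .Colouring.edge i v with view {k₁} {ℓ} i
    ... | left j rewrite p₀-l j v = C₁.edge j v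
    ... | right j = λ h → ⊥-elim (h (p₀-r j v))
    start .Colouring.disj i j v with view {k₁} {ℓ} i | view {k₁} {ℓ} j
    ... | left a | left b rewrite p₀-l a v | p₀-l b v = λ h e → cong (_↑ˡ ℓ) (C₁.disj a b v h e)
    ... | right a | _ = λ h → ⊥-elim (h (p₀-r a v))
    ... | left a | right b = λ h e → ⊥-elim (h (trans e (p₀-r b v)))
    start .Colouring.locked i v l with view {k₁} {ℓ} i
    ... | left j = trans (p₀-l j v) (C₁.locked j v (trans (sym (lock-l j v)) l))
    ... | right j = p₀-r j v

    -- `glob` says without subtraction that as many edges inside A as inside B are still uncoloured.
    -- In `few`, the 4 is there because a colour with at most `Θ` covered vertices may receive two
    -- more edges.
    record Inv (C : Colouring G lock) : Set where
      no-eta-equality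
      open Colouring C
      field
        main : ∀ j v → p (j ↑ˡ ℓ) v ≡ C₁.p j v
        fsame : ∀ j → col x′ (k₁ ↑ʳ j) ≡ 0
        bal : ∀ j → col A (k₁ ↑ʳ j) ≡ col B (k₁ ↑ʳ j)
        few : ∀ j → col ne (k₁ ↑ʳ j) ≤ Θ + 4
        glob : tot true + ∑ (row (on false)) ≡ tot false + ∑ (row (on true))

    private
      not-xor : ∀ a → not (a xor true) ≡ a
      not-xor true = refl
      not-xor false = refl

      not-xor′ : ∀ a → not (a xor false) ≡ not a
      not-xor′ true = refl
      not-xor′ false = refl

      rowon : ∀ {k} {lk : Fin k → Fin N → Bool} (C : Colouring G lk) b v → Colouring.row C (on b) v ≡ ⟦ not (side v xor b) ⟧ * Colouring.row C s v
      rowon C b v = ∑-*ˡ ⟦ not (side v xor b) ⟧ (λ i → s v (Colouring.p C i v))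

      cross-equal : ∑ (λ v → ⟦ side v ⟧ * C₁.row x′ v) ≡ ∑ (λ v → ⟦ not (side v) ⟧ * C₁.row x′ v)
      cross-equal = begin
        ∑ (λ v → ⟦ side v ⟧ * C₁.row x′ v) ≡⟨ ∑-cong (λ v → sym (∑-*ˡ ⟦ side v ⟧ (λ i → x′ v (C₁.p i v)))) ⟩
        ∑ (λ v → ∑ (λ i → ⟦ side v ⟧ * x′ v (C₁.p i v))) ≡⟨ ∑-swap _ ⟩
        ∑ (λ i → ∑ (λ v → ⟦ side v ⟧ * x′ v (C₁.p i v))) ≡⟨ ∑-cong (λ i → trans (sym (∑-inv (C₁.p i) (C₁.inv i) _)) (∑-cong (λ v → pt i v))) ⟩
        ∑ (λ i → ∑ (λ v → ⟦ not (side v) ⟧ * x′ v (C₁.p i v))) ≡⟨ sym (∑-swap _) ⟩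
        ∑ (λ v → ∑ (λ i → ⟦ not (side v) ⟧ * x′ v (C₁.p i v))) ≡⟨ ∑-cong (λ v → ∑-*ˡ ⟦ not (side v) ⟧ (λ i → x′ v (C₁.p i v))) ⟩
        ∑ (λ v → ⟦ not (side v) ⟧ * C₁.row x′ v) ∎
        where
        open ≡-Reasoning
        bb : ∀ a b → ⟦ b ⟧ * ⟦ b xor a ⟧ ≡ ⟦ not a ⟧ * ⟦ a xor b ⟧
        bb true true = refl
        bb true false = refl
        bb false true = refl
        bb false false = refl
        pt : ∀ i v → ⟦ side (C₁.p i v) ⟧ * x′ (C₁.p i v) (C₁.p i (C₁.p i v)) ≡ ⟦ not (side v) ⟧ * x′ v (C₁.p i v)
        pt i v = trans (cong (λ z → ⟦ side (C₁.p i v) ⟧ * x′ (C₁.p i v) z) (C₁.inv i v)) (bb (side v) (side (C₁.p i v)))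

      -- Each of the `k₁` perfect colours is at every vertex locked or used by a same-side or a
      -- cross edge. Both halves have `m` vertices, and the coloured cross edges contribute equally
      -- to them.
      rows-equal : ∑ (λ v → ⟦ side v ⟧ * (C₁.row s v + lockdeg C₁ v)) ≡ ∑ (λ v → ⟦ not (side v) ⟧ * (C₁.row s v + lockdeg C₁ v))
      rows-equal = +-cancelʳ-≡ (∑ (λ v → ⟦ side v ⟧ * C₁.row x′ v)) _ _ (trans (sum side halfA) (trans (sym (sum (λ v → not (side v)) halfB))
          (cong (∑ (λ v → ⟦ not (side v) ⟧ * (C₁.row s v + lockdeg C₁ v)) +_) (sym cross-equal))))
        where
        kk : ∀ v → C₁.row s v + lockdeg C₁ v + C₁.row x′ v ≡ k₁
        kk v = trans (ar (C₁.row s v) (lockdeg C₁ v) (C₁.row x′ v)) (trans (cong₂ (λ a b → a + lockdeg C₁ v + b) (sym (row-split C₁ side v)) (sym (∑-0 (λ i → cong ⟦_⟧ (perfect i v))))) (C₁.row-total v))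
          where
          ar : ∀ a b c → a + b + c ≡ a + c + b + 0
          ar = solve-∀
        sum : (P : Fin N → Bool) → ∑ (λ v → ⟦ P v ⟧) ≡ m → ∑ (λ v → ⟦ P v ⟧ * (C₁.row s v + lockdeg C₁ v)) + ∑ (λ v → ⟦ P v ⟧ * C₁.row x′ v) ≡ m * k₁
        sum P h = trans (sym (∑-+ _ _)) (trans (∑-cong (λ v → trans (sym (*-distribˡ-+ ⟦ P v ⟧ (C₁.row s v + lockdeg C₁ v) (C₁.row x′ v))) (cong (⟦ P v ⟧ *_) (kk v)))) (trans (∑-*ʳ k₁ (λ v → ⟦ P v ⟧)) (cong (_* k₁) h)))

      dist : (P : Fin N → Bool) (f g : Fin N → ℕ) → ∑ (λ v → ⟦ P v ⟧ * (f v + g v)) ≡ ∑ (λ v → ⟦ P v ⟧ * f v) + ∑ (λ v → ⟦ P v ⟧ * g v)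
      dist P f g = trans (∑-cong (λ v → *-distribˡ-+ ⟦ P v ⟧ (f v) (g v))) (∑-+ _ _)

      start-row : ∀ b v → Colouring.row start (on b) v ≡ ⟦ not (side v xor b) ⟧ * C₁.row s v
      start-row b v = trans (rowon start b v) (cong (⟦ not (side v xor b) ⟧ *_) (trans (∑-↑ ℓ _) (trans (cong₂ _+_ (∑-cong (λ j → cong (s v) (p₀-l j v)))
        (∑-0 (λ j → trans (cong (s v) (p₀-r j v)) (Fs-diag side v)))) (+-identityʳ _))))

    start-inv : Inv start
    start-inv = record
      { main = p₀-l
      ; fsame = λ j → ∑-0 (λ v → trans (cong (x′ v) (p₀-r j v)) (Fc-diag side v))
      ; bal = λ j → trans (∑-0 (λ v → trans (cong (A v) (p₀-r j v)) (FA-diag side v))) (sym (∑-0 (λ v → trans (cong (B v) (p₀-r j v)) (FB-diag side v))))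
      ; few = λ j → ≤-trans (≤-reflexive (∑-0 (λ v → trans (cong (ne v) (p₀-r j v)) (ne-diag v)))) z≤n
      ; glob = +-cancelʳ-≡ (a + b) _ _ (begin
          tot true + ∑ (Colouring.row start (on false)) + (a + b) ≡⟨ cong₂ (λ x y → x + y + (a + b)) (∑-cong (λ v → cong (λ z → ⟦ z ⟧ * sd v) (not-xor (side v))))
               (∑-cong (λ v → trans (start-row false v) (cong (λ z → ⟦ z ⟧ * C₁.row s v) (not-xor′ (side v))))) ⟩
          sA + rB + (a + b) ≡⟨ ar sA rB a b ⟩
          (sA + a) + (rB + b) ≡⟨ cong₂ _+_ (trans (sym (dist side sd (lockdeg C₁))) (trans balance (dist (λ v → not (side v)) sd (lockdeg C₁))))
               (trans (sym (dist (λ v → not (side v)) (C₁.row s) (lockdeg C₁))) (trans (sym rows-equal) (dist side (C₁.row s) (lockdeg C₁)))) ⟩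
          (sB + b) + (rA + a) ≡⟨ ar′ sB rA a b ⟩
          sB + rA + (a + b) ≡⟨ sym (cong₂ (λ x y → x + y + (a + b)) (∑-cong (λ v → cong (λ z → ⟦ z ⟧ * sd v) (not-xor′ (side v))))
               (∑-cong (λ v → trans (start-row true v) (cong (λ z → ⟦ z ⟧ * C₁.row s v) (not-xor (side v)))))) ⟩
          tot false + ∑ (Colouring.row start (on true)) + (a + b) ∎) }
      where
      open ≡-Reasoning
      a = ∑ (λ v → ⟦ side v ⟧ * lockdeg C₁ v)
      b = ∑ (λ v → ⟦ not (side v) ⟧ * lockdeg C₁ v)
      sA = ∑ (λ v → ⟦ side v ⟧ * sd v)
      sB = ∑ (λ v → ⟦ not (side v) ⟧ * sd v)
      rA = ∑ (λ v → ⟦ side v ⟧ * C₁.row s v)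
      rB = ∑ (λ v → ⟦ not (side v) ⟧ * C₁.row s v)
      ar : ∀ x y a b → x + y + (a + b) ≡ x + a + (y + b)
      ar = solve-∀
      ar′ : ∀ x y a b → x + b + (y + a) ≡ x + y + (a + b)
      ar′ = solve-∀

    Next : Colouring G lock → Set
    Next C = Σ (Colouring G lock) λ D → Inv D × ∑ (Colouring.col C ne) < ∑ (Colouring.col D ne)

    module _ (C : Colouring G lock) (I : Inv C) where
      open Colouring C
      open Inv I

      cover : Fin N → ℕ
      cover v = ∑ (λ j → ne v (p (k₁ ↑ʳ j) v))

      row-sum : ∀ v → row s v ≡ C₁.row s v + cover v
      row-sum v = trans (∑-↑ ℓ _) (cong₂ _+_ (∑-cong (λ j → cong (s v) (main j v))) (∑-cong (λ j → sym (trans (ne-split side v _)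
        (trans (cong (s v (p (k₁ ↑ʳ j) v) +_) (∑≡0 (fsame j) v)) (+-identityʳ _))))))

      -- The auxiliary colours carry only same-side edges that the first `k₁` colours left over at
      -- `v`; comparing `loaded` with `samedeg` shows that there are at most `L` of these.
      cover≤ : ∀ v → cover v ≤ L
      cover≤ v = lin 0 (+-mono-≤ (+-mono-≤ (loaded v) (samedeg v)) (≤-trans (≤-reflexive (sym (row-sum v))) (row≤ s (Fs-diag side) v)))
        (ar k₁ L (C₁.row s v) (lockdeg C₁ v) (sd v) (cover v))
        where
        ar : ∀ k L r l d c → L + (k + (d + l) + (r + c)) ≡ c + (r + l + L + k + d) + 0
        ar = solve-∀

      full-few : ∑ (λ j → ⟦ does (suc Θ ≤? col ne (k₁ ↑ʳ j)) ⟧) ≤ Φ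
      full-few = ≤-pred (*-cancelʳ-< (suc Θ) _ _ (≤-<-trans (begin
        ∑ (λ j → ⟦ does (suc Θ ≤? col ne (k₁ ↑ʳ j)) ⟧) * suc Θ ≡⟨ sym (∑-*ʳ (suc Θ) (λ j → ⟦ does (suc Θ ≤? col ne (k₁ ↑ʳ j)) ⟧)) ⟩
        ∑ (λ j → ⟦ does (suc Θ ≤? col ne (k₁ ↑ʳ j)) ⟧ * suc Θ) ≤⟨ ∑-mono pt ⟩
        ∑ (λ j → col ne (k₁ ↑ʳ j)) ≡⟨ ∑-swap _ ⟩
        ∑ cover ≤⟨ ∑-≤ cover≤ ⟩
        N * L ∎) num₁))
        where
        open ≤-Reasoning
        pt : ∀ j → ⟦ does (suc Θ ≤? col ne (k₁ ↑ʳ j)) ⟧ * suc Θ ≤ col ne (k₁ ↑ʳ j)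
        pt j = ind (suc Θ ≤? col ne (k₁ ↑ʳ j))
          where
          ind : ∀ {a b} (d : Dec (a ≤ b)) → ⟦ does d ⟧ * a ≤ b
          ind (yes q) = ≤-trans (≤-reflexive (+-identityʳ _)) q
          ind (no _) = z≤n

      -- The four vertices meet at most 4 L auxiliary colours, and at most `Φ` colours have more
      -- than `Θ` covered vertices, the total being at most N L. By `num₂` another colour is left.
      room : ∀ u v u′ v′ → ∃ λ j → p (k₁ ↑ʳ j) u ≡ u × p (k₁ ↑ʳ j) v ≡ v × p (k₁ ↑ʳ j) u′ ≡ u′ × p (k₁ ↑ʳ j) v′ ≡ v′ × col ne (k₁ ↑ʳ j) ≤ Θ
      room u v u′ v′ = go (∑<→∃ (λ j → c u j + c v j + (c u′ j + c v′ j) + f j) (λ _ → 1) (≤-trans (s≤s (≤-trans (≤-reflexive (trans (∑-+ _ _)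
          (cong (_+ ∑ f) (trans (∑-+ _ _) (cong₂ _+_ (∑-+ _ _) (∑-+ _ _)))))) (+-mono-≤ (+-mono-≤ (+-mono-≤ (cover≤ u) (cover≤ v)) (+-mono-≤ (cover≤ u′) (cover≤ v′))) full-few)))
          (≤-trans num₂ (≤-reflexive (sym (∑-1 ℓ))))))
        where
        c : Fin N → Fin ℓ → ℕ
        c v j = ne v (p (k₁ ↑ʳ j) v)
        f : Fin ℓ → ℕ
        f j = ⟦ does (suc Θ ≤? col ne (k₁ ↑ʳ j)) ⟧
        fixed : ∀ v j → c v j ≡ 0 → p (k₁ ↑ʳ j) v ≡ v
        fixed v j h with p (k₁ ↑ʳ j) v ≟ v
        ... | yes e = e
        ... | no q = ⊥-elim (0≢1+n (trans (sym h) (ne-≢ (λ e → q (sym e)))))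
        small : ∀ {a b} (d : Dec (suc a ≤ b)) → ⟦ does d ⟧ ≡ 0 → b ≤ a
        small (no q) _ = ≤-pred (≰⇒> q)
        go : (∃ λ j → c u j + c v j + (c u′ j + c v′ j) + f j < 1) → _
        go (j , h) = j , fixed u j (m+n≡0⇒m≡0 (c u j) z₁) , fixed v j (m+n≡0⇒n≡0 (c u j) z₁) , fixed u′ j (m+n≡0⇒m≡0 (c u′ j) z₂)
                   , fixed v′ j (m+n≡0⇒n≡0 (c u′ j) z₂) , small (suc Θ ≤? col ne (k₁ ↑ʳ j)) (m+n≡0⇒n≡0 (c u j + c v j + (c u′ j + c v′ j)) z₀)
          where
          z₀ = n≤0⇒n≡0 (≤-pred h)
          z = m+n≡0⇒m≡0 (c u j + c v j + (c u′ j + c v′ j)) z₀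
          z₁ = m+n≡0⇒m≡0 (c u j + c v j) z
          z₂ = m+n≡0⇒n≡0 (c u j + c v j) z

      SameUnc : Bool → Fin N → Fin N → Set
      SameUnc b u v = unc u v ≡ true × side u ≡ b × side v ≡ b

      put : ∀ b u v u′ v′ j → SameUnc b u v → SameUnc (not b) u′ v′ →
        p (k₁ ↑ʳ j) u ≡ u → p (k₁ ↑ʳ j) v ≡ v → p (k₁ ↑ʳ j) u′ ≡ u′ → p (k₁ ↑ʳ j) v′ ≡ v′ → col ne (k₁ ↑ʳ j) ≤ Θ → Next C
      put b u v u′ v′ j (uv , su , sv) (uv′ , su′ , sv′) pu pv pu′ pv′ sm = A₂.new , inv′ , lt
        where
        α = k₁ ↑ʳ j
        A₁ : Added C α u v
        A₁ = add C α u v uv pu pv (lock-r j u) (lock-r j v)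
        module A₁ = Added A₁
        opp : ∀ {a c} → side a ≡ b → side c ≡ not b → a ≢ c
        opp {a} {c} ha hc e = flip≢ b (trans (sym ha) (trans (cong side e) hc))
          where
          flip≢ : ∀ b → b ≡ not b → ⊥
          flip≢ true ()
          flip≢ false ()
        ≢ˢ : ∀ {a c : Fin N} → a ≢ c → c ≢ a
        ≢ˢ h e = h (sym e)
        A₂ : Added A₁.new α u′ v′
        A₂ = add A₁.new α u′ v′ (unc-add C A₁ (≢ˢ (opp su su′)) (≢ˢ (opp sv su′)) uv′)
               (trans (A₁.rest u′ (≢ˢ (opp su su′)) (≢ˢ (opp sv su′))) pu′) (trans (A₁.rest v′ (≢ˢ (opp su sv′)) (≢ˢ (opp sv sv′))) pv′) (lock-r j u′) (lock-r j v′)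
        module A₂ = Added A₂
        u≢v = ≢-of (unc-E uv)
        u≢v′ = ≢-of (unc-E uv′)
        col2 : ∀ F → Diag0 F → Colouring.col A₂.new F α ≡ col F α + (F u v + F v u) + (F u′ v′ + F v′ u′)
        col2 F F0 = trans (A₂.col-eq F F0) (cong (_+ (F u′ v′ + F v′ u′)) (A₁.col-eq F F0))
        other : ∀ F i → i ≢ α → Colouring.col A₂.new F i ≡ col F i
        other F i h = trans (A₂.col-other F i h) (A₁.col-other F i h)
        tot2 : ∀ F → Diag0 F → ∑ (Colouring.row A₂.new F) ≡ ∑ (row F) + (F u v + F v u + (F u′ v′ + F v′ u′))
        tot2 F F0 = +-cancelʳ-≡ (col F α) _ _ (trans (cong (_+ col F α) (Colouring.∑row≡∑col A₂.new F)) (trans (∑-upd (Colouring.col A₂.new F) (col F) α (λ i h → other F i h))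
          (trans (cong₂ _+_ (sym (∑row≡∑col F)) (col2 F F0)) (ar (∑ (row F)) (col F α) (F u v + F v u) (F u′ v′ + F v′ u′)))))
          where
          ar : ∀ r c x y → r + (c + x + y) ≡ r + (x + y) + c
          ar = solve-∀
        s1 : ∀ {a c d} → a ≢ c → side a ≡ d → side c ≡ d → s a c ≡ 1
        s1 {a} {c} {d} h ha hc = Fs-1 side h (trans (cong₂ _xor_ ha hc) (xor-self side d))
        on2 : ∀ c → on c u v + on c v u + (on c u′ v′ + on c v′ u′) ≡ 2
        on2 c = trans (cong₂ _+_ (cong₂ _+_ (t u v b su sv u≢v) (t v u b sv su (≢ˢ u≢v))) (cong₂ _+_ (t u′ v′ (not b) su′ sv′ u≢v′) (t v′ u′ (not b) sv′ su′ (≢ˢ u≢v′)))) (fin b c)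
          where
          t : ∀ a d e → side a ≡ e → side d ≡ e → a ≢ d → on c a d ≡ ⟦ not (e xor c) ⟧
          t a d e ha hd h = trans (cong₂ (λ x y → ⟦ not (x xor c) ⟧ * y) ha (s1 h ha hd)) (*-identityʳ _)
          fin : ∀ b c → ⟦ not (b xor c) ⟧ + ⟦ not (b xor c) ⟧ + (⟦ not (not b xor c) ⟧ + ⟦ not (not b xor c) ⟧) ≡ 2
          fin true true = refl
          fin true false = refl
          fin false true = refl
          fin false false = refl
        AB : A u v + A v u + (A u′ v′ + A v′ u′) ≡ B u v + B v u + (B u′ v′ + B v′ u′)
        AB rewrite su | sv | su′ | sv′ | ne-≢ u≢v | ne-≢ (≢ˢ u≢v) | ne-≢ u≢v′ | ne-≢ (≢ˢ u≢v′) = fin b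
          where
          fin : ∀ b → ⟦ b ⟧ * 1 + ⟦ b ⟧ * 1 + (⟦ not b ⟧ * 1 + ⟦ not b ⟧ * 1) ≡ ⟦ not b ⟧ * 1 + ⟦ not b ⟧ * 1 + (⟦ not (not b) ⟧ * 1 + ⟦ not (not b) ⟧ * 1)
          fin true = refl
          fin false = refl
        inv′ : Inv A₂.new
        inv′ .Inv.main i w = trans (A₂.other _ w (↑ˡ≢↑ʳ i j)) (trans (A₁.other _ w (↑ˡ≢↑ʳ i j)) (main i w))
        inv′ .Inv.fsame i with i ≟ j
        ... | no h = trans (other x′ _ (λ e → h (↑ʳ-inj {k₁} e))) (fsame i)
        ... | yes refl = trans (col2 x′ (Fc-diag side)) (trans (cong (λ z → z + (x′ u v + x′ v u) + (x′ u′ v′ + x′ v′ u′)) (fsame i)) x0)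
          where
          x0 : x′ u v + x′ v u + (x′ u′ v′ + x′ v′ u′) ≡ 0
          x0 rewrite su | sv | su′ | sv′ | xor-self side b | xor-self side (not b) = refl
        inv′ .Inv.bal i with i ≟ j
        ... | no h = trans (other A _ (λ e → h (↑ʳ-inj {k₁} e))) (trans (bal i) (sym (other B _ (λ e → h (↑ʳ-inj {k₁} e)))))
        ... | yes refl = trans (col2 A (FA-diag side)) (trans (+-assoc (col A α) _ _) (trans (cong₂ _+_ (bal i) AB) (trans (sym (+-assoc (col B α) _ _)) (sym (col2 B (FB-diag side))))))
        inv′ .Inv.few i with i ≟ j
        ... | no h = ≤-trans (≤-reflexive (other ne _ (λ e → h (↑ʳ-inj {k₁} e)))) (few i)
        ... | yes refl = ≤-trans (≤-reflexive (trans (col2 ne ne-diag) (trans (cong₂ (λ x y → col ne α + x + y) (cong₂ _+_ (ne-≢ u≢v) (ne-≢ (≢ˢ u≢v))) (cong₂ _+_ (ne-≢ u≢v′) (ne-≢ (≢ˢ u≢v′)))) (+-assoc _ 2 2))))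
                           (+-monoˡ-≤ 4 sm)
        inv′ .Inv.glob = trans (cong (tot true +_) (trans (tot2 (on false) (on-diag false)) (cong (∑ (row (on false)) +_) (on2 false))))
          (trans (sym (+-assoc (tot true) _ 2)) (trans (cong (_+ 2) glob) (trans (+-assoc (tot false) _ 2)
            (cong (tot false +_) (sym (trans (tot2 (on true) (on-diag true)) (cong (∑ (row (on true)) +_) (on2 true))))))))
        lt : ∑ (col ne) < ∑ (Colouring.col A₂.new ne)
        lt = ≤-trans (≤-trans (≤-reflexive (+-comm 1 _)) (+-monoʳ-≤ (∑ (col ne)) (≤-trans (≤-reflexive (sym (ne-≢ u≢v))) (≤-trans (m≤m+n _ _) (m≤m+n _ _)))))
          (≤-reflexive (trans (cong (_+ (ne u v + ne v u + (ne u′ v′ + ne v′ u′))) (sym (∑row≡∑col ne))) (trans (sym (tot2 ne ne-diag)) (Colouring.∑row≡∑col A₂.new ne))))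

      q : Bool → ℕ
      q b = ∑ (λ v → ∑ (λ u → on b v u * ⟦ unc v u ⟧))

      q-eq : ∀ b → tot b ≡ ∑ (row (on b)) + q b
      q-eq b = trans (∑-cong (λ v → trans (sym (trans (∑-cong (λ u → *-assoc ⟦ not (side v xor b) ⟧ (s v u) _)) (∑-*ˡ ⟦ not (side v xor b) ⟧ (λ u → s v u * ⟦ E v u ⟧)))) (deg-split (on b) (on-diag b) v))) (∑-+ _ _)

      q-same : q true ≡ q false
      q-same = +-cancelʳ-≡ (∑ (row (on true)) + ∑ (row (on false))) _ _ (trans (ar (q true) (∑ (row (on true))) (∑ (row (on false))))
         (trans (cong (_+ ∑ (row (on false))) (sym (q-eq true))) (trans glob (trans (cong (_+ ∑ (row (on true))) (q-eq false)) (ar′ (q false) (∑ (row (on true))) (∑ (row (on false))))))))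
        where
        ar : ∀ q a b → q + (a + b) ≡ a + q + b
        ar = solve-∀
        ar′ : ∀ q a b → b + q + a ≡ q + (a + b)
        ar′ = solve-∀

      from-q : ∀ b → 0 < q b → ∃ λ u → ∃ λ v → SameUnc b u v
      from-q b h with ∑>0→∃ _ h
      ... | u , h′ with ∑>0→∃ _ h′
      ...   | v , h″ = u , v , dig (side u) (side v) (unc u v) refl refl refl h″
        where
        dig : ∀ a c e → side u ≡ a → side v ≡ c → unc u v ≡ e → 0 < on b u v * ⟦ unc u v ⟧ → SameUnc b u v
        dig a c e ea ec ee h rewrite ee | ea | ec = dig′ b a c e (not (u == v)) h
          where
          dig′ : ∀ b a c e n → 0 < ⟦ not (a xor b) ⟧ * ⟦ n ∧ not (a xor c) ⟧ * ⟦ e ⟧ → e ≡ true × a ≡ b × c ≡ b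
          dig′ true true true true n _ = refl , refl , refl
          dig′ false false false true n _ = refl , refl , refl
          dig′ true true false true true ()
          dig′ true true false true false ()
          dig′ false false true true true ()
          dig′ false false true true false ()
          dig′ true false c e n ()
          dig′ false true c e n ()
          dig′ true true c false n h = ⊥-elim (n≮0 (≤-trans h (≤-reflexive (*-zeroʳ (1 * ⟦ n ∧ not (true xor c) ⟧)))))
          dig′ false false c false n h = ⊥-elim (n≮0 (≤-trans h (≤-reflexive (*-zeroʳ (1 * ⟦ n ∧ not (false xor c) ⟧)))))

      to-q : ∀ b u v → SameUnc b u v → 0 < q b
      to-q b u v (e , su , sv) = ≤-trans (≤-trans (≤-reflexive (sym one)) (term≤∑ (λ v → on b u v * ⟦ unc u v ⟧) v)) (term≤∑ (λ u → ∑ (λ v → on b u v * ⟦ unc u v ⟧)) u)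
        where
        sxx : side u xor side v ≡ false
        sxx = trans (cong₂ _xor_ su sv) (xor-self side b)
        one : on b u v * ⟦ unc u v ⟧ ≡ 1
        one rewrite e | Fs-1 side {u} {v} (≢-of (unc-E e)) sxx | su | xor-self side b = refl

      -- By `q-same` an uncoloured edge inside one half has a counterpart inside the other. Giving
      -- both the same colour keeps that colour balanced.
      step : ∀ b u v → SameUnc b u v → Next C
      step b u v uv = go (from-q (not b) (qq b (to-q b u v uv)))
        where
        qq : ∀ b → 0 < q b → 0 < q (not b)
        qq true = subst (0 <_) q-same
        qq false = subst (0 <_) (sym q-same)
        go : (∃ λ u → ∃ λ v → SameUnc (not b) u v) → Next C
        go (u′ , v′ , uv′) = case room u v u′ v′ of λ { (j , a , b₁ , c , d , e) → put b u v u′ v′ j uv uv′ a b₁ c d e }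

    record Result : Set where
      no-eta-equality
      field
        colouring : Colouring G lock
        inv : Inv colouring
        all-same : ∀ v → Colouring.row colouring s v ≡ sd v

    private
      done : ∀ C → Inv C → (∀ u v → Colouring.unc C u v ∧ not (side u xor side v) ≢ true) → Result
      done C I h = record { colouring = C ; inv = I
        ; all-same = λ v → sym (trans (deg-split s (Fs-diag side) v) (trans (cong (row s v +_) (∑-0 (λ u → z v u))) (+-identityʳ _))) }
        where
        open Colouring C
        z : ∀ v u → s v u * ⟦ unc v u ⟧ ≡ 0
        z v u with isTrue (side v xor side u)
        ... | inj₁ e = cong (_* ⟦ unc v u ⟧) (Fs-cross side {v} {u} e)
        ... | inj₂ e = trans (cong (λ t → s v u * ⟦ t ⟧) (¬true (λ t → h v u (∧-intro t (cong not e))))) (*-zeroʳ (s v u))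

      loop : ∀ f C → Inv C → k * N ≤ ∑ (Colouring.col C ne) + f → Result
      again : ∀ f (C : Colouring G lock) → k * N ≤ ∑ (Colouring.col C ne) + f → Next C → Result

      loop f C I le = case any? (λ u → any? (λ v → (Colouring.unc C u v ∧ not (side u xor side v)) ≟ᵇ true)) of λ
        { (no h) → done C I (λ u v e → h (u , v , e))
        ; (yes (u , v , e)) → again f C le (step C I (side u) u v (proj₁ (∧-true e) , refl , sym (xe (side u) (side v) (not-true (proj₂ (∧-true {Colouring.unc C u v} e)))))) }
        where
        xe : ∀ a b → a xor b ≡ false → a ≡ b
        xe true true _ = refl
        xe false false _ = refl
      again zero C le (D , I , lt) = ⊥-elim (<⇒≱ lt (≤-trans (≤-trans (∑-≤ (λ i → m+n≤o⇒m≤o _ (m+n≤o⇒m≤o _ (≤-reflexive (Colouring.col-total D i))))) le) (≤-reflexive (+-identityʳ _))))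
      again (suc f) C le (D , I , lt) = loop f D I (≤-trans le (≤-trans (≤-reflexive (+-suc _ f)) (+-monoˡ-≤ f lt)))

    abstract
      distribute : Result
      distribute = loop (k * N) start start-inv (m≤n+m _ _)

-- Composition of the colouring steps

module Stage1 where
  open Prelude
  open Sums
  open EdgeColouring
  open Vizing
  open Equalize
  open Sides
  open Augment
  open Complete
  open Distribute

  module _ {N} (G : SimpleGraph N) (side : Fin N → Bool) where
    open SimpleGraph G

    samedeg : Fin N → ℕ
    samedeg v = ∑ (λ u → Fs side v u * ⟦ E v u ⟧)

    crossdeg : Fin N → ℕ
    crossdeg v = ∑ (λ u → Fc side v u * ⟦ E v u ⟧)

    Same : SimpleGraph N
    Same .SimpleGraph.E u v = E u v ∧ not (side u xor side v)
    Same .SimpleGraph.E-sym u v = cong₂ (λ a b → a ∧ not b) (E-sym u v) (xor-comm side (side u) (side v))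
    Same .SimpleGraph.E-irr v = cong (_∧ not (side v xor side v)) (E-irr v)

    deg-Same : ∀ v → SimpleGraph.deg Same v ≡ samedeg v
    deg-Same v = ∑-cong pt
      where
      pt : ∀ u → ⟦ E v u ∧ not (side v xor side u) ⟧ ≡ Fs side v u * ⟦ E v u ⟧
      pt u with v ≟ u
      ... | yes refl rewrite E-irr v = sym (*-zeroʳ (Fs side v v))
      ... | no h rewrite ==-≢ h with E v u | side v xor side u
      ...   | true | true = refl
      ...   | true | false = refl
      ...   | false | true = refl
      ...   | false | false = refl

  -- Same-side degree plus locks is smaller than `k₁` by at least `slack` and at most `g`. `K`
  -- bounds the uncoloured edges at a vertex after the first colouring, a + 1 exceeds the average
  -- gap of a colour, `τ₁` bounds the gaps after equalising, and `τ₀` is the budget for the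
  -- augmentations. `M₀` is a lower bound for the cross degrees, and `ℓ` is the number of auxiliary
  -- colours.
  record Numbers : Set where
    no-eta-equality
    field
      m k₁ ℓ c slack g K a τ₁ τ₀ ω L M₀ Θ Φ : ℕ
      vizing-bound : 2 * (1 + (c + c)) * k₁ < K * slack
      gap-bound : (m + m) * (g + K) < k₁ * suc a
      even-bound : 2 * (a + (c + c)) ≤ τ₁
      even-bound′ : a + 2 ≤ τ₁
      budget-bound : τ₁ + τ₁ + τ₁ + c ≤ τ₀
      load-bound : g + K ≤ L
      over-bound : k₁ * (τ₀ + 2) < suc ω * L
      same-bound : m + (τ₀ + 2) + (ω + ω) + (L + L) < M₀ + M₀
      shift-bound : τ₀ + 2 + (ω + ω) + L < M₀
      full-bound : (m + m) * L < suc Φ * suc Θ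
      room-bound : L + L + (L + L) + Φ < ℓ
      finish-bound : m + (Θ + 4) + (g + ℓ + (g + ℓ)) < M₀ + M₀

  module Stage {N} (G : SimpleGraph N) (side : Fin N → Bool) (nums : Numbers) (lock₁ : Fin (Numbers.k₁ nums) → Fin N → Bool) where
    open Numbers nums
    open SimpleGraph G

    private
      s = Fs side

    lockd : Fin N → ℕ
    lockd v = ∑ (λ i → ⟦ lock₁ i v ⟧)

    k : ℕ
    k = k₁ + ℓ

    lock : Fin k → Fin N → Bool
    lock i v = glue (λ j → lock₁ j v) (λ _ → false) i

    record Coloured : Set where
      no-eta-equality
      field
        colouring : Colouring G lock
        perfect : ∀ i v → Colouring.avail colouring i v ≡ false
        all-same : ∀ v → Colouring.row colouring s v ≡ samedeg G side v

    module Run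
      (halfA : ∑ (λ v → ⟦ side v ⟧) ≡ m) (halfB : ∑ (λ v → ⟦ not (side v) ⟧) ≡ m)
      (few-locks : ∀ i → ∑ (λ v → ⟦ lock₁ i v ⟧) ≤ c)
      (lock-even : ∀ i → ∃ λ h → ∑ (λ v → ⟦ lock₁ i v ⟧) ≡ h + h)
      (cross≥ : ∀ v → M₀ ≤ crossdeg G side v)
      (same≤ : ∀ v → samedeg G side v + lockd v + slack ≤ k₁)
      (same≥ : ∀ v → k₁ ≤ samedeg G side v + lockd v + g)
      (balance : ∑ (λ v → ⟦ side v ⟧ * (samedeg G side v + lockd v)) ≡ ∑ (λ v → ⟦ not (side v) ⟧ * (samedeg G side v + lockd v))) where

      half : N ≡ m + m
      half = trans (sym (∑-1 N)) (trans (∑-cong (λ v → sym (⟦⟧-not (side v)))) (trans (∑-+ _ _) (cong₂ _+_ halfA halfB)))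

      opposite : ∀ v → ∑ (λ u → ⟦ side v xor side u ⟧) ≡ m
      opposite v with side v
      ... | true = halfB
      ... | false = halfA

      dense-cross : AugmentData G lock₁
      dense-cross = record
        { side = side ; m = m ; M₀ = M₀ ; τ = τ₀ + 2 ; ω = ω ; L = L ; opposite = opposite ; crossdeg = cross≥
        ; num₁ = over-bound ; num₂ = same-bound ; num₃ = shift-bound }

      Near : Set
      Near = Σ (Colouring G lock₁) λ C → Loaded G lock₁ dense-cross C
        × (∀ i → N + N + N ≤ τ₀ + Colouring.col C s i + (Colouring.col C ne i + ∑ (λ v → ⟦ lock₁ i v ⟧) + (Colouring.col C ne i + ∑ (λ v → ⟦ lock₁ i v ⟧))))

      module _ (C : Colouring (Same G side) lock₁) (unc< : ∀ v → ∑ (λ u → ⟦ Colouring.unc C v u ⟧) < K) where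
        private
          module C = Colouring C

        row-low : ∀ v → samedeg G side v ≤ C.row ne v + K
        row-low v = ≤-trans (≤-reflexive (trans (sym (deg-Same G side v)) (C.deg-ne v))) (+-monoʳ-≤ (C.row ne v) (<⇒≤ (unc< v)))

        avail-low : ∀ v → ∑ (λ i → ⟦ C.avail i v ⟧) ≤ g + K
        avail-low v = lin 0 (+-mono-≤ (same≥ v) (row-low v)) (trans (cong (λ t → g + K + (t + samedeg G side v)) (sym (C.row-total v)))
          (ar g K (C.row ne v) (lockd v) (∑ (λ i → ⟦ C.avail i v ⟧)) (samedeg G side v)))
          where
          ar : ∀ g K r l a d → g + K + (r + l + a + d) ≡ a + (d + l + g + (r + K)) + 0
          ar = solve-∀

        total : ∑ (gap c a τ₁ few-locks even-bound even-bound′ C) < k₁ * suc a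
        total = ≤-<-trans (≤-trans (≤-reflexive (∑-swap (λ i v → ⟦ C.avail i v ⟧))) (≤-trans (∑-≤ avail-low) (≤-reflexive (cong (_* (g + K)) half)))) gap-bound

        weaken : (D : Colouring (Same G side) lock₁) → SameRows c a τ₁ few-locks even-bound even-bound′ C D → (∀ i → ∑ (λ v → ⟦ Colouring.avail D i v ⟧) ≤ τ₁) → Near
        weaken D rows gaps = W , ld , bd
          where
          module D = Colouring D
          W : Colouring G lock₁
          W .Colouring.p = D.p
          W .Colouring.inv = D.inv
          W .Colouring.edge i v h = proj₁ (∧-true (D.edge i v h))
          W .Colouring.disj = D.disj
          W .Colouring.locked = D.locked
          s≡ne : ∀ i v → s v (D.p i v) ≡ ne v (D.p i v)
          s≡ne i v with D.p i v ≟ v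
          ... | yes e rewrite e = trans (Fs-diag side v) (sym (ne-diag v))
          ... | no h = trans (Fs-1 side {v} {D.p i v} (λ e → h (sym e)) (not-true (proj₂ (∧-true {E v (D.p i v)} (D.edge i v h))))) (sym (ne-≢ (λ e → h (sym e))))
          ld : ∀ v → k₁ ≤ Colouring.row W s v + lockd v + L
          ld v = ≤-trans (lin 0 (+-mono-≤ (same≥ v) (row-low v)) (ar (C.row ne v) (lockd v) g K k₁ (samedeg G side v)))
            (+-mono-≤ (+-monoˡ-≤ (lockd v) (≤-reflexive (trans (sym (rows ne v)) (∑-cong (λ i → sym (s≡ne i v)))))) load-bound)
            where
            ar : ∀ r l g K k d → r + l + (g + K) + (k + d) ≡ k + (d + l + g + (r + K)) + 0
            ar = solve-∀
          -- All coloured edges are same-side edges so far. Since `N` is the number of covered,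
          -- locked and available vertices of a colour, the budget amounts to three times the gap
          -- plus the locks being at most `τ₀`.
          bd : ∀ i → N + N + N ≤ τ₀ + Colouring.col W s i + (D.col ne i + ∑ (λ v → ⟦ lock₁ i v ⟧) + (D.col ne i + ∑ (λ v → ⟦ lock₁ i v ⟧)))
          bd i = subst (λ t → N + N + N ≤ τ₀ + t + (cn + lk + (cn + lk))) (sym (∑-cong (s≡ne i)))
            (subst (λ n → n + n + n ≤ τ₀ + cn + (cn + lk + (cn + lk))) (D.col-total i)
              (lin 0 (≤-trans (+-mono-≤ (+-mono-≤ (+-mono-≤ (gaps i) (gaps i)) (gaps i)) (few-locks i)) budget-bound) (ar cn lk (∑ (λ v → ⟦ D.avail i v ⟧)) τ₀)))
            where
            cn = D.col ne i
            lk = ∑ (λ v → ⟦ lock₁ i v ⟧)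
            ar : ∀ n l a t → t + n + (n + l + (n + l)) + (a + a + a + l) ≡ n + l + a + (n + l + a) + (n + l + a) + t + 0
            ar = solve-∀

      abstract
        near : Near
        near = go (vizing (Same G side) lock₁ c slack K few-locks (λ v → subst (λ t → t + lockd v + slack ≤ k₁) (sym (deg-Same G side v)) (same≤ v)) vizing-bound)
          where
          go : (Σ (Colouring (Same G side) lock₁) λ C → ∀ v → ∑ (λ u → ⟦ Colouring.unc C v u ⟧) < K) → Near
          go (C , h) = case equalize c a τ₁ few-locks even-bound even-bound′ C (total C h) of λ { (D , r , q) → weaken C h D r q }

      module Finish (C₁ : Colouring G lock₁) (ld : ∀ v → k₁ ≤ Colouring.row C₁ s v + lockdeg C₁ v + L) (pf : ∀ i v → Colouring.avail C₁ i v ≡ false) where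
        same-le : ∀ v → samedeg G side v + lockdeg C₁ v ≤ k₁
        same-le v = m+n≤o⇒m≤o _ (same≤ v)

        remainder : DistributionData N
        remainder = record
          { k₁ = k₁ ; ℓ = ℓ ; G = G ; lock₁ = lock₁ ; side = side ; m = m ; L = L ; Θ = Θ ; Φ = Φ ; halfA = halfA ; halfB = halfB
          ; num₁ = subst (λ n → n * L < suc Φ * suc Θ) (sym half) full-bound ; num₂ = room-bound
          ; C₁ = C₁ ; perfect = pf ; loaded = ld ; samedeg = same-le ; balance = balance }
        module D = Distribution remainder

        finish : D.Result → Coloured
        finish R = pack (K.complete R.colouring status tight)
          where
          module R = D.Result R
          module I = D.Inv R.inv
          sparse : CompletionData G lock
          sparse = record
            { side = side ; m = m ; M₀ = M₀ ; Θ = Θ + 4 ; H = g + ℓ ; opposite = opposite ; halfA = halfA ; halfB = halfB ; crossdeg = cross≥ ; num = finish-bound }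
          module K = Completion G lock sparse
          module RC = Colouring R.colouring
          status : K.Status R.colouring
          status i with view {k₁} {ℓ} i
          ... | left j = inj₁ (λ v → trans (cong₂ (λ x b → (x == v) ∧ not b) (I.main j v) (D.lock-l j v)) (pf j v))
          ... | right j = inj₂ (record { unl = D.lock-r j ; bal = I.bal j ; few = ≤-trans (∑-mono (λ v → ≤-trans (m≤m+n _ _) (≤-reflexive (sym (ne-split side v (RC.p (k₁ ↑ʳ j) v)))))) (I.few j) })
          -- All same-side edges are coloured by now, and their number plus the locks falls short of
          -- `k₁` by at most `g`; the auxiliary colours add `ℓ`.
          tight : K.Tight R.colouring
          tight v = ≤-trans (+-monoˡ-≤ ℓ (same≥ v)) (≤-reflexive (trans (+-assoc (samedeg G side v + lockd v) g ℓ)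
            (cong₂ (λ x y → x + y + (g + ℓ)) (sym (R.all-same v)) (sym (D.lockdeg-eq v)))))
          pack : (Σ (Colouring G lock) λ E → (∀ v → Colouring.row E s v ≡ RC.row s v) × (∀ i v → Colouring.avail E i v ≡ false)) → Coloured
          pack (E , r , h) = record { colouring = E ; perfect = h ; all-same = λ v → trans (r v) (R.all-same v) }

      abstract
        coloured : Coloured
        coloured = go near
          where
          module A = Augment.Loop G lock₁ dense-cross τ₀ refl lock-even half
          go : Near → Coloured
          go (C , ld , bd) = case A.perfect C ld bd of λ { (D , ld′ , pf) → Finish.finish D ld′ pf (Finish.D.distribute D ld′ pf) }

-- König's and Galvin's theorems

module Bipartite where
  open Prelude
  open Sums
  open Kempe
  open EdgeColouring
  open Vizing
  import Data.Nat.Properties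
  open import Relation.Binary.Definitions using (tri<; tri≈; tri>)

  no-lock : ∀ {N k} → Fin k → Fin N → Bool
  no-lock _ _ = false

  module Konig {N} (G : SimpleGraph N) (side : Fin N → Bool) (D : ℕ)
               (bip : ∀ u v → SimpleGraph.E G u v ≡ true → side v ≡ not (side u))
               (deg≤ : ∀ v → SimpleGraph.deg G v ≤ D) where
    open SimpleGraph G

    Col : Set
    Col = Colouring {k = D} G no-lock

    Next : Col → Set
    Next C = Σ Col λ C′ → ∑ (Colouring.row C ne) < ∑ (Colouring.row C′ ne)

    module _ (C : Col) where
      open Colouring C

      spare : ∀ v u → unc v u ≡ true → ∃ λ α → avail α v ≡ true
      spare v u h = count∃ (λ α → avail α v) (+-cancelˡ-< (row ne v) 0 _ (≤-trans (≤-trans (≤-reflexive (cong suc (+-identityʳ _)))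
        (≤-trans (≤-reflexive (+-comm 1 _)) (≤-trans (+-monoʳ-≤ (row ne v) (≤-trans (≤-reflexive (cong ⟦_⟧ (sym h))) (term≤∑ (λ x → ⟦ unc v x ⟧) u)))
          (≤-trans (≤-reflexive (sym (deg-ne v))) (deg≤ v))))) (≤-reflexive (sym tot))))
        where
        tot : row ne v + ∑ (λ α → ⟦ avail α v ⟧) ≡ D
        tot = trans (cong (_+ ∑ (λ α → ⟦ avail α v ⟧)) (sym (trans (cong (row ne v +_) (∑-0 {D} (λ _ → refl))) (+-identityʳ _)))) (row-total v)

      -- On the alternating path from `a`, where `α` is missing, a vertex missing `β` is on the side
      -- of `a` and hence differs from `b`. So the swap on this path makes `β` available at `a` and
      -- does not touch `b`.
      enlarge : ∀ a b → unc a b ≡ true → ∀ α β → avail α a ≡ true → avail β b ≡ true → Next C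
      enlarge a b ab α β aα bβ = Added.new A , lt
        where
        module W = Walk (p α) (p β) (inv α) (inv β) a (avail-p aα)
        flip : ∀ i v → p i v ≢ v → side (p i v) ≡ not (side v)
        flip i v h = bip v (p i v) (edge i v h)
        Sb : W.S b ≡ false
        Sb = ¬true (λ h → contra (side a) (trans (sym (W.bipartite side (flip α) (flip β) b h (avail-p bβ))) (bip a b (unc-E ab))))
          where
          contra : ∀ x → x ≡ not x → ⊥
          contra true ()
          contra false ()
        Sa : W.S a ≡ true
        Sa = W.S-in 0 z≤n
        module Sw = Swap C α β W.S (W.closed 1) (W.closed 0) (λ _ _ → refl) (λ _ _ → refl)
        A : Added Sw.new β a b
        A = add Sw.new β a b (Sw.unc-same ab) (trans (Sw.p′-β a Sa) (avail-p aα)) (trans (Sw.p′-out β b Sb) (avail-p bβ)) refl refl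
        one : ⟦ a == a ⟧ * ne a b ≡ 1
        one rewrite ==-refl a | ne-≢ (≢-of (unc-E ab)) = refl
        lt : ∑ (row ne) < ∑ (Colouring.row (Added.new A) ne)
        lt = ∑-mono-< (λ x → ≤-trans (≤-reflexive (sym (Sw.row-same ne x))) (≤-trans (m≤m+n _ _) (≤-reflexive (sym (Added.row-eq A ne ne-diag x))))) a
          (begin
            suc (row ne a) ≡⟨ cong suc (sym (Sw.row-same ne a)) ⟩
            suc (Colouring.row Sw.new ne a) ≡⟨ +-comm 1 _ ⟩
            Colouring.row Sw.new ne a + 1 ≤⟨ +-monoʳ-≤ (Colouring.row Sw.new ne a) (≤-trans (≤-reflexive (sym one)) (m≤m+n _ _)) ⟩
            Colouring.row Sw.new ne a + (⟦ a == a ⟧ * ne a b + ⟦ a == b ⟧ * ne b a) ≡⟨ sym (Added.row-eq A ne ne-diag a) ⟩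
            Colouring.row (Added.new A) ne a ∎)
          where open ≤-Reasoning

      abstract
        next : ∀ a b → unc a b ≡ true → Next C
        next a b ab = case (spare a b ab , spare b a (unc-sym ab)) of λ { ((α , aα) , (β , bβ)) → enlarge a b ab α β aα bβ }

    private
      Result : Set
      Result = Σ Col λ C → ∀ u v → E u v ≡ true → ∃ λ i → Colouring.p C i u ≡ v

      loop : ∀ f (C : Col) → ∑ deg ≤ ∑ (Colouring.row C ne) + f → Result
      again : ∀ f (C : Col) → ∑ deg ≤ ∑ (Colouring.row C ne) + f → Next C → Result

      loop f C le = case any? (λ u → any? (λ v → Colouring.unc C u v ≟ᵇ true)) of λ
        { (no h) → C , (λ u v e → case Colouring.hit? C u v of λ { (yes q) → q ; (no q) → ⊥-elim (h (u , v , Colouring.unc-intro C e (λ i r → q (i , r)))) })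
        ; (yes (u , v , e)) → again f C le (next C u v e) }
      again zero C le (C′ , lt) = ⊥-elim (<⇒≱ lt (≤-trans (∑-mono (λ v → m+n≤o⇒m≤o _ (≤-reflexive (sym (Colouring.deg-ne C′ v))))) (≤-trans le (≤-reflexive (+-identityʳ _)))))
      again (suc f) C le (C′ , lt) = loop f C′ (≤-trans le (≤-trans (≤-reflexive (+-suc _ f)) (+-monoˡ-≤ f lt)))

    abstract
      konig : Result
      konig = loop (∑ deg) (record { p = λ _ v → v ; inv = λ _ _ → refl ; edge = λ _ _ h → ⊥-elim (h refl) ; disj = λ _ _ _ h → ⊥-elim (h refl) ; locked = λ _ _ () }) (m≤n+m _ _)

  -- Galvin's argument.  An edge is a pair (c , a): its colour c in a König colouring and its end a on the
  -- side A; at a small colours are preferred, at the other end large ones.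
  module ListColouring {N D} (q : Fin D → Fin N → Fin N) (qinv : ∀ c v → q c (q c v) ≡ v) where

    EdgeSet : Set
    EdgeSet = Fin D → Fin N → Bool

    -- A kernel of the line graph with conflicting edges directed towards the preferred one. In
    -- `indepB` equality of the colours is enough: the involution `q c` then identifies `a` and `a′`
    -- as well.
    record Kernel (M : EdgeSet) : Set where
      no-eta-equality
      field
        K : EdgeSet
        sub : ∀ c a → K c a ≡ true → M c a ≡ true
        indepA : ∀ c c′ a → K c a ≡ true → K c′ a ≡ true → c ≡ c′
        indepB : ∀ c c′ a a′ → K c a ≡ true → K c′ a′ ≡ true → q c a ≡ q c′ a′ → c ≡ c′
        absorbing : ∀ c a → M c a ≡ true → K c a ≡ false →
          (∃ λ c′ → toℕ c′ < toℕ c × K c′ a ≡ true) ⊎ (∃ λ c′ → toℕ c < toℕ c′ × K c′ (q c′ (q c a)) ≡ true)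

    size : EdgeSet → ℕ
    size M = ∑ (λ c → ∑ (λ a → ⟦ M c a ⟧))

    module _ (M : EdgeSet) where
      Top : Fin D → Fin N → Set
      Top c a = M c a ≡ true × (∀ c′ → toℕ c′ < toℕ c → M c′ a ≡ false)

      top? : ∀ c a → Dec (Top c a)
      top? c a with M c a ≟ᵇ true | all? (λ c′ → below c′)
        where
        below : ∀ c′ → Dec (toℕ c′ < toℕ c → M c′ a ≡ false)
        below c′ with toℕ c′ <? toℕ c | M c′ a ≟ᵇ false
        ... | yes l | yes e = yes (λ _ → e)
        ... | yes l | no e = no (λ h → e (h l))
        ... | no l | _ = yes (λ h → ⊥-elim (l h))
      ... | yes e | yes h = yes (e , h)
      ... | no e | _ = no (λ z → e (proj₁ z))
      ... | yes _ | no h = no (λ z → h (proj₂ z))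

      Conflict : Fin D → Fin N → Fin D → Set
      Conflict c a c′ = Top c a × toℕ c < toℕ c′ × Top c′ (q c′ (q c a))

      conflict? : ∀ c a c′ → Dec (Conflict c a c′)
      conflict? c a c′ with top? c a | toℕ c <? toℕ c′ | top? c′ (q c′ (q c a))
      ... | yes x | yes y | yes z = yes (x , y , z)
      ... | no x | _ | _ = no (λ h → x (proj₁ h))
      ... | yes _ | no y | _ = no (λ h → y (proj₁ (proj₂ h)))
      ... | yes _ | yes _ | no z = no (λ h → z (proj₂ (proj₂ h)))

      topmost : ∀ c a → M c a ≡ true → ∃ λ t → Top t a × toℕ t ≤ toℕ c
      topmost c a h with least (λ c → M c a) c h
      ... | t , e , le , low = t , (e , low) , le

      -- Each edge that is not the favourite of its end in A is absorbed by that favourite. So the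
      -- favourites form a kernel as soon as no two of them meet on the other side.
      tops : (∀ c a c′ → ¬ Conflict c a c′) → Kernel M
      tops nc = record
        { K = λ c a → does (top? c a)
        ; sub = λ c a h → proj₁ (does-sound (top? c a) h)
        ; indepA = λ c c′ a h h′ → uniq c c′ a (does-sound (top? c a) h) (does-sound (top? c′ a) h′)
        ; indepB = λ c c′ a a′ h h′ e → uniqB c c′ a a′ (does-sound (top? c a) h) (does-sound (top? c′ a′) h′) e
        ; absorbing = λ c a h nk → inj₁ (ab c a h nk (topmost c a h)) }
        where
        uniq : ∀ c c′ a → Top c a → Top c′ a → c ≡ c′
        uniq c c′ a (e , l) (e′ , l′) with <-cmp (toℕ c) (toℕ c′)
        ... | tri< lt _ _ = tf e (l′ c lt)
        ... | tri≈ _ eq _ = toℕ-injective eq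
        ... | tri> _ _ gt = tf e′ (l c′ gt)
        uniqB : ∀ c c′ a a′ → Top c a → Top c′ a′ → q c a ≡ q c′ a′ → c ≡ c′
        uniqB c c′ a a′ t t′ e with <-cmp (toℕ c) (toℕ c′)
        ... | tri< lt _ _ = ⊥-elim (nc c a c′ (t , lt , subst (Top c′) (trans (sym (qinv c′ a′)) (cong (q c′) (sym e))) t′))
        ... | tri≈ _ eq _ = toℕ-injective eq
        ... | tri> _ _ gt = ⊥-elim (nc c′ a′ c (t′ , gt , subst (Top c) (trans (sym (qinv c a)) (cong (q c) e)) t))
        ab : ∀ c a → M c a ≡ true → does (top? c a) ≡ false → (∃ λ t → Top t a × toℕ t ≤ toℕ c) → ∃ λ c′ → toℕ c′ < toℕ c × does (top? c′ a) ≡ true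
        ab c a h nk (t , topt , le) with m≤n⇒m<n∨m≡n le
        ... | inj₁ lt = t , lt , does-complete (top? t a) topt
        ... | inj₂ eq = tf (does-complete (top? c a) (subst (λ z → Top z a) (toℕ-injective eq) topt)) nk

      -- The less preferred of two conflicting top edges can be discarded: whatever absorbs the other absorbs it.
      module Drop (c : Fin D) (a : Fin N) (c′ : Fin D) (cf : Conflict c a c′) where
        a′ = q c′ (q c a)

        M′ : EdgeSet
        M′ d x = M d x ∧ not ((d == c) ∧ (x == a))

        keep : ∀ d x → d ≢ c ⊎ x ≢ a → M d x ≡ true → M′ d x ≡ true
        keep d x (inj₁ h) e rewrite ==-≢ h = ∧-intro e refl
        keep d x (inj₂ h) e rewrite ==-≢ h with d == c
        ... | true = ∧-intro e refl
        ... | false = ∧-intro e refl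

        smaller : size M′ < size M
        smaller = ∑-mono-< (λ d → ∑-mono (λ x → ⟦⟧-mono (λ h → proj₁ (∧-true {M d x} h)))) c
          (∑-mono-< (λ x → ⟦⟧-mono (λ h → proj₁ (∧-true {M c x} h))) a (subst₂ (λ x y → ⟦ x ⟧ < ⟦ y ⟧) (sym gone) (sym (proj₁ (proj₁ cf))) (s≤s z≤n)))
          where
          gone : M′ c a ≡ false
          gone rewrite ==-refl c | ==-refl a with M c a
          ... | true = refl
          ... | false = refl

        lift : Kernel M′ → Kernel M
        lift 𝒦 = record { K = K ; sub = λ d x h → proj₁ (∧-true {M d x} (sub d x h)) ; indepA = indepA ; indepB = indepB ; absorbing = ab }
          where
          open Kernel 𝒦
          c≢c′ : c′ ≢ c
          c≢c′ e = <-irrefl (cong toℕ (sym e)) (proj₁ (proj₂ cf))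
          same-b : q c′ a′ ≡ q c a
          same-b = qinv c′ (q c a)
          special : (∃ λ d → toℕ d < toℕ c × K d a ≡ true) ⊎ (∃ λ d → toℕ c < toℕ d × K d (q d (q c a)) ≡ true)
          special with isTrue (K c′ a′)
          ... | inj₁ e = inj₂ (c′ , proj₁ (proj₂ cf) , e)
          ... | inj₂ e with absorbing c′ a′ (keep c′ a′ (inj₁ c≢c′) (proj₁ (proj₂ (proj₂ cf)))) e
          ...   | inj₁ (d , lt , kd) = tf (proj₁ (∧-true {M d a′} (sub d a′ kd))) (proj₂ (proj₂ (proj₂ cf)) d lt)
          ...   | inj₂ (d , lt , kd) = inj₂ (d , <-trans (proj₁ (proj₂ cf)) lt , subst (λ z → K d (q d z) ≡ true) same-b kd)
          ab : ∀ d x → M d x ≡ true → K d x ≡ false → (∃ λ c′ → toℕ c′ < toℕ d × K c′ x ≡ true) ⊎ (∃ λ c′ → toℕ d < toℕ c′ × K c′ (q c′ (q d x)) ≡ true)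
          ab d x h nk with d ≟ c | x ≟ a
          ... | yes refl | yes refl = special
          ... | no z | _ = absorbing d x (keep d x (inj₁ z) h) nk
          ... | yes _ | no z = absorbing d x (keep d x (inj₂ z) h) nk

    private
      kernel′ : ∀ f M → size M ≤ f → Kernel M
      kernel-again : ∀ f M → size M ≤ f → (∃ λ c → ∃ λ a → ∃ λ c′ → Conflict M c a c′) → Kernel M
      kernel′ f M le = case any? (λ c → any? (λ a → any? (λ c′ → conflict? M c a c′))) of λ
        { (no h) → tops M (λ c a c′ z → h (c , a , c′ , z))
        ; (yes z) → kernel-again f M le z }
      kernel-again zero M le (c , a , c′ , cf) = ⊥-elim (n≮0 (≤-trans (Drop.smaller M c a c′ cf) le))
      kernel-again (suc f) M le (c , a , c′ , cf) = Drop.lift M c a c′ cf (kernel′ f _ (≤-pred (≤-trans (Drop.smaller M c a c′ cf) le)))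

    abstract
      kernel : ∀ M → Kernel M
      kernel M = kernel′ (size M) M ≤-refl

    lt : Fin D → Fin D → Bool
    lt c c′ = does (toℕ c <? toℕ c′)

    -- The outdegree in the directed line graph: smaller colours at the end `a`, larger ones at the
    -- other end.
    out : EdgeSet → Fin D → Fin N → ℕ
    out M c a = ∑ (λ c′ → ⟦ lt c′ c ∧ M c′ a ⟧ + ⟦ lt c c′ ∧ M c′ (q c′ (q c a)) ⟧)

    record Lists (f : Fin N → ℕ) (M : EdgeSet) (t : ℕ) : Set where
      no-eta-equality
      field
        col : Fin D → Fin N → ℕ
        col< : ∀ c a → M c a ≡ true → col c a < t
        allowed : ∀ c a → M c a ≡ true → col c a ≢ f a
        properA : ∀ c c′ a → M c a ≡ true → M c′ a ≡ true → col c a ≡ col c′ a → c ≡ c′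
        properB : ∀ c c′ a a′ → M c a ≡ true → M c′ a′ ≡ true → q c a ≡ q c′ a′ → col c a ≡ col c′ a′ → c ≡ c′

    -- The colours are used up from the largest one; f a is the colour forbidden at a.
    lists : (f : Fin N → ℕ) → ∀ t M → (∀ c a → M c a ≡ true → out M c a + suc ⟦ does (f a <? t) ⟧ ≤ t) → Lists f M t
    lists f zero M h = record { col = λ _ _ → 0 ; col< = λ c a m → no-M c a m ; allowed = λ c a m → no-M c a m ; properA = λ c _ a m → no-M c a m ; properB = λ c _ a _ m → no-M c a m }
      where
      no-M : ∀ c a {X : Set} → M c a ≡ true → X
      no-M c a m = ⊥-elim (n≮0 (≤-trans (m≤n+m _ (out M c a)) (h c a m)))
    lists f (suc t) M h = record
      { col = col
      ; col< = λ c a m → case isTrue (𝒦.K c a) of λ { (inj₁ e) → ≤-reflexive (cong suc (colK c a e)) ; (inj₂ e) → ≤-trans (≤-reflexive (cong suc (colR c a e))) (s≤s (<⇒≤ (R.col< c a (inM′ c a m e)))) }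
      ; allowed = λ c a m → case isTrue (𝒦.K c a) of λ { (inj₁ e) z → does-not (f a ≟ℕ t) (not-true (proj₂ (∧-true {M c a} (𝒦.sub c a e)))) (trans (sym z) (colK c a e)) ; (inj₂ e) z → R.allowed c a (inM′ c a m e) (trans (sym (colR c a e)) z) }
      ; properA = pA
      ; properB = pB }
      where
      _≟ℕ_ = Data.Nat.Properties._≟_
      does-not : ∀ {X : Set} (d : Dec X) → does d ≡ false → ¬ X
      does-not (no x) _ = x
      -- Only edges whose end in A does not forbid the colour `t` compete for it.
      L : EdgeSet
      L c a = M c a ∧ not (does (f a ≟ℕ t))
      𝒦₀ : Kernel L
      𝒦₀ = kernel L
      module 𝒦 = Kernel 𝒦₀
      M′ : EdgeSet
      M′ c a = M c a ∧ not (𝒦.K c a)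
      inM′ : ∀ c a → M c a ≡ true → 𝒦.K c a ≡ false → M′ c a ≡ true
      inM′ c a m e = ∧-intro m (cong not e)
      M′⊆M : ∀ c a → M′ c a ≡ true → M c a ≡ true
      M′⊆M c a m = proj₁ (∧-true {M c a} m)
      notK : ∀ c a → M′ c a ≡ true → 𝒦.K c a ≡ false
      notK c a m = not-true (proj₂ (∧-true {M c a} m))
      le-out : ∀ c a c′ → ⟦ lt c′ c ∧ M′ c′ a ⟧ + ⟦ lt c c′ ∧ M′ c′ (q c′ (q c a)) ⟧ ≤ ⟦ lt c′ c ∧ M c′ a ⟧ + ⟦ lt c c′ ∧ M c′ (q c′ (q c a)) ⟧
      le-out c a c′ = +-mono-≤
        (⟦⟧-mono {lt c′ c ∧ M′ c′ a} {lt c′ c ∧ M c′ a} (λ e → ∧-intro (proj₁ (∧-true {lt c′ c} e)) (M′⊆M c′ a (proj₂ (∧-true {lt c′ c} e)))))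
        (⟦⟧-mono {lt c c′ ∧ M′ c′ (q c′ (q c a))} {lt c c′ ∧ M c′ (q c′ (q c a))} (λ e → ∧-intro (proj₁ (∧-true {lt c c′} e)) (M′⊆M c′ _ (proj₂ (∧-true {lt c c′} e)))))
      drop : ∀ c a → L c a ≡ true → 𝒦.K c a ≡ false → out M′ c a < out M c a
      drop c a l nk with 𝒦.absorbing c a l nk
      ... | inj₁ (c′ , lt₁ , kk) = ∑-mono-< (le-out c a) c′ (+-mono-<-≤ (subst₂ (λ x y → ⟦ x ⟧ < ⟦ y ⟧) (sym off) (sym on) (s≤s z≤n))
              (⟦⟧-mono {lt c c′ ∧ M′ c′ (q c′ (q c a))} {lt c c′ ∧ M c′ (q c′ (q c a))} (λ e → ∧-intro (proj₁ (∧-true {lt c c′} e)) (M′⊆M c′ _ (proj₂ (∧-true {lt c c′} e))))))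
        where
        off : lt c′ c ∧ M′ c′ a ≡ false
        off = ¬true (λ e → tf kk (notK c′ a (proj₂ (∧-true {lt c′ c} e))))
        on : lt c′ c ∧ M c′ a ≡ true
        on = ∧-intro (does-complete (_ <? _) lt₁) (proj₁ (∧-true {M c′ a} (𝒦.sub c′ a kk)))
      ... | inj₂ (c′ , lt₁ , kk) = ∑-mono-< (le-out c a) c′ (+-mono-≤-< (⟦⟧-mono {lt c′ c ∧ M′ c′ a} {lt c′ c ∧ M c′ a} (λ e → ∧-intro (proj₁ (∧-true {lt c′ c} e)) (M′⊆M c′ a (proj₂ (∧-true {lt c′ c} e)))))
              (subst₂ (λ x y → ⟦ x ⟧ < ⟦ y ⟧) (sym off) (sym on) (s≤s z≤n)))
        where
        x = q c′ (q c a)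
        off : lt c c′ ∧ M′ c′ x ≡ false
        off = ¬true (λ e → tf kk (notK c′ x (proj₂ (∧-true {lt c c′} e))))
        on : lt c c′ ∧ M c′ x ≡ true
        on = ∧-intro (does-complete (_ <? _) lt₁) (proj₁ (∧-true {M c′ x} (𝒦.sub c′ x kk)))
      h′ : ∀ c a → M′ c a ≡ true → out M′ c a + suc ⟦ does (f a <? t) ⟧ ≤ t
      h′ c a m = ≤-pred (≤-trans bound (h c a (M′⊆M c a m)))
        where
        -- The right side falls by one in either case. If `t` is forbidden at `a`, no forbidden
        -- colour is left below `t`; otherwise the edge has an outneighbour in the kernel, and this
        -- one is removed.
        bound : suc (out M′ c a + suc ⟦ does (f a <? t) ⟧) ≤ out M c a + suc ⟦ does (f a <? suc t) ⟧
        bound with f a ≟ℕ t in eq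
        ... | yes e = ≤-trans (≤-reflexive (trans (cong (λ z → suc (out M′ c a + suc ⟦ z ⟧)) (does-false (f a <? t) (λ z → <-irrefl e z))) (sym (+-suc (out M′ c a) 1))))
                (+-mono-≤ (∑-mono (le-out c a)) (≤-reflexive (cong (λ z → suc ⟦ z ⟧) (sym (does-complete (f a <? suc t) (s≤s (≤-reflexive e)))))))
        ... | no ne′ = +-mono-<-≤ (drop c a (∧-intro (M′⊆M c a m) (cong (λ d → not (does d)) eq)) (notK c a m))
                (s≤s (⟦⟧-mono (λ e → does-complete (f a <? suc t) (≤-trans (does-sound (f a <? t) e) (n≤1+n t)))))
      R₀ : Lists f M′ t
      R₀ = lists f t M′ h′
      module R = Lists R₀
      col : Fin D → Fin N → ℕ
      col c a = if 𝒦.K c a then t else R.col c a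
      colK : ∀ c a → 𝒦.K c a ≡ true → col c a ≡ t
      colK c a e rewrite e = refl
      colR : ∀ c a → 𝒦.K c a ≡ false → col c a ≡ R.col c a
      colR c a e rewrite e = refl
      clash : ∀ c a c′ a′ {X : Set} → 𝒦.K c a ≡ true → M c′ a′ ≡ true → 𝒦.K c′ a′ ≡ false → col c a ≡ col c′ a′ → X
      clash c a c′ a′ e m e′ z = ⊥-elim (<-irrefl (trans (sym (colR c′ a′ e′)) (trans (sym z) (colK c a e))) (R.col< c′ a′ (inM′ c′ a′ m e′)))
      pA : ∀ c c′ a → M c a ≡ true → M c′ a ≡ true → col c a ≡ col c′ a → c ≡ c′
      pA c c′ a m m′ z with isTrue (𝒦.K c a) | isTrue (𝒦.K c′ a)
      ... | inj₁ e | inj₁ e′ = 𝒦.indepA c c′ a e e′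
      ... | inj₁ e | inj₂ e′ = clash c a c′ a e m′ e′ z
      ... | inj₂ e | inj₁ e′ = clash c′ a c a e′ m e (sym z)
      ... | inj₂ e | inj₂ e′ = R.properA c c′ a (inM′ c a m e) (inM′ c′ a m′ e′) (trans (sym (colR c a e)) (trans z (colR c′ a e′)))
      pB : ∀ c c′ a a′ → M c a ≡ true → M c′ a′ ≡ true → q c a ≡ q c′ a′ → col c a ≡ col c′ a′ → c ≡ c′
      pB c c′ a a′ m m′ b z with isTrue (𝒦.K c a) | isTrue (𝒦.K c′ a′)
      ... | inj₁ e | inj₁ e′ = 𝒦.indepB c c′ a a′ e e′ b
      ... | inj₁ e | inj₂ e′ = clash c a c′ a′ e m′ e′ z
      ... | inj₂ e | inj₁ e′ = clash c′ a′ c a e′ m e (sym z)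
      ... | inj₂ e | inj₂ e′ = R.properB c c′ a a′ (inM′ c a m e) (inM′ c′ a′ m′ e′) b (trans (sym (colR c a e)) (trans z (colR c′ a′ e′)))

  module Galvin {N} (G : SimpleGraph N) (side : Fin N → Bool) (D : ℕ)
                (bip : ∀ u v → SimpleGraph.E G u v ≡ true → side v ≡ not (side u))
                (deg≤ : ∀ v → SimpleGraph.deg G v ≤ D) (f : Fin N → ℕ) where
    open SimpleGraph G

    record Result : Set where
      no-eta-equality
      field
        col : Fin N → Fin N → ℕ
        col-sym : ∀ u v → E u v ≡ true → col u v ≡ col v u
        col< : ∀ u v → E u v ≡ true → col u v < suc D
        allowed : ∀ u v → E u v ≡ true → side u ≡ true → col u v ≢ f u
        proper : ∀ u v w → E u v ≡ true → E u w ≡ true → v ≢ w → col u v ≢ col u w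

    private
      module _ (C : Colouring {k = D} G no-lock) (all : ∀ u v → E u v ≡ true → ∃ λ i → Colouring.p C i u ≡ v) where
        open Colouring C
        open ListColouring p inv

        M : EdgeSet
        M c a = side a ∧ not (p c a == a)

        -- A colour different from `c` is either smaller or larger and contributes at most one
        -- outneighbour, so the outdegree is at most D - 1. A list of D + 1 colours with one of them
        -- forbidden is long enough.
        out-small : ∀ c a → out M c a + suc ⟦ does (f a <? suc D) ⟧ ≤ suc D
        out-small c a = ≤-trans (≤-reflexive (+-suc _ _)) (s≤s (≤-trans (+-monoʳ-≤ (out M c a) (⟦⟧≤1 _)) (≤-trans (≤-reflexive (cong (out M c a +_) (sym (∑-δ1 c))))
            (≤-trans (≤-reflexive (sym (∑-+ _ _))) (≤-trans (∑-mono pt) (≤-reflexive (∑-1 D)))))))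
          where
          and≤ : ∀ x y → ⟦ x ∧ y ⟧ ≤ ⟦ x ⟧
          and≤ true y = ⟦⟧≤1 y
          and≤ false y = z≤n
          pt : ∀ c′ → ⟦ lt c′ c ∧ M c′ a ⟧ + ⟦ lt c c′ ∧ M c′ (p c′ (p c a)) ⟧ + ⟦ c == c′ ⟧ ≤ 1
          pt c′ = ≤-trans (+-monoˡ-≤ ⟦ c == c′ ⟧ (+-mono-≤ (and≤ (lt c′ c) (M c′ a)) (and≤ (lt c c′) (M c′ (p c′ (p c a)))))) tri
            where
            tri : ⟦ lt c′ c ⟧ + ⟦ lt c c′ ⟧ + ⟦ c == c′ ⟧ ≤ 1
            tri with <-cmp (toℕ c) (toℕ c′)
            ... | tri< l ne′ ng rewrite does-false (toℕ c′ <? toℕ c) ng | does-complete (toℕ c <? toℕ c′) l | ==-≢ {x = c} {c′} (λ e → ne′ (cong toℕ e)) = ≤-refl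
            ... | tri≈ nl e ng rewrite does-false (toℕ c′ <? toℕ c) ng | does-false (toℕ c <? toℕ c′) nl = ⟦⟧≤1 _
            ... | tri> nl ne′ g rewrite does-complete (toℕ c′ <? toℕ c) g | does-false (toℕ c <? toℕ c′) nl | ==-≢ {x = c} {c′} (λ e → ne′ (cong toℕ e)) = ≤-refl

        Ls : Lists f M (suc D)
        Ls = lists f (suc D) M (λ c a _ → out-small c a)
        module Ls = Lists Ls

        end : Fin N → Fin N → Fin N
        end u v = if side u then u else v

        pick : ∀ u v → Dec (∃ λ i → p i u ≡ v) → ℕ
        pick u v (yes (i , _)) = Ls.col i (end u v)
        pick u v (no _) = 0

        colour : Fin N → Fin N → ℕ
        colour u v = pick u v (hit? u v)

        colour-eq : ∀ u v → E u v ≡ true → ∃ λ i → p i u ≡ v × colour u v ≡ Ls.col i (end u v)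
        colour-eq u v e with hit? u v
        ... | yes (i , h) = i , h , refl
        ... | no h = ⊥-elim (h (all u v e))

        same-index : ∀ {u v i j} → E u v ≡ true → p i u ≡ v → p j u ≡ v → i ≡ j
        same-index {u} e h h′ = disj _ _ u (λ z → ≢-of e (trans (sym z) h)) (trans h (sym h′))

        end-true : ∀ {u v} → side u ≡ true → end u v ≡ u
        end-true h rewrite h = refl
        end-false : ∀ {u v} → side u ≡ false → end u v ≡ v
        end-false h rewrite h = refl

        M-true : ∀ {u v i} → E u v ≡ true → p i u ≡ v → side u ≡ true → M i u ≡ true
        M-true {u} {v} {i} e h s = ∧-intro s (cong not (==-≢ {x = p i u} (λ z → ≢-of e (trans (sym z) h))))

        M-end : ∀ {u v i} → E u v ≡ true → p i u ≡ v → M i (end u v) ≡ true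
        M-end {u} {v} {i} e h = go (side u) refl
          where
          go : ∀ b → side u ≡ b → M i (end u v) ≡ true
          go true s = subst (λ z → M i z ≡ true) (sym (end-true s)) (M-true e h s)
          go false s = subst (λ z → M i z ≡ true) (sym (end-false s)) (M-true (trans (E-sym v u) e) (trans (cong (p i) (sym h)) (inv i u)) (trans (bip u v e) (cong not s)))

        end-sym : ∀ u v → E u v ≡ true → end u v ≡ end v u
        end-sym u v e = go (side u) refl
          where
          go : ∀ b → side u ≡ b → end u v ≡ end v u
          go true s = trans (end-true s) (sym (end-false (trans (bip u v e) (cong not s))))
          go false s = trans (end-false s) (sym (end-true (trans (bip u v e) (cong not s))))

        result : Result
        result .Result.col = colour
        result .Result.col-sym u v e with colour-eq u v e | colour-eq v u (trans (E-sym v u) e)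
        ... | i , h , c | j , h′ , c′ = trans c (trans (cong₂ Ls.col (same-index e h (trans (cong (p j) (sym h′)) (inv j v))) (end-sym u v e)) (sym c′))
        result .Result.col< u v e with colour-eq u v e
        ... | i , h , c = ≤-trans (s≤s (≤-reflexive c)) (Ls.col< i (end u v) (M-end e h))
        result .Result.allowed u v e s z with colour-eq u v e
        ... | i , h , c = Ls.allowed i u (M-true e h s) (trans (cong (Ls.col i) (sym (end-true s))) (trans (sym c) z))
        result .Result.proper u v w e e′ v≢w z with colour-eq u v e | colour-eq u w e′
        ... | i , h , c | j , h′ , c′ = go (side u) refl
          where
          fin : i ≡ j → ⊥
          fin refl = v≢w (trans (sym h) h′)
          go : ∀ b → side u ≡ b → ⊥
          go true s = fin (Ls.properA i j u (M-true e h s) (M-true e′ h′ s) (trans (cong (Ls.col i) (sym (end-true s))) (trans (trans (sym c) (trans z c′)) (cong (Ls.col j) (end-true s)))))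
          go false s = fin (Ls.properB i j v w (subst (λ t → M i t ≡ true) (end-false s) (M-end e h)) (subst (λ t → M j t ≡ true) (end-false s) (M-end e′ h′))
                         (trans (trans (cong (p i) (sym h)) (inv i u)) (sym (trans (cong (p j) (sym h′)) (inv j u))))
                         (trans (cong (Ls.col i) (sym (end-false s))) (trans (trans (sym c) (trans z c′)) (cong (Ls.col j) (end-false s)))))

    abstract
      galvin : Result
      galvin = case Konig.konig G side D bip deg≤ of λ { (C , all) → result C all }

-- Large matchings

module Matchings where
  open Prelude
  open Sums
  open EdgeColouring
  open Vizing
  open Bipartite

  module _ {N} (G : SimpleGraph N) where
    open SimpleGraph G

    record Matching : Set where
      no-eta-equality
      field
        ψ : Fin N → Fin N
        ψ-inv : ∀ v → ψ (ψ v) ≡ v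
        ψ-edge : ∀ v → ψ v ≢ v → E v (ψ v) ≡ true

      cover : ℕ
      cover = ∑ (λ v → ne v (ψ v))

    class : ∀ {k} → Colouring {k = k} G no-lock → Fin k → Matching
    class C i = record { ψ = C.p i ; ψ-inv = C.inv i ; ψ-edge = C.edge i }
      where module C = Colouring C

    -- A largest class of an almost complete colouring with few colours.
    dense-matching : ∀ k s K → (∀ v → deg v + s ≤ k) → 2 * k < K * s → ∀ x → k * x + N * K < ∑ deg → Σ Matching λ M → x < Matching.cover M
    dense-matching k s K slack num x big = go (vizing G (no-lock {N} {k}) 0 s K (λ _ → ≤-reflexive (∑-0 {N} (λ _ → refl)))
        (λ v → ≤-trans (≤-reflexive (cong (λ t → t + s) (trans (cong (deg v +_) (∑-0 {k} (λ _ → refl))) (+-identityʳ _)))) (slack v)) num)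
      where
      go : (Σ (Colouring {k = k} G no-lock) λ C → ∀ v → ∑ (λ u → ⟦ Colouring.unc C v u ⟧) < K) → Σ Matching λ M → x < Matching.cover M
      go (C , h) = case ∑<→∃ (λ _ → x) (C.col ne) (+-cancelʳ-< (N * K) _ _ (≤-trans (≤-reflexive (cong (λ t → suc (t + N * K)) (∑-const k x)))
          (≤-trans big (≤-trans (≤-reflexive (trans (∑-cong C.deg-ne) (∑-+ _ _))) (+-mono-≤ (≤-reflexive (C.∑row≡∑col ne)) (∑-≤ (λ v → <⇒≤ (h v)))))))) of λ
          { (i , q) → class C i , q }
        where module C = Colouring C

    Maximal : Matching → Set
    Maximal M = ∀ u v → E u v ≡ true → Matching.ψ M u ≡ u → Matching.ψ M v ≡ v → ⊥

    private
      -- A matching as an edge colouring with a single colour, so that `add` can enlarge it.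
      One : Set
      One = Colouring {k = 1} G no-lock

      module _ (C : One) where
        open Colouring C

        Free : Fin N → Fin N → Set
        Free u v = E u v ≡ true × p zero u ≡ u × p zero v ≡ v

        free? : ∀ u v → Dec (Free u v)
        free? u v with E u v ≟ᵇ true | p zero u ≟ u | p zero v ≟ v
        ... | yes a | yes b | yes c = yes (a , b , c)
        ... | no a | _ | _ = no (λ h → a (proj₁ h))
        ... | yes _ | no b | _ = no (λ h → b (proj₁ (proj₂ h)))
        ... | yes _ | yes _ | no c = no (λ h → c (proj₂ (proj₂ h)))

        bigger : ∀ u v → Free u v → Σ One λ C′ → ∑ (row ne) < ∑ (Colouring.row C′ ne)
        bigger u v (e , fu , fv) = Added.new A , ∑-mono-< (λ x → ≤-trans (m≤m+n _ _) (≤-reflexive (sym (Added.row-eq A ne ne-diag x)))) u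
            (≤-trans (≤-trans (≤-reflexive (+-comm 1 _)) (+-monoʳ-≤ (row ne u) (≤-trans (≤-reflexive (sym one)) (m≤m+n _ _)))) (≤-reflexive (sym (Added.row-eq A ne ne-diag u))))
          where
          one : ⟦ u == u ⟧ * ne u v ≡ 1
          one rewrite ==-refl u | ne-≢ (≢-of e) = refl
          un : unc u v ≡ true
          un = unc-intro e λ { zero h → ≢-of e (trans (sym fu) h) }
          A : Added C zero u v
          A = add C zero u v un fu fv refl refl

      loop : ∀ f (C : One) → ∑ deg ≤ ∑ (Colouring.row C ne) + f → Σ Matching Maximal
      again : ∀ f (C : One) → ∑ deg ≤ ∑ (Colouring.row C ne) + f → (Σ One λ C′ → ∑ (Colouring.row C ne) < ∑ (Colouring.row C′ ne)) → Σ Matching Maximal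
      loop f C le = case any? (λ u → any? (λ v → free? C u v)) of λ
        { (no h) → class C zero , λ u v e a b → h (u , v , e , a , b)
        ; (yes (u , v , fr)) → again f C le (bigger C u v fr) }
      again zero C le (C′ , lt) = ⊥-elim (<⇒≱ lt (≤-trans (∑-mono (λ v → m+n≤o⇒m≤o _ (≤-reflexive (sym (Colouring.deg-ne C′ v))))) (≤-trans le (≤-reflexive (+-identityʳ _)))))
      again (suc f) C le (C′ , lt) = loop f C′ (≤-trans le (≤-trans (≤-reflexive (+-suc _ f)) (+-monoˡ-≤ f lt)))

    abstract
      maximal : Σ Matching Maximal
      maximal = loop (∑ deg) (record { p = λ _ v → v ; inv = λ _ _ → refl ; edge = λ _ _ h → ⊥-elim (h refl) ; disj = λ _ _ _ h → ⊥-elim (h refl) ; locked = λ _ _ () }) (m≤n+m _ _)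

    -- The uncovered vertices are independent, and all degrees on ρ are equal.
    maximal-cover : ∀ (ρ : Fin N → Bool) d → (∀ v → deg v ≡ ⟦ ρ v ⟧ * suc d) → (M : Matching) → Maximal M →
      ∑ (λ v → ⟦ ρ v ⟧) ≤ Matching.cover M + Matching.cover M
    maximal-cover ρ d dg M mx = ≤-trans (≤-trans (∑-mono pt₁) (≤-reflexive (∑-+ _ _))) (+-monoˡ-≤ cover few)
      where
      open Matching M
      fx : Fin N → Bool
      fx v = v == ψ v
      nf = λ v → not (fx v)
      pt₁ : ∀ v → ⟦ ρ v ⟧ ≤ ⟦ fx v ∧ ρ v ⟧ + ne v (ψ v)
      pt₁ v with v == ψ v
      ... | true = m≤m+n _ _
      ... | false = ⟦⟧≤1 _
      fixed : ∀ v → fx v ≡ true → ψ v ≡ v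
      fixed v h = sym (==-sound h)
      pt₂ : ∀ u v → ⟦ fx u ⟧ * ⟦ E u v ⟧ ≤ ⟦ nf v ⟧ * ⟦ E u v ⟧
      pt₂ u v with E u v in e
      ... | false = ≤-trans (≤-reflexive (*-zeroʳ ⟦ fx u ⟧)) z≤n
      ... | true with fx u in eu | fx v in ev
      ...   | false | _ = z≤n
      ...   | true | false = ≤-refl
      ...   | true | true = ⊥-elim (mx u v e (fixed u eu) (fixed v ev))
      few : ∑ (λ v → ⟦ fx v ∧ ρ v ⟧) ≤ cover
      few = *-cancelʳ-≤ _ _ (suc d) (begin
        ∑ (λ v → ⟦ fx v ∧ ρ v ⟧) * suc d ≡⟨ sym (∑-*ʳ (suc d) (λ v → ⟦ fx v ∧ ρ v ⟧)) ⟩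
        ∑ (λ v → ⟦ fx v ∧ ρ v ⟧ * suc d) ≡⟨ ∑-cong (λ v → trans (cong (_* suc d) (⟦⟧-∧ (fx v) (ρ v))) (trans (*-assoc ⟦ fx v ⟧ _ _) (cong (⟦ fx v ⟧ *_) (sym (dg v))))) ⟩
        ∑ (λ u → ⟦ fx u ⟧ * deg u) ≡⟨ ∑-cong (λ u → sym (∑-*ˡ ⟦ fx u ⟧ (λ v → ⟦ E u v ⟧))) ⟩
        ∑ (λ u → ∑ (λ v → ⟦ fx u ⟧ * ⟦ E u v ⟧)) ≤⟨ ∑-mono (λ u → ∑-mono (pt₂ u)) ⟩
        ∑ (λ u → ∑ (λ v → ⟦ nf v ⟧ * ⟦ E u v ⟧)) ≡⟨ ∑-swap _ ⟩
        ∑ (λ v → ∑ (λ u → ⟦ nf v ⟧ * ⟦ E u v ⟧)) ≡⟨ ∑-cong (λ v → trans (∑-*ˡ ⟦ nf v ⟧ (λ u → ⟦ E u v ⟧)) (cong (⟦ nf v ⟧ *_) (∑-cong (λ u → cong ⟦_⟧ (E-sym u v))))) ⟩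
        ∑ (λ v → ⟦ nf v ⟧ * deg v) ≤⟨ ∑-mono (λ v → *-monoʳ-≤ ⟦ nf v ⟧ (≤-trans (≤-reflexive (dg v)) (≤-trans (*-monoˡ-≤ (suc d) (⟦⟧≤1 (ρ v))) (≤-reflexive (+-identityʳ _))))) ⟩
        ∑ (λ v → ⟦ nf v ⟧ * suc d) ≡⟨ ∑-*ʳ (suc d) (λ v → ⟦ nf v ⟧) ⟩
        cover * suc d ∎)
        where open ≤-Reasoning

-- The fourth-moment potential

module Potential where
  open Prelude
  open import Data.Integer using (ℤ; +_; ∣_∣)
  import Data.Integer as ℤ
  import Data.Integer.Properties as ℤₚ
  import Data.Integer.Tactic.RingSolver as ℤ-Solver

  private
    sq : ℤ → ℕ
    sq X = ∣ X ∣ * ∣ X ∣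

    sq-eq : ∀ X → + sq X ≡ X ℤ.* X
    sq-eq (+ n) = ℤₚ.pos-* n n
    sq-eq ℤ.-[1+ n ] = refl

    diff : ℕ → ℕ → ℤ
    diff a b = + a ℤ.- + b

  abstract
    -- The square of the signed difference, computed in the integers but kept as a natural number:
    -- only even powers of a discrepancy occur in the sums.
    dist² : ℕ → ℕ → ℕ
    dist² a b = sq (diff a b)

    private
      d-eq : ∀ a b → + dist² a b ≡ diff a b ℤ.* diff a b
      d-eq a b = sq-eq (diff a b)

      -- Parallelogram identity for X = a - b and Y = x - y: exchanging x with y turns X + Y into X
      -- - Y.
      E₁ : ∀ a b x y → (a ℤ.+ x ℤ.- (b ℤ.+ y)) ℤ.* (a ℤ.+ x ℤ.- (b ℤ.+ y)) ℤ.+ (a ℤ.+ y ℤ.- (b ℤ.+ x)) ℤ.* (a ℤ.+ y ℤ.- (b ℤ.+ x))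
         ≡ (a ℤ.- b) ℤ.* (a ℤ.- b) ℤ.+ (a ℤ.- b) ℤ.* (a ℤ.- b) ℤ.+ ((x ℤ.- y) ℤ.* (x ℤ.- y) ℤ.+ (x ℤ.- y) ℤ.* (x ℤ.- y))
      E₁ = ℤ-Solver.solve-∀

      -- In terms of squares, (X + Y)⁴ + (X - Y)⁴ = 2 X⁴ + 12 X² Y² + 2 Y⁴.
      E₂ : ∀ a b x y → let S = (a ℤ.+ x ℤ.- (b ℤ.+ y)) ℤ.* (a ℤ.+ x ℤ.- (b ℤ.+ y)) ; U = (a ℤ.+ y ℤ.- (b ℤ.+ x)) ℤ.* (a ℤ.+ y ℤ.- (b ℤ.+ x))
                           Q = (a ℤ.- b) ℤ.* (a ℤ.- b) ; q = (x ℤ.- y) ℤ.* (x ℤ.- y) in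
         S ℤ.* S ℤ.+ U ℤ.* U ≡ Q ℤ.* Q ℤ.+ Q ℤ.* Q ℤ.+ + 12 ℤ.* (Q ℤ.* q) ℤ.+ (q ℤ.* q ℤ.+ q ℤ.* q)
      E₂ = ℤ-Solver.solve-∀

      plus : ∀ a x → + (a + x) ≡ + a ℤ.+ + x
      plus = ℤₚ.pos-+

      d-plus : ∀ a b x y → + dist² (a + x) (b + y) ≡ (+ a ℤ.+ + x ℤ.- (+ b ℤ.+ + y)) ℤ.* (+ a ℤ.+ + x ℤ.- (+ b ℤ.+ + y))
      d-plus a b x y = trans (d-eq (a + x) (b + y)) (cong (λ z → z ℤ.* z) (cong₂ ℤ._-_ (plus a x) (plus b y)))

    private
      p₁ : ∀ S U → + (S + U) ≡ + S ℤ.+ + U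
      p₁ = plus

      p₂ : ∀ Q q → + (Q + Q + (q + q)) ≡ + Q ℤ.+ + Q ℤ.+ (+ q ℤ.+ + q)
      p₂ Q q = trans (plus (Q + Q) (q + q)) (cong₂ ℤ._+_ (plus Q Q) (plus q q))

      p₃ : ∀ S U → + (S * S + U * U) ≡ + S ℤ.* + S ℤ.+ + U ℤ.* + U
      p₃ S U = trans (plus (S * S) (U * U)) (cong₂ ℤ._+_ (ℤₚ.pos-* S S) (ℤₚ.pos-* U U))

      p₄ : ∀ Q q → + (Q * Q + Q * Q + 12 * (Q * q) + (q * q + q * q)) ≡ + Q ℤ.* + Q ℤ.+ + Q ℤ.* + Q ℤ.+ + 12 ℤ.* (+ Q ℤ.* + q) ℤ.+ (+ q ℤ.* + q ℤ.+ + q ℤ.* + q)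
      p₄ Q q = trans (plus (Q * Q + Q * Q + 12 * (Q * q)) (q * q + q * q)) (cong₂ ℤ._+_ (trans (plus (Q * Q + Q * Q) (12 * (Q * q))) (cong₂ ℤ._+_ (p₃ Q Q)
        (trans (ℤₚ.pos-* 12 (Q * q)) (cong (+ 12 ℤ.*_) (ℤₚ.pos-* Q q))))) (p₃ q q))

      inj₁′ : ∀ S U Q q {s u Q′ q′} → + S ≡ s → + U ≡ u → + Q ≡ Q′ → + q ≡ q′ → s ℤ.+ u ≡ Q′ ℤ.+ Q′ ℤ.+ (q′ ℤ.+ q′) → S + U ≡ Q + Q + (q + q)
      inj₁′ S U Q q refl refl refl refl h = ℤₚ.+-injective (trans (p₁ S U) (trans h (sym (p₂ Q q))))

      inj₂′ : ∀ S U Q q {s u Q′ q′} → + S ≡ s → + U ≡ u → + Q ≡ Q′ → + q ≡ q′ →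
        s ℤ.* s ℤ.+ u ℤ.* u ≡ Q′ ℤ.* Q′ ℤ.+ Q′ ℤ.* Q′ ℤ.+ + 12 ℤ.* (Q′ ℤ.* q′) ℤ.+ (q′ ℤ.* q′ ℤ.+ q′ ℤ.* q′) → S * S + U * U ≡ Q * Q + Q * Q + 12 * (Q * q) + (q * q + q * q)
      inj₂′ S U Q q refl refl refl refl h = ℤₚ.+-injective (trans (p₃ S U) (trans h (sym (p₄ Q q))))

    dist²-sum : ∀ a b x y → dist² (a + x) (b + y) + dist² (a + y) (b + x) ≡ dist² a b + dist² a b + (dist² x y + dist² x y)
    dist²-sum a b x y = inj₁′ (dist² (a + x) (b + y)) (dist² (a + y) (b + x)) (dist² a b) (dist² x y)
      (d-plus a b x y) (d-plus a b y x) (d-eq a b) (d-eq x y) (E₁ (+ a) (+ b) (+ x) (+ y))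

    dist⁴-sum : ∀ a b x y → dist² (a + x) (b + y) * dist² (a + x) (b + y) + dist² (a + y) (b + x) * dist² (a + y) (b + x)
      ≡ dist² a b * dist² a b + dist² a b * dist² a b + 12 * (dist² a b * dist² x y) + (dist² x y * dist² x y + dist² x y * dist² x y)
    dist⁴-sum a b x y = inj₂′ (dist² (a + x) (b + y)) (dist² (a + y) (b + x)) (dist² a b) (dist² x y)
      (d-plus a b x y) (d-plus a b y x) (d-eq a b) (d-eq x y) (E₂ (+ a) (+ b) (+ x) (+ y))

    dist²-0 : dist² 0 0 ≡ 0
    dist²-0 = refl

    dist²-small : ∀ {x y} → x ≤ 2 → y ≤ 2 → dist² x y ≤ 4
    dist²-small {0} {0} _ _ = z≤n
    dist²-small {0} {1} _ _ = s≤s z≤n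
    dist²-small {0} {2} _ _ = s≤s (s≤s (s≤s (s≤s z≤n)))
    dist²-small {1} {0} _ _ = s≤s z≤n
    dist²-small {1} {1} _ _ = z≤n
    dist²-small {1} {2} _ _ = s≤s z≤n
    dist²-small {2} {0} _ _ = s≤s (s≤s (s≤s (s≤s z≤n)))
    dist²-small {2} {1} _ _ = s≤s z≤n
    dist²-small {2} {2} _ _ = z≤n
    dist²-small {suc (suc (suc _))} (s≤s (s≤s ())) _
    dist²-small {0} {suc (suc (suc _))} _ (s≤s (s≤s ()))
    dist²-small {1} {suc (suc (suc _))} _ (s≤s (s≤s ()))
    dist²-small {2} {suc (suc (suc _))} _ (s≤s (s≤s ()))

    dist²-sym : ∀ a b → dist² a b ≡ dist² b a
    dist²-sym a b = ℤₚ.+-injective (trans (d-eq a b) (trans (sw (+ a) (+ b)) (sym (d-eq b a))))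
      where
      sw : ∀ a b → (a ℤ.- b) ℤ.* (a ℤ.- b) ≡ (b ℤ.- a) ℤ.* (b ℤ.- a)
      sw = ℤ-Solver.solve-∀

    dist²-add : ∀ b c → dist² (b + c) b ≡ c * c
    dist²-add b c = ℤₚ.+-injective (trans (d-eq (b + c) b) (trans (cong (λ z → (z ℤ.- + b) ℤ.* (z ℤ.- + b)) (plus b c)) (trans (sw (+ b) (+ c)) (sym (ℤₚ.pos-* c c)))))
      where
      sw : ∀ b c → (b ℤ.+ c ℤ.- b) ℤ.* (b ℤ.+ c ℤ.- b) ≡ c ℤ.* c
      sw = ℤ-Solver.solve-∀

  close : ∀ e a b → dist² a b < suc e * suc e → a ≤ b + e
  close e a b h with a ≤? b + e
  ... | yes p = p
  ... | no np with m≤n⇒∃[o]m+o≡n (≰⇒> np)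
  ...   | t , refl = ⊥-elim (<⇒≱ h (≤-trans (*-mono-≤ le le) (≤-reflexive (sym (trans (cong (λ z → dist² z b) (ar b e t)) (dist²-add b (suc e + t)))))))
    where
    le : suc e ≤ suc e + t
    le = m≤m+n _ t
    ar : ∀ b e t → suc (b + e) + t ≡ b + (suc e + t)
    ar = solve-∀

  -- Fourth moments: with R elements still to come, X⁴ + 24 R X² is on average increased by at most 16 + 96 R by a
  -- random sign of a step of size at most 2.
  pot : ℕ → ℕ → ℕ → ℕ
  pot R a b = dist² a b * dist² a b + 24 * R * dist² a b

  -- Since q = (x - y)² is at most 4, the mixed term 12 Q q is at most twice 24 Q, which is the
  -- difference between the coefficients for R + 1 and R; this explains the 24. The terms q² ≤ 16
  -- and 24 R q ≤ 96 R are the error.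
  pot-step : ∀ R a b x y → x ≤ 2 → y ≤ 2 →
    pot R (a + x) (b + y) + pot R (a + y) (b + x) ≤ (pot (suc R) a b + (16 + 96 * R)) + (pot (suc R) a b + (16 + 96 * R))
  pot-step R a b x y hx hy = begin
    (S * S + 24 * R * S) + (U * U + 24 * R * U) ≡⟨ a₁ S U R ⟩
    (S * S + U * U) + 24 * R * (S + U) ≡⟨ cong₂ (λ u w → u + 24 * R * w) (dist⁴-sum a b x y) (dist²-sum a b x y) ⟩
    (Q * Q + Q * Q + 12 * (Q * q) + (q * q + q * q)) + 24 * R * (Q + Q + (q + q))
      ≤⟨ +-mono-≤ (+-mono-≤ (+-monoʳ-≤ (Q * Q + Q * Q) (*-monoʳ-≤ 12 (*-monoʳ-≤ Q q4))) (+-mono-≤ (*-mono-≤ q4 q4) (*-mono-≤ q4 q4)))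
          (*-monoʳ-≤ (24 * R) (+-monoʳ-≤ (Q + Q) (+-mono-≤ q4 q4))) ⟩
    (Q * Q + Q * Q + 12 * (Q * 4) + (16 + 16)) + 24 * R * (Q + Q + (4 + 4)) ≡⟨ a₂ Q R ⟩
    (Q * Q + 24 * suc R * Q + (16 + 96 * R)) + (Q * Q + 24 * suc R * Q + (16 + 96 * R)) ∎
    where
    open ≤-Reasoning
    S = dist² (a + x) (b + y)
    U = dist² (a + y) (b + x)
    Q = dist² a b
    q = dist² x y
    q4 = dist²-small hx hy
    a₁ : ∀ S U R → (S * S + 24 * R * S) + (U * U + 24 * R * U) ≡ (S * S + U * U) + 24 * R * (S + U)
    a₁ = solve-∀
    a₂ : ∀ Q R → (Q * Q + Q * Q + 12 * (Q * 4) + (16 + 16)) + 24 * R * (Q + Q + (4 + 4)) ≡ (Q * Q + 24 * suc R * Q + (16 + 96 * R)) + (Q * Q + 24 * suc R * Q + (16 + 96 * R))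
    a₂ = solve-∀

-- Balanced partitions that respect a matching

module Partition where
  open Prelude
  open Sums
  open Kempe
  open EdgeColouring
  open Sides
  open Potential

  module _ {N} (A : Fin N → Fin N → Bool) where

    nbrs : (Fin N → Bool) → Fin N → ℕ
    nbrs P v = ∑ (λ u → ⟦ A v u ⟧ * ⟦ P u ⟧)

    -- Unplaced vertices are the fixed points of `φ`, and `R` bounds their number as well as the
    -- number of steps to come. Each step is charged N (16 + 96 N) in `potential`. Placed vertices
    -- of A and B are paired by `φ`; since it commutes with `ψ`, both halves receive equally many
    -- pairs of `ψ`.
    record Partial (ψ : Fin N → Fin N) (R : ℕ) : Set where
      no-eta-equality
      field
        φ : Fin N → Fin N
        φ-inv : ∀ v → φ (φ v) ≡ v
        φψ : ∀ v → φ (ψ v) ≡ ψ (φ v)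
        inA inB : Fin N → Bool
        rest : ∀ v → φ v ≡ v → inA v ≡ false × inB v ≡ false
        split : ∀ v → φ v ≢ v → inB v ≡ not (inA v)
        swap : ∀ v → φ v ≢ v → inA (φ v) ≡ not (inA v)
        inA-ψ : ∀ v → inA (ψ v) ≡ inA v
        inB-ψ : ∀ v → inB (ψ v) ≡ inB v
        few : ∑ (λ v → ⟦ φ v == v ⟧) ≤ R
        potential : ∑ (λ v → pot R (nbrs inA v) (nbrs inB v)) + R * (N * (16 + 96 * N)) ≤ N * (N * (16 + 96 * N))

    -- Put the ψ-classes of u and w on opposite sides, choosing the orientation of smaller potential.
    record UnitData (ψ : Fin N → Fin N) (R : ℕ) : Set where
      no-eta-equality
      field
        S : Partial ψ (suc R)
        R≤N : R ≤ N
        u w : Fin N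
        fu : Partial.φ S u ≡ u
        fw : Partial.φ S w ≡ w
        e₁ : ψ u ≡ u → ψ w ≡ w
        e₂ : ψ w ≡ w → ψ u ≡ u
        u≢w : u ≢ w
        u≢ψw : u ≢ ψ w

    module Unit (ψ : Fin N → Fin N) (ψ-inv : ∀ v → ψ (ψ v) ≡ v) {R} (setup : UnitData ψ R) where
      open UnitData setup
      open Partial S

      cl : Fin N → Fin N → Bool
      cl z v = (v == z) ∨ (v == ψ z)

      φ′ : Fin N → Fin N
      φ′ v = if v == u then w else if v == ψ u then ψ w else if v == w then u else if v == ψ w then ψ u else φ v

      private
        ≢ˢ : ∀ {a b : Fin N} → a ≢ b → b ≢ a
        ≢ˢ h e = h (sym e)

        ψu≢w : ψ u ≢ w
        ψu≢w e = u≢ψw (trans (sym (ψ-inv u)) (cong ψ e))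
        ψu≢ψw : ψ u ≢ ψ w
        ψu≢ψw e = u≢w (trans (sym (ψ-inv u)) (trans (cong ψ e) (ψ-inv w)))

        at-u : φ′ u ≡ w
        at-u rewrite ==-refl u = refl
        at-ψu : φ′ (ψ u) ≡ ψ w
        at-ψu with ψ u ≟ u
        ... | yes e = trans (cong φ′ e) (trans at-u (sym (e₁ e)))
        ... | no h rewrite ==-≢ h | ==-refl (ψ u) = refl
        at-w : φ′ w ≡ u
        at-w rewrite ==-≢ (≢ˢ u≢w) | ==-≢ (≢ˢ ψu≢w) | ==-refl w = refl
        at-ψw : φ′ (ψ w) ≡ ψ u
        at-ψw with ψ w ≟ w
        ... | yes e = trans (cong φ′ e) (trans at-w (sym (e₂ e)))
        ... | no h rewrite ==-≢ (≢ˢ u≢ψw) | ==-≢ (≢ˢ ψu≢ψw) | ==-≢ h | ==-refl (ψ w) = refl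

        data Where (v : Fin N) : Set where
          is-u : v ≡ u → Where v
          is-ψu : v ≡ ψ u → Where v
          is-w : v ≡ w → Where v
          is-ψw : v ≡ ψ w → Where v
          is-o : v ≢ u → v ≢ ψ u → v ≢ w → v ≢ ψ w → Where v

        where? : ∀ v → Where v
        where? v with v ≟ u | v ≟ ψ u | v ≟ w | v ≟ ψ w
        ... | yes e | _ | _ | _ = is-u e
        ... | no _ | yes e | _ | _ = is-ψu e
        ... | no _ | no _ | yes e | _ = is-w e
        ... | no _ | no _ | no _ | yes e = is-ψw e
        ... | no a | no b | no c | no d = is-o a b c d

        at-o : ∀ {v} → v ≢ u → v ≢ ψ u → v ≢ w → v ≢ ψ w → φ′ v ≡ φ v
        at-o a b c d rewrite ==-≢ a | ==-≢ b | ==-≢ c | ==-≢ d = refl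

        fψu : φ (ψ u) ≡ ψ u
        fψu = trans (φψ u) (cong ψ fu)
        fψw : φ (ψ w) ≡ ψ w
        fψw = trans (φψ w) (cong ψ fw)

        unmoved : ∀ {v z} → φ z ≡ z → v ≢ z → φ v ≢ z
        unmoved fz h e = h (trans (sym (φ-inv _)) (trans (cong φ e) fz))

        ψ-move : ∀ {v z} → v ≢ z → ψ v ≢ ψ z
        ψ-move h e = h (trans (sym (ψ-inv _)) (trans (cong ψ e) (ψ-inv _)))
        ψ-move′ : ∀ {v z} → v ≢ ψ z → ψ v ≢ z
        ψ-move′ h e = h (trans (sym (ψ-inv _)) (cong ψ e))

      inv′ : ∀ v → φ′ (φ′ v) ≡ v
      inv′ v with where? v
      ... | is-u refl = trans (cong φ′ at-u) at-w
      ... | is-ψu refl = trans (cong φ′ at-ψu) at-ψw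
      ... | is-w refl = trans (cong φ′ at-w) at-u
      ... | is-ψw refl = trans (cong φ′ at-ψw) at-ψu
      ... | is-o a b c d = trans (cong φ′ (at-o a b c d)) (trans (at-o (unmoved fu a) (unmoved fψu b) (unmoved fw c) (unmoved fψw d)) (φ-inv v))

      comm′ : ∀ v → φ′ (ψ v) ≡ ψ (φ′ v)
      comm′ v with where? v
      ... | is-u refl = trans at-ψu (cong ψ (sym at-u))
      ... | is-ψu refl = trans (cong φ′ (ψ-inv u)) (trans at-u (trans (sym (ψ-inv w)) (cong ψ (sym at-ψu))))
      ... | is-w refl = trans at-ψw (cong ψ (sym at-w))
      ... | is-ψw refl = trans (cong φ′ (ψ-inv w)) (trans at-w (trans (sym (ψ-inv u)) (cong ψ (sym at-ψw))))
      ... | is-o a b c d = trans (at-o (ψ-move′ b) (ψ-move a) (ψ-move′ d) (ψ-move c)) (trans (φψ v) (cong ψ (sym (at-o a b c d))))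

      cl-u : ∀ z → cl z z ≡ true
      cl-u z rewrite ==-refl z = refl

      cl-ψ : ∀ z v → cl z (ψ v) ≡ cl z v
      cl-ψ z v = Bool-≡ to from
        where
        or-r : ∀ a {b} → b ≡ true → a ∨ b ≡ true
        or-r true _ = refl
        or-r false h = h
        to : cl z (ψ v) ≡ true → cl z v ≡ true
        to h with ∨-true {ψ v == z} h
        ... | inj₁ e = or-r (v == z) (trans (cong (v ==_) (trans (cong ψ (sym (==-sound e))) (ψ-inv v))) (==-refl v))
        ... | inj₂ e = subst (λ t → cl z t ≡ true) (sym (trans (sym (ψ-inv v)) (trans (cong ψ (==-sound e)) (ψ-inv z)))) (cl-u z)
        from : cl z v ≡ true → cl z (ψ v) ≡ true
        from h with ∨-true {v == z} h
        ... | inj₁ e = or-r (ψ v == z) (trans (cong (λ t → ψ t == ψ z) (==-sound e)) (==-refl (ψ z)))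
        ... | inj₂ e = subst (λ t → cl z t ≡ true) (sym (trans (cong ψ (==-sound e)) (ψ-inv z))) (cl-u z)

      cl-o : ∀ {z v} → v ≢ z → v ≢ ψ z → cl z v ≡ false
      cl-o a b rewrite ==-≢ a | ==-≢ b = refl

      steps : Fin N → Fin N → ℕ
      steps z v = ∑ (λ x → ⟦ A v x ⟧ * ⟦ cl z x ⟧)

      steps≤2 : ∀ z v → steps z v ≤ 2
      steps≤2 z v = ≤-trans (∑-mono pt) (≤-reflexive (trans (∑-+ _ _) (cong₂ _+_ (∑-δ1′ z) (∑-δ1′ (ψ z)))))
        where
        pt : ∀ x → ⟦ A v x ⟧ * ⟦ cl z x ⟧ ≤ ⟦ x == z ⟧ + ⟦ x == ψ z ⟧
        pt x = ≤-trans (*-monoˡ-≤ ⟦ cl z x ⟧ (⟦⟧≤1 (A v x))) (≤-trans (≤-reflexive (+-identityʳ _)) (or (x == z) (x == ψ z)))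
          where
          or : ∀ a b → ⟦ a ∨ b ⟧ ≤ ⟦ a ⟧ + ⟦ b ⟧
          or true b = s≤s z≤n
          or false b = ≤-refl

      nbrs-∨ : ∀ P z → (∀ x → cl z x ≡ true → P x ≡ false) → ∀ v → nbrs (λ x → P x ∨ cl z x) v ≡ nbrs P v + steps z v
      nbrs-∨ P z dis v = trans (∑-cong (λ x → trans (cong (⟦ A v x ⟧ *_) (pt x)) (*-distribˡ-+ ⟦ A v x ⟧ ⟦ P x ⟧ ⟦ cl z x ⟧))) (∑-+ _ _)
        where
        pt : ∀ x → ⟦ P x ∨ cl z x ⟧ ≡ ⟦ P x ⟧ + ⟦ cl z x ⟧
        pt x with isTrue (cl z x)
        ... | inj₁ e rewrite e | dis x e = refl
        ... | inj₂ e rewrite e with P x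
        ...   | true = refl
        ...   | false = refl

      in-cl : ∀ {z x} → cl z x ≡ true → x ≡ z ⊎ x ≡ ψ z
      in-cl {z} {x} h with ∨-true {x == z} h
      ... | inj₁ e = inj₁ (==-sound e)
      ... | inj₂ e = inj₂ (==-sound e)

      free : ∀ z → φ z ≡ z → ∀ x → cl z x ≡ true → inA x ≡ false × inB x ≡ false
      free z fz x h with in-cl {z} {x} h
      ... | inj₁ refl = rest x fz
      ... | inj₂ refl = rest x (trans (φψ z) (cong ψ fz))

      cl-uw : ∀ {x} → cl u x ≡ true → cl w x ≡ false
      cl-uw {x} h with in-cl {u} {x} h
      ... | inj₁ refl = cl-o u≢w u≢ψw
      ... | inj₂ refl = cl-o ψu≢w ψu≢ψw

      Σpot : (Fin N → Bool) → (Fin N → Bool) → ℕ → ℕ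
      Σpot a b R = ∑ (λ v → pot R (nbrs a v) (nbrs b v))

      module Oriented (x y : Fin N) (xy : (x ≡ u × y ≡ w) ⊎ (x ≡ w × y ≡ u))
        (ok : Σpot (λ v → inA v ∨ cl x v) (λ v → inB v ∨ cl y v) R ≤ Σpot inA inB (suc R) + N * (16 + 96 * R)) where

        disj-xy : ∀ {v} → cl x v ≡ true → cl y v ≡ false
        disj-xy {v} h = go xy h
          where
          go : (x ≡ u × y ≡ w) ⊎ (x ≡ w × y ≡ u) → cl x v ≡ true → cl y v ≡ false
          go (inj₁ (refl , refl)) h = cl-uw {v} h
          go (inj₂ (refl , refl)) h = ¬true (λ e → tf h (cl-uw {v} e))

        fx : φ x ≡ x
        fx = go xy
          where
          go : (x ≡ u × y ≡ w) ⊎ (x ≡ w × y ≡ u) → φ x ≡ x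
          go (inj₁ (refl , _)) = fu
          go (inj₂ (refl , _)) = fw

        fy : φ y ≡ y
        fy = go xy
          where
          go : (x ≡ u × y ≡ w) ⊎ (x ≡ w × y ≡ u) → φ y ≡ y
          go (inj₁ (_ , refl)) = fw
          go (inj₂ (_ , refl)) = fu

        A′ B′ : Fin N → Bool
        A′ v = inA v ∨ cl x v
        B′ v = inB v ∨ cl y v

        data Spot (v : Fin N) : Set where
          in-x : cl x v ≡ true → cl y (φ′ v) ≡ true → φ′ v ≢ v → Spot v
          in-y : cl y v ≡ true → cl x (φ′ v) ≡ true → φ′ v ≢ v → Spot v
          outside : cl x v ≡ false → cl y v ≡ false → φ′ v ≡ φ v → cl x (φ v) ≡ false → Spot v

        cl-ψz : ∀ z → cl z (ψ z) ≡ true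
        cl-ψz z = trans (cl-ψ z z) (cl-u z)

        spot : ∀ v → Spot v
        spot v = go xy (where? v)
          where
          go : (x ≡ u × y ≡ w) ⊎ (x ≡ w × y ≡ u) → Where v → Spot v
          go (inj₁ (refl , refl)) (is-u refl) = in-x (cl-u u) (subst (λ z → cl w z ≡ true) (sym at-u) (cl-u w)) (λ e → u≢w (trans (sym e) at-u))
          go (inj₁ (refl , refl)) (is-ψu refl) = in-x (cl-ψz u) (subst (λ z → cl w z ≡ true) (sym at-ψu) (cl-ψz w)) (λ e → ψu≢ψw (trans (sym e) at-ψu))
          go (inj₁ (refl , refl)) (is-w refl) = in-y (cl-u w) (subst (λ z → cl u z ≡ true) (sym at-w) (cl-u u)) (λ e → u≢w (trans (sym at-w) e))
          go (inj₁ (refl , refl)) (is-ψw refl) = in-y (cl-ψz w) (subst (λ z → cl u z ≡ true) (sym at-ψw) (cl-ψz u)) (λ e → ψu≢ψw (trans (sym at-ψw) e))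
          go (inj₁ (refl , refl)) (is-o a b c d) = outside (cl-o a b) (cl-o c d) (at-o a b c d) (cl-o (unmoved fu a) (unmoved fψu b))
          go (inj₂ (refl , refl)) (is-u refl) = in-y (cl-u u) (subst (λ z → cl w z ≡ true) (sym at-u) (cl-u w)) (λ e → u≢w (trans (sym e) at-u))
          go (inj₂ (refl , refl)) (is-ψu refl) = in-y (cl-ψz u) (subst (λ z → cl w z ≡ true) (sym at-ψu) (cl-ψz w)) (λ e → ψu≢ψw (trans (sym e) at-ψu))
          go (inj₂ (refl , refl)) (is-w refl) = in-x (cl-u w) (subst (λ z → cl u z ≡ true) (sym at-w) (cl-u u)) (λ e → u≢w (trans (sym at-w) e))
          go (inj₂ (refl , refl)) (is-ψw refl) = in-x (cl-ψz w) (subst (λ z → cl u z ≡ true) (sym at-ψw) (cl-ψz u)) (λ e → ψu≢ψw (trans (sym at-ψw) e))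
          go (inj₂ (refl , refl)) (is-o a b c d) = outside (cl-o c d) (cl-o a b) (at-o a b c d) (cl-o (unmoved fw c) (unmoved fψw d))

        or-T : ∀ a {b} → b ≡ true → a ∨ b ≡ true
        or-T true _ = refl
        or-T false h = h
        or-F : ∀ {a b} → a ≡ false → b ≡ false → a ∨ b ≡ false
        or-F refl refl = refl
        or-L : ∀ {a b} → b ≡ false → a ∨ b ≡ a
        or-L {true} _ = refl
        or-L {false} h = h

        x-side : ∀ {v} → cl x v ≡ true → A′ v ≡ true × B′ v ≡ false
        x-side {v} h = or-T (inA v) h , or-F (proj₂ (free x fx v h)) (disj-xy {v} h)

        y-side : ∀ {v} → cl y v ≡ true → A′ v ≡ false × B′ v ≡ true
        y-side {v} h = or-F (proj₁ (free y fy v h)) (¬true (λ e → tf h (disj-xy {v} e))) , or-T (inB v) h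

        rest′ : ∀ v → φ′ v ≡ v → A′ v ≡ false × B′ v ≡ false
        rest′ v f with spot v
        ... | in-x _ _ h = ⊥-elim (h f)
        ... | in-y _ _ h = ⊥-elim (h f)
        ... | outside a b e _ = trans (or-L a) (proj₁ (rest v (trans (sym e) f))) , trans (or-L b) (proj₂ (rest v (trans (sym e) f)))

        split′ : ∀ v → φ′ v ≢ v → B′ v ≡ not (A′ v)
        split′ v f with spot v
        ... | in-x a _ _ = trans (proj₂ (x-side a)) (cong not (sym (proj₁ (x-side a))))
        ... | in-y a _ _ = trans (proj₂ (y-side a)) (cong not (sym (proj₁ (y-side a))))
        ... | outside a b e _ = trans (or-L b) (trans (split v (λ z → f (trans e z))) (cong not (sym (or-L a))))

        swap′ : ∀ v → φ′ v ≢ v → A′ (φ′ v) ≡ not (A′ v)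
        swap′ v f with spot v
        ... | in-x a b _ = trans (proj₁ (y-side b)) (cong not (sym (proj₁ (x-side a))))
        ... | in-y a b _ = trans (proj₁ (x-side b)) (cong not (sym (proj₁ (y-side a))))
        ... | outside a b e c = trans (cong A′ e) (trans (or-L c) (trans (swap v (λ z → f (trans e z))) (cong not (sym (or-L a)))))

        -- The vertex `x` is no longer fixed. In fact two or four vertices are placed, but one per
        -- step is enough.
        few′ : ∑ (λ v → ⟦ φ′ v == v ⟧) ≤ R
        few′ = ≤-pred (≤-trans (∑-mono-< le x lt) few)
          where
          le : ∀ v → ⟦ φ′ v == v ⟧ ≤ ⟦ φ v == v ⟧
          le v with spot v
          ... | in-x _ _ h rewrite ==-≢ h = z≤n
          ... | in-y _ _ h rewrite ==-≢ h = z≤n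
          ... | outside _ _ e _ rewrite e = ≤-refl
          lt : ⟦ φ′ x == x ⟧ < ⟦ φ x == x ⟧
          lt with spot x
          ... | in-x _ _ h rewrite ==-≢ h | fx | ==-refl x = s≤s z≤n
          ... | in-y h _ _ = tf h (disj-xy {x} (cl-u x))
          ... | outside h _ _ _ = tf (cl-u x) h

        new : Partial ψ R
        new = record
          { φ = φ′ ; φ-inv = inv′ ; φψ = comm′ ; inA = A′ ; inB = B′ ; rest = rest′ ; split = split′ ; swap = swap′
          ; inA-ψ = λ v → cong₂ _∨_ (inA-ψ v) (cl-ψ x v) ; inB-ψ = λ v → cong₂ _∨_ (inB-ψ v) (cl-ψ y v)
          ; few = few′
          ; potential = ≤-trans (≤-trans (+-monoˡ-≤ (R * (N * (16 + 96 * N))) (≤-trans ok (+-monoʳ-≤ (Σpot inA inB (suc R)) (*-monoʳ-≤ N (+-monoʳ-≤ 16 (*-monoʳ-≤ 96 R≤N))))))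
              (≤-reflexive (+-assoc (Σpot inA inB (suc R)) _ _))) potential }

        fixed : ∀ v → φ′ v ≡ v → φ v ≡ v
        fixed v f with spot v
        ... | in-x _ _ h = ⊥-elim (h f)
        ... | in-y _ _ h = ⊥-elim (h f)
        ... | outside _ _ e _ = trans (sym e) f

      Next : Set
      Next = Σ (Partial ψ R) λ S′ → ∀ v → Partial.φ S′ v ≡ v → φ v ≡ v

      next : Next
      next = choose (≤-total S₁ S₂)
        where
        S₁ = Σpot (λ v → inA v ∨ cl u v) (λ v → inB v ∨ cl w v) R
        S₂ = Σpot (λ v → inA v ∨ cl w v) (λ v → inB v ∨ cl u v) R
        X = Σpot inA inB (suc R) + N * (16 + 96 * R)
        both : S₁ + S₂ ≤ X + X
        both = ≤-trans (≤-reflexive (trans (cong₂ _+_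
            (∑-cong (λ v → cong₂ (pot R) (nbrs-∨ inA u (λ x h → proj₁ (free u fu x h)) v) (nbrs-∨ inB w (λ x h → proj₂ (free w fw x h)) v)))
            (∑-cong (λ v → cong₂ (pot R) (nbrs-∨ inA w (λ x h → proj₁ (free w fw x h)) v) (nbrs-∨ inB u (λ x h → proj₂ (free u fu x h)) v)))) (sym (∑-+ _ _))))
          (≤-trans (∑-mono (λ v → pot-step R (nbrs inA v) (nbrs inB v) (steps u v) (steps w v) (steps≤2 u v) (steps≤2 w v)))
            (≤-reflexive (trans (∑-+ _ _) (cong₂ _+_ eq eq))))
          where
          eq : ∑ (λ v → pot (suc R) (nbrs inA v) (nbrs inB v) + (16 + 96 * R)) ≡ X
          eq = trans (∑-+ _ _) (cong (Σpot inA inB (suc R) +_) (∑-const N (16 + 96 * R)))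
        half : ∀ {a b x} → a ≤ b → a + b ≤ x + x → a ≤ x
        half {a} {b} {x} h t = ≮⇒≥ (λ lt → <⇒≱ (+-mono-< lt lt) (≤-trans (+-monoʳ-≤ a h) t))
        choose : S₁ ≤ S₂ ⊎ S₂ ≤ S₁ → Next
        choose (inj₁ h) = O.new , O.fixed
          where module O = Oriented u w (inj₁ (refl , refl)) (half h both)
        choose (inj₂ h) = O.new , O.fixed
          where module O = Oriented w u (inj₂ (refl , refl)) (half h (≤-trans (≤-reflexive (+-comm S₂ S₁)) both))

    -- Pairs of `ψ₀` are placed two at a time, one on either side. A single remaining pair has to be
    -- broken up, whence `ψ` may cover two vertices fewer than `ψ₀`.
    record Split (ψ₀ : Fin N → Fin N) (e : ℕ) : Set where
      no-eta-equality
      field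
        ψ φ : Fin N → Fin N
        side : Fin N → Bool
        ψ-inv : ∀ v → ψ (ψ v) ≡ v
        φ-inv : ∀ v → φ (φ v) ≡ v
        φψ : ∀ v → φ (ψ v) ≡ ψ (φ v)
        φ-side : ∀ v → side (φ v) ≡ not (side v)
        ψ-side : ∀ v → side (ψ v) ≡ side v
        ψ-sub : ∀ v → ψ v ≡ v ⊎ ψ v ≡ ψ₀ v
        ψ-cover : ∑ (λ v → ne v (ψ₀ v)) ≤ ∑ (λ v → ne v (ψ v)) + 2
        A≤B : ∀ v → nbrs side v ≤ nbrs (λ u → not (side u)) v + e
        B≤A : ∀ v → nbrs (λ u → not (side u)) v ≤ nbrs side v + e

    module _ (ψ₀ : Fin N → Fin N) (ψ₀-inv : ∀ v → ψ₀ (ψ₀ v) ≡ v) (m : ℕ) (half : N ≡ m + m)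
             (e : ℕ) (large : N * (N * (16 + 96 * N)) < suc e * suc e * (suc e * suc e)) where

      private
        start : Partial ψ₀ N
        start = record
          { φ = λ v → v ; φ-inv = λ _ → refl ; φψ = λ _ → refl ; inA = λ _ → false ; inB = λ _ → false
          ; rest = λ _ _ → refl , refl ; split = λ _ h → ⊥-elim (h refl) ; swap = λ _ h → ⊥-elim (h refl)
          ; inA-ψ = λ _ → refl ; inB-ψ = λ _ → refl
          ; few = ≤-trans (∑-mono (λ v → ⟦⟧≤1 (v == v))) (≤-reflexive (∑-1 N))
          ; potential = ≤-reflexive (cong (_+ N * (N * (16 + 96 * N))) (∑-0 (λ v → trans (cong₂ (pot N) (zero-nbrs v) (zero-nbrs v)) (pot-0 N)))) }
          where
          zero-nbrs : ∀ v → nbrs (λ _ → false) v ≡ 0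
          zero-nbrs v = ∑-0 (λ u → *-zeroʳ ⟦ A v u ⟧)
          pot-0 : ∀ R → pot R 0 0 ≡ 0
          pot-0 R rewrite dist²-0 = *-zeroʳ (24 * R)

        module _ (ψ : Fin N → Fin N) (ψ-inv : ∀ v → ψ (ψ v) ≡ v) where
          Waiting : ∀ {R} → Partial ψ R → Fin N → Set
          Waiting S v = Partial.φ S v ≡ v × ψ v ≢ v

          waiting? : ∀ {R} (S : Partial ψ R) v → Dec (Waiting S v)
          waiting? S v with Partial.φ S v ≟ v | ψ v ≟ v
          ... | yes a | no b = yes (a , b)
          ... | no a | _ = no (λ h → a (proj₁ h))
          ... | yes _ | yes b = no (λ h → proj₂ h b)

          Two : ∀ {R} → Partial ψ R → Fin N → Fin N → Set
          Two S u w = Waiting S u × Waiting S w × u ≢ w × u ≢ ψ w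

          two? : ∀ {R} (S : Partial ψ R) u w → Dec (Two S u w)
          two? S u w with waiting? S u | waiting? S w | u ≟ w | u ≟ ψ w
          ... | yes a | yes b | no c | no d = yes (a , b , c , d)
          ... | no a | _ | _ | _ = no (λ h → a (proj₁ h))
          ... | yes _ | no b | _ | _ = no (λ h → b (proj₁ (proj₂ h)))
          ... | yes _ | yes _ | yes c | _ = no (λ h → proj₁ (proj₂ (proj₂ h)) c)
          ... | yes _ | yes _ | no _ | yes d = no (λ h → proj₂ (proj₂ (proj₂ h)) d)

          none-left : ∀ {u} (S : Partial ψ 0) → Partial.φ S u ≡ u → ⊥
          none-left {u} S h = n≮0 (≤-trans (≤-trans (≤-reflexive (sym (cong ⟦_⟧ (trans (cong (_== u) h) (==-refl u))))) (term≤∑ (λ v → ⟦ Partial.φ S v == v ⟧) u)) (Partial.few S))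

          Paired : Set
          Paired = ∃ λ R → R ≤ N × Σ (Partial ψ R) λ S → ∀ u w → ¬ Two S u w

          pairs : ∀ R → R ≤ N → Partial ψ R → Paired
          pairs-again : ∀ R → R ≤ N → (S : Partial ψ R) → ∀ u w → Two S u w → Paired
          pairs R le S = case any? (λ u → any? (λ w → two? S u w)) of λ
            { (no h) → R , le , S , λ u w t → h (u , w , t)
            ; (yes (u , w , t)) → pairs-again R le S u w t }
          pairs-again zero le S u w ((fu , _) , _) = ⊥-elim (none-left S fu)
          pairs-again (suc R) le S u w ((fu , mu) , (fw , mw) , u≢w , u≢ψw) =
            pairs R (≤-trans (n≤1+n R) le) (proj₁ (Unit.next ψ ψ-inv (record
              { S = S ; R≤N = ≤-trans (n≤1+n R) le ; u = u ; w = w ; fu = fu ; fw = fw ; e₁ = λ z → ⊥-elim (mu z) ; e₂ = λ z → ⊥-elim (mw z) ; u≢w = u≢w ; u≢ψw = u≢ψw })))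

          Singles : ∀ {R} → Partial ψ R → Set
          Singles S = ∀ v → Partial.φ S v ≡ v → ψ v ≡ v

          Finished : Set
          Finished = ∃ λ R → Σ (Partial ψ R) λ S → ∀ v → Partial.φ S v ≢ v

          singles : ∀ R → R ≤ N → (S : Partial ψ R) → Singles S → Finished
          singles-again : ∀ R → R ≤ N → (S : Partial ψ R) → Singles S → ∀ u → Partial.φ S u ≡ u → Finished
          singles R le S sg = case any? (λ u → Partial.φ S u ≟ u) of λ
            { (no h) → R , S , λ v z → h (v , z)
            ; (yes (u , fu)) → singles-again R le S sg u fu }
          singles-again zero le S sg u fu = ⊥-elim (none-left S fu)
          singles-again (suc R) le S sg u fu = go (another (λ v → φ v == v) u (trans (cong (_== u) fu) (==-refl u)) ev)
            where
            open Partial S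
            le′ = ≤-trans (n≤1+n R) le
            -- `N` is even and `φ` moves an even number of vertices.
            ev : ∃ λ t → ∑ (λ v → ⟦ φ v == v ⟧) ≡ t + t
            ev = case involution-even φ φ-inv ne ne-diag ne-sym of λ
              { (t , q) → even-part m t _ (trans (cong (∑ (λ v → ⟦ φ v == v ⟧) +_) (sym q)) (trans (sym (∑-+ _ _)) (trans (∑-cong (λ v → trans (cong (λ b → ⟦ φ v == v ⟧ + ⟦ not b ⟧) (==-sym v (φ v))) (⟦⟧-not (φ v == v)))) (trans (∑-1 N) half)))) }
            go : (∃ λ w → u ≢ w × (φ w == w) ≡ true) → Finished
            go (w , u≢w , h) = case Unit.next ψ ψ-inv (record
              { S = S ; R≤N = le′ ; u = u ; w = w ; fu = fu ; fw = ==-sound h ; e₁ = λ _ → sg w (==-sound h) ; e₂ = λ _ → sg u fu ; u≢w = u≢w ; u≢ψw = λ z → u≢w (trans z (sg w (==-sound h))) }) of λ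
              { (S′ , fx) → singles R le′ S′ (λ v z → sg v (fx v z)) }

        finish : (ψ : Fin N → Fin N) → (∀ v → ψ (ψ v) ≡ v) → (∀ v → ψ v ≡ v ⊎ ψ v ≡ ψ₀ v) → ∑ (λ v → ne v (ψ₀ v)) ≤ ∑ (λ v → ne v (ψ v)) + 2 →
          ∀ {R} → R ≤ N → (S : Partial ψ R) → (∀ v → Partial.φ S v ≡ v → ψ v ≡ v) → Split ψ₀ e
        finish ψ ψ-inv sub cov {R} le S sg = pack (singles ψ ψ-inv R le S sg)
          where
          pack : (∃ λ R → Σ (Partial ψ R) λ S → ∀ v → Partial.φ S v ≢ v) → Split ψ₀ e
          pack (R , S , nf) = record
            { ψ = ψ ; φ = φ ; side = inA ; ψ-inv = ψ-inv ; φ-inv = φ-inv ; φψ = φψ ; φ-side = λ v → swap v (nf v) ; ψ-side = inA-ψ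
            ; ψ-sub = sub ; ψ-cover = cov
            ; A≤B = λ v → close e _ _ (small v)
            ; B≤A = λ v → close e _ _ (subst (_< suc e * suc e) (dist²-sym (nbrs inA v) (nbrs (λ u → not (inA u)) v)) (small v)) }
            where
            open Partial S
            -- The final potential contains the fourth power of the discrepancy at `v`, and its
            -- total is below the fourth power of e + 1 by `large`.
            small : ∀ v → dist² (nbrs inA v) (nbrs (λ u → not (inA u)) v) < suc e * suc e
            small v = ≰⇒> (λ h → <⇒≱ large (≤-trans (*-mono-≤ h h) (≤-trans (≤-reflexive (cong (λ z → dist² (nbrs inA v) z * dist² (nbrs inA v) z) (∑-cong (λ u → cong (λ z → ⟦ A v u ⟧ * ⟦ z ⟧) (sym (split u (nf u)))))))
              (≤-trans (m≤m+n _ _) (≤-trans (term≤∑ (λ v → pot R (nbrs inA v) (nbrs inB v)) v) (≤-trans (m≤m+n _ _) potential))))))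

        -- An unpaired last pair is split into two singletons.
        split-pair : ∀ R → R ≤ N → (S : Partial ψ₀ R) → (∀ u w → ¬ Two ψ₀ ψ₀-inv S u w) → ∀ u → Waiting ψ₀ ψ₀-inv S u → Split ψ₀ e
        split-pair R le S nt u (fu , mu) = finish ψ ψ-inv sub cov le S′ sg
          where
          open Partial S
          u′ = ψ₀ u
          fu′ : φ u′ ≡ u′
          fu′ = trans (φψ u) (cong ψ₀ fu)
          ψ : Fin N → Fin N
          ψ v = if v == u then u else if v == u′ then u′ else ψ₀ v
          data At (v : Fin N) : Set where
            fx : ψ v ≡ v → (v ≡ u ⊎ v ≡ u′) → At v
            mv : ψ v ≡ ψ₀ v → v ≢ u → v ≢ u′ → At v
          at : ∀ v → At v
          at v with v ≟ u | v ≟ u′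
          ... | yes refl | _ = fx e₁ (inj₁ refl)
            where
            e₁ : ψ v ≡ v
            e₁ rewrite ==-refl v = refl
          ... | no h | yes refl = fx e₁ (inj₂ refl)
            where
            e₁ : ψ v ≡ v
            e₁ rewrite ==-≢ h | ==-refl v = refl
          ... | no h | no h′ = mv e₁ h h′
            where
            e₁ : ψ v ≡ ψ₀ v
            e₁ rewrite ==-≢ h | ==-≢ h′ = refl
          away : ∀ {v} → v ≢ u → v ≢ u′ → ψ (ψ₀ v) ≡ ψ₀ (ψ₀ v)
          away {v} h h′ with at (ψ₀ v)
          ... | mv q _ _ = q
          ... | fx _ (inj₁ q) = ⊥-elim (h′ (trans (sym (ψ₀-inv v)) (cong ψ₀ q)))
          ... | fx _ (inj₂ q) = ⊥-elim (h (trans (sym (ψ₀-inv v)) (trans (cong ψ₀ q) (ψ₀-inv u))))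
          ψ-inv : ∀ v → ψ (ψ v) ≡ v
          ψ-inv v with at v
          ... | fx q _ = trans (cong ψ q) q
          ... | mv q h h′ = trans (cong ψ q) (trans (away h h′) (ψ₀-inv v))
          sub : ∀ v → ψ v ≡ v ⊎ ψ v ≡ ψ₀ v
          sub v with at v
          ... | fx q _ = inj₁ q
          ... | mv q _ _ = inj₂ q
          cov : ∑ (λ v → ne v (ψ₀ v)) ≤ ∑ (λ v → ne v (ψ v)) + 2
          cov = ≤-trans (∑-mono pt) (≤-reflexive (trans (∑-+ _ _) (cong (∑ (λ v → ne v (ψ v)) +_) (trans (∑-+ _ _) (cong₂ _+_ (∑-δ1′ u) (∑-δ1′ u′))))))
            where
            pt : ∀ v → ne v (ψ₀ v) ≤ ne v (ψ v) + (⟦ v == u ⟧ + ⟦ v == u′ ⟧)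
            pt v with at v
            ... | mv q _ _ rewrite q = m≤m+n _ _
            ... | fx q (inj₁ refl) rewrite ==-refl v = ≤-trans (⟦⟧≤1 _) (≤-trans (m≤m+n 1 _) (m≤n+m _ (ne v (if true then v else (if v == u′ then u′ else ψ₀ v)))))
            ... | fx q (inj₂ e) = ≤-trans (⟦⟧≤1 _) (≤-trans (≤-trans (≤-reflexive (cong ⟦_⟧ (sym (trans (cong (_== u′) e) (==-refl u′))))) (m≤n+m _ ⟦ v == u ⟧)) (m≤n+m _ (ne v (ψ v))))
          off : ∀ {v} → v ≢ u → v ≢ u′ → φ v ≢ u × φ v ≢ u′
          off h h′ = (λ e → h (trans (sym (φ-inv _)) (trans (cong φ e) fu))) , (λ e → h′ (trans (sym (φ-inv _)) (trans (cong φ e) fu′)))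
          comm : ∀ v → φ (ψ v) ≡ ψ (φ v)
          comm v with at v
          ... | fx q (inj₁ refl) = trans (cong φ q) (trans fu (sym (trans (cong ψ fu) q)))
          ... | fx q (inj₂ refl) = trans (cong φ q) (trans fu′ (sym (trans (cong ψ fu′) q)))
          ... | mv q h h′ with at (φ v)
          ...   | mv q′ _ _ = trans (cong φ q) (trans (φψ v) (sym q′))
          ...   | fx _ (inj₁ z) = ⊥-elim (proj₁ (off h h′) z)
          ...   | fx _ (inj₂ z) = ⊥-elim (proj₂ (off h h′) z)
          carry : (P : Fin N → Bool) → (∀ v → P (ψ₀ v) ≡ P v) → ∀ v → P (ψ v) ≡ P v
          carry P hp v with sub v
          ... | inj₁ q = cong P q
          ... | inj₂ q = trans (cong P q) (hp v)
          S′ : Partial ψ R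
          S′ = record { φ = φ ; φ-inv = φ-inv ; φψ = comm ; inA = inA ; inB = inB ; rest = rest ; split = split ; swap = swap
                      ; inA-ψ = carry inA inA-ψ ; inB-ψ = carry inB inB-ψ ; few = few ; potential = potential }
          sg : ∀ v → φ v ≡ v → ψ v ≡ v
          sg v fv with at v
          ... | fx q _ = q
          ... | mv q h h′ with ψ₀ v ≟ v
          ...   | yes z = trans q z
          ...   | no z = ⊥-elim (nt u v ((fu , mu) , (fv , z) , (λ e → h (sym e)) , (λ e → h′ (trans (sym (ψ₀-inv v)) (cong ψ₀ (sym e))))))

        conclude : Paired ψ₀ ψ₀-inv → Split ψ₀ e
        conclude (R , le , S , nt) = case any? (λ u → waiting? ψ₀ ψ₀-inv S u) of λ
          { (no h) → finish ψ₀ ψ₀-inv (λ _ → inj₂ refl) (m≤m+n _ 2) le S (λ v fv → case ψ₀ v ≟ v of λ { (yes q) → q ; (no q) → ⊥-elim (h (v , fv , q)) })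
          ; (yes (u , wt)) → split-pair R le S nt u wt }

      abstract
        split-graph : Split ψ₀ e
        split-graph = conclude (pairs ψ₀ ψ₀-inv N ≤-refl start)

-- Vertex classes formed from a matching

module Classes where
  open Prelude
  open Sums
  open Kempe
  open EdgeColouring
  import Data.Nat.Properties
  open import Relation.Binary.Definitions using (tri<; tri≈; tri>)

  infix 7 _≐_
  _≐_ : ∀ {k} → Fin k → ℕ → Bool
  i ≐ n = does (toℕ i Data.Nat.Properties.≟ n)

  ≐-sound : ∀ {k} {i : Fin k} {n} → (i ≐ n) ≡ true → toℕ i ≡ n
  ≐-sound {i = i} {n} h = does-sound (toℕ i Data.Nat.Properties.≟ n) h

  ≐-complete : ∀ {k} {i : Fin k} {n} → toℕ i ≡ n → (i ≐ n) ≡ true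
  ≐-complete {i = i} {n} h = does-complete (toℕ i Data.Nat.Properties.≟ n) h

  ∑-≐ : ∀ {k} n → n < k → ∑ {k} (λ i → ⟦ i ≐ n ⟧) ≡ 1
  ∑-≐ {k} n lt = trans (∑-cong pt) (∑-δ1′ (fromℕ< lt))
    where
    pt : ∀ i → ⟦ i ≐ n ⟧ ≡ ⟦ i == fromℕ< lt ⟧
    pt i = cong ⟦_⟧ (Bool-≡ (λ h → trans (cong (i ==_) (sym (toℕ-injective (trans (≐-sound {i = i} h) (sym (toℕ-fromℕ< lt)))))) (==-refl i))
                           (λ h → ≐-complete {i = i} (trans (cong toℕ (==-sound h)) (toℕ-fromℕ< lt))))

  module _ {N} (P : Fin N → Bool) where

    index : Fin N → ℕ
    index x = ∑ (λ y → ⟦ P y ∧ does (toℕ y <? toℕ x) ⟧)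

    index< : ∀ x → P x ≡ true → index x < ∑ (λ y → ⟦ P y ⟧)
    index< x px = ∑-mono-< (λ y → ⟦⟧-mono (λ h → proj₁ (∧-true {P y} h))) x
      (subst₂ (λ a b → ⟦ a ⟧ < ⟦ b ⟧) (sym (¬true (λ h → <-irrefl refl (does-sound (toℕ x <? toℕ x) (proj₂ (∧-true {P x} h)))))) (sym px) (s≤s z≤n))

    private
      less : ∀ x y → P x ≡ true → toℕ x < toℕ y → index x < index y
      less x y px lt = ∑-mono-< (λ z → ⟦⟧-mono (λ h → ∧-intro (proj₁ (∧-true {P z} h)) (does-complete (toℕ z <? toℕ y) (<-trans (does-sound (toℕ z <? toℕ x) (proj₂ (∧-true {P z} h))) lt)))) x
        (subst₂ (λ a b → ⟦ a ⟧ < ⟦ b ⟧) (sym (¬true (λ h → <-irrefl refl (does-sound (toℕ x <? toℕ x) (proj₂ (∧-true {P x} h))))))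
          (sym (∧-intro px (does-complete (toℕ x <? toℕ y) lt))) (s≤s z≤n))

    index-inj : ∀ x y → P x ≡ true → P y ≡ true → index x ≡ index y → x ≡ y
    index-inj x y px py e = toℕ-injective (≤-antisym (≮⇒≥ (λ lt → <-irrefl (sym e) (less y x py lt))) (≮⇒≥ (λ lt → <-irrefl e (less x y px lt))))

  record Subset {N} (P : Fin N → Bool) (ρ : ℕ) : Set where
    no-eta-equality
    field
      Q : Fin N → Bool
      sub : ∀ x → Q x ≡ true → P x ≡ true
      size : ∑ (λ x → ⟦ Q x ⟧) ≡ ρ

  abstract
    subset : ∀ {N} d (P : Fin N → Bool) ρ → ∑ (λ x → ⟦ P x ⟧) ≡ d + ρ → Subset P ρ
    subset zero P ρ e = record { Q = P ; sub = λ _ h → h ; size = e }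
    subset {N} (suc d) P ρ e with count∃ P (subst (0 <_) (sym e) (s≤s z≤n))
    ... | x , px = record { Q = S.Q ; sub = λ y h → proj₁ (∧-true {P y} (S.sub y h)) ; size = S.size }
      where
      P′ : Fin N → Bool
      P′ y = P y ∧ not (y == x)
      pt : ∀ y → ⟦ P y ⟧ ≡ ⟦ y == x ⟧ + ⟦ P′ y ⟧
      pt y with y ≟ x
      ... | yes refl rewrite ==-refl y | px = refl
      ... | no h rewrite ==-≢ h with P y
      ...   | true = refl
      ...   | false = refl
      S₀ : Subset P′ ρ
      S₀ = subset d P′ ρ (suc-injective (trans (cong (_+ ∑ (λ y → ⟦ P′ y ⟧)) (sym (∑-δ1′ x))) (trans (sym (trans (∑-cong pt) (∑-+ _ _))) e)))
      module S = Subset S₀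

  module _ {N} (ψ : Fin N → Fin N) (ψ-inv : ∀ v → ψ (ψ v) ≡ v) where

    second : Fin N → Bool
    second v = does (toℕ (ψ v) <? toℕ v)

    second-ψ : ∀ v → second v ≡ true → second (ψ v) ≡ false
    second-ψ v h = ¬true (λ h′ → <-asym (does-sound (_ <? _) h) (subst (λ z → toℕ z < toℕ (ψ v)) (ψ-inv v) (does-sound (toℕ (ψ (ψ v)) <? toℕ (ψ v)) h′)))

    second-moved : ∀ v → second v ≡ true → ψ v ≢ v
    second-moved v h e = <-irrefl (cong toℕ e) (does-sound (toℕ (ψ v) <? toℕ v) h)

    -- Of a moved vertex and its partner exactly one is `second`, and `ψ` carries the vertices of
    -- one kind to those of the other.
    seconds : (P : Fin N → Bool) → (∀ v → P (ψ v) ≡ P v) → ∑ (λ v → ⟦ P v ⟧ * ne v (ψ v)) ≡ ∑ (λ v → ⟦ P v ∧ second v ⟧) + ∑ (λ v → ⟦ P v ∧ second v ⟧)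
    seconds P inv = trans (∑-cong pt) (trans (∑-+ _ _) (cong (∑ (λ v → ⟦ P v ∧ second v ⟧) +_)
        (trans (∑-cong (λ v → cong (λ b → ⟦ b ∧ second (ψ v) ⟧) (sym (inv v)))) (∑-inv ψ ψ-inv (λ v → ⟦ P v ∧ second v ⟧)))))
      where
      tri : ∀ v → ne v (ψ v) ≡ ⟦ second v ⟧ + ⟦ second (ψ v) ⟧
      tri v with ψ v ≟ v
      ... | yes e = trans (trans (cong (ne v) e) (ne-diag v)) (sym (cong₂ (λ a b → ⟦ a ⟧ + ⟦ b ⟧) (¬true (λ h → second-moved v h e)) (¬true (λ h → second-moved (ψ v) h (cong ψ e)))))
      ... | no h with <-cmp (toℕ (ψ v)) (toℕ v)
      ...   | tri≈ _ e _ = ⊥-elim (h (toℕ-injective e))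
      ...   | tri< lt _ _ = trans (ne-≢ (λ e → h (sym e))) (sym (cong₂ (λ a b → ⟦ a ⟧ + ⟦ b ⟧) (does-complete (toℕ (ψ v) <? toℕ v) lt) (second-ψ v (does-complete (toℕ (ψ v) <? toℕ v) lt))))
      ...   | tri> ng _ gt = trans (ne-≢ (λ e → h (sym e))) (sym (cong₂ (λ a b → ⟦ a ⟧ + ⟦ b ⟧) (does-false (toℕ (ψ v) <? toℕ v) ng)
                (does-complete (toℕ (ψ (ψ v)) <? toℕ (ψ v)) (subst (λ z → toℕ z < toℕ (ψ v)) (sym (ψ-inv v)) gt))))
      pt : ∀ v → ⟦ P v ⟧ * ne v (ψ v) ≡ ⟦ P v ∧ second v ⟧ + ⟦ P v ∧ second (ψ v) ⟧
      pt v = trans (cong (⟦ P v ⟧ *_) (tri v)) (trans (*-distribˡ-+ ⟦ P v ⟧ _ _) (sym (cong₂ _+_ (⟦⟧-∧ (P v) (second v)) (⟦⟧-∧ (P v) (second (ψ v))))))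

  -- Vertex classes inside a ψ-invariant part: nr marks the vertices that share the class of their partner.
  module Indexed {N} (ψ : Fin N → Fin N) (ψ-inv : ∀ v → ψ (ψ v) ≡ v) (part nr : Fin N → Bool)
                 (nr-part : ∀ v → nr v ≡ true → part v ≡ true × part (ψ v) ≡ true × nr (ψ v) ≡ false) where

    rep : Fin N → Bool
    rep v = part v ∧ not (nr v)

    base : Fin N → Fin N
    base v = if nr v then ψ v else v

    class : Fin N → ℕ
    class v = index rep (base v)

    base-nr : ∀ {v} → nr v ≡ true → base v ≡ ψ v
    base-nr h rewrite h = refl

    base-rep : ∀ {v} → nr v ≡ false → base v ≡ v
    base-rep h rewrite h = refl

    rep-base : ∀ v → part v ≡ true → rep (base v) ≡ true
    rep-base v h with isTrue (nr v)
    ... | inj₁ e rewrite base-nr e | proj₁ (proj₂ (nr-part v e)) | proj₂ (proj₂ (nr-part v e)) = refl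
    ... | inj₂ e rewrite base-rep e | h | e = refl

    class< : ∀ v → part v ≡ true → class v < ∑ (λ v → ⟦ rep v ⟧)
    class< v h = index< rep (base v) (rep-base v h)

    class-eq : ∀ u v → part u ≡ true → part v ≡ true → class u ≡ class v → u ≡ v ⊎ u ≡ ψ v
    class-eq u v pu pv e = go (isTrue (nr u)) (isTrue (nr v)) (index-inj rep (base u) (base v) (rep-base u pu) (rep-base v pv) e)
      where
      go : nr u ≡ true ⊎ nr u ≡ false → nr v ≡ true ⊎ nr v ≡ false → base u ≡ base v → u ≡ v ⊎ u ≡ ψ v
      go (inj₁ a) (inj₁ b) q = inj₁ (trans (sym (ψ-inv u)) (trans (cong ψ (trans (sym (base-nr a)) (trans q (base-nr b)))) (ψ-inv v)))
      go (inj₁ a) (inj₂ b) q = inj₂ (trans (sym (ψ-inv u)) (cong ψ (trans (sym (base-nr a)) (trans q (base-rep b)))))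
      go (inj₂ a) (inj₁ b) q = inj₂ (trans (sym (base-rep a)) (trans q (base-nr b)))
      go (inj₂ a) (inj₂ b) q = inj₁ (trans (sym (base-rep a)) (trans q (base-rep b)))

    rep-count : ∑ (λ v → ⟦ rep v ⟧) + ∑ (λ v → ⟦ nr v ⟧) ≡ ∑ (λ v → ⟦ part v ⟧)
    rep-count = trans (sym (∑-+ _ _)) (∑-cong pt)
      where
      pt : ∀ v → ⟦ rep v ⟧ + ⟦ nr v ⟧ ≡ ⟦ part v ⟧
      pt v with isTrue (nr v)
      ... | inj₁ e rewrite e | proj₁ (nr-part v e) = refl
      ... | inj₂ e rewrite e with part v
      ...   | true = refl
      ...   | false = refl

    module _ {k} (i : Fin k) where

      reps followers : ℕ
      reps = ∑ (λ v → ⟦ rep v ∧ (i ≐ class v) ⟧)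
      followers = ∑ (λ v → ⟦ nr v ∧ (i ≐ class v) ⟧)

      reps≤1 : reps ≤ 1
      reps≤1 = ∑-≤1 _ (λ u v hu hv → index-inj rep u v (proj₁ (∧-true {rep u} hu)) (proj₁ (∧-true {rep v} hv))
        (trans (cong (index rep) (sym (base-rep (not-true (proj₂ (∧-true {part u} (proj₁ (∧-true {rep u} hu))))))))
          (trans (trans (sym (≐-sound {i = i} (proj₂ (∧-true {rep u} hu)))) (≐-sound {i = i} (proj₂ (∧-true {rep v} hv))))
            (cong (index rep) (base-rep (not-true (proj₂ (∧-true {part v} (proj₁ (∧-true {rep v} hv))))))))))

      -- `ψ` carries a follower of class `i` to the representative of that class.
      followers≤ : followers ≤ reps
      followers≤ = ≤-trans (≤-reflexive (sym (∑-inv ψ ψ-inv (λ v → ⟦ nr v ∧ (i ≐ class v) ⟧)))) (∑-mono (λ v → ⟦⟧-mono (pt v)))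
        where
        pt : ∀ v → nr (ψ v) ∧ (i ≐ class (ψ v)) ≡ true → rep v ∧ (i ≐ class v) ≡ true
        pt v h = ∧-intro (∧-intro (subst (λ z → part z ≡ true) (ψ-inv v) (proj₁ (proj₂ np))) (cong not nv))
                         (≐-complete {i = i} (trans (≐-sound {i = i} (proj₂ (∧-true {nr (ψ v)} h))) (cong (index rep) (trans (base-nr e) (trans (ψ-inv v) (sym (base-rep nv)))))))
          where
          e = proj₁ (∧-true {nr (ψ v)} h)
          np = nr-part (ψ v) e
          nv : nr v ≡ false
          nv = subst (λ z → nr z ≡ false) (ψ-inv v) (proj₂ (proj₂ np))

    ∑-reps : ∀ k → ∑ (λ v → ⟦ rep v ⟧) ≤ k → ∑ {k} reps ≡ ∑ (λ v → ⟦ rep v ⟧)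
    ∑-reps k le = trans (∑-swap _) (∑-cong pt)
      where
      pt : ∀ v → ∑ {k} (λ i → ⟦ rep v ∧ (i ≐ class v) ⟧) ≡ ⟦ rep v ⟧
      pt v with rep v in e
      ... | true = ∑-≐ {k} (class v) (≤-trans (class< v (proj₁ (∧-true {part v} e))) le)
      ... | false = ∑-0 {k} (λ _ → refl)

-- Forbidden colours of the first phase

module LockFamily where
  open Prelude
  open Sums
  open Classes

  -- Colour i is forbidden on the vertices of B of class i, on the φ-images of those of them that are not matched to the
  -- dummy vertex, and at the dummy vertex if it is matched to a vertex of that class.
  record LockData (N k₁ : ℕ) : Set where
    no-eta-equality
    field
      side dum nr : Fin N → Bool
      φ : Fin N → Fin N
      cl : Fin N → ℕ
      o : Bool
      T : ℕ
      φ-inv : ∀ v → φ (φ v) ≡ v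
      φ-side : ∀ v → side (φ v) ≡ not (side v)
      dum-B : ∀ v → dum v ≡ true → side v ≡ false
      one-dummy : ∑ (λ v → ⟦ dum v ⟧) ≡ ⟦ o ⟧
      nr-part : ∀ v → nr v ≡ true → not (side v) ∧ not (dum v) ≡ true
      cl< : ∀ v → not (side v) ∧ not (dum v) ≡ true → cl v < k₁
      reps≤1 : (i : Fin k₁) → ∑ (λ v → ⟦ ((not (side v) ∧ not (dum v)) ∧ not (nr v)) ∧ (i ≐ cl v) ⟧) ≤ 1
      followers≤ : (i : Fin k₁) → ∑ (λ v → ⟦ nr v ∧ (i ≐ cl v) ⟧) ≤ ∑ (λ v → ⟦ ((not (side v) ∧ not (dum v)) ∧ not (nr v)) ∧ (i ≐ cl v) ⟧)
      ∑-reps : ∑ {k₁} (λ i → ∑ (λ v → ⟦ ((not (side v) ∧ not (dum v)) ∧ not (nr v)) ∧ (i ≐ cl v) ⟧)) ≡ T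

  module Locks {N k₁} (setup : LockData N k₁) where
    open LockData setup

    part : Fin N → Bool
    part v = not (side v) ∧ not (dum v)

    reps members followers : Fin k₁ → ℕ
    reps i = ∑ (λ v → ⟦ (part v ∧ not (nr v)) ∧ (i ≐ cl v) ⟧)
    members i = ∑ (λ v → ⟦ part v ∧ (i ≐ cl v) ⟧)
    followers i = ∑ (λ v → ⟦ nr v ∧ (i ≐ cl v) ⟧)

    members-split : ∀ i → members i ≡ reps i + followers i
    members-split i = trans (∑-cong (λ v → pt (part v) (nr v) (i ≐ cl v) (nr-part v))) (∑-+ _ _)
      where
      pt : ∀ p n x → (n ≡ true → p ≡ true) → ⟦ p ∧ x ⟧ ≡ ⟦ (p ∧ not n) ∧ x ⟧ + ⟦ n ∧ x ⟧
      pt true true x _ = refl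
      pt true false x _ = sym (+-identityʳ _)
      pt false true x h = case h refl of λ ()
      pt false false x _ = refl

    members≤2 : ∀ i → members i ≤ 2
    members≤2 i = ≤-trans (≤-reflexive (members-split i)) (+-mono-≤ (reps≤1 i) (≤-trans (followers≤ i) (reps≤1 i)))

    -- On A this marks the vertices with a lock. For even order these are all of A; for odd order
    -- they are only the `φ`-images of followers, because the lock that balances a representative is
    -- put at the dummy vertex.
    χ : Fin N → Bool
    χ v = not (dum (φ v)) ∧ (not o ∨ nr (φ v))

    has : Fin k₁ → Bool
    has i = does (1 ≤? reps i)

    has-eq : ∀ i → ⟦ has i ⟧ ≡ reps i
    has-eq i = go (1 ≤? reps i) (reps≤1 i)
      where
      go : ∀ {a} (d : Dec (1 ≤ a)) → a ≤ 1 → ⟦ does d ⟧ ≡ a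
      go (yes p) q = ≤-antisym p q
      go (no p) q = sym (n≤0⇒n≡0 (≤-pred (≰⇒> p)))

    pickL : Bool → Bool → Bool → Bool → Bool → Bool
    pickL a d x h y = if a then x else (if d then h else y)

    lock₁ : Fin k₁ → Fin N → Bool
    lock₁ i v = pickL (side v) (dum v) (χ v ∧ (i ≐ cl (φ v))) (has i) (i ≐ cl v)

    lock-B : ∀ i v → side v ≡ false → dum v ≡ false → lock₁ i v ≡ (i ≐ cl v)
    lock-B i v h q = cong₂ (λ a d → pickL a d (χ v ∧ (i ≐ cl (φ v))) (has i) (i ≐ cl v)) h q

    private
      onA : Fin k₁ → ℕ
      onA i = ∑ (λ v → ⟦ side v ∧ (χ v ∧ (i ≐ cl (φ v))) ⟧)

      lock-split : ∀ i v → ⟦ lock₁ i v ⟧ ≡ ⟦ side v ∧ (χ v ∧ (i ≐ cl (φ v))) ⟧ + (⟦ part v ∧ (i ≐ cl v) ⟧ + ⟦ dum v ⟧ * ⟦ has i ⟧)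
      lock-split i v = lem (side v) (dum v) (χ v ∧ (i ≐ cl (φ v))) (has i) (i ≐ cl v) (dum-B v)
        where
        lem : ∀ a d x h y → (d ≡ true → a ≡ false) → ⟦ pickL a d x h y ⟧ ≡ ⟦ a ∧ x ⟧ + (⟦ (not a ∧ not d) ∧ y ⟧ + ⟦ d ⟧ * ⟦ h ⟧)
        lem true true x h y z = case z refl of λ ()
        lem true false x h y _ = sym (+-identityʳ _)
        lem false true x h y _ = sym (+-identityʳ _)
        lem false false x h y _ = sym (+-identityʳ _)

      onA-eq : ∀ i → onA i + ⟦ o ⟧ * reps i ≡ members i
      onA-eq i = trans (cong (_+ ⟦ o ⟧ * reps i) (trans (sym (∑-inv φ φ-inv (λ v → ⟦ side v ∧ (χ v ∧ (i ≐ cl (φ v))) ⟧))) (∑-cong pt))) (go o)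
        where
        pt : ∀ v → ⟦ side (φ v) ∧ (χ (φ v) ∧ (i ≐ cl (φ (φ v)))) ⟧ ≡ ⟦ not (side v) ∧ ((not (dum v) ∧ (not o ∨ nr v)) ∧ (i ≐ cl v)) ⟧
        pt v = cong₂ (λ a z → ⟦ a ∧ ((not (dum z) ∧ (not o ∨ nr z)) ∧ (i ≐ cl z)) ⟧) (φ-side v) (φ-inv v)
        p₁ : ∀ a d n x → (n ≡ true → not a ∧ not d ≡ true) → ⟦ not a ∧ ((not d ∧ (false ∨ n)) ∧ x) ⟧ ≡ ⟦ n ∧ x ⟧
        p₁ false false n x _ = refl
        p₁ true d false x _ = refl
        p₁ false true false x _ = refl
        p₁ true d true x h = case h refl of λ ()
        p₁ false true true x h = case h refl of λ ()
        p₂ : ∀ a d x → ⟦ not a ∧ ((not d ∧ true) ∧ x) ⟧ ≡ ⟦ (not a ∧ not d) ∧ x ⟧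
        p₂ true _ _ = refl
        p₂ false true _ = refl
        p₂ false false _ = refl
        go : ∀ b → ∑ (λ v → ⟦ not (side v) ∧ ((not (dum v) ∧ (not b ∨ nr v)) ∧ (i ≐ cl v)) ⟧) + ⟦ b ⟧ * reps i ≡ members i
        go true = trans (trans (cong₂ _+_ (∑-cong (λ v → p₁ (side v) (dum v) (nr v) (i ≐ cl v) (nr-part v))) (+-identityʳ (reps i))) (+-comm (followers i) (reps i))) (sym (members-split i))
        go false = trans (+-identityʳ _) (∑-cong (λ v → p₂ (side v) (dum v) (i ≐ cl v)))

    -- Every member of the class in B is locked and has one counterpart, at its `φ`-image or at the
    -- dummy vertex. So the number of locks is even, which the parity argument for perfect colours
    -- requires, and at most 4.
    lock-total : ∀ i → ∑ (λ v → ⟦ lock₁ i v ⟧) ≡ members i + members i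
    lock-total i = trans (∑-cong (lock-split i)) (trans (∑-+ _ _) (trans (cong (onA i +_) (trans (∑-+ _ _) (cong (members i +_)
      (trans (∑-*ʳ ⟦ has i ⟧ (λ v → ⟦ dum v ⟧)) (cong₂ _*_ one-dummy (has-eq i)))))) (trans (ar (onA i) (members i) (⟦ o ⟧ * reps i)) (cong (_+ members i) (onA-eq i)))))
      where
      ar : ∀ a b c → a + (b + c) ≡ a + c + b
      ar = solve-∀

    few-locks : ∀ i → ∑ (λ v → ⟦ lock₁ i v ⟧) ≤ 4
    few-locks i = ≤-trans (≤-reflexive (lock-total i)) (+-mono-≤ (members≤2 i) (members≤2 i))

    lockd : Fin N → ℕ
    lockd v = ∑ (λ i → ⟦ lock₁ i v ⟧)

    lockd-A : ∀ v → side v ≡ true → lockd v ≡ ⟦ χ v ⟧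
    lockd-A v h = trans (∑-cong (λ i → cong (λ a → ⟦ pickL a (dum v) (χ v ∧ (i ≐ cl (φ v))) (has i) (i ≐ cl v) ⟧) h)) (go (χ v) refl)
      where
      go : ∀ b → χ v ≡ b → ∑ (λ i → ⟦ b ∧ (i ≐ cl (φ v)) ⟧) ≡ ⟦ b ⟧
      go true q = ∑-≐ (cl (φ v)) (cl< (φ v) (∧-intro (trans (cong not (φ-side v)) (cong (λ b → not (not b)) h)) (proj₁ (∧-true {not (dum (φ v))} q))))
      go false q = ∑-0 {k₁} (λ _ → refl)

    lockd-B : ∀ v → side v ≡ false → dum v ≡ false → lockd v ≡ 1
    lockd-B v h q = trans (∑-cong (λ i → cong ⟦_⟧ (lock-B i v h q))) (∑-≐ (cl v) (cl< v (∧-intro (cong not h) (cong not q))))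

    lockd-dum : ∀ v → dum v ≡ true → lockd v ≡ T
    lockd-dum v q = trans (∑-cong (λ i → trans (cong₂ (λ a d → ⟦ pickL a d (χ v ∧ (i ≐ cl (φ v))) (has i) (i ≐ cl v) ⟧) (dum-B v q) q) (has-eq i))) ∑-reps

-- From the edge colouring to a total colouring

module Assembly where
  open Prelude
  open Sums
  open Kempe
  open EdgeColouring
  open Sides
  open Distribute
  open Stage1
  open Bipartite
  open Partition
  open Classes
  open import Data.Fin.Properties using (toℕ-↑ˡ; toℕ-↑ʳ)

  record TotalColouring {N} (G : SimpleGraph N) (bound : ℕ) : Set where
    no-eta-equality
    open SimpleGraph G
    field
      vcol : Fin N → ℕ
      ecol : Fin N → Fin N → ℕ
      vcol< : ∀ v → vcol v < bound
      ecol< : ∀ u v → E u v ≡ true → ecol u v < bound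
      ecol-sym : ∀ u v → E u v ≡ true → ecol u v ≡ ecol v u
      vertex-proper : ∀ u v → E u v ≡ true → vcol u ≢ vcol v
      edge-proper : ∀ u v w → E u v ≡ true → E u w ≡ true → v ≢ w → ecol u v ≢ ecol u w
      incidence-proper : ∀ u v → E u v ≡ true → ecol u v ≢ vcol u

  -- For odd order (o = true) a dummy vertex is added to the side B = {side = false}; it stands for the colours missing at
  -- the vertices of A, and its colour-i edge is absent exactly when colour i is used on a vertex of B.
  record AssemblyData {N} (G : SimpleGraph N) : Set where
    no-eta-equality
    field
      side dum χ : Fin N → Bool
      o : Bool
      r T e D : ℕ
      nums : Numbers
      lock₁ : Fin (Numbers.k₁ nums) → Fin N → Bool
      f clB : Fin N → ℕ
      deg-eq : ∀ v → SimpleGraph.deg G v + ⟦ dum v ⟧ * r ≡ r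
      one-dummy : ∑ (λ v → ⟦ dum v ⟧) ≡ ⟦ o ⟧
      dum-B : ∀ v → dum v ≡ true → side v ≡ false
      halfA : ∑ (λ v → ⟦ side v ⟧) ≡ Numbers.m nums
      halfB : ∑ (λ v → ⟦ not (side v) ⟧) ≡ Numbers.m nums
      odd-r : o ≡ true → r ≡ T + T
      few-locks : ∀ i → ∑ (λ v → ⟦ lock₁ i v ⟧) ≤ Numbers.c nums
      lock-even : ∀ i → ∃ λ h → ∑ (λ v → ⟦ lock₁ i v ⟧) ≡ h + h
      lockd-A : ∀ v → side v ≡ true → ∑ (λ i → ⟦ lock₁ i v ⟧) ≡ ⟦ χ v ⟧
      lockd-B : ∀ v → side v ≡ false → dum v ≡ false → ∑ (λ i → ⟦ lock₁ i v ⟧) ≡ 1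
      lockd-dum : ∀ v → dum v ≡ true → ∑ (λ i → ⟦ lock₁ i v ⟧) ≡ T
      lock-B : ∀ i v → side v ≡ false → dum v ≡ false → lock₁ i v ≡ (i ≐ clB v)
      ρ-χ : o ≡ true → ∑ (λ u → ⟦ side u ∧ not (χ u) ⟧) ≡ suc T
      χ-even : o ≡ false → ∀ v → χ v ≡ true
      A≤B : ∀ v → nbrs (SimpleGraph.E G) side v ≤ nbrs (SimpleGraph.E G) (λ u → not (side u)) v + e
      B≤A : ∀ v → nbrs (SimpleGraph.E G) (λ u → not (side u)) v ≤ nbrs (SimpleGraph.E G) side v + e
      f< : ∀ v → side v ≡ true → f v < suc D
      f-proper : ∀ u v → side u ≡ true → side v ≡ true → SimpleGraph.E G u v ≡ true → f u ≢ f v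
      clB< : ∀ v → side v ≡ false → dum v ≡ false → clB v < Numbers.k₁ nums
      clB-proper : ∀ u v → side u ≡ false → side v ≡ false → SimpleGraph.E G u v ≡ true → clB u ≢ clB v
      D-eq : D + (Numbers.k₁ nums + Numbers.ℓ nums) ≡ suc r
      T≤k₁ : T + Numbers.slack nums ≤ Numbers.k₁ nums
      k₁≤T : Numbers.k₁ nums ≤ T + Numbers.g nums
      same-hi : r + e + 2 + (Numbers.slack nums + Numbers.slack nums) ≤ Numbers.k₁ nums + Numbers.k₁ nums
      same-lo : Numbers.k₁ nums + Numbers.k₁ nums + e ≤ r + (Numbers.g nums + Numbers.g nums)
      cross-lo : Numbers.M₀ nums + Numbers.M₀ nums + e ≤ r
      cross-lo′ : Numbers.M₀ nums ≤ suc T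

  module Assemble {N} (G : SimpleGraph N) (setup : AssemblyData G) where
    open AssemblyData setup
    open SimpleGraph G
    open Numbers nums using (m; k₁; ℓ; c; slack; g; M₀)

    private
      s = Fs side
      x′ = Fc side

      lockd : Fin N → ℕ
      lockd v = ∑ (λ i → ⟦ lock₁ i v ⟧)

      parts : ∑ (λ v → ⟦ not (side v) ∧ not (dum v) ⟧) + ⟦ o ⟧ ≡ m
      parts = trans (cong (∑ (λ v → ⟦ not (side v) ∧ not (dum v) ⟧) +_) (sym one-dummy)) (trans (sym (∑-+ _ _)) (trans (∑-cong (λ v → pt (side v) (dum v) (dum-B v))) halfB))
        where
        pt : ∀ a d → (d ≡ true → a ≡ false) → ⟦ not a ∧ not d ⟧ + ⟦ d ⟧ ≡ ⟦ not a ⟧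
        pt true true h = case h refl of λ ()
        pt true false _ = refl
        pt false true _ = refl
        pt false false _ = refl

      -- The dummy vertex is joined to the vertices of A without a lock, T + 1 in number by `ρ-χ`.
      -- Its degree plus locks becomes (T + 1) + T = r + 1, and its neighbours, which have no lock,
      -- reach r + 1 as well.
      Γ : SimpleGraph N
      Γ .SimpleGraph.E u v = E u v ∨ ((dum u ∧ (side v ∧ not (χ v))) ∨ (dum v ∧ (side u ∧ not (χ u))))
      Γ .SimpleGraph.E-sym u v = cong₂ _∨_ (E-sym u v) (or-comm (dum u ∧ (side v ∧ not (χ v))) _)
        where
        or-comm : ∀ a b → a ∨ b ≡ b ∨ a
        or-comm true true = refl
        or-comm true false = refl
        or-comm false true = refl
        or-comm false false = refl
      Γ .SimpleGraph.E-irr v with isTrue (dum v)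
      ... | inj₁ q rewrite E-irr v | q | dum-B v q = refl
      ... | inj₂ q rewrite E-irr v | q = refl

      EΓ = SimpleGraph.E Γ

      no-dum-edge : ∀ u v → dum u ≡ true → E u v ≡ false
      no-dum-edge u v q = ¬true (λ h → 1+n≢0 (trans (cong suc (sym (m+n∸n≡m 0 0))) (pos h)))
        where
        deg0 : deg u ≡ 0
        deg0 = +-cancelʳ-≡ r _ _ (trans (cong (deg u +_) (sym (trans (cong (λ b → ⟦ b ⟧ * r) q) (+-identityʳ r)))) (deg-eq u))
        pos : E u v ≡ true → 1 ≡ 0
        pos h = trans (sym (cong ⟦_⟧ h)) (∑≡0 {f = λ v → ⟦ E u v ⟧} deg0 v)

      -- The new edges join A to the dummy vertex, hence cross.
      same-Γ : ∀ v → samedeg Γ side v ≡ samedeg G side v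
      same-Γ v = ∑-cong (λ u → pt u)
        where
        pt : ∀ u → s v u * ⟦ EΓ v u ⟧ ≡ s v u * ⟦ E v u ⟧
        pt u with isTrue (dum v) | isTrue (dum u)
        ... | inj₁ p | inj₁ q rewrite p | q | dum-B v p | dum-B u q with E v u
        ...   | true = refl
        ...   | false = refl
        pt u | inj₁ p | inj₂ q rewrite p | q | dum-B v p | no-dum-edge v u p with side u
        ...   | true = trans (cong (_* ⟦ (true ∧ not (χ u)) ∨ false ⟧) (cong ⟦_⟧ (∧-f (not (v == u))))) (sym (*-zeroʳ ⟦ not (v == u) ∧ false ⟧))
          where
          ∧-f : ∀ b → b ∧ false ≡ false
          ∧-f true = refl
          ∧-f false = refl
        ...   | false = refl
        pt u | inj₂ p | inj₁ q rewrite p | q | dum-B u q | trans (E-sym v u) (no-dum-edge u v q) with side v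
        ...   | true = trans (cong (_* ⟦ true ∧ not (χ v) ⟧) (cong ⟦_⟧ (∧-f (not (v == u))))) (sym (*-zeroʳ ⟦ not (v == u) ∧ false ⟧))
          where
          ∧-f : ∀ b → b ∧ false ≡ false
          ∧-f true = refl
          ∧-f false = refl
        ...   | false = refl
        pt u | inj₂ p | inj₂ q rewrite p | q with E v u
        ...   | true = refl
        ...   | false = refl

      deg-split′ : ∀ v → samedeg G side v + crossdeg G side v ≡ deg v
      deg-split′ v = trans (sym (∑-+ _ _)) (∑-cong pt)
        where
        pt : ∀ u → s v u * ⟦ E v u ⟧ + x′ v u * ⟦ E v u ⟧ ≡ ⟦ E v u ⟧
        pt u = trans (sym (*-distribʳ-+ ⟦ E v u ⟧ (s v u) (x′ v u))) (trans (cong (_* ⟦ E v u ⟧) (sym (ne-split side v u))) (abs (isTrue (E v u))))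
          where
          abs : E v u ≡ true ⊎ E v u ≡ false → ne v u * ⟦ E v u ⟧ ≡ ⟦ E v u ⟧
          abs (inj₁ h) rewrite h = trans (*-identityʳ _) (ne-≢ (≢-of h))
          abs (inj₂ h) rewrite h = *-zeroʳ (ne v u)

      deg-real : ∀ v → dum v ≡ false → deg v ≡ r
      deg-real v q = trans (sym (+-identityʳ _)) (trans (cong (λ b → deg v + ⟦ b ⟧ * r) (sym q)) (deg-eq v))

      deg-dum : ∀ v → dum v ≡ true → deg v ≡ 0
      deg-dum v q = ∑-0 (λ u → cong ⟦_⟧ (no-dum-edge v u q))

      close-deg : ∀ v → samedeg G side v ≤ crossdeg G side v + e × crossdeg G side v ≤ samedeg G side v + e
      close-deg v with isTrue (side v)
      ... | inj₁ q = subst₂ _≤_ (sym (eqA q)) (cong (_+ e) (sym (eqA′ q))) (A≤B v) , subst₂ _≤_ (sym (eqA′ q)) (cong (_+ e) (sym (eqA q))) (B≤A v)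
        where
        eqA : side v ≡ true → samedeg G side v ≡ nbrs E side v
        eqA q = ∑-cong pt
          where
          pt : ∀ u → s v u * ⟦ E v u ⟧ ≡ ⟦ E v u ⟧ * ⟦ side u ⟧
          pt u with isTrue (E v u)
          ... | inj₂ h rewrite h = *-zeroʳ (s v u)
          ... | inj₁ h rewrite h | ==-≢ (≢-of h) | q with side u
          ...   | true = refl
          ...   | false = refl
        eqA′ : side v ≡ true → crossdeg G side v ≡ nbrs E (λ u → not (side u)) v
        eqA′ q = ∑-cong pt
          where
          pt : ∀ u → x′ v u * ⟦ E v u ⟧ ≡ ⟦ E v u ⟧ * ⟦ not (side u) ⟧
          pt u rewrite q = *-comm ⟦ not (side u) ⟧ _
      ... | inj₂ q = subst₂ _≤_ (sym (eqB q)) (cong (_+ e) (sym (eqB′ q))) (B≤A v) , subst₂ _≤_ (sym (eqB′ q)) (cong (_+ e) (sym (eqB q))) (A≤B v)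
        where
        eqB : side v ≡ false → samedeg G side v ≡ nbrs E (λ u → not (side u)) v
        eqB q = ∑-cong pt
          where
          pt : ∀ u → s v u * ⟦ E v u ⟧ ≡ ⟦ E v u ⟧ * ⟦ not (side u) ⟧
          pt u with isTrue (E v u)
          ... | inj₂ h rewrite h = *-zeroʳ (s v u)
          ... | inj₁ h rewrite h | ==-≢ (≢-of h) | q with side u
          ...   | true = refl
          ...   | false = refl
        eqB′ : side v ≡ false → crossdeg G side v ≡ nbrs E side v
        eqB′ q = ∑-cong pt
          where
          pt : ∀ u → x′ v u * ⟦ E v u ⟧ ≡ ⟦ E v u ⟧ * ⟦ side u ⟧
          pt u rewrite q = *-comm ⟦ side u ⟧ _

      half≤ : ∀ {a b} → a + a ≤ b + b → a ≤ b
      half≤ h = ≮⇒≥ (λ lt → <⇒≱ (+-mono-< lt lt) h)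

      real-sum : ∀ v → dum v ≡ false → samedeg G side v + crossdeg G side v ≡ r
      real-sum v q = trans (deg-split′ v) (deg-real v q)

      lockd≤1 : ∀ v → dum v ≡ false → lockd v ≤ 1
      lockd≤1 v q with isTrue (side v)
      ... | inj₁ h = ≤-trans (≤-reflexive (lockd-A v h)) (⟦⟧≤1 _)
      ... | inj₂ h = ≤-reflexive (lockd-B v h q)

      same-dum : ∀ v → dum v ≡ true → samedeg G side v ≡ 0
      same-dum v q = m+n≡0⇒m≡0 _ (trans (deg-split′ v) (deg-dum v q))

      same≤ : ∀ v → samedeg Γ side v + lockd v + slack ≤ k₁
      same≤ v with isTrue (dum v)
      -- The dummy vertex has no same-side edges; its `T` locks, about half of r, take their place.
      ... | inj₁ q = ≤-trans (≤-reflexive (cong₂ (λ a b → a + b + slack) (trans (same-Γ v) (same-dum v q)) (lockd-dum v q))) T≤k₁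
      ... | inj₂ q = ≤-trans (+-monoˡ-≤ slack (+-mono-≤ (≤-reflexive (same-Γ v)) (lockd≤1 v q))) (half≤ (≤-trans (lin 0 (proj₁ (close-deg v)) (ar sm cr e slack)) (≤-trans (≤-reflexive (cong (λ t → t + e + 2 + (slack + slack)) (real-sum v q))) same-hi)))
        where
        sm = samedeg G side v
        cr = crossdeg G side v
        ar : ∀ a b e s → a + b + e + 2 + (s + s) + a ≡ a + 1 + s + (a + 1 + s) + (b + e) + 0
        ar = solve-∀

      same≥ : ∀ v → k₁ ≤ samedeg Γ side v + lockd v + g
      same≥ v with isTrue (dum v)
      ... | inj₁ q = ≤-trans k₁≤T (≤-reflexive (cong₂ (λ a b → a + b + g) (sym (trans (same-Γ v) (same-dum v q))) (sym (lockd-dum v q))))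
      ... | inj₂ q = half≤ (≤-trans (+-cancelʳ-≤ e _ _ (≤-trans same-lo (≤-trans (≤-reflexive (cong (_+ (g + g)) (sym (real-sum v q)))) (lin 0 (proj₂ (close-deg v)) (ar sm cr e g)))))
          (+-mono-≤ le le))
        where
        sm = samedeg G side v
        cr = crossdeg G side v
        ar : ∀ a b e g → (a + g) + (a + g) + e + b ≡ a + b + (g + g) + (a + e) + 0
        ar = solve-∀
        le : sm + g ≤ samedeg Γ side v + lockd v + g
        le = +-monoˡ-≤ g (≤-trans (≤-reflexive (sym (same-Γ v))) (m≤m+n _ _))

      o-true : ∀ v → dum v ≡ true → o ≡ true
      o-true v q with isTrue o
      ... | inj₁ h = h
      ... | inj₂ h = ⊥-elim (n≮0 (≤-trans (≤-trans (≤-reflexive (cong ⟦_⟧ (sym q))) (term≤∑ (λ v → ⟦ dum v ⟧) v)) (≤-reflexive (trans one-dummy (cong ⟦_⟧ h)))))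

      cross≥ : ∀ v → M₀ ≤ crossdeg Γ side v
      cross≥ v with isTrue (dum v)
      ... | inj₁ q = ≤-trans cross-lo′ (≤-trans (≤-reflexive (sym (ρ-χ (o-true v q)))) (∑-mono pt))
        where
        pt : ∀ u → ⟦ side u ∧ not (χ u) ⟧ ≤ x′ v u * ⟦ EΓ v u ⟧
        pt u rewrite q | dum-B v q | no-dum-edge v u q with side u | χ u
        ... | true | false = s≤s z≤n
        ... | true | true = z≤n
        ... | false | _ = z≤n
      ... | inj₂ q = ≤-trans (half≤ (+-cancelʳ-≤ e _ _ (≤-trans cross-lo (≤-trans (≤-reflexive (sym (real-sum v q))) (lin 0 (proj₁ (close-deg v)) (ar (samedeg G side v) (crossdeg G side v) e))))))
          (∑-mono (λ u → *-monoʳ-≤ (x′ v u) (⟦⟧-mono {E v u} {EΓ v u} (λ h → cong (_∨ ((dum v ∧ (side u ∧ not (χ u))) ∨ (dum u ∧ (side v ∧ not (χ v))))) h))))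
        where
        ar : ∀ a b e → b + b + e + a ≡ a + b + (b + e) + 0
        ar = solve-∀

      cross-equal : ∑ (λ v → ⟦ side v ⟧ * crossdeg G side v) ≡ ∑ (λ v → ⟦ not (side v) ⟧ * crossdeg G side v)
      cross-equal = trans (∑-cong (λ v → sym (∑-*ˡ ⟦ side v ⟧ (λ u → x′ v u * ⟦ E v u ⟧)))) (trans (∑-swap _)
        (∑-cong (λ u → trans (∑-cong (λ v → pt v u)) (∑-*ˡ ⟦ not (side u) ⟧ (λ v → x′ u v * ⟦ E u v ⟧)))))
        where
        pt : ∀ v u → ⟦ side v ⟧ * (x′ v u * ⟦ E v u ⟧) ≡ ⟦ not (side u) ⟧ * (x′ u v * ⟦ E u v ⟧)
        pt v u rewrite E-sym v u with side v | side u
        ... | true | true = refl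
        ... | true | false = refl
        ... | false | true = refl
        ... | false | false = refl

      -- Cross degrees agree in total, so it is enough to compare degrees in `G` plus locks. For odd
      -- order this means m r + (m - T - 1) = (m - 1)(r + 1) + T, that is r = 2 T, which determines
      -- the number of classes in B.
      balance : ∑ (λ v → ⟦ side v ⟧ * (samedeg Γ side v + lockd v)) ≡ ∑ (λ v → ⟦ not (side v) ⟧ * (samedeg Γ side v + lockd v))
      balance = +-cancelʳ-≡ (∑ (λ v → ⟦ side v ⟧ * crossdeg G side v)) _ _ (trans (sum side) (trans (AB (isTrue o)) (trans (sym (sum (λ v → not (side v))))
          (cong (∑ (λ v → ⟦ not (side v) ⟧ * (samedeg Γ side v + lockd v)) +_) (sym cross-equal)))))
        where
        sum : (P : Fin N → Bool) → ∑ (λ v → ⟦ P v ⟧ * (samedeg Γ side v + lockd v)) + ∑ (λ v → ⟦ P v ⟧ * crossdeg G side v) ≡ ∑ (λ v → ⟦ P v ⟧ * (deg v + lockd v))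
        sum P = trans (sym (∑-+ _ _)) (∑-cong (λ v → trans (sym (*-distribˡ-+ ⟦ P v ⟧ (samedeg Γ side v + lockd v) (crossdeg G side v))) (cong (⟦ P v ⟧ *_)
          (trans (cong (λ t → t + lockd v + crossdeg G side v) (same-Γ v)) (trans (ar (samedeg G side v) (lockd v) (crossdeg G side v)) (cong (_+ lockd v) (deg-split′ v)))))))
          where
          ar : ∀ a b c → a + b + c ≡ a + c + b
          ar = solve-∀
        A-val : ∑ (λ v → ⟦ side v ⟧ * (deg v + lockd v)) ≡ m * r + ∑ (λ v → ⟦ side v ∧ χ v ⟧)
        A-val = trans (∑-cong pt) (trans (∑-+ _ _) (cong (_+ ∑ (λ v → ⟦ side v ∧ χ v ⟧)) (trans (∑-*ʳ r (λ v → ⟦ side v ⟧)) (cong (_* r) halfA))))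
          where
          pt : ∀ v → ⟦ side v ⟧ * (deg v + lockd v) ≡ ⟦ side v ⟧ * r + ⟦ side v ∧ χ v ⟧
          pt v with isTrue (side v)
          ... | inj₁ h rewrite h | lockd-A v h | deg-real v (¬true (λ q → tf h (dum-B v q))) = lem r ⟦ χ v ⟧
            where
            lem : ∀ a b → a + b + 0 ≡ a + 0 + b
            lem = solve-∀
          ... | inj₂ h rewrite h = refl
        B-val : ∑ (λ v → ⟦ not (side v) ⟧ * (deg v + lockd v)) ≡ ∑ (λ v → ⟦ not (side v) ∧ not (dum v) ⟧) * (r + 1) + ⟦ o ⟧ * T
        B-val = trans (∑-cong pt) (trans (∑-+ _ _) (cong₂ _+_ (∑-*ʳ (r + 1) (λ v → ⟦ not (side v) ∧ not (dum v) ⟧)) (trans (∑-*ʳ T (λ v → ⟦ dum v ⟧)) (cong (_* T) one-dummy))))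
          where
          pt : ∀ v → ⟦ not (side v) ⟧ * (deg v + lockd v) ≡ ⟦ not (side v) ∧ not (dum v) ⟧ * (r + 1) + ⟦ dum v ⟧ * T
          pt v with isTrue (side v) | isTrue (dum v)
          ... | inj₁ h | inj₁ q = tf h (dum-B v q)
          ... | inj₁ h | inj₂ q rewrite h | q = refl
          ... | inj₂ h | inj₁ q rewrite h | q | lockd-dum v q | deg-dum v q = refl
          ... | inj₂ h | inj₂ q rewrite h | q | lockd-B v h q | deg-real v q = sym (+-identityʳ _)
        AB : o ≡ true ⊎ o ≡ false → ∑ (λ v → ⟦ side v ⟧ * (deg v + lockd v)) ≡ ∑ (λ v → ⟦ not (side v) ⟧ * (deg v + lockd v))
        AB (inj₁ q) = trans A-val (+-cancelʳ-≡ (suc T) _ _ (trans (+-assoc (m * r) _ _) (trans (cong (m * r +_) (trans (cong (∑ (λ v → ⟦ side v ∧ χ v ⟧) +_) (sym (ρ-χ q)))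
              (trans (sym (∑-+ _ _)) (trans (∑-cong pt) halfA)))) (trans fin (cong (_+ suc T) (sym B-val))))))
          where
          pt : ∀ u → ⟦ side u ∧ χ u ⟧ + ⟦ side u ∧ not (χ u) ⟧ ≡ ⟦ side u ⟧
          pt u with side u | χ u
          ... | true | true = refl
          ... | true | false = refl
          ... | false | _ = refl
          P = ∑ (λ v → ⟦ not (side v) ∧ not (dum v) ⟧)
          fin : m * r + m ≡ P * (r + 1) + ⟦ o ⟧ * T + suc T
          fin = trans (cong (λ x → x * r + x) (trans (sym parts) (cong (λ b → P + ⟦ b ⟧) q))) (trans (ar P r) (trans (cong (λ t → P * (r + 1) + t + 1) (odd-r q)) (trans (ar2 (P * (r + 1)) T) (cong (λ b → P * (r + 1) + ⟦ b ⟧ * T + suc T) (sym q)))))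
            where
            ar : ∀ p r → (p + 1) * r + (p + 1) ≡ p * (r + 1) + r + 1
            ar = solve-∀
            ar2 : ∀ x t → x + (t + t) + 1 ≡ x + 1 * t + suc t
            ar2 = solve-∀
        AB (inj₂ q) = trans A-val (trans (cong (m * r +_) (trans (∑-cong pt) halfA)) (trans (ar m r) (sym (trans B-val (cong₂ (λ p b → p * (r + 1) + ⟦ b ⟧ * T) (trans (sym (+-identityʳ _)) (trans (cong (λ b → ∑ (λ v → ⟦ not (side v) ∧ not (dum v) ⟧) + ⟦ b ⟧) (sym q)) parts)) q)))))
          where
          ar : ∀ m r → m * r + m ≡ m * (r + 1) + 0
          ar = solve-∀
          pt : ∀ v → ⟦ side v ∧ χ v ⟧ ≡ ⟦ side v ⟧
          pt v = trans (cong (λ b → ⟦ side v ∧ b ⟧) (χ-even q v)) (lem (side v))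
            where
            lem : ∀ a → ⟦ a ∧ true ⟧ ≡ ⟦ a ⟧
            lem true = refl
            lem false = refl

      module St = Stage Γ side nums lock₁

      k = St.k

    module Final (R : St.Coloured) where
      open Stage.Coloured R
      private
        module C = Colouring colouring

        locked-class : ∀ (i : Fin k) v → side v ≡ false → dum v ≡ false → toℕ i ≡ clB v → C.p i v ≡ v
        locked-class i v sv dv h = C.locked i v (go (view {k₁} {ℓ} i) h)
          where
          go : ∀ {i} → View {k₁} {ℓ} i → toℕ i ≡ clB v → St.lock i v ≡ true
          go (left j) h = trans (glue-l (λ j → lock₁ j v) (λ (_ : Fin ℓ) → false) j) (trans (lock-B j v sv dv) (≐-complete {i = j} (trans (sym (toℕ-↑ˡ j ℓ)) h)))
          go (right j) h = ⊥-elim (<⇒≱ (clB< v sv dv) (≤-trans (m≤m+n k₁ (toℕ j)) (≤-reflexive (trans (sym (toℕ-↑ʳ k₁ j)) h))))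

        -- The edges for the last D + 1 colours. Edges at the dummy vertex have served their purpose
        -- and are dropped.
        H : SimpleGraph N
        H .SimpleGraph.E u v = E u v ∧ ((side u xor side v) ∧ not (does (C.hit? u v)))
        H .SimpleGraph.E-sym u v = cong₂ _∧_ (E-sym u v) (cong₂ (λ a b → a ∧ not b) (xor-comm side (side u) (side v)) (hs u v))
          where
          hs : ∀ u v → does (C.hit? u v) ≡ does (C.hit? v u)
          hs u v = Bool-≡ (λ h → does-complete (C.hit? v u) (fl (does-sound (C.hit? u v) h))) (λ h → does-complete (C.hit? u v) (fl (does-sound (C.hit? v u) h)))
            where
            fl : ∀ {u v} → (∃ λ i → C.p i u ≡ v) → ∃ λ i → C.p i v ≡ u
            fl (i , q) = i , trans (cong (C.p i) (sym q)) (C.inv i _)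
        H .SimpleGraph.E-irr v = cong (_∧ ((side v xor side v) ∧ not (does (C.hit? v v)))) (E-irr v)

        bip : ∀ u v → SimpleGraph.E H u v ≡ true → side v ≡ not (side u)
        bip u v h = fl (side u) (side v) (proj₁ (∧-true (proj₂ (∧-true {E u v} h))))
          where
          fl : ∀ a b → a xor b ≡ true → b ≡ not a
          fl true false _ = refl
          fl false true _ = refl

        lockdeg-k : ∀ v → ∑ (λ i → ⟦ St.lock i v ⟧) ≡ lockd v
        lockdeg-k v = trans (∑-↑ {k₁} ℓ _) (trans (cong₂ _+_ (∑-cong (λ j → cong ⟦_⟧ (glue-l (λ j → lock₁ j v) (λ (_ : Fin ℓ) → false) j)))
          (∑-0 (λ j → cong ⟦_⟧ (glue-r (λ j → lock₁ j v) (λ (_ : Fin ℓ) → false) j)))) (+-identityʳ _))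

        row-k : ∀ v → samedeg G side v + C.row x′ v + lockd v ≡ k
        row-k v = trans (cong₂ (λ a b → a + C.row x′ v + b) (trans (sym (same-Γ v)) (sym (all-same v))) (sym (lockdeg-k v)))
          (trans (cong (_+ ∑ (λ i → ⟦ St.lock i v ⟧)) (sym (row-split colouring side v))) (trans (sym (+-identityʳ _)) (trans (cong (C.row ne v + ∑ (λ i → ⟦ St.lock i v ⟧) +_) (sym (∑-0 (λ i → cong ⟦_⟧ (perfect i v))))) (C.row-total v))))

        crossΓ : ∀ v → dum v ≡ false → crossdeg Γ side v ≤ crossdeg G side v + ⟦ side v ∧ not (χ v) ⟧ * ⟦ o ⟧
        crossΓ v q = ≤-trans (∑-mono pt) (≤-reflexive (trans (∑-+ _ _) (cong (crossdeg G side v +_) (trans (∑-*ˡ ⟦ side v ∧ not (χ v) ⟧ (λ u → ⟦ dum u ⟧)) (cong (⟦ side v ∧ not (χ v) ⟧ *_) one-dummy)))))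
          where
          pt : ∀ u → x′ v u * ⟦ EΓ v u ⟧ ≤ x′ v u * ⟦ E v u ⟧ + ⟦ side v ∧ not (χ v) ⟧ * ⟦ dum u ⟧
          pt u rewrite q with E v u | dum u | side v ∧ not (χ v)
          ... | true | _ | _ = m≤m+n _ _
          ... | false | true | true = ≤-trans (≤-reflexive (*-identityʳ (x′ v u))) (≤-trans (⟦⟧≤1 _) (m≤n+m 1 _))
          ... | false | true | false = ≤-trans (≤-reflexive (*-zeroʳ (x′ v u))) z≤n
          ... | false | false | _ = ≤-trans (≤-reflexive (*-zeroʳ (x′ v u))) z≤n

        -- A vertex of A has a lock or an edge to the dummy vertex, never both.
        lock-dummy : ∀ v → dum v ≡ false → ⟦ side v ∧ not (χ v) ⟧ * ⟦ o ⟧ + lockd v ≤ 1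
        lock-dummy v q with isTrue (side v)
        ... | inj₂ h rewrite h | lockd-B v h q = ≤-refl
        ... | inj₁ h rewrite h | lockd-A v h with χ v
        ...   | true = ≤-refl
        ...   | false = ≤-trans (≤-reflexive (trans (+-identityʳ _) (+-identityʳ _))) (⟦⟧≤1 o)

        -- At a vertex other than the dummy each of the `k` colours is locked or used, while degree
        -- in `Γ` plus locks is at most r + 1. So at most r + 1 - k = D edges are uncoloured.
        degH : ∀ v → SimpleGraph.deg H v ≤ D
        degH v with isTrue (dum v)
        ... | inj₁ q = ≤-trans (≤-reflexive (∑-0 (λ u → cong (λ b → ⟦ b ∧ ((side v xor side u) ∧ not (does (C.hit? v u))) ⟧) (no-dum-edge v u q)))) z≤n
        ... | inj₂ q = +-cancelʳ-≤ k _ _ (≤-trans bound (≤-reflexive (sym D-eq)))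
          where
          sm = samedeg G side v
          rx = C.row x′ v
          h1 : SimpleGraph.deg H v + rx ≤ crossdeg Γ side v
          h1 = ≤-trans (+-monoˡ-≤ rx (∑-mono pt)) (≤-reflexive (trans (+-comm _ rx) (sym (C.deg-split x′ (Fc-diag side) v))))
            where
            pt : ∀ u → ⟦ SimpleGraph.E H v u ⟧ ≤ x′ v u * ⟦ C.unc v u ⟧
            pt u with E v u | side v xor side u
            ... | true | true = ≤-reflexive (sym (+-identityʳ _))
            ... | true | false = z≤n
            ... | false | _ = z≤n
          bound : SimpleGraph.deg H v + k ≤ suc r
          bound = lin 0 (+-mono-≤ (≤-trans h1 (crossΓ v q)) (lock-dummy v q)) (trans (cong (λ t → suc t + (SimpleGraph.deg H v + rx + (dl + lockd v))) (sym (real-sum v q)))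
            (trans (ar (SimpleGraph.deg H v) sm (crossdeg G side v) rx dl (lockd v)) (cong (λ t → SimpleGraph.deg H v + t + (crossdeg G side v + dl + 1) + 0) (row-k v))))
            where
            dl = ⟦ side v ∧ not (χ v) ⟧ * ⟦ o ⟧
            ar : ∀ h a b x d l → suc (a + b) + (h + x + (d + l)) ≡ h + (a + x + l) + (b + d + 1) + 0
            ar = solve-∀

        module Gv = Galvin.Result (Galvin.galvin H side D bip degH f)

        pick : ∀ u v → Dec (∃ λ i → C.p i u ≡ v) → ℕ
        pick u v (yes (i , _)) = toℕ i
        pick u v (no _) = k + Gv.col u v

        ecol : Fin N → Fin N → ℕ
        ecol u v = pick u v (C.hit? u v)

        data Kind (u v : Fin N) : Set where
          early : ∀ i → C.p i u ≡ v → ecol u v ≡ toℕ i → Kind u v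
          late : SimpleGraph.E H u v ≡ true → ecol u v ≡ k + Gv.col u v → Kind u v

        EΓ-of : ∀ {u v} → E u v ≡ true → EΓ u v ≡ true
        EΓ-of {u} {v} h = cong (_∨ ((dum u ∧ (side v ∧ not (χ v))) ∨ (dum v ∧ (side u ∧ not (χ u))))) h

        same-hit : ∀ u v → E u v ≡ true → side u xor side v ≡ false → (∀ i → C.p i u ≢ v) → ⊥
        same-hit u v h sv nh = 0≢1+n (trans (sym (∑≡0 z v)) one)
          where
          z : ∑ (λ w → s u w * ⟦ C.unc u w ⟧) ≡ 0
          z = +-cancelˡ-≡ (C.row s u) _ _ (trans (sym (C.deg-split s (Fs-diag side) u)) (trans (sym (all-same u)) (sym (+-identityʳ _))))
          one : s u v * ⟦ C.unc u v ⟧ ≡ 1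
          one = cong₂ (λ a b → a * ⟦ b ⟧) (Fs-1 side {u} {v} (≢-of h) sv) (C.unc-intro (EΓ-of h) nh)

        kind : ∀ u v → E u v ≡ true → Kind u v
        kind u v h = go (C.hit? u v) refl
          where
          go : (d : Dec (∃ λ i → C.p i u ≡ v)) → C.hit? u v ≡ d → Kind u v
          go (yes (i , q)) e = early i q (cong (pick u v) e)
          go (no nq) e = late (∧-intro h (∧-intro cross (cong not (does-false (C.hit? u v) nq)))) (cong (pick u v) e)
            where
            cross : side u xor side v ≡ true
            cross with isTrue (side u xor side v)
            ... | inj₁ q = q
            ... | inj₂ q = ⊥-elim (same-hit u v h q (λ i z → nq (i , z)))

        -- The dummy vertex has no edge in `G`, so its value 0 is arbitrary.
        vcol : Fin N → ℕ
        vcol v = if side v then k + f v else (if dum v then 0 else clB v)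

        vcol-A : ∀ {v} → side v ≡ true → vcol v ≡ k + f v
        vcol-A h rewrite h = refl

        vcol-B : ∀ {v} → side v ≡ false → dum v ≡ false → vcol v ≡ clB v
        vcol-B h q rewrite h | q = refl

        real-of : ∀ {u v} → E u v ≡ true → dum u ≡ false
        real-of h = ¬true (λ q → tf h (no-dum-edge _ _ q))

        bound-eq : k + suc D ≡ suc (suc r)
        bound-eq = trans (+-suc k D) (cong suc (trans (+-comm k D) D-eq))

        class<k : ∀ v → side v ≡ false → dum v ≡ false → clB v < k
        class<k v h q = ≤-trans (clB< v h q) (m≤m+n k₁ ℓ)

        k≤ : k ≤ suc (suc r)
        k≤ = ≤-trans (m≤m+n k (suc D)) (≤-reflexive bound-eq)

      -- Colours below `k` go to vertices of B and the others to vertices of A, so the two halves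
      -- never conflict. Incidences in B are proper by the locks, those in A by the colour forbidden
      -- in the list colouring.
      total : TotalColouring G (suc (suc r))
      total .TotalColouring.vcol = vcol
      total .TotalColouring.ecol = ecol
      total .TotalColouring.vcol< v with isTrue (side v) | isTrue (dum v)
      ... | inj₁ h | _ = ≤-trans (≤-reflexive (cong suc (vcol-A h))) (≤-trans (+-monoʳ-< k (f< v h)) (≤-reflexive bound-eq))
      ... | inj₂ h | inj₁ q rewrite h | q = s≤s z≤n
      ... | inj₂ h | inj₂ q = ≤-trans (≤-reflexive (cong suc (vcol-B h q))) (≤-trans (class<k v h q) k≤)
      total .TotalColouring.ecol< u v h with kind u v h
      ... | early i _ c = ≤-trans (≤-reflexive (cong suc c)) (≤-trans (toℕ<n i) k≤)
      ... | late e c = ≤-trans (≤-reflexive (cong suc c)) (≤-trans (+-monoʳ-< k (Gv.col< u v e)) (≤-reflexive bound-eq))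
      total .TotalColouring.ecol-sym u v h with kind u v h | kind v u (trans (E-sym v u) h)
      ... | early i q c | early j q′ c′ = trans c (trans (cong toℕ (C.disj i j u (λ z → ≢-of h (trans (sym z) q)) (trans q (sym (trans (cong (C.p j) (sym q′)) (C.inv j v)))))) (sym c′))
      ... | late e c | late e′ c′ = trans c (trans (cong (k +_) (Gv.col-sym u v e)) (sym c′))
      ... | early i q _ | late e′ _ = ⊥-elim (tf (does-complete (C.hit? v u) (i , trans (cong (C.p i) (sym q)) (C.inv i u))) (not-true (proj₂ (∧-true {side v xor side u} (proj₂ (∧-true {E v u} e′))))))
      ... | late e _ | early j q _ = ⊥-elim (tf (does-complete (C.hit? u v) (j , trans (cong (C.p j) (sym q)) (C.inv j v))) (not-true (proj₂ (∧-true {side u xor side v} (proj₂ (∧-true {E u v} e))))))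
      total .TotalColouring.vertex-proper u v h z with isTrue (side u) | isTrue (side v)
      ... | inj₁ a | inj₁ b = f-proper u v a b h (+-cancelˡ-≡ k _ _ (trans (sym (vcol-A a)) (trans z (vcol-A b))))
      ... | inj₂ a | inj₂ b = clB-proper u v a b h (trans (sym (vcol-B a ru)) (trans z (vcol-B b rv)))
        where
        ru = real-of h
        rv = real-of (trans (E-sym v u) h)
      ... | inj₁ a | inj₂ b = <⇒≱ (class<k v b rv) (≤-trans (m≤m+n k (f u)) (≤-reflexive (trans (sym (vcol-A a)) (trans z (vcol-B b rv)))))
        where rv = real-of (trans (E-sym v u) h)
      ... | inj₂ a | inj₁ b = <⇒≱ (class<k u a ru) (≤-trans (m≤m+n k (f v)) (≤-reflexive (trans (sym (vcol-A b)) (trans (sym z) (vcol-B a ru)))))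
        where ru = real-of h
      total .TotalColouring.edge-proper u v w h h′ v≢w z with kind u v h | kind u w h′
      ... | early i q c | early j q′ c′ = v≢w (trans (sym q) (trans (cong (λ l → C.p l u) (toℕ-injective (trans (sym c) (trans z c′)))) q′))
      ... | late e c | late e′ c′ = Gv.proper u v w e e′ v≢w (+-cancelˡ-≡ k _ _ (trans (sym c) (trans z c′)))
      ... | early i _ c | late _ c′ = <⇒≱ (toℕ<n i) (≤-trans (m≤m+n k _) (≤-reflexive (trans (sym c′) (trans (sym z) c))))
      ... | late _ c | early j _ c′ = <⇒≱ (toℕ<n j) (≤-trans (m≤m+n k _) (≤-reflexive (trans (sym c) (trans z c′))))
      total .TotalColouring.incidence-proper u v h z with kind u v h | isTrue (side u)
      ... | early i _ c | inj₁ a = <⇒≱ (toℕ<n i) (≤-trans (m≤m+n k (f u)) (≤-reflexive (trans (sym (vcol-A a)) (trans (sym z) c))))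
      ... | late e c | inj₁ a = Gv.allowed u v e a (+-cancelˡ-≡ k _ _ (trans (sym c) (trans z (vcol-A a))))
      ... | early i q c | inj₂ b = ≢-of h (trans (sym (locked-class i u b ru (trans (sym c) (trans z (vcol-B b ru))))) q)
        where ru = real-of h
      ... | late e c | inj₂ b = <⇒≱ (class<k u b ru) (≤-trans (m≤m+n k _) (≤-reflexive (trans (sym c) (trans z (vcol-B b ru)))))
        where ru = real-of h

    abstract
      total-colouring : TotalColouring G (suc (suc r))
      total-colouring = Final.total (St.Run.coloured halfA halfB few-locks lock-even cross≥ same≤ same≥ balance)

-- Classes and locks from a partition and a matching

module Wiring where
  open Prelude
  open Sums
  open EdgeColouring
  open Stage1
  open Partition
  open Classes
  open LockFamily
  open Assembly

  double≤ : ∀ {a b} → a + a ≤ b + b → a ≤ b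
  double≤ h = ≮⇒≥ (λ lt → <⇒≱ (+-mono-< lt lt) h)

  double≡ : ∀ {a b} → a + a ≡ b + b → a ≡ b
  double≡ h = ≤-antisym (double≤ (≤-reflexive h)) (double≤ (≤-reflexive (sym h)))

  quarter≤ : ∀ {a b} → (a + a) + (a + a) ≤ (b + b) + (b + b) → a ≤ b
  quarter≤ h = double≤ (double≤ h)

  module Halves {N m} (φ ψ : Fin N → Fin N) (side : Fin N → Bool) (φ-inv : ∀ v → φ (φ v) ≡ v) (ψ-inv : ∀ v → ψ (ψ v) ≡ v)
      (φψ : ∀ v → φ (ψ v) ≡ ψ (φ v)) (φ-side : ∀ v → side (φ v) ≡ not (side v)) (ψ-side : ∀ v → side (ψ v) ≡ side v) (half : N ≡ m + m) where

    private
      φ-ne : ∀ v → ne (φ v) (φ (ψ v)) ≡ ne v (ψ v)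
      φ-ne v with v ≟ ψ v
      ... | yes q = trans (cong (ne (φ v)) (cong φ (sym q))) (trans (ne-diag (φ v)) (sym (trans (cong (ne v) (sym q)) (ne-diag v))))
      ... | no h = trans (ne-≢ (λ q → h (trans (sym (φ-inv v)) (trans (cong φ q) (φ-inv (ψ v)))))) (sym (ne-≢ h))

      A=B : ∑ (λ v → ⟦ side v ⟧ * ne v (ψ v)) ≡ ∑ (λ v → ⟦ not (side v) ⟧ * ne v (ψ v))
      A=B = trans (sym (∑-inv φ φ-inv (λ v → ⟦ side v ⟧ * ne v (ψ v)))) (∑-cong (λ v → cong₂ (λ a b → ⟦ a ⟧ * b) (φ-side v) (trans (cong (ne (φ v)) (sym (φψ v))) (φ-ne v))))

    secA secB : ℕ
    secA = ∑ (λ v → ⟦ side v ∧ second ψ ψ-inv v ⟧)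
    secB = ∑ (λ v → ⟦ not (side v) ∧ second ψ ψ-inv v ⟧)

    private
      sA : ∑ (λ v → ⟦ side v ⟧ * ne v (ψ v)) ≡ secA + secA
      sA = seconds ψ ψ-inv side ψ-side
      sB : ∑ (λ v → ⟦ not (side v) ⟧ * ne v (ψ v)) ≡ secB + secB
      sB = seconds ψ ψ-inv (λ v → not (side v)) (λ v → cong not (ψ-side v))

    -- `φ` carries the pairs of `ψ` in A to those in B, so the number of covered vertices is four
    -- times the number of pairs in either half.
    cover-A : ∑ (λ v → ne v (ψ v)) ≡ secA + secA + (secA + secA)
    cover-A = trans (sym (∑-split side (λ v → ne v (ψ v)))) (cong₂ _+_ sA (trans (sym A=B) sA))

    cover-B : ∑ (λ v → ne v (ψ v)) ≡ secB + secB + (secB + secB)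
    cover-B = trans (sym (∑-split side (λ v → ne v (ψ v)))) (cong₂ _+_ (trans A=B sB) sB)

    private
      sideφ : ∑ (λ v → ⟦ side v ⟧) ≡ ∑ (λ v → ⟦ not (side v) ⟧)
      sideφ = trans (sym (∑-inv φ φ-inv (λ v → ⟦ side v ⟧))) (∑-cong (λ v → cong ⟦_⟧ (φ-side v)))

    halfA : ∑ (λ v → ⟦ side v ⟧) ≡ m
    halfA = double≡ (trans (cong (∑ (λ v → ⟦ side v ⟧) +_) sideφ) (trans (sym (∑-+ _ _)) (trans (∑-cong (λ v → ⟦⟧-not (side v))) (trans (∑-1 N) half))))

    halfB : ∑ (λ v → ⟦ not (side v) ⟧) ≡ m
    halfB = trans (sym sideφ) halfA

  -- A half contains a quarter as many pairs as there are covered vertices. `pairs-B` provides the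
  -- `ρ` pairs that leave exactly `T` classes in B, and `pairs-A` reduces A to at most D + 1
  -- classes; the summand 2 allows for the pair that the partition may break up.
  record WireData {N} (G : SimpleGraph N) : Set where
    no-eta-equality
    field
      dum : Fin N → Bool
      o : Bool
      r T e ρ D : ℕ
      ψ₀ : Fin N → Fin N
      nums : Numbers
      deg-eq : ∀ v → SimpleGraph.deg G v + ⟦ dum v ⟧ * r ≡ r
      one-dummy : ∑ (λ v → ⟦ dum v ⟧) ≡ ⟦ o ⟧
      half : N ≡ Numbers.m nums + Numbers.m nums
      odd-r : o ≡ true → r ≡ T + T
      ψ₀-non : ∀ v → ψ₀ v ≢ v → SimpleGraph.E G v (ψ₀ v) ≡ false × dum v ≡ false
      c-eq : Numbers.c nums ≡ 4
      ρ-eq : ρ + T + ⟦ o ⟧ ≡ Numbers.m nums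
      D-eq : D + (Numbers.k₁ nums + Numbers.ℓ nums) ≡ suc r
      T≤k₁ : T + Numbers.slack nums ≤ Numbers.k₁ nums
      k₁≤T : Numbers.k₁ nums ≤ T + Numbers.g nums
      same-hi : r + e + 2 + (Numbers.slack nums + Numbers.slack nums) ≤ Numbers.k₁ nums + Numbers.k₁ nums
      same-lo : Numbers.k₁ nums + Numbers.k₁ nums + e ≤ r + (Numbers.g nums + Numbers.g nums)
      cross-lo : Numbers.M₀ nums + Numbers.M₀ nums + e ≤ r
      cross-lo′ : Numbers.M₀ nums ≤ suc T
      pairs-B : (ρ + ρ) + (ρ + ρ) + 2 ≤ ∑ (λ v → ne v (ψ₀ v))
      pairs-A : (Numbers.m nums + Numbers.m nums) + (Numbers.m nums + Numbers.m nums) + 2 ≤ (suc D + suc D) + (suc D + suc D) + ∑ (λ v → ne v (ψ₀ v))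

  module Wire {N} (G : SimpleGraph N) (setup : WireData G) where
    open WireData setup
    open SimpleGraph G
    open Numbers nums using (m; k₁; ℓ; c; slack; g; M₀)

    module Oriented (S : Split E ψ₀ e) (dum-B : ∀ v → dum v ≡ true → Split.side S v ≡ false) where
      open Split S
      module Hv = Halves {m = m} φ ψ side φ-inv ψ-inv φψ φ-side ψ-side half
      open Hv using (secA; secB; halfA; halfB)

      private
        part : Fin N → Bool
        part v = not (side v) ∧ not (dum v)

        real-ψ : ∀ v → ψ v ≢ v → dum v ≡ false × E v (ψ v) ≡ false
        real-ψ v h with ψ-sub v
        ... | inj₁ q = ⊥-elim (h q)
        ... | inj₂ q = proj₂ (ψ₀-non v (λ z → h (trans q z))) , trans (cong (E v) q) (proj₁ (ψ₀-non v (λ z → h (trans q z))))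

        moved-ψ : ∀ v → ψ v ≢ v → ψ (ψ v) ≢ ψ v
        moved-ψ v h q = h (trans (sym q) (ψ-inv v))

        not-ψ : ∀ u v → E u v ≡ true → u ≡ v ⊎ u ≡ ψ v → ⊥
        not-ψ u v h (inj₁ q) = ≢-of h q
        not-ψ u v h (inj₂ q) = tf (trans (E-sym v u) h) (trans (cong (E v) q) (proj₂ (real-ψ v (λ z → ≢-of h (trans q z)))))

        nrA : Fin N → Bool
        nrA v = side v ∧ second ψ ψ-inv v

        nrA-part : ∀ v → nrA v ≡ true → side v ≡ true × side (ψ v) ≡ true × nrA (ψ v) ≡ false
        nrA-part v h = sv , trans (ψ-side v) sv , ¬true (λ h′ → tf (proj₂ (∧-true {side (ψ v)} h′)) (second-ψ ψ ψ-inv v (proj₂ (∧-true {side v} h))))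
          where sv = proj₁ (∧-true {side v} h)

        module A = Indexed ψ ψ-inv side nrA nrA-part

        repA≤ : ∑ (λ v → ⟦ A.rep v ⟧) ≤ suc D
        repA≤ = quarter≤ (+-cancelʳ-≤ ((secA + secA) + (secA + secA) + 2) _ _ (≤-trans (≤-reflexive eq) (≤-trans pairs-A
            (≤-trans (+-monoʳ-≤ ((suc D + suc D) + (suc D + suc D)) ψ-cover) (≤-reflexive (cong (λ t → (suc D + suc D) + (suc D + suc D) + (t + 2)) Hv.cover-A))))))
          where
          x = ∑ (λ v → ⟦ A.rep v ⟧)
          ar : ∀ x s → x + x + (x + x) + (s + s + (s + s) + 2) ≡ (x + s) + (x + s) + ((x + s) + (x + s)) + 2
          ar = solve-∀
          eq : x + x + (x + x) + (secA + secA + (secA + secA) + 2) ≡ (m + m) + (m + m) + 2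
          eq = trans (ar x secA) (cong (λ t → t + t + (t + t) + 2) (trans A.rep-count halfA))

        ρ≤ : ρ ≤ secB
        ρ≤ = quarter≤ (+-cancelʳ-≤ 2 _ _ (≤-trans pairs-B (≤-trans ψ-cover (≤-reflexive (cong (_+ 2) Hv.cover-B)))))

      module Core (nr : Fin N → Bool) (nr-sub : ∀ v → nr v ≡ true → not (side v) ∧ second ψ ψ-inv v ≡ true) (nr-size : ∑ (λ v → ⟦ nr v ⟧) ≡ ρ) where
        private
          nr-part : ∀ v → nr v ≡ true → part v ≡ true × part (ψ v) ≡ true × nr (ψ v) ≡ false
          nr-part v h = ∧-intro nb (cong not (proj₁ (real-ψ v mv)))
                      , ∧-intro (trans (cong not (ψ-side v)) nb) (cong not (proj₁ (real-ψ (ψ v) (moved-ψ v mv))))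
                      , ¬true (λ h′ → tf (proj₂ (∧-true {not (side (ψ v))} (nr-sub (ψ v) h′))) (second-ψ ψ ψ-inv v sc))
            where
            nb = proj₁ (∧-true {not (side v)} (nr-sub v h))
            sc = proj₂ (∧-true {not (side v)} (nr-sub v h))
            mv = second-moved ψ ψ-inv v sc

          module B = Indexed ψ ψ-inv part nr nr-part

          parts : ∑ (λ v → ⟦ part v ⟧) + ⟦ o ⟧ ≡ m
          parts = trans (cong (∑ (λ v → ⟦ part v ⟧) +_) (sym one-dummy)) (trans (sym (∑-+ _ _)) (trans (∑-cong (λ v → pt (side v) (dum v) (dum-B v))) halfB))
            where
            pt : ∀ a d → (d ≡ true → a ≡ false) → ⟦ not a ∧ not d ⟧ + ⟦ d ⟧ ≡ ⟦ not a ⟧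
            pt true true h = case h refl of λ ()
            pt true false _ = refl
            pt false true _ = refl
            pt false false _ = refl

          T-eq : ∑ (λ v → ⟦ B.rep v ⟧) ≡ T
          T-eq = +-cancelʳ-≡ (ρ + ⟦ o ⟧) _ _ (trans (sym (+-assoc _ ρ ⟦ o ⟧)) (trans (cong (λ t → ∑ (λ v → ⟦ B.rep v ⟧) + t + ⟦ o ⟧) (sym nr-size))
            (trans (cong (_+ ⟦ o ⟧) B.rep-count) (trans parts (trans (sym ρ-eq) (ar ρ T ⟦ o ⟧))))))
            where
            ar : ∀ a b c → a + b + c ≡ b + (a + c)
            ar = solve-∀

          T≤ : ∑ (λ v → ⟦ B.rep v ⟧) ≤ k₁
          T≤ = ≤-trans (≤-reflexive T-eq) (m+n≤o⇒m≤o _ T≤k₁)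

          cl< : ∀ v → part v ≡ true → B.class v < k₁
          cl< v h = ≤-trans (B.class< v h) T≤

          locks : LockData N k₁
          locks = record
            { side = side ; dum = dum ; nr = nr ; φ = φ ; cl = B.class ; o = o ; T = T ; φ-inv = φ-inv ; φ-side = φ-side ; dum-B = dum-B
            ; one-dummy = one-dummy ; nr-part = λ v h → proj₁ (nr-part v h) ; cl< = cl< ; reps≤1 = B.reps≤1 ; followers≤ = B.followers≤
            ; ∑-reps = trans (B.∑-reps k₁ T≤) T-eq }
          module L = Locks locks

          ρ-χ : o ≡ true → ∑ (λ u → ⟦ side u ∧ not (L.χ u) ⟧) ≡ suc T
          ρ-χ q = +-cancelʳ-≡ ρ _ _ (trans (cong (∑ (λ u → ⟦ side u ∧ not (L.χ u) ⟧) +_) (sym count)) (trans (sym (∑-+ _ _)) (trans (∑-cong (λ u → pt (side u) (L.χ u))) (trans halfA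
              (trans (sym ρ-eq) (trans (cong (λ b → ρ + T + ⟦ b ⟧) q) (ar ρ T)))))))
            where
            ar : ∀ a b → a + b + 1 ≡ suc b + a
            ar = solve-∀
            χA : ∀ v → side v ∧ L.χ v ≡ side v ∧ nr (φ v)
            χA v = trans (cong (λ b → side v ∧ (not (dum (φ v)) ∧ (not b ∨ nr (φ v)))) q) (lem (side v) (dum (φ v)) (nr (φ v)) (λ n → proj₂ (∧-true {not (side (φ v))} (proj₁ (nr-part (φ v) n)))))
              where
              lem : ∀ a d n → (n ≡ true → not d ≡ true) → a ∧ (not d ∧ n) ≡ a ∧ n
              lem a false n _ = refl
              lem a true false _ = refl
              lem a true true h = case h refl of λ ()
            count : ∑ (λ u → ⟦ side u ∧ L.χ u ⟧) ≡ ρ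
            count = trans (∑-cong (λ v → cong ⟦_⟧ (χA v))) (trans (sym (∑-inv φ φ-inv (λ v → ⟦ side v ∧ nr (φ v) ⟧))) (trans (∑-cong p) nr-size))
              where
              lem : ∀ a n → (n ≡ true → a ≡ true) → ⟦ a ∧ n ⟧ ≡ ⟦ n ⟧
              lem true n _ = refl
              lem false false _ = refl
              lem false true h = case h refl of λ ()
              p : ∀ v → ⟦ side (φ v) ∧ nr (φ (φ v)) ⟧ ≡ ⟦ nr v ⟧
              p v = trans (cong₂ (λ a z → ⟦ a ∧ nr z ⟧) (φ-side v) (φ-inv v)) (lem (not (side v)) (nr v) (λ n → proj₁ (∧-true {not (side v)} (proj₁ (nr-part v n)))))
            pt : ∀ a x → ⟦ a ∧ not x ⟧ + ⟦ a ∧ x ⟧ ≡ ⟦ a ⟧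
            pt true true = refl
            pt true false = refl
            pt false _ = refl

          χ-even : o ≡ false → ∀ v → L.χ v ≡ true
          χ-even q v = cong₂ (λ d b → not d ∧ (not b ∨ nr (φ v))) nd q
            where
            zero-⟦⟧ : ∀ {b} → ⟦ b ⟧ ≡ 0 → b ≡ false
            zero-⟦⟧ {false} _ = refl
            nd : dum (φ v) ≡ false
            nd = zero-⟦⟧ (∑≡0 {f = λ v → ⟦ dum v ⟧} (trans one-dummy (cong ⟦_⟧ q)) (φ v))

          part-of : ∀ u v → side u ≡ false → E u v ≡ true → part u ≡ true
          part-of u v a h = ∧-intro (cong not a) (cong not (¬true (λ q → 1+n≢0 (trans (sym (cong ⟦_⟧ h)) (∑≡0 {f = λ v → ⟦ E u v ⟧}
            (+-cancelʳ-≡ r _ _ (trans (cong (deg u +_) (sym (trans (cong (λ b → ⟦ b ⟧ * r) q) (+-identityʳ r)))) (deg-eq u))) v)))))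

          blueprint : AssemblyData G
          blueprint = record
            { side = side ; dum = dum ; χ = L.χ ; o = o ; r = r ; T = T ; e = e ; D = D ; nums = nums ; lock₁ = L.lock₁ ; f = A.class ; clB = B.class
            ; deg-eq = deg-eq ; one-dummy = one-dummy ; dum-B = dum-B ; halfA = halfA ; halfB = halfB ; odd-r = odd-r
            ; few-locks = λ i → ≤-trans (L.few-locks i) (≤-reflexive (sym c-eq)) ; lock-even = λ i → L.members i , L.lock-total i
            ; lockd-A = L.lockd-A ; lockd-B = L.lockd-B ; lockd-dum = L.lockd-dum ; lock-B = L.lock-B ; ρ-χ = ρ-χ ; χ-even = χ-even ; A≤B = A≤B ; B≤A = B≤A
            ; f< = λ v h → ≤-trans (A.class< v h) repA≤ ; f-proper = λ u v a b h q → not-ψ u v h (A.class-eq u v a b q)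
            ; clB< = λ v h q → cl< v (∧-intro (cong not h) (cong not q))
            ; clB-proper = λ u v a b h q → not-ψ u v h (B.class-eq u v (part-of u v a h) (part-of v u b (trans (E-sym v u) h)) q)
            ; D-eq = D-eq ; T≤k₁ = T≤k₁ ; k₁≤T = k₁≤T ; same-hi = same-hi ; same-lo = same-lo ; cross-lo = cross-lo ; cross-lo′ = cross-lo′ }

        total : TotalColouring G (suc (suc r))
        total = Assemble.total-colouring G blueprint

      result : TotalColouring G (suc (suc r))
      -- In B only `ρ` of the available pairs become classes, since the number of classes there must
      -- be exactly `T`. In A all pairs are used.
      result = Core.total Q sub size
        where open Subset (subset (secB ∸ ρ) (λ v → not (side v) ∧ second ψ ψ-inv v) ρ (sym (m∸n+n≡m ρ≤)))

    flip : Split E ψ₀ e → Split E ψ₀ e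
    flip S = record
      { ψ = ψ ; φ = φ ; side = λ v → not (side v) ; ψ-inv = ψ-inv ; φ-inv = φ-inv ; φψ = φψ ; φ-side = λ v → cong not (φ-side v) ; ψ-side = λ v → cong not (ψ-side v)
      ; ψ-sub = ψ-sub ; ψ-cover = ψ-cover ; A≤B = λ v → subst (λ t → nbrs E (λ u → not (side u)) v ≤ t + e) (nn v) (B≤A v)
      ; B≤A = λ v → subst (λ t → t ≤ nbrs E (λ u → not (side u)) v + e) (nn v) (A≤B v) }
      where
      open Split S
      notnot : ∀ b → b ≡ not (not b)
      notnot true = refl
      notnot false = refl
      nn : ∀ v → nbrs E side v ≡ nbrs E (λ u → not (not (side u))) v
      nn v = ∑-cong (λ u → cong (λ b → ⟦ E v u ⟧ * ⟦ b ⟧) (notnot (side u)))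

    abstract
      wire : Split E ψ₀ e → TotalColouring G (suc (suc r))
      wire S = case any? (λ v → (dum v ∧ Split.side S v) ≟ᵇ true) of λ
        { (no h) → Oriented.result S (λ v d → ¬true (λ sv → h (v , ∧-intro d sv)))
        ; (yes (v , q)) → Oriented.result (flip S) (λ u d → cong not (trans (cong (Split.side S) (uniq u v d (proj₁ (∧-true {dum v} q)))) (proj₂ (∧-true {dum v} q)))) }
        where
        uniq : ∀ u v → dum u ≡ true → dum v ≡ true → u ≡ v
        uniq u v du dv with u ≟ v
        ... | yes e = e
        ... | no h = ⊥-elim (<⇒≱ (≤-trans two (≤-reflexive one-dummy)) (⟦⟧≤1 o))
          where
          two : 2 ≤ ∑ (λ w → ⟦ dum w ⟧)
          two = ≤-trans (≤-reflexive (sym (trans (∑-+ _ _) (cong₂ _+_ (∑-δ1 u) (∑-δ1 v))))) (∑-mono pt)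
            where
            pt : ∀ w → ⟦ u == w ⟧ + ⟦ v == w ⟧ ≤ ⟦ dum w ⟧
            pt w with isTrue (u == w) | isTrue (v == w)
            ... | inj₁ a | inj₁ b = ⊥-elim (h (trans (==-sound a) (sym (==-sound b))))
            ... | inj₁ a | inj₂ b rewrite a | b | trans (cong dum (sym (==-sound a))) du = s≤s z≤n
            ... | inj₂ a | inj₁ b rewrite a | b | trans (cong dum (sym (==-sound b))) dv = s≤s z≤n
            ... | inj₂ a | inj₂ b rewrite a | b = z≤n

-- Choice of the numerical parameters

module Parameters where
  open Prelude
  open Sums
  open Stage1
  open import Data.Nat.Base using (>-nonZero)
  open Wiring using (double≤)

  -- R is the number of auxiliary colours, and all error terms are
  -- small compared with 64 R ≤ 2 r - n.
  record Constraints : Set where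
    no-eta-equality
    field
      n m r d T p M b o e q z R L Φ lam φ : ℕ
      hN : n + o ≡ m + m
      ho : o ≤ 1
      hr : suc (r + d) ≡ n
      hT : T + T ≡ r + p
      hp : p ≤ 1
      hop : o + p ≤ 1
      hM : r ≡ e + (M + M + b)
      hb : b ≤ 1
      h16 : 16 ≤ e
      hR : R ≡ 4 * L + Φ + e
      hL : 12928 * e ≤ L
      hS : n + 64 * R ≤ r + r + 1
      hRz : R ≡ z * e
      hLl : L ≡ lam * e
      hΦ : Φ ≡ φ * e
      hlam : lam ≡ 101 * (128 * q)
      hφ : φ ≡ 128 * q * lam
      hcap : m + m ≤ 128 * q * z * e
      hbig : 18 * (128 * q * z) < e

  module Arithmetic (setup : Constraints) where
    open Constraints setup

    4L≤R : 4 * L ≤ R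
    4L≤R = lin (Φ + e) ≤-refl (trans (cong (_+ 4 * L) hR) (ar L Φ e))
      where
      ar : ∀ L Φ e → 4 * L + Φ + e + 4 * L ≡ 4 * L + 4 * L + (Φ + e)
      ar = solve-∀

    50000e≤R : 50000 * e ≤ R
    50000e≤R = lin (1712 * e) (≤-trans (*-monoʳ-≤ 4 hL) 4L≤R) (ar R e)
      where
      ar : ∀ R e → R + 4 * (12928 * e) ≡ 50000 * e + R + 1712 * e
      ar = solve-∀

    e≤R : e ≤ R
    e≤R = ≤-trans (m≤m+n e (49999 * e)) 50000e≤R

    800000≤R : 800000 ≤ R
    800000≤R = ≤-trans (*-monoʳ-≤ 50000 h16) 50000e≤R

    private
      ≥ : ∀ {a b} → a ≡ b → a ≤ b
      ≥ = ≤-reflexive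

      four-M : 2 * r + 0 ≤ 4 * M + 2 * e + 2 * b
      four-M = ≤-reflexive (trans (cong (λ t → 2 * t + 0) hM) (ar e M b))
        where
        ar : ∀ e M b → 2 * (e + (M + M + b)) + 0 ≡ 4 * M + 2 * e + 2 * b
        ar = solve-∀

    -- After doubling, about n + 4 R + 4 L + 200 e is compared with 4 M, which is about 2 r - 2 e
    -- and so at least about n + 64 R - 2 e. Both 4 L and 50000 e are at most R.
    same-bound : m + (100 * e + 2) + (R + R) + (L + L) < M + M
    same-bound = double≤ (lin (57 * R) (+-mono-≤ (+-mono-≤ (+-mono-≤ hS (*-monoʳ-≤ 2 hb)) (+-mono-≤ ho (≤-trans (*-monoˡ-≤ e (m≤m+n 202 49798)) 50000e≤R)))
        (+-mono-≤ (+-mono-≤ 4L≤R (≤-trans (m≤m+n 10 799990) 800000≤R)) (+-mono-≤ (≥ (sym hN)) four-M))) (ar n m r M b o e R L))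
      where
      ar : ∀ n m r M b o e R L → (M + M + (M + M)) + (n + 64 * R + 2 * b + (o + 202 * e) + (4 * L + 10 + (m + m + (2 * r + 0))))
        ≡ (suc (m + (100 * e + 2) + (R + R) + (L + L)) + suc (m + (100 * e + 2) + (R + R) + (L + L))) + (r + r + 1 + 2 * 1 + (1 + R) + (R + R + (n + o + (4 * M + 2 * e + 2 * b)))) + 57 * R
      ar = solve-∀

    finish-bound : m + (R + 4) + (3 * e + R + (3 * e + R)) < M + M
    finish-bound = double≤ (lin (56 * R) (+-mono-≤ (+-mono-≤ (+-mono-≤ hS (*-monoʳ-≤ 2 hb)) (+-mono-≤ ho (≤-trans (*-monoˡ-≤ e (m≤m+n 14 49986)) 50000e≤R)))
        (+-mono-≤ (≤-trans (m≤m+n 14 799986) 800000≤R) (+-mono-≤ (≥ (sym hN)) four-M))) (ar n m r M b o e R))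
      where
      ar : ∀ n m r M b o e R → (M + M + (M + M)) + (n + 64 * R + 2 * b + (o + 14 * e) + (14 + (m + m + (2 * r + 0))))
        ≡ (suc (m + (R + 4) + (3 * e + R + (3 * e + R))) + suc (m + (R + 4) + (3 * e + R + (3 * e + R)))) + (r + r + 1 + 2 * 1 + (1 + R) + (R + (n + o + (4 * M + 2 * e + 2 * b)))) + 56 * R
      ar = solve-∀

    shift-bound : 100 * e + 2 + (R + R) + L < M
    shift-bound = double≤ (double≤ (lin (53 * R + n) (+-mono-≤ (+-mono-≤ (+-mono-≤ hS (*-monoʳ-≤ 2 hb)) (≤-trans (*-monoˡ-≤ e (m≤m+n 402 49598)) 50000e≤R))
        (+-mono-≤ (+-mono-≤ 4L≤R (≤-trans (m≤m+n 15 799985) 800000≤R)) four-M)) (ar n r M b e R L)))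
      where
      ar : ∀ n r M b e R L → (M + M + (M + M)) + (n + 64 * R + 2 * b + 402 * e + (4 * L + 15 + (2 * r + 0)))
        ≡ ((suc (100 * e + 2 + (R + R) + L) + suc (100 * e + 2 + (R + R) + L)) + (suc (100 * e + 2 + (R + R) + L) + suc (100 * e + 2 + (R + R) + L)))
          + (r + r + 1 + 2 * 1 + R + (R + R + (4 * M + 2 * e + 2 * b))) + (53 * R + n)
      ar = solve-∀

    k₁ : ℕ
    k₁ = T + 2 * e

    private
      2k₁≤ : k₁ + k₁ ≤ m + m + 4 * e
      2k₁≤ = lin (o + d) (+-mono-≤ (≥ hT) (+-mono-≤ hp (+-mono-≤ (≥ hr) (≥ hN)))) (ar m e T r p o d n)
        where
        ar : ∀ m e T r p o d n → m + m + 4 * e + (T + T + (p + (suc (r + d) + (n + o)))) ≡ T + 2 * e + (T + 2 * e) + (r + p + (1 + (n + (m + m)))) + (o + d)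
        ar = solve-∀

    64R≤N : 64 * R ≤ m + m
    64R≤N = lin (d + d + 1) (+-mono-≤ hS (+-mono-≤ (≥ hr) (+-mono-≤ (≥ hr) (≤-trans (≤-trans (m≤m+n n o) ≤-refl) (≥ hN))))) (ar n m r d R)
      where
      ar : ∀ n m r d R → m + m + (n + 64 * R + (suc (r + d) + (suc (r + d) + n))) ≡ 64 * R + (r + r + 1 + (n + (n + (m + m)))) + (d + d + 1)
      ar = solve-∀

    k₁≤N : k₁ ≤ m + m
    k₁≤N = double≤ (lin (63 * R) (+-mono-≤ 2k₁≤ (+-mono-≤ 64R≤N (≤-trans (*-monoˡ-≤ e (m≤m+n 4 49996)) 50000e≤R))) (ar m e T R))
      where
      ar : ∀ m e T R → m + m + (m + m) + (T + 2 * e + (T + 2 * e) + (64 * R + 4 * e)) ≡ T + 2 * e + (T + 2 * e) + (m + m + 4 * e + (m + m + R)) + 63 * R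
      ar = solve-∀

    k₁>0 : 0 < k₁
    k₁>0 = ≤-trans (≤-trans (≤-trans (s≤s z≤n) h16) (m≤m+n e (e + 0))) (m≤n+m (2 * e) T)

    N≤4k₁ : m + m ≤ 4 * k₁
    N≤4k₁ = lin (64 * R + 2 * p + 6 * e) (+-mono-≤ (+-mono-≤ hS (≥ (sym hN))) (+-mono-≤ ho (+-mono-≤ (≥ (sym hT)) (+-mono-≤ (≥ (sym hT)) (≤-trans (≤-trans (m≤m+n 2 14) h16) (m≤m+n e e)))))) (ar n m r T p o e R)
      where
      ar : ∀ n m r T p o e R → 4 * (T + 2 * e) + (n + 64 * R + (m + m) + (o + (r + p + (r + p + 2)))) ≡ m + m + (r + r + 1 + (n + o) + (1 + (T + T + (T + T + (e + e))))) + (64 * R + 2 * p + 6 * e)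
      ar = solve-∀

    -- Linear against quadratic: `N` is at most 128 q z e, and `hbig` says that 18 times this factor
    -- is below e.
    vizing-bound : 2 * (1 + (4 + 4)) * k₁ < e * e
    vizing-bound = ≤-<-trans (*-monoʳ-≤ 18 (≤-trans k₁≤N hcap)) (≤-trans (s≤s (≤-reflexive (sym (*-assoc 18 (128 * q * z) e)))) (*-monoˡ-< e ⦃ e≢0 ⦄ hbig))
      where
      e≢0 : NonZero e
      e≢0 = >-nonZero (≤-trans (s≤s z≤n) h16)

    -- At most 3 e + e colours are missing at each vertex, and N is at most 4 k₁; the average gap is
    -- therefore at most 16 e.
    gap-bound : (m + m) * (3 * e + e) < k₁ * suc (16 * e)
    gap-bound = ≤-<-trans (*-monoˡ-≤ (3 * e + e) N≤4k₁) (lin 0 k₁>0 (ar k₁ e))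
      where
      ar : ∀ k e → k * suc (16 * e) + 1 ≡ suc (4 * k * (3 * e + e)) + k + 0
      ar = solve-∀

    even-bound : 2 * (16 * e + (4 + 4)) ≤ 33 * e
    even-bound = lin 0 h16 (ar e)
      where
      ar : ∀ e → 33 * e + 16 ≡ 2 * (16 * e + 8) + e + 0
      ar = solve-∀

    even-bound′ : 16 * e + 2 ≤ 33 * e
    even-bound′ = lin (16 * e + 14) h16 (ar e)
      where
      ar : ∀ e → 33 * e + 16 ≡ 16 * e + 2 + e + (16 * e + 14)
      ar = solve-∀

    budget-bound : 33 * e + 33 * e + 33 * e + 4 ≤ 100 * e
    budget-bound = lin 12 h16 (ar e)
      where
      ar : ∀ e → 100 * e + 16 ≡ 33 * e + 33 * e + 33 * e + 4 + e + 12
      ar = solve-∀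

    load-bound : 3 * e + e ≤ L
    load-bound = lin (12924 * e) hL (ar e L)
      where
      ar : ∀ e L → L + 12928 * e ≡ 3 * e + e + L + 12924 * e
      ar = solve-∀

    -- Bounding 100 e + 3 by 101 e and `N` by 128 q z e, with R = z e and L = lam e, reduces this to
    -- 101 · 128 q ≤ lam. This is the origin of `lam`.
    over-bound : k₁ * (100 * e + 2) < suc R * L
    over-bound = ≤-trans (≤-trans step₁ step₂) (*-monoˡ-≤ L (n≤1+n R))
      where
      step₁ : suc (k₁ * (100 * e + 2)) ≤ (m + m) * (101 * e)
      step₁ = ≤-trans (lin 0 k₁>0 (ar k₁ e)) (≤-trans (*-monoʳ-≤ k₁ (lin 13 h16 (ar′ e))) (*-monoˡ-≤ (101 * e) k₁≤N))
        where
        ar : ∀ k e → k * (100 * e + 3) + 1 ≡ suc (k * (100 * e + 2)) + k + 0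
        ar = solve-∀
        ar′ : ∀ e → 101 * e + 16 ≡ 100 * e + 3 + e + 13
        ar′ = solve-∀
      step₂ : (m + m) * (101 * e) ≤ R * L
      step₂ = ≤-trans (*-monoˡ-≤ (101 * e) hcap) (≤-reflexive (trans (ar q z e) (sym (cong₂ _*_ hRz (trans hLl (cong (_* e) hlam))))))
        where
        ar : ∀ q z e → 128 * q * z * e * (101 * e) ≡ z * e * (101 * (128 * q) * e)
        ar = solve-∀

    -- In the same way the bound on `N` reduces this to 128 q lam ≤ φ, the origin of `φ`.
    full-bound : (m + m) * L < suc Φ * suc R
    full-bound = ≤-<-trans (≤-trans (*-monoˡ-≤ L hcap) (≤-reflexive (trans (cong (128 * q * z * e *_) hLl) (trans (ar q z e lam) (sym (cong₂ _*_ (trans hΦ (cong (_* e) hφ)) hRz))))))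
      (*-mono-< (n<1+n Φ) (n<1+n R))
      where
      ar : ∀ q z e l → 128 * q * z * e * (l * e) ≡ 128 * q * l * e * (z * e)
      ar = solve-∀

    room-bound : L + L + (L + L) + Φ < R
    room-bound = lin 15 h16 (trans (cong (_+ 16) hR) (ar L Φ e))
      where
      ar : ∀ L Φ e → 4 * L + Φ + e + 16 ≡ suc (L + L + (L + L) + Φ) + e + 15
      ar = solve-∀

    nums : Numbers
    nums = record
      { m = m ; k₁ = k₁ ; ℓ = R ; c = 4 ; slack = e ; g = 3 * e ; K = e ; a = 16 * e ; τ₁ = 33 * e ; τ₀ = 100 * e ; ω = R ; L = L ; M₀ = M ; Θ = R ; Φ = Φ
      ; vizing-bound = vizing-bound ; gap-bound = gap-bound ; even-bound = even-bound ; even-bound′ = even-bound′ ; budget-bound = budget-bound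
      ; load-bound = load-bound ; over-bound = over-bound ; same-bound = same-bound ; shift-bound = shift-bound
      ; full-bound = full-bound ; room-bound = room-bound ; finish-bound = finish-bound }

    T≤k₁ : T + e ≤ k₁
    T≤k₁ = +-monoʳ-≤ T (m≤m+n e (e + 0))

    k₁≤T : k₁ ≤ T + 3 * e
    k₁≤T = +-monoʳ-≤ T (*-monoˡ-≤ e (m≤m+n 2 1))

    same-hi : r + e + 2 + (e + e) ≤ k₁ + k₁
    same-hi = lin (p + 14) (+-mono-≤ (≥ (sym hT)) h16) (ar r p e T)
      where
      ar : ∀ r p e T → T + 2 * e + (T + 2 * e) + (r + p + 16) ≡ r + e + 2 + (e + e) + (T + T + e) + (p + 14)
      ar = solve-∀

    same-lo : k₁ + k₁ + e ≤ r + (3 * e + 3 * e)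
    same-lo = lin 15 (+-mono-≤ (≥ hT) (+-mono-≤ hp h16)) (ar r p e T)
      where
      ar : ∀ r p e T → r + (3 * e + 3 * e) + (T + T + (p + 16)) ≡ T + 2 * e + (T + 2 * e) + e + (r + p + (1 + e)) + 15
      ar = solve-∀

    cross-lo : M + M + e ≤ r
    cross-lo = ≤-trans (≤-trans (m≤m+n (M + M + e) b) (≤-reflexive (ar M e b))) (≥ (sym hM))
      where
      ar : ∀ M e b → M + M + e + b ≡ e + (M + M + b)
      ar = solve-∀

    cross-lo′ : M ≤ suc T
    cross-lo′ = ≤-trans (double≤ (≤-trans (≤-trans (m≤m+n (M + M) e) cross-lo) (≤-trans (m≤m+n r p) (≥ (sym hT))))) (n≤1+n T)

    D : ℕ
    D = suc r ∸ (k₁ + R)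

    D-eq : D + (k₁ + R) ≡ suc r
    D-eq = m∸n+n≡m {suc r} {k₁ + R} (double≤ (double≤ (lin (59 * R + n + 1) (+-mono-≤ hS (+-mono-≤ (≥ hT) (+-mono-≤ (≥ hT) (+-mono-≤ (*-monoʳ-≤ 2 hp) (≤-trans (*-monoˡ-≤ e (m≤m+n 8 49992)) 50000e≤R))))) (ar n r T p e R))))
      where
      ar : ∀ n r T p e R → suc r + suc r + (suc r + suc r) + (n + 64 * R + (T + T + (T + T + (2 * p + 8 * e))))
        ≡ (T + 2 * e + R + (T + 2 * e + R)) + (T + 2 * e + R + (T + 2 * e + R)) + (r + r + 1 + (r + p + (r + p + (2 * 1 + R)))) + (59 * R + n + 1)
      ar = solve-∀

    ρ : ℕ
    ρ = m ∸ (T + o)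

    ρ-eq : ρ + T + o ≡ m
    ρ-eq = trans (+-assoc ρ T o) (m∸n+n≡m {m} {T + o} (double≤ (lin d (+-mono-≤ (≥ hT) (+-mono-≤ hop (+-mono-≤ (≥ hr) (≥ hN)))) (ar m n r T p o d))))
      where
      ar : ∀ m n r T p o d → m + m + (T + T + (o + p + (suc (r + d) + (n + o)))) ≡ T + o + (T + o) + (r + p + (1 + (n + (m + m)))) + d
      ar = solve-∀

    module _ (cov : ℕ) (hcov : 2 * d + 4 + 5 * R ≤ cov) where
      pairs-B : (ρ + ρ) + (ρ + ρ) + 2 ≤ cov
      pairs-B = lin (5 * R + 2 * o + 2 * p) (+-mono-≤ (+-mono-≤ hcov (*-monoʳ-≤ 4 (≥ ρ-eq))) (+-mono-≤ (+-mono-≤ (*-monoʳ-≤ 2 (≥ (sym hN))) (*-monoʳ-≤ 2 (≥ (sym hT)))) (*-monoʳ-≤ 2 (≥ (sym hr)))))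
        (ar cov d R ρ T o m r p n)
        where
        ar : ∀ c d R ρ T o m r p n → c + (2 * d + 4 + 5 * R + 4 * (ρ + T + o) + (2 * (m + m) + 2 * (r + p) + 2 * n))
          ≡ ρ + ρ + (ρ + ρ) + 2 + (c + 4 * m + (2 * (n + o) + 2 * (T + T) + 2 * suc (r + d))) + (5 * R + 2 * o + 2 * p)
        ar = solve-∀

      -- With T close to r / 2, the difference 4 m - 4 (D + 1) is about 2 (n - r) + 4 R + 8 e, hence
      -- about 2 d + 4 R up to small terms. This decides how large a matching must be requested in
      -- `hcov`.
      pairs-A : (m + m) + (m + m) + 2 ≤ (suc D + suc D) + (suc D + suc D) + cov
      pairs-A = lin 4 (+-mono-≤ (+-mono-≤ (+-mono-≤ hcov (*-monoʳ-≤ 4 (≥ (sym D-eq)))) (+-mono-≤ (*-monoʳ-≤ 2 (≥ (sym hN))) (*-monoʳ-≤ 2 (≥ (sym hr)))))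
          (+-mono-≤ (+-mono-≤ (*-monoʳ-≤ 2 (≥ hT)) (*-monoʳ-≤ 2 hp)) (+-mono-≤ (*-monoʳ-≤ 2 ho) (≤-trans (*-monoˡ-≤ e (m≤m+n 8 49992)) 50000e≤R))))
        (ar cov d R D T o m r p n e)
        where
        ar : ∀ c d R D T o m r p n e → suc D + suc D + (suc D + suc D) + c + (2 * d + 4 + 5 * R + 4 * suc r + (2 * (m + m) + 2 * n) + (2 * (T + T) + 2 * p + (2 * o + 8 * e)))
          ≡ m + m + (m + m) + 2 + (c + 4 * (D + (T + 2 * e + R)) + (2 * (n + o) + 2 * suc (r + d)) + (2 * (r + p) + 2 * 1 + (2 * 1 + R))) + 4
        ar = solve-∀

    ★ : 2 * d + 1 + 64 * R ≤ n
    ★ = lin 0 (+-mono-≤ hS (*-monoʳ-≤ 2 (≥ hr))) (ar n r d R)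
      where
      ar : ∀ n r d R → n + (n + 64 * R + 2 * suc (r + d)) ≡ 2 * d + 1 + 64 * R + (r + r + 1 + 2 * n) + 0
      ar = solve-∀

    few-pairs : ∀ cov → 4 * d + 8 + 10 * R ≤ n → n ≤ cov + cov → 2 * d + 4 + 5 * R ≤ cov
    few-pairs cov h h′ = double≤ (≤-trans (≤-reflexive (ar d R)) (≤-trans h h′))
      where
      ar : ∀ d R → 2 * d + 4 + 5 * R + (2 * d + 4 + 5 * R) ≡ 4 * d + 8 + 10 * R
      ar = solve-∀

    module _ (h : n < 4 * d + 8 + 10 * R) where
      many-colours : 2 * (d + e) < e * e
      many-colours = ≤-<-trans (≤-trans (*-monoʳ-≤ 2 de≤) (*-monoˡ-≤ (m + m) (m≤m+n 2 16))) (≤-<-trans (*-monoʳ-≤ 18 hcap) (≤-trans (s≤s (≤-reflexive (sym (*-assoc 18 (128 * q * z) e)))) (*-monoˡ-< e ⦃ e≢0 ⦄ hbig)))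
        where
        e≢0 : NonZero e
        e≢0 = >-nonZero (≤-trans (s≤s z≤n) h16)
        de≤ : d + e ≤ m + m
        de≤ = lin (d + 1 + 63 * R + o) (+-mono-≤ ★ (+-mono-≤ e≤R (≥ hN))) (ar d e n o R m)
          where
          ar : ∀ d e n o R m → m + m + (2 * d + 1 + 64 * R + (e + (n + o))) ≡ d + e + (n + (R + (m + m))) + (d + 1 + 63 * R + o)
          ar = solve-∀

      -- By `★`, `n` exceeds the cover that is asked for by 58 R. As `d` is of the order of `n`
      -- here, d times this surplus outweighs the uncoloured edges and the effect of using `e`
      -- additional colours.
      dense-pairs : (d + e) * (2 * d + 3 + 5 * R) + (m + m) * e < n * d
      dense-pairs = lin (50 * (d * R) + 37 * (e * R)) (+-mono-≤ (+-mono-≤ (+-mono-≤ (*-monoʳ-≤ (d + e) x≤) (*-monoˡ-≤ e ho)) (+-mono-≤ (*-monoʳ-≤ (2 * e) (<⇒≤ h)) (*-monoʳ-≤ (8 * d) e≤R)))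
          (+-mono-≤ (+-mono-≤ (*-monoʳ-≤ e (≤-trans (m≤m+n 18 799982) 800000≤R)) (≤-trans (m≤m+n 1 15) h16)) (*-monoˡ-≤ e (≥ (sym hN))))) (ar n d e R o m)
        where
        x≤ : 2 * d + 3 + 5 * R + 58 * R ≤ n
        x≤ = lin 0 (+-mono-≤ ★ (≤-trans (m≤m+n 2 799998) 800000≤R)) (ar′ d R n)
          where
          ar′ : ∀ d R n → n + (2 * d + 1 + 64 * R + 2) ≡ 2 * d + 3 + 5 * R + 58 * R + (n + R) + 0
          ar′ = solve-∀
        ar : ∀ n d e R o m → n * d + ((d + e) * (2 * d + 3 + 5 * R + 58 * R) + o * e + (2 * e * n + 8 * d * e) + (e * 18 + 1 + (m + m) * e))
          ≡ suc ((d + e) * (2 * d + 3 + 5 * R) + (m + m) * e) + ((d + e) * n + 1 * e + (2 * e * (4 * d + 8 + 10 * R) + 8 * d * R) + (e * R + e + (n + o) * e)) + (50 * (d * R) + 37 * (e * R))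
        ar = solve-∀

-- The cyclic colouring

module Cyclic where
  open Prelude
  open EdgeColouring
  open Assembly
  open Wiring using (double≡)
  open import Data.Nat.DivMod using (m%n<n; m≡m%n+[m/n]*n)

  module _ {n} (G : SimpleGraph n) (M h : ℕ) .{{_ : NonZero M}} (odd : M ≡ suc (h + h)) (n≤M : n ≤ M) where
    open SimpleGraph G

    private
      lift : ∀ a b → a % M ≡ b % M → ∃ λ s → ∃ λ t → a + s * M ≡ b + t * M
      lift a b e = b / M , a / M , trans (cong (_+ b / M * M) (m≡m%n+[m/n]*n a M)) (trans (ar e (a / M * M) (b / M * M)) (cong (_+ a / M * M) (sym (m≡m%n+[m/n]*n b M))))
        where
        ar : ∀ {x x′} → x ≡ x′ → ∀ y z → x + y + z ≡ x′ + z + y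
        ar {x} refl y z = trans (+-assoc x y z) (trans (cong (x +_) (+-comm y z)) (sym (+-assoc x z y)))

      shape : ∀ a b s t → s ≤ t → a + s * M ≡ b + t * M → ∃ λ δ → a ≡ b + δ * M
      shape a b s t le e with m≤n⇒∃[o]m+o≡n le
      ... | δ , refl = δ , +-cancelʳ-≡ (s * M) _ _ (trans e (ar b s δ M))
        where
        ar : ∀ b s δ m → b + (s + δ) * m ≡ b + δ * m + s * m
        ar = solve-∀

      close₁ : ∀ a b δ → a < M → a ≡ b + δ * M → a ≡ b
      close₁ a b zero _ e = trans e (+-identityʳ _)
      close₁ a b (suc δ) lt e = ⊥-elim (<⇒≱ lt (≤-trans (≤-trans (m≤m+n M (δ * M)) (m≤n+m _ b)) (≤-reflexive (sym e))))

      odd≢even : ∀ x y → x + x ≢ suc (y + y)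
      odd≢even zero y ()
      odd≢even (suc x) zero q = 1+n≢0 (suc-injective (trans (sym (cong suc (+-suc x x))) q))
      odd≢even (suc x) (suc y) q = odd≢even x y (suc-injective (suc-injective (trans (sym (cong suc (+-suc x x))) (trans q (cong (λ z → suc (suc z)) (+-suc y y))))))

      -- From 2 a - 2 b = δ M and a < M follows δ ≤ 1, and δ = 1 is impossible because M is odd.
      close₂ : ∀ a b δ → a < M → a + a ≡ b + b + δ * M → a ≡ b
      close₂ a b zero _ e = double≡ (trans e (+-identityʳ _))
      close₂ a b (suc zero) _ e = ⊥-elim (odd≢even a (b + h) (trans e (trans (cong (λ x → b + b + 1 * x) odd) (ar b h))))
        where
        ar : ∀ b h → b + b + 1 * suc (h + h) ≡ suc (b + h + (b + h))
        ar = solve-∀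
      close₂ a b (suc (suc δ)) lt e = ⊥-elim (<⇒≱ (+-mono-< lt lt) (≤-trans (≤-trans (m≤m+n (M + M) (δ * M)) (≤-reflexive (+-assoc M M (δ * M)))) (≤-trans (m≤n+m _ (b + b)) (≤-reflexive (sym e)))))

      bound : ∀ (v : Fin n) → toℕ v < M
      bound v = ≤-trans (toℕ<n v) n≤M

      cancel₁ : ∀ x (u v : Fin n) → (x + toℕ u) % M ≡ (x + toℕ v) % M → u ≡ v
      cancel₁ x u v e = go (lift (x + toℕ u) (x + toℕ v) e)
        where
        side : ∀ (u v : Fin n) → (∃ λ δ → x + toℕ u ≡ x + toℕ v + δ * M) → u ≡ v
        side u v (δ , q) = toℕ-injective (close₁ (toℕ u) (toℕ v) δ (bound u) (+-cancelˡ-≡ x _ _ (trans q (+-assoc x (toℕ v) (δ * M)))))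
        go : (∃ λ s → ∃ λ t → x + toℕ u + s * M ≡ x + toℕ v + t * M) → u ≡ v
        go (s , t , q) with ≤-total s t
        ... | inj₁ le = side u v (shape _ _ s t le q)
        ... | inj₂ le = sym (side v u (shape _ _ t s le (sym q)))

      cancel₂ : ∀ (u v : Fin n) → (toℕ u + toℕ u) % M ≡ (toℕ v + toℕ v) % M → u ≡ v
      cancel₂ u v e = go (lift (toℕ u + toℕ u) (toℕ v + toℕ v) e)
        where
        side : ∀ (u v : Fin n) → (∃ λ δ → toℕ u + toℕ u ≡ toℕ v + toℕ v + δ * M) → u ≡ v
        side u v (δ , q) = toℕ-injective (close₂ (toℕ u) (toℕ v) δ (bound u) q)
        go : (∃ λ s → ∃ λ t → toℕ u + toℕ u + s * M ≡ toℕ v + toℕ v + t * M) → u ≡ v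
        go (s , t , q) with ≤-total s t
        ... | inj₁ le = side u v (shape _ _ s t le q)
        ... | inj₂ le = sym (side v u (shape _ _ t s le (sym q)))

    -- The colour of a vertex is the one that a loop there would get, so incidences are covered by
    -- the cancellation used for adjacent edges.
    cyclic : TotalColouring G M
    cyclic = record
      { vcol = λ v → (toℕ v + toℕ v) % M
      ; ecol = λ u v → (toℕ u + toℕ v) % M
      ; vcol< = λ v → m%n<n (toℕ v + toℕ v) M
      ; ecol< = λ u v _ → m%n<n (toℕ u + toℕ v) M
      ; ecol-sym = λ u v _ → cong (_% M) (+-comm (toℕ u) (toℕ v))
      ; vertex-proper = λ u v h e → ≢-of h (cancel₂ u v e)
      ; edge-proper = λ u v w _ _ v≢w e → v≢w (cancel₁ (toℕ u) v w e)
      ; incidence-proper = λ u v h e → ≢-of h (sym (cancel₁ (toℕ u) v u e)) }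

-- Incomplete graphs: the complement and its matching

module Dense where
  open Prelude
  open Sums
  open EdgeColouring
  open Matchings
  open Partition
  open Assembly
  open Wiring
  open Parameters
  open import Data.Nat.DivMod using (m%n<n; m≡m%n+[m/n]*n; m/n*n≤m)
  open import Data.Nat.Base using (>-nonZero)

  halving : ∀ x → ∃ λ h → ∃ λ b → b ≤ 1 × x ≡ h + h + b
  halving zero = 0 , 0 , z≤n , refl
  halving (suc x) with halving x
  ... | h , zero , _ , refl = h , 1 , s≤s z≤n , ar h
    where
    ar : ∀ h → suc (h + h + 0) ≡ h + h + 1
    ar = solve-∀
  ... | h , suc zero , _ , refl = suc h , 0 , z≤n , ar h
    where
    ar : ∀ h → suc (h + h + 1) ≡ suc h + suc h + 0
    ar = solve-∀
  ... | h , suc (suc _) , s≤s () , _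

  module Complement {N} (G : SimpleGraph N) (dum : Fin N → Bool) (o : Bool) (r d n : ℕ)
      (deg-eq : ∀ v → SimpleGraph.deg G v + ⟦ dum v ⟧ * r ≡ r) (one-dummy : ∑ (λ v → ⟦ dum v ⟧) ≡ ⟦ o ⟧)
      (size : n + ⟦ o ⟧ ≡ N) (hr : suc (r + d) ≡ n) where
    open SimpleGraph G

    private
      adj : Bool → Bool → Bool → Bool → Bool
      adj q a b e = not q ∧ ((not a ∧ not b) ∧ not e)

    -- The dummy vertex is isolated in this complement as well, which keeps it out of all pairs; the
    -- other vertices have degree `d`.
    co : SimpleGraph N
    co .SimpleGraph.E u v = adj (u == v) (dum u) (dum v) (E u v)
    co .SimpleGraph.E-sym u v = trans (cong₂ (λ q e → adj q (dum u) (dum v) e) (==-sym u v) (E-sym u v)) (sw (v == u) (dum u) (dum v) (E v u))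
      where
      sw : ∀ q a b e → adj q a b e ≡ adj q b a e
      sw true _ _ _ = refl
      sw false true true _ = refl
      sw false true false _ = refl
      sw false false true _ = refl
      sw false false false _ = refl
    co .SimpleGraph.E-irr v rewrite ==-refl v = refl

    co-edge : ∀ u v → SimpleGraph.E co u v ≡ true → E u v ≡ false × dum u ≡ false
    co-edge u v h = go (u == v) (dum u) (dum v) (E u v) h
      where
      go : ∀ q a b e → adj q a b e ≡ true → e ≡ false × a ≡ false
      go false false false false _ = refl , refl
      go true _ _ _ ()
      go false true _ _ ()
      go false false true _ ()
      go false false false true ()

    no-edge : ∀ u v → dum u ≡ true → E u v ≡ false
    no-edge u v q = ¬true (λ h → 1+n≢0 (trans (sym (cong ⟦_⟧ h)) (∑≡0 {f = λ v → ⟦ E u v ⟧}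
      (+-cancelʳ-≡ r _ _ (trans (cong (deg u +_) (sym (trans (cong (λ b → ⟦ b ⟧ * r) q) (+-identityʳ r)))) (deg-eq u))) v)))

    co-deg : ∀ v → SimpleGraph.deg co v ≡ ⟦ not (dum v) ⟧ * d
    co-deg v with isTrue (dum v)
    ... | inj₁ q = trans (∑-0 (λ u → cong ⟦_⟧ (trans (cong (λ a → adj (v == u) a (dum u) (E v u)) q) (z (v == u) (dum u) (E v u))))) (cong (λ a → ⟦ not a ⟧ * d) (sym q))
      where
      z : ∀ q b e → adj q true b e ≡ false
      z true _ _ = refl
      z false _ _ = refl
    ... | inj₂ q = trans (+-cancelʳ-≡ (r + 1 + ⟦ o ⟧) _ _ (trans sum (sym (trans (ar d r ⟦ o ⟧) (trans (cong (_+ ⟦ o ⟧) hr) size))))) (sym (trans (cong (λ a → ⟦ not a ⟧ * d) q) (+-identityʳ d)))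
      where
      ar : ∀ d r o → d + (r + 1 + o) ≡ suc (r + d) + o
      ar = solve-∀
      dv : deg v ≡ r
      dv = trans (sym (+-identityʳ _)) (trans (cong (λ b → deg v + ⟦ b ⟧ * r) (sym q)) (deg-eq v))
      pt : ∀ u → ⟦ SimpleGraph.E co v u ⟧ + (⟦ E v u ⟧ + ⟦ v == u ⟧ + ⟦ dum u ⟧) ≡ 1
      pt u = trans (cong (λ a → ⟦ adj (v == u) a (dum u) (E v u) ⟧ + (⟦ E v u ⟧ + ⟦ v == u ⟧ + ⟦ dum u ⟧)) q)
        (four (v == u) (dum u) (E v u) (λ x → trans (cong dum (sym (==-sound x))) q) (λ x → trans (cong (E v) (sym (==-sound x))) (E-irr v)) (λ x → trans (E-sym v u) (no-edge u v x)))
        where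
        four : ∀ x b e → (x ≡ true → b ≡ false) → (x ≡ true → e ≡ false) → (b ≡ true → e ≡ false) → ⟦ adj x false b e ⟧ + (⟦ e ⟧ + ⟦ x ⟧ + ⟦ b ⟧) ≡ 1
        four true true e h _ _ = case h refl of λ ()
        four true false true _ h _ = case h refl of λ ()
        four true false false _ _ _ = refl
        four false true true _ _ h = case h refl of λ ()
        four false true false _ _ _ = refl
        four false false true _ _ _ = refl
        four false false false _ _ _ = refl
      sum : SimpleGraph.deg co v + (r + 1 + ⟦ o ⟧) ≡ N
      sum = trans (cong (SimpleGraph.deg co v +_) (sym (trans (∑-+ _ _) (cong₂ _+_ (trans (∑-+ _ _) (cong₂ _+_ dv (∑-δ1 v))) one-dummy)))) (trans (sym (∑-+ _ _)) (trans (∑-cong pt) (∑-1 N)))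

    real-count : ∑ (λ v → ⟦ not (dum v) ⟧) ≡ n
    real-count = +-cancelʳ-≡ ⟦ o ⟧ _ _ (trans (cong (∑ (λ v → ⟦ not (dum v) ⟧) +_) (sym one-dummy)) (trans (sym (∑-+ _ _)) (trans (∑-cong (λ v → pt (dum v))) (trans (∑-1 N) (sym size)))))
      where
      pt : ∀ b → ⟦ not b ⟧ + ⟦ b ⟧ ≡ 1
      pt true = refl
      pt false = refl

    co-total : ∑ (SimpleGraph.deg co) ≡ n * d
    co-total = trans (∑-cong co-deg) (trans (∑-*ʳ d (λ v → ⟦ not (dum v) ⟧)) (cong (_* d) real-count))

  -- Here o tells whether a dummy vertex has been added.
  record DenseData {N} (G : SimpleGraph N) : Set where
    no-eta-equality
    field
      dum : Fin N → Bool
      o : Bool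
      r d n m q lam φ z W B E₀ : ℕ
      hlam : lam ≡ 101 * (128 * q)
      hφ : φ ≡ 128 * q * lam
      hz : z ≡ 4 * lam + φ + 1
      hW : W ≡ 128 * q * z
      hB : B ≡ 64 * q * z
      hE₀ : E₀ ≡ 112 * (W * (W * W))
      deg-eq : ∀ v → SimpleGraph.deg G v + ⟦ dum v ⟧ * r ≡ r
      one-dummy : ∑ (λ v → ⟦ dum v ⟧) ≡ ⟦ o ⟧
      size : n + ⟦ o ⟧ ≡ N
      hr : suc (r + suc d) ≡ n
      half : N ≡ m + m
      q>0 : 0 < q
      large : B * E₀ ≤ n
      dense : n + q * n ≤ 2 * (q * r)

  module Incomplete {N} (G : SimpleGraph N) (setup : DenseData G) where
    open DenseData setup
    open SimpleGraph G

    private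
      instance
        q≢0 : NonZero q
        q≢0 = >-nonZero q>0

      positive : ∀ {x y} → x ≡ suc y → 0 < x
      positive refl = s≤s z≤n

      z>0 : 0 < z
      z>0 = positive (trans hz (+-comm (4 * lam + φ) 1))

      scaled : ∀ c {x} → x ≡ suc c * q * z → 0 < x
      scaled c refl = *-mono-≤ {1} {suc c * q} {1} {z} (*-mono-≤ {1} {suc c} {1} {q} (s≤s z≤n) q>0) z>0

      B>0 : 0 < B
      B>0 = scaled 63 hB

      W>0 : 0 < W
      W>0 = scaled 127 hW

      instance
        B≢0 : NonZero B
        B≢0 = >-nonZero B>0

    abstract
      e : ℕ
      e = N / B

      e*B≤N : e * B ≤ N
      e*B≤N = m/n*n≤m N B

      N< : N < B + e * B
      N< = ≤-trans (s≤s (≤-reflexive (m≡m%n+[m/n]*n N B))) (+-monoˡ-≤ (e * B) (m%n<n N B))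

    private
      n≤N : n ≤ N
      n≤N = ≤-trans (m≤m+n n ⟦ o ⟧) (≤-reflexive size)

      E₀≤e : E₀ ≤ e
      E₀≤e = ≮⇒≥ (λ lt → <⇒≱ N< (≤-trans (*-monoˡ-≤ B lt) (≤-trans (≤-reflexive (*-comm E₀ B)) (≤-trans large n≤N))))

      W³ = W * (W * W)

      112W³≤e : 112 * W³ ≤ e
      112W³≤e = ≤-trans (≤-reflexive (sym hE₀)) E₀≤e

      W≤W³ : W ≤ W³
      W≤W³ = ≤-trans (≤-reflexive (sym (*-identityʳ W))) (*-monoʳ-≤ W (*-mono-≤ W>0 W>0))

      h16 : 16 ≤ e
      h16 = ≤-trans (*-mono-≤ {16} {112} {1} {W³} (m≤m+n 16 96) (≤-trans W>0 W≤W³)) 112W³≤e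

      hbig : 18 * W < e
      hbig = ≤-trans (≤-trans (≤-trans (+-monoˡ-≤ (18 * W) W>0) (≤-trans (≤-reflexive (ar W)) (*-monoˡ-≤ W (m≤m+n 19 93)))) (*-monoʳ-≤ 112 W≤W³)) 112W³≤e
        where
        ar : ∀ w → w + 18 * w ≡ 19 * w
        ar = solve-∀

      e>0 : 0 < e
      e>0 = ≤-trans (s≤s z≤n) h16

      N≤We : N ≤ W * e
      N≤We = ≤-trans (<⇒≤ N<) (≤-trans (+-monoˡ-≤ (e * B) (≤-trans (≤-reflexive (sym (+-identityʳ B))) (*-monoˡ-≤ B e>0))) (≤-reflexive (trans (cong (λ x → e * x + e * x) hB) (trans (ar e q z) (cong (_* e) (sym hW))))))
        where
        ar : ∀ e q z → e * (64 * q * z) + e * (64 * q * z) ≡ 128 * q * z * e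
        ar = solve-∀

      N>0 : 0 < N
      N>0 = ≤-trans (*-mono-≤ e>0 B>0) e*B≤N

      -- The left side is at most 112 N³ and so at most 112 W³ e³, and 112 W³ ≤ e by the choice of
      -- `E₀`.
      potential-bound : N * (N * (16 + 96 * N)) < suc e * suc e * (suc e * suc e)
      potential-bound = ≤-<-trans (≤-trans (*-monoʳ-≤ N (*-monoʳ-≤ N (≤-trans (+-monoˡ-≤ (96 * N) (*-monoʳ-≤ 16 N>0)) (≤-reflexive (ar N)))))
          (≤-trans (*-mono-≤ N≤We (*-mono-≤ N≤We (*-monoʳ-≤ 112 N≤We))) (≤-trans (≤-reflexive (ar′ W e)) (*-monoˡ-≤ (e * (e * e)) 112W³≤e))))
        (≤-trans (s≤s (≤-reflexive (ar″ e))) (*-mono-< (*-mono-< (n<1+n e) (n<1+n e)) (*-mono-< (n<1+n e) (n<1+n e))))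
        where
        ar : ∀ n → 16 * n + 96 * n ≡ 112 * n
        ar = solve-∀
        ar′ : ∀ w e → w * e * (w * e * (112 * (w * e))) ≡ 112 * (w * (w * w)) * (e * (e * e))
        ar′ = solve-∀
        ar″ : ∀ e → e * (e * (e * e)) ≡ e * e * (e * e)
        ar″ = solve-∀

      R L Φ : ℕ
      R = z * e
      L = lam * e
      Φ = φ * e

      -- Multiplied by q, the term 64 R becomes e B, at most n + 1; and `dense` says that q (2 r -
      -- n) is at least n.
      hS : n + 64 * R ≤ r + r + 1
      hS = *-cancelˡ-≤ q (≤-trans (≤-reflexive (trans (ar q n z e) (cong (λ x → q * n + e * x) (sym hB)))) (≤-trans (+-monoʳ-≤ (q * n) (≤-trans e*B≤N (≤-trans (≤-reflexive (sym size)) (+-monoʳ-≤ n (⟦⟧≤1 o)))))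
          (≤-trans (≤-reflexive (ar′ q n)) (≤-trans (+-mono-≤ dense q>0) (≤-reflexive (ar″ q r))))))
        where
        ar : ∀ q n z e → q * (n + 64 * (z * e)) ≡ q * n + e * (64 * q * z)
        ar = solve-∀
        ar′ : ∀ q n → q * n + (n + 1) ≡ n + q * n + 1
        ar′ = solve-∀
        ar″ : ∀ q r → 2 * (q * r) + q ≡ q * (r + r + 1)
        ar″ = solve-∀

      hR : R ≡ 4 * L + Φ + e
      hR = trans (cong (_* e) hz) (ar lam φ e)
        where
        ar : ∀ l f e → (4 * l + f + 1) * e ≡ 4 * (l * e) + f * e + e
        ar = solve-∀

      hL : 12928 * e ≤ L
      hL = *-monoˡ-≤ e (≤-trans (*-monoʳ-≤ 12928 q>0) (≤-reflexive (trans (ar q) (sym hlam))))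
        where
        ar : ∀ q → 12928 * q ≡ 101 * (128 * q)
        ar = solve-∀

      e≤r : e ≤ r
      e≤r = double≤ (+-cancelʳ-≤ 1 _ _ (≤-trans (≤-trans (lin′ e z z>0 e>0) (m≤n+m _ n)) hS))
        where
        lin′ : ∀ e z → 0 < z → 0 < e → e + e + 1 ≤ 64 * (z * e)
        lin′ e z hz he = ≤-trans (+-monoʳ-≤ (e + e) he) (≤-trans (≤-reflexive (ar e)) (≤-trans (*-monoˡ-≤ e (m≤m+n 3 61)) (*-monoʳ-≤ 64 (≤-trans (≤-reflexive (sym (+-identityʳ e))) (*-monoˡ-≤ e hz)))))
          where
          ar : ∀ e → e + e + e ≡ 3 * e
          ar = solve-∀

      -- A dummy vertex is added only for odd `n`, and a regular graph of odd order has even degree.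
      handshake : o ≡ true → ∃ λ t → r ≡ t + t
      handshake q = case ∑∑-even (λ u v → ⟦ E u v ⟧) (λ u v → cong ⟦_⟧ (E-sym u v)) (λ v → cong ⟦_⟧ (E-irr v)) of λ
        { (s , h) → even-part (m * r) s r (trans (+-comm r (s + s)) (trans (cong₂ (λ a b → a + b) (sym h) (sym (trans (cong (λ b → ⟦ b ⟧ * r) q) (+-identityʳ r)))) (trans (tot) (trans (cong (_* r) half) (ar m r))))) }
        where
        tot : ∑ deg + ⟦ o ⟧ * r ≡ N * r
        tot = trans (cong (∑ deg +_) (trans (cong (_* r) (sym one-dummy)) (sym (∑-*ʳ r (λ v → ⟦ dum v ⟧))))) (trans (sym (∑-+ _ _)) (trans (∑-cong deg-eq) (∑-const N r)))
        ar : ∀ m r → (m + m) * r ≡ m * r + m * r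
        ar = solve-∀

      hN : n + ⟦ o ⟧ ≡ m + m
      hN = trans size half

      module Co = Complement G dum o r (suc d) n deg-eq one-dummy size hr

    module Run (T p M b : ℕ) (hT : T + T ≡ r + p) (hp : p ≤ 1) (hop : ⟦ o ⟧ + p ≤ 1) (odd-r : o ≡ true → r ≡ T + T) (hM : r ≡ e + (M + M + b)) (hb : b ≤ 1) where
      private
        constraints : Constraints
        constraints = record
          { n = n ; m = m ; r = r ; d = suc d ; T = T ; p = p ; M = M ; b = b ; o = ⟦ o ⟧ ; e = e ; q = q ; z = z ; R = R ; L = L ; Φ = Φ ; lam = lam ; φ = φ
          ; hN = hN ; ho = ⟦⟧≤1 o ; hr = hr ; hT = hT ; hp = hp ; hop = hop ; hM = hM ; hb = hb ; h16 = h16 ; hR = hR ; hL = hL ; hS = hS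
          ; hRz = refl ; hLl = refl ; hΦ = refl ; hlam = hlam ; hφ = hφ
          ; hcap = subst₂ (λ x y → x ≤ y * e) half hW N≤We ; hbig = subst (λ x → 18 * x < e) hW hbig }
        module P = Arithmetic constraints

        Target : Set
        Target = Σ (Matching Co.co) λ M → 2 * suc d + 4 + 5 * R ≤ Matching.cover M

        matching : Target
        matching with 4 * suc d + 8 + 10 * R ≤? n
        -- If `n` is at least about 4 d, covering half of the vertices is enough, and in a regular
        -- complement every maximal matching does so.
        ... | yes h = case maximal Co.co of λ { (M , mx) → M , P.few-pairs (Matching.cover M) h
                (≤-trans (≤-reflexive (sym Co.real-count)) (maximal-cover Co.co (λ v → not (dum v)) d Co.co-deg M mx)) }
        -- Otherwise the complement is dense, and a largest class of a nearly complete colouring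
        -- with few more than `d` colours is large enough.
        ... | no h = case dense-matching Co.co (suc d + e) e e (λ v → +-monoˡ-≤ e (≤-trans (≤-reflexive (Co.co-deg v)) (≤-trans (*-monoˡ-≤ (suc d) (⟦⟧≤1 (not (dum v)))) (≤-reflexive (+-identityʳ _)))))
                (P.many-colours (≰⇒> h)) (2 * suc d + 3 + 5 * R) (≤-trans (subst (λ x → (suc d + e) * (2 * suc d + 3 + 5 * R) + x * e < n * suc d) (sym half) (P.dense-pairs (≰⇒> h))) (≤-reflexive (sym Co.co-total))) of λ
                { (M , lt) → M , ≤-trans (≤-reflexive (ar (suc d) R)) lt }
          where
          ar : ∀ d R → 2 * d + 4 + 5 * R ≡ suc (2 * d + 3 + 5 * R)
          ar = solve-∀

        finish : Target → TotalColouring G (suc (suc r))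
        finish (Mt , cv) = Wire.wire G wires (split-graph E ψ ψ-inv m half e potential-bound)
          where
          open Matching Mt
          wires : WireData G
          wires = record
            { dum = dum ; o = o ; r = r ; T = T ; e = e ; ρ = P.ρ ; D = P.D ; ψ₀ = ψ ; nums = P.nums ; deg-eq = deg-eq ; one-dummy = one-dummy ; half = half ; odd-r = odd-r
            ; ψ₀-non = λ v h → Co.co-edge v (ψ v) (ψ-edge v h) ; c-eq = refl ; ρ-eq = P.ρ-eq ; D-eq = P.D-eq ; T≤k₁ = P.T≤k₁ ; k₁≤T = P.k₁≤T
            ; same-hi = P.same-hi ; same-lo = P.same-lo ; cross-lo = P.cross-lo ; cross-lo′ = P.cross-lo′ ; pairs-B = P.pairs-B cover cv ; pairs-A = P.pairs-A cover cv }

      coloured : TotalColouring G (suc (suc r))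
      coloured = finish matching

    abstract
      colouring : TotalColouring G (suc (suc r))
      colouring = case halving (r ∸ e) of λ { (M , b , hb , hM) → go M b hb (trans (sym (m+[n∸m]≡n e≤r)) (cong (e +_) hM)) (isTrue o) }
        where
        go : ∀ M b → b ≤ 1 → r ≡ e + (M + M + b) → o ≡ true ⊎ o ≡ false → TotalColouring G (suc (suc r))
        go M b hb hM (inj₁ q) = case handshake q of λ { (t , h) → Run.coloured t 0 M b (trans (sym h) (sym (+-identityʳ r))) z≤n (≤-trans (≤-reflexive (+-identityʳ _)) (⟦⟧≤1 o)) (λ _ → h) hM hb }
        go M b hb hM (inj₂ q) = case halving r of λ
          { (t , zero , _ , h) → Run.coloured t 0 M b (trans (sym (trans h (+-identityʳ _))) (sym (+-identityʳ r))) z≤n (≤-trans (≤-reflexive (+-identityʳ _)) (⟦⟧≤1 o)) (λ z → tf z q) hM hb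
          ; (t , suc zero , _ , h) → Run.coloured (suc t) 1 M b (trans (ar t) (cong (_+ 1) (sym h))) ≤-refl (≤-reflexive (cong (λ x → ⟦ x ⟧ + 1) q)) (λ z → tf z q) hM hb
          ; (t , suc (suc _) , s≤s () , _) }
          where
          ar : ∀ t → suc t + suc t ≡ t + t + 1 + 1
          ar = solve-∀

-- Regular graphs with rational density bound

module Main where
  open Prelude
  open Sums
  open EdgeColouring
  open Assembly
  open Cyclic
  open Dense
  import Defs as D
  open import Data.Fin.Properties using (fromℕ<-cong; fromℕ<-injective)
  open import Data.List using (filter; foldr; tabulate)
  open import Data.Bool using (T)
  open import Data.Bool.Properties using (T?)
  open import Data.Nat using (_⊔_)
  open import Data.Nat.Coprimality using (Coprime)
  open import Data.Integer using (+_; -[1+_])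
  import Data.Integer as ℤ
  import Data.Integer.Properties as ℤ
  open import Data.Rational using (ℚ; mkℚ; 0ℚ; 1ℚ; ½; *<*; toℚᵘ)
  import Data.Rational as ℚ
  import Data.Rational.Properties as ℚ
  open import Data.Rational.Unnormalised using (mkℚᵘ)
  import Data.Rational.Unnormalised as ℚᵘ
  import Data.Rational.Unnormalised.Properties as ℚᵘ

  widen : ∀ {N} {G : SimpleGraph N} {a b} → a ≤ b → TotalColouring G a → TotalColouring G b
  widen le C = record
    { TotalColouring C hiding (vcol<; ecol<)
    ; vcol< = λ v → ≤-trans (TotalColouring.vcol< C v) le
    ; ecol< = λ u v h → ≤-trans (TotalColouring.ecol< C u v h) le }

  module AddIsolated {n} (G : SimpleGraph n) where
    open SimpleGraph G

    isolated : Fin (suc n) → Bool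
    isolated zero = true
    isolated (suc _) = false

    E⁺ : Fin (suc n) → Fin (suc n) → Bool
    E⁺ (suc u) (suc v) = E u v
    E⁺ _ _ = false

    G⁺ : SimpleGraph (suc n)
    G⁺ .SimpleGraph.E = E⁺
    G⁺ .SimpleGraph.E-sym zero zero = refl
    G⁺ .SimpleGraph.E-sym zero (suc v) = refl
    G⁺ .SimpleGraph.E-sym (suc u) zero = refl
    G⁺ .SimpleGraph.E-sym (suc u) (suc v) = E-sym u v
    G⁺ .SimpleGraph.E-irr zero = refl
    G⁺ .SimpleGraph.E-irr (suc v) = E-irr v

    regular⁺ : ∀ r → (∀ v → deg v ≡ r) → ∀ v → SimpleGraph.deg G⁺ v + ⟦ isolated v ⟧ * r ≡ r
    regular⁺ r reg zero = trans (cong (_+ 1 * r) (∑-0 (λ { zero → refl ; (suc _) → refl }))) (+-identityʳ r)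
    regular⁺ r reg (suc v) = trans (+-identityʳ _) (trans (∑-cons (λ u → ⟦ E⁺ (suc v) u ⟧)) (reg v))

    one-isolated : ∑ (λ v → ⟦ isolated v ⟧) ≡ 1
    one-isolated = trans (∑-cons (λ v → ⟦ isolated v ⟧)) (cong suc (∑-0 {n} (λ _ → refl)))

    restrict : ∀ {b} → TotalColouring G⁺ b → TotalColouring G b
    restrict C = record
      { vcol = λ v → vcol (suc v) ; ecol = λ u v → ecol (suc u) (suc v)
      ; vcol< = λ v → vcol< (suc v) ; ecol< = λ u v → ecol< (suc u) (suc v)
      ; ecol-sym = λ u v → ecol-sym (suc u) (suc v) ; vertex-proper = λ u v → vertex-proper (suc u) (suc v)
      ; edge-proper = λ u v w h h′ ne → edge-proper (suc u) (suc v) (suc w) h h′ (λ { refl → ne refl })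
      ; incidence-proper = λ u v → incidence-proper (suc u) (suc v) }
      where open TotalColouring C

  -- All error terms are measured in the unit e = N / B.  Since q (2 r - n) ≥ n, this choice of B gives 64 z e ≤ 2 r - n;
  -- E₀ is a lower bound for e that makes the fourth moment of all discrepancies smaller than e⁴.
  module Constants (q : ℕ) where
    lam φ z W B E₀ : ℕ
    lam = 101 * (128 * q)
    φ = 128 * q * lam
    z = 4 * lam + φ + 1
    W = 128 * q * z
    B = 64 * q * z
    E₀ = 112 * (W * (W * W))

  module RegularGraph {n} (G : SimpleGraph n) (r q : ℕ) (reg : ∀ v → SimpleGraph.deg G v ≡ r) (q>0 : 0 < q)
      (large : Constants.B q * Constants.E₀ q ≤ n) (dense : n + q * n ≤ 2 * (q * r)) where
    open SimpleGraph G
    open Constants q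

    r<n : Fin n → r < n
    r<n v = ≤-trans (≤-reflexive (trans (cong suc (sym (reg v))) (trans (+-comm 1 (deg v)) (trans (cong (λ x → deg v + x) (sym (∑-δ1 v))) (sym (∑-+ _ _))))))
      (≤-trans (∑-mono pt) (≤-reflexive (∑-1 n)))
      where
      pt : ∀ u → ⟦ E v u ⟧ + ⟦ v == u ⟧ ≤ 1
      pt u with isTrue (v == u)
      ... | inj₁ h = ≤-reflexive (cong₂ (λ a b → ⟦ a ⟧ + ⟦ b ⟧) (trans (cong (E v) (sym (==-sound h))) (E-irr v)) h)
      ... | inj₂ h = ≤-trans (≤-reflexive (trans (cong (λ b → ⟦ E v u ⟧ + ⟦ b ⟧) h) (+-identityʳ _))) (⟦⟧≤1 (E v u))

    Parity : Set
    Parity = ∃ λ h → ∃ λ b → b ≤ 1 × n ≡ h + h + b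

    complete : n ≡ suc r → Parity → TotalColouring G (suc (suc r))
    complete hn (h , zero , _ , p) = widen (s≤s (≤-reflexive (trans (sym (trans p (+-identityʳ _))) hn))) (cyclic G (suc (h + h)) h refl (m≤n⇒m≤1+n (≤-reflexive (trans p (+-identityʳ _)))))
    complete hn (h , suc zero , _ , p) = widen (≤-trans (≤-reflexive (sym n-odd)) (m≤n⇒m≤1+n (≤-reflexive hn))) (cyclic G (suc (h + h)) h refl (≤-reflexive n-odd))
      where
      n-odd : n ≡ suc (h + h)
      n-odd = trans p (+-comm _ 1)
    complete hn (h , suc (suc _) , s≤s () , _)

    incomplete : ∀ d → suc (r + suc d) ≡ n → Parity → TotalColouring G (suc (suc r))
    incomplete d hr (h , zero , _ , p) = Incomplete.colouring G (record
      { dum = λ _ → false ; o = false ; r = r ; d = d ; n = n ; m = h ; q = q ; lam = lam ; φ = φ ; z = z ; W = W ; B = B ; E₀ = E₀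
      ; hlam = refl ; hφ = refl ; hz = refl ; hW = refl ; hB = refl ; hE₀ = refl
      ; deg-eq = λ v → trans (+-identityʳ _) (reg v) ; one-dummy = ∑-0 {n} (λ _ → refl) ; size = +-identityʳ n ; hr = hr
      ; half = trans p (+-identityʳ _) ; q>0 = q>0 ; large = large ; dense = dense })
    incomplete d hr (h , suc zero , _ , p) = restrict (Incomplete.colouring G⁺ (record
      { dum = isolated ; o = true ; r = r ; d = d ; n = n ; m = suc h ; q = q ; lam = lam ; φ = φ ; z = z ; W = W ; B = B ; E₀ = E₀
      ; hlam = refl ; hφ = refl ; hz = refl ; hW = refl ; hB = refl ; hE₀ = refl
      ; deg-eq = regular⁺ r reg ; one-dummy = one-isolated ; size = +-comm n 1 ; hr = hr
      ; half = cong suc (trans p (trans (+-comm (h + h) 1) (sym (+-suc h h)))) ; q>0 = q>0 ; large = large ; dense = dense }))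
      where open AddIsolated G
    incomplete d hr (h , suc (suc _) , s≤s () , _)

    colouring : Fin n → TotalColouring G (suc (suc r))
    colouring v with m≤n⇒∃[o]m+o≡n (r<n v)
    ... | zero , h = complete (sym (trans (cong suc (sym (+-identityʳ r))) h)) (halving n)
    ... | suc d , h = incomplete d h (halving n)

  true-T : ∀ {b} → T b → b ≡ true
  true-T {true} _ = refl

  module _ {n} (G : D.Graph n) where
    simple : SimpleGraph n
    simple .SimpleGraph.E = D.adj G
    simple .SimpleGraph.E-sym = D.sym G
    simple .SimpleGraph.E-irr = D.irrefl G

    degree-∑ : ∀ v → D.degree G v ≡ SimpleGraph.deg simple v
    degree-∑ v = count id
      where
      count : ∀ {m} (g : Fin m → Fin n) → length (filter (λ u → T? (D.adj G v u)) (tabulate g)) ≡ ∑ (λ i → ⟦ D.adj G v (g i) ⟧)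
      count {zero} g = sym (∑-nil _)
      count {suc m} g = trans (step (g zero)) (sym (∑-cons _))
        where
        xs : List (Fin n)
        xs = tabulate (g ∘ suc)
        step : ∀ w → length (filter (λ u → T? (D.adj G v u)) (w ∷ xs)) ≡ ⟦ D.adj G v w ⟧ + ∑ (λ i → ⟦ D.adj G v (g (suc i)) ⟧)
        step w with D.adj G v w
        ... | true = cong suc (count (g ∘ suc))
        ... | false = count (g ∘ suc)

    total : ∀ {b k} → b ≡ k → TotalColouring simple b → D.TotalColoring G k
    total refl C = record
      { vcol = λ v → fromℕ< (vcol< v)
      ; ecol = λ u v a → fromℕ< (ecol< u v (true-T a))
      ; ecol-sym = λ u v a b → fromℕ<-cong _ _ (ecol-sym u v (true-T a)) _ _
      ; vertex-proper = λ u v a h → vertex-proper u v (true-T a) (fromℕ<-injective _ _ (vcol< u) (vcol< v) h)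
      ; edge-proper = λ u v w a b ne h → edge-proper u v w (true-T a) (true-T b) ne (fromℕ<-injective _ _ (ecol< u v (true-T a)) (ecol< u w (true-T b)) h)
      ; incidence-proper = λ u v a h → incidence-proper u v (true-T a) (fromℕ<-injective _ _ (ecol< u v (true-T a)) (vcol< u) h) }
      where open TotalColouring C

  max-regular : ∀ {n} (G : D.Graph (suc n)) r → D.Regular G r → D.maxDegree G ≡ r
  max-regular {n} G r reg = go zero (tabulate suc)
    where
    go : ∀ x xs → foldr (λ v m → D.degree G v ⊔ m) 0 (x ∷ xs) ≡ r
    go x [] = trans (⊔-identityʳ _) (reg x)
    go x (y ∷ ys) = trans (cong₂ _⊔_ (reg x) (go y ys)) (⊔-idem r)

  -- Since ε is at least the reciprocal q⁻¹ of its denominator, the density hypothesis gives 2 r ≥ (1 + q⁻¹) n.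
  density : ∀ a d .(c : Coprime (suc a) (suc d)) n r → ½ ℚ.* ((1ℚ ℚ.+ mkℚ (+ suc a) d c) ℚ.* (+ n ℚ./ 1)) ℚ.≤ + r ℚ./ 1 → n + suc d * n ≤ 2 * (suc d * r)
  density a d c n r h = lin (a * n) (ℤ.drop‿+≤+ (subst₂ ℤ._≤_ left right integral)) (ar a n (suc d) r)
    where
    ε = mkℚ (+ suc a) d c
    εᵘ = mkℚᵘ (+ suc a) d
    q = suc d
    expand : toℚᵘ (½ ℚ.* ((1ℚ ℚ.+ ε) ℚ.* (+ n ℚ./ 1))) ℚᵘ.≃ ℚᵘ.½ ℚᵘ.* ((ℚᵘ.1ℚᵘ ℚᵘ.+ εᵘ) ℚᵘ.* mkℚᵘ (+ n) 0)
    expand = ℚᵘ.≃-trans (ℚ.toℚᵘ-homo-* ½ ((1ℚ ℚ.+ ε) ℚ.* (+ n ℚ./ 1))) (ℚᵘ.*-congˡ {ℚᵘ.½} (ℚᵘ.≃-trans (ℚ.toℚᵘ-homo-* (1ℚ ℚ.+ ε) (+ n ℚ./ 1))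
      (ℚᵘ.*-cong {toℚᵘ (1ℚ ℚ.+ ε)} (ℚ.toℚᵘ-homo-+ 1ℚ ε) (ℚ.toℚᵘ-fromℚᵘ (mkℚᵘ (+ n) 0)))))
    integral : (+ 1 ℤ.* ((+ 1 ℤ.* + q ℤ.+ + suc a ℤ.* + 1) ℤ.* + n)) ℤ.* + 1 ℤ.≤ + r ℤ.* + (2 * (1 * q * 1))
    integral = ℚᵘ.drop-*≤* (ℚᵘ.≤-respˡ-≃ expand (ℚᵘ.≤-respʳ-≃ (ℚ.toℚᵘ-fromℚᵘ (mkℚᵘ (+ r) 0)) (ℚ.toℚᵘ-mono-≤ h)))
    left : (+ 1 ℤ.* ((+ 1 ℤ.* + q ℤ.+ + suc a ℤ.* + 1) ℤ.* + n)) ℤ.* + 1 ≡ + ((q + suc a) * n)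
    left = trans (ℤ.*-identityʳ _) (trans (ℤ.*-identityˡ _) (trans (cong (ℤ._* + n) (cong₂ ℤ._+_ (ℤ.*-identityˡ (+ q)) (ℤ.*-identityʳ (+ suc a)))) (sym (ℤ.pos-* (q + suc a) n))))
    right : + r ℤ.* + (2 * (1 * q * 1)) ≡ + (r * (2 * (1 * q * 1)))
    right = sym (ℤ.pos-* r _)
    ar : ∀ a n q r → 2 * (q * r) + (q + suc a) * n ≡ n + q * n + r * (2 * (1 * q * 1)) + a * n
    ar = solve-∀

  -- The `suc` excludes the empty graph, which has no vertex to show that r < n.
  threshold : ℚ → ℕ
  threshold (mkℚ _ d _) = suc (Constants.B (suc d) * Constants.E₀ (suc d))

  main : ∀ ε → 0ℚ ℚ.< ε → ∀ n → threshold ε ≤ n → (G : D.Graph n) → ∀ r → D.Regular G r →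
    ½ ℚ.* ((1ℚ ℚ.+ ε) ℚ.* (+ n ℚ./ 1)) ℚ.≤ + r ℚ./ 1 → D.χT≤ G (D.maxDegree G + 2)
  main (mkℚ (+ zero) d c) (*<* (ℤ.+<+ ()))
  main (mkℚ -[1+ a ] d c) (*<* ())
  main (mkℚ (+ suc a) d c) _ (suc n) large G r reg h = total G (trans (+-comm 2 r) (cong (_+ 2) (sym (max-regular G r reg))))
    (RegularGraph.colouring (simple G) r (suc d) (λ v → trans (sym (degree-∑ G v)) (reg v)) (s≤s z≤n) (≤-trans (n≤1+n _) large) (density a d c (suc n) r h) zero)

open import Defs
open import Data.Nat using (ℕ; _≥_)
open import Data.Integer using (+_)
open import Data.Rational using (ℚ; 0ℚ; 1ℚ; _<_; _≤_; _*_; _/_; _+_; ½)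
open import Data.Product using (∃-syntax)
open import Data.Product using (_,_)

theorem2 : (ε : ℚ) → 0ℚ < ε → ε < 1ℚ →
    ∃[ n₀ ] ((n : ℕ) → n ≥ n₀ → (G : Graph n) → (r : ℕ) → Regular G r →
    ½ * ((1ℚ + ε) * (+ n / 1)) ≤ + r / 1 →
    χT≤ G (Data.Nat._+_ (maxDegree G) 2))
theorem2 ε ε>0 _ = Main.threshold ε , Main.main ε ε>0
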